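{- Let $\gamma=\frac{5+\sqrt5}{10}$ and define $f_1:[0,2]\setminus\{\gamma,2\gamma\}\to[0,1]$ by $f_1(x)=0$ if $0\le x<\gamma$, $f_1(x)=\frac{\sqrt5-1}{2}$ if $\gamma<x<2\gamma$, and $f_1(x)=1$ if $2\gamma<x\le 2$. Fix an integer $l\geq 0$ and reals $\epsilon_1,\epsilon_2>0$. There exists $M(\epsilon_1,\epsilon_2)>0$ such that for all $g>M(\epsilon_1,\epsilon_2)$ and all sets of integers \[ C\subseteq \big[1,(\gamma-\epsilon_1)g\big) \cup \big((\gamma+\epsilon_1)g,(2\gamma-\epsilon_1)g\big) \cup \big((2\gamma+\epsilon_1)g,2g\big] \] with $|C|=l$, we have \[ \left|\mathbb{P}_g[C\subseteq S]-\prod_{n\in C}f_{1}\left(\tfrac{n}{g}\right)\right|<\epsilon_2. \]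
   Context: A numerical semigroup $S$ is a submonoid of $\mathbb{N}_0$ with finite complement; its genus is $|\mathbb{N}_0\setminus S|$. $\mathbb{P}_g$ is the uniform probability measure on the finite set $\mathcal{S}_g$ of numerical semigroups of genus $g$, and $S$ denotes a random element of $\mathcal{S}_g$. -}

module Defs where

open import Data.Bool using (Bool; true; false; _∧_; _∨_; not; if_then_else_; T)
open import Data.Nat as ℕ using (ℕ; zero; suc)
open import Data.Integer using (+_)
open import Data.List using (List; []; _∷_; length; upTo; filter; map; foldr; concatMap)
open import Data.Rational using (ℚ; _+_; _*_; _-_; -_; 0ℚ; 1ℚ; _/_)
open import Data.Rational.Properties using (_≤?_; _<?_)
open import Relation.Nullary.Decidable using (⌊_⌋)

-- The field ℚ(√5) ⊂ ℝ, with its order inherited from ℝ.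
-- An element  a + b√5  is represented by the pair (a , b).

record Q5 : Set where
  constructor _+√5·_
  field
    re : ℚ
    ir : ℚ
open Q5 public

embQ : ℚ → Q5
embQ q = q +√5· 0ℚ

embN : ℕ → Q5
embN n = embQ ((+ n) / 1)

_⊕_ : Q5 → Q5 → Q5
(a +√5· b) ⊕ (c +√5· d) = (a + c) +√5· (b + d)

_⊖_ : Q5 → Q5 → Q5
(a +√5· b) ⊖ (c +√5· d) = (a - c) +√5· (b - d)

_⊗_ : Q5 → Q5 → Q5
(a +√5· b) ⊗ (c +√5· d) =
  ((a * c) + ((+ 5 / 1) * (b * d))) +√5· ((a * d) + (b * c))

five : ℚ
five = + 5 / 1

posB : Q5 → Bool
posB (a +√5· b) with ⌊ 0ℚ ≤? a ⌋ | ⌊ 0ℚ ≤? b ⌋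
... | true  | true  = ⌊ 0ℚ <? a ⌋ ∨ ⌊ 0ℚ <? b ⌋
... | true  | false = ⌊ five * (b * b) <? a * a ⌋
... | false | true  = ⌊ a * a <? five * (b * b) ⌋
... | false | false = false

_<₅_ : Q5 → Q5 → Set
x <₅ y = T (posB (y ⊖ x))

_<₅ᵇ_ : Q5 → Q5 → Bool
x <₅ᵇ y = posB (y ⊖ x)

_≤₅_ : Q5 → Q5 → Set
x ≤₅ y = T (not (posB (x ⊖ y)))

absLt : Q5 → Q5 → Set
absLt x e = T (posB (e ⊖ x) ∧ posB (e ⊕ x))

γ : Q5
γ = (+ 1 / 2) +√5· (+ 1 / 10)

twoγ : Q5
twoγ = 1ℚ +√5· (+ 1 / 5)

φinv : Q5
φinv = (- (+ 1 / 2)) +√5· (+ 1 / 2)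

-- f₁ on [0,2] \ {γ, 2γ}.  (Values at γ, 2γ are irrelevant: we only evaluate
-- at rational points n/g, which are never equal to γ or 2γ.)
f₁ : Q5 → Q5
f₁ x = if x <₅ᵇ γ then embQ 0ℚ else (if x <₅ᵇ twoγ then φinv else embQ 1ℚ)

-- n / g as an element of ℚ(√5)  (g = 0 never occurs below since g > M ≥ 0)
ratio : ℕ → ℕ → Q5
ratio n zero    = embQ 0ℚ
ratio n (suc k) = embQ ((+ n) / suc k)

prodQ5 : List Q5 → Q5
prodQ5 = foldr _⊗_ (embQ 1ℚ)

-- Numerical semigroups of genus g.
-- Every numerical semigroup of genus g has all its gaps in [1, 2g-1]
-- (standard fact), so it is determined by its membership vector on
-- {0, …, 2g}: a list of 2g+1 booleans, entry n = true iff n is a GAP.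
-- The set S encoded by a list `gs` is { n ≤ 2g : n not a gap } ∪ (2g, ∞).

allBits : ℕ → List (List Bool)
allBits zero    = [] ∷ []
allBits (suc k) = concatMap (λ bs → (false ∷ bs) ∷ (true ∷ bs) ∷ []) (allBits k)

allB : {A : Set} → (A → Bool) → List A → Bool
allB p []       = true
allB p (x ∷ xs) = p x ∧ allB p xs

isGap : List Bool → ℕ → Bool
isGap []       n       = false
isGap (b ∷ bs) zero    = b
isGap (b ∷ bs) (suc n) = isGap bs n

inS : List Bool → ℕ → Bool
inS gs n = not (isGap gs n)

countTrue : List Bool → ℕ
countTrue []           = 0
countTrue (true ∷ bs)  = suc (countTrue bs)
countTrue (false ∷ bs) = countTrue bs

-- Is the set encoded by gs (a list of length 2g+1) a numerical semigroup
-- of genus g?  0 ∈ S, S closed under +, and |ℕ \ S| = g.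
-- Closure only needs checking for a, b ≤ 2g (larger sums lie in S).
isNSg : ℕ → List Bool → Bool
isNSg g gs =
  inS gs 0
  ∧ allB (λ a → allB (λ b → not (inS gs a ∧ inS gs b) ∨ inS gs (a ℕ.+ b)) rng) rng
  ∧ ⌊ countTrue gs ℕ.≟ g ⌋
  where rng = upTo (suc (2 ℕ.* g))

-- 𝒮_g as a list (each semigroup occurs exactly once)
𝒮 : ℕ → List (List Bool)
𝒮 g = filter (λ gs → T? (isNSg g gs)) (allBits (suc (2 ℕ.* g)))
  where
  open import Relation.Nullary.Decidable using (T?)

probSub : ℕ → List ℕ → Q5
probSub g C with length (𝒮 g)
... | zero  = embQ 0ℚ
... | suc k = embQ ((+ length (filter (λ gs → T? (allB (inS gs) C)) (𝒮 g))) / suc k)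
  where
  open import Relation.Nullary.Decidable using (T?)

InRegion : ℚ → ℕ → ℕ → Set
InRegion ε₁ g n =
  ((1 ℕ.≤ n) × (embN n <₅ ((γ ⊖ embQ ε₁) ⊗ embN g)))
  ⊎ (((γ ⊕ embQ ε₁) ⊗ embN g) <₅ embN n × embN n <₅ ((twoγ ⊖ embQ ε₁) ⊗ embN g))
  ⊎ (((twoγ ⊕ embQ ε₁) ⊗ embN g) <₅ embN n × n ℕ.≤ 2 ℕ.* g)
  where
  open import Data.Product using (_×_)
  open import Data.Sum using (_⊎_)

module Submission where

-- A semigroup of genus g is encoded by its Kunz coordinates, a word of positive integers of length m − 1 and sum g.
-- Words in the letters 1 and 2 are always admissible, so there are at least F g (Fibonacci) semigroups.
-- Words with a letter ≥ 4, or with a letter 3 beyond index k₀ ≈ 2g/D, are exponentially rarer.  If the maximum q is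
-- attained last at a, subadditivity gives k i + k (a − i) ≥ q for i < a, and k i + k (m + a − i) ≥ q − 1 for i > a;
-- if b is the first index with k b = 1, then moreover k (i + b) ≤ k i + 1.  Give a letter u the weight (13/21)^u, where
-- 13/21 is slightly more than the reciprocal of the golden ratio φ.  The total weight of the pairs (k i , k (a − i)) chained by
-- these inequalities shrinks by the factor 98/100 per pair, which is a finite computation for each q ≤ 11; for q ≥ 12
-- the weights 4^(u−1) / 5^u suffice.
-- In the remaining semigroups the letters beyond k₀ form, for each initial pattern, an arbitrary word of fixed sum in
-- the letters 1 and 2.  The number of twos concentrates where the ratio of ones to all letters is 1/φ; this puts m near γ g, and
-- whether n ∈ S is decided by the size of n when n < m or n > 2m, and otherwise by whether the letter at n − m is 1.
-- Everything is counted in integers, with √5 enclosed between p/D and (p + 1)/D.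

-- Reflection at the peak alone is too weak: the pairs (u , v) of entries at most c with u + v ≥ c
-- have total weight about 1.15 for c = 3 and 1.06 for c = 4, so independent pairs would lose an
-- exponential factor. The link at distance b turns the pairs into b interleaved Markov chains that
-- contract. The price is that the first b pairs of each region have no predecessor, and b is
-- unbounded. Above the peak such a free start costs a factor 7/6; it is repaid below the peak,
-- where every coordinate before index b is at least 2 and earns a factor 6/7. The free starts
-- outnumber these coordinates by at most 2, so only a constant is lost. The numbers 21/13 and 55/34
-- are convergents of φ from below. A class of size at most a polynomial times (21/13)^g is
-- negligible because F g grows at least like (55/34)^g. For maxima from 4 to 11 it is enough that
-- the chains do not grow. For maximum 3 the contraction 98/100 itself is needed: the word after the
-- peak is counted by Fibonacci numbers, so the gain over F g can only come from the length of the
-- chain before it.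

open import Defs
open import Data.Bool using (Bool; true; false; _∧_; _∨_; not; T; if_then_else_)
import Data.Bool.Properties
open import Data.Nat
open import Data.Nat.Properties
open import Data.Nat.DivMod using (_/_; _%_; m≡m%n+[m/n]*n; m%n<n; [m+kn]%n≡m%n; m<n⇒m%n≡m; +-distrib-/; m<n⇒m/n≡0; m*n/n≡m; m*n%n≡0)
open import Data.Nat.Tactic.RingSolver using (solve-∀)
open import Data.List using (List; []; _∷_; _++_; length; map; concatMap; upTo; filter; filterᵇ; drop; applyUpTo)
open import Data.List.Properties using (length-map; length-upTo; length-drop; length-applyUpTo; length-++; ∷-injectiveˡ; ∷-injectiveʳ)
open import Data.List.Relation.Unary.Any using (here; there)
open import Data.List.Relation.Unary.All as All using (All; []; _∷_)
open import Data.List.Relation.Unary.AllPairs using ([]; _∷_)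
open import Data.List.Relation.Unary.Unique.Propositional using (Unique)
open import Data.List.Relation.Unary.Unique.Propositional.Properties as Uniqueₚ using ()
open import Data.List.Membership.Propositional using (_∈_)
open import Data.List.Membership.Propositional.Properties using (∈-∃++; ∈-++⁻; ∈-++⁺ˡ; ∈-++⁺ʳ; ∈-map⁺; ∈-map⁻; ∈-filter⁺; ∈-filter⁻; ∈-upTo⁺; ∈-applyUpTo⁺)
open import Data.Product using (∃; ∃-syntax; _×_; _,_; proj₁; proj₂)
open import Data.Sum using (_⊎_; inj₁; inj₂)
open import Data.Unit using (tt)
open import Data.Empty using (⊥; ⊥-elim)
open import Function using (_∘_; id)
open import Relation.Nullary using (¬_; yes; no; Dec)
open import Relation.Binary.Definitions using (tri<; tri≈; tri>)
open import Relation.Nullary.Decidable using (T?; ⌊_⌋; toWitness; fromWitness)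
open import Relation.Binary.PropositionalEquality using (_≡_; _≢_; refl; sym; trans; cong; cong₂; subst; subst₂; module ≡-Reasoning)
open import Data.Rational as ℚ using (ℚ; 0ℚ; 1ℚ) renaming (_+_ to infixl 6 _+ᵣ_; _*_ to infixl 7 _*ᵣ_; _-_ to infixl 6 _-ᵣ_; -_ to infix 8 -ᵣ_; _<_ to infix 4 _<ᵣ_; _≤_ to infix 4 _≤ᵣ_)
import Data.Rational.Properties as ℚ
import Data.Rational.Unnormalised as ℚᵘ
import Data.Rational.Unnormalised.Properties as ℚᵘ
open import Data.Rational.Solver using (module +-*-Solver)
open +-*-Solver using (solve; _:=_; _:+_; _:*_; _:-_; con)
import Data.Integer as ℤ
import Data.Integer.Properties as ℤ

-- Truth values and elementary inequalities in ℕ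

χ : Bool → ℕ
χ true  = 1
χ false = 0

χ≤1 : ∀ b → χ b ≤ 1
χ≤1 true  = ≤-refl
χ≤1 false = z≤n

T⇒≡ : ∀ {b} → T b → b ≡ true
T⇒≡ {true} _ = refl

≡⇒T : ∀ {b} → b ≡ true → T b
≡⇒T refl = tt

T-∧⁻ : ∀ {a b} → T (a ∧ b) → T a × T b
T-∧⁻ {true} {true} _ = tt , tt

T-∧⁺ : ∀ {a b} → T a → T b → T (a ∧ b)
T-∧⁺ {true} _ y = y

¬T⇒≡ : ∀ {b} → ¬ T b → b ≡ false
¬T⇒≡ {true}  h = ⊥-elim (h tt)
¬T⇒≡ {false} h = refl

T-dec : ∀ b → T b ⊎ b ≡ false
T-dec true  = inj₁ tt
T-dec false = inj₂ refl

T-⇔ : ∀ {a b} → (T a → T b) → (T b → T a) → a ≡ b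
T-⇔ {true}  {true}  f h = refl
T-⇔ {true}  {false} f h = ⊥-elim (f tt)
T-⇔ {false} {true}  f h = ⊥-elim (h tt)
T-⇔ {false} {false} f h = refl

χ-mono : ∀ {a b} → (T a → T b) → χ a ≤ χ b
χ-mono {true}  {true}  h = ≤-refl
χ-mono {true}  {false} h = ⊥-elim (h tt)
χ-mono {false} {b}     h = z≤n

<ᵇ-true : ∀ {m n} → m < n → (m <ᵇ n) ≡ true
<ᵇ-true h = T⇒≡ (<⇒<ᵇ h)

<ᵇ-false : ∀ {m n} → n ≤ m → (m <ᵇ n) ≡ false
<ᵇ-false {m} {n} h = ¬T⇒≡ (λ t → <⇒≱ (<ᵇ⇒< m n t) h)

-- To prove l ≤ r, exhibit a ≤ b with  l + b + slack ≡ r + a.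
lin : ∀ {a b l r} (s : ℕ) → a ≤ b → l + b + s ≡ r + a → l ≤ r
lin {a} {b} {l} {r} s h e = +-cancelʳ-≤ b l r
  (≤-trans (m≤m+n (l + b) s) (≤-trans (≤-reflexive e) (+-monoʳ-≤ r h)))

cancel*ˡ : ∀ k {a b} → 0 < k → k * a ≤ k * b → a ≤ b
cancel*ˡ (suc k) _ h = *-cancelˡ-≤ (suc k) h

^>0 : ∀ a n → 0 < a → 0 < a ^ n
^>0 a zero    h = s≤s z≤n
^>0 a (suc n) h = *-mono-≤ h (^>0 a n h)

*>0 : ∀ {a b} → 0 < a → 0 < b → 0 < a * b
*>0 h k = *-mono-≤ h k

-- Finite sums and products over ranges and lists

∑ : ℕ → (ℕ → ℕ) → ℕ
∑ zero    f = 0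
∑ (suc n) f = ∑ n f + f n

∏ : ℕ → (ℕ → ℕ) → ℕ
∏ zero    f = 1
∏ (suc n) f = ∏ n f * f (suc n)

∑-cong : ∀ n {f h} → (∀ i → i < n → f i ≡ h i) → ∑ n f ≡ ∑ n h
∑-cong zero    e = refl
∑-cong (suc n) e = cong₂ _+_ (∑-cong n (λ i l → e i (m<n⇒m<1+n l))) (e n ≤-refl)

∑-mono : ∀ n {f h} → (∀ i → i < n → f i ≤ h i) → ∑ n f ≤ ∑ n h
∑-mono zero    e = z≤n
∑-mono (suc n) e = +-mono-≤ (∑-mono n (λ i l → e i (m<n⇒m<1+n l))) (e n ≤-refl)

∑-+ : ∀ n f h → ∑ n (λ i → f i + h i) ≡ ∑ n f + ∑ n h
∑-+ zero    f h = refl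
∑-+ (suc n) f h = trans (cong (_+ (f n + h n)) (∑-+ n f h)) (lem (∑ n f) (∑ n h) (f n) (h n))
  where
  lem : ∀ a b c d → a + b + (c + d) ≡ a + c + (b + d)
  lem = solve-∀

∑-*ˡ : ∀ n c f → ∑ n (λ i → c * f i) ≡ c * ∑ n f
∑-*ˡ zero    c f = sym (*-zeroʳ c)
∑-*ˡ (suc n) c f = trans (cong (_+ c * f n) (∑-*ˡ n c f)) (sym (*-distribˡ-+ c (∑ n f) (f n)))

∑-const : ∀ n c → ∑ n (λ _ → c) ≡ n * c
∑-const zero    c = refl
∑-const (suc n) c = trans (cong (_+ c) (∑-const n c)) (+-comm (n * c) c)

∑-bound : ∀ n c {f} → (∀ i → i < n → f i ≤ c) → ∑ n f ≤ n * c
∑-bound n c h = ≤-trans (∑-mono n h) (≤-reflexive (∑-const n c))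

∑-split : ∀ a b f → ∑ (a + b) f ≡ ∑ a f + ∑ b (λ i → f (a + i))
∑-split a zero    f = trans (cong (λ x → ∑ x f) (+-identityʳ a)) (sym (+-identityʳ _))
∑-split a (suc b) f rewrite +-suc a b =
  trans (cong (_+ f (a + b)) (∑-split a b f)) (+-assoc (∑ a f) _ _)

∑-head : ∀ n f → ∑ (suc n) f ≡ f 0 + ∑ n (λ i → f (suc i))
∑-head n f = ∑-split 1 n f

∑-swap : ∀ a b (f : ℕ → ℕ → ℕ) → ∑ a (λ i → ∑ b (λ j → f i j)) ≡ ∑ b (λ j → ∑ a (λ i → f i j))
∑-swap zero    b f = sym (trans (∑-const b 0) (*-zeroʳ b))
∑-swap (suc a) b f = trans (cong (_+ ∑ b (f a)) (∑-swap a b f)) (sym (∑-+ b _ (f a)))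

∑-≤-split : ∀ {a b} f → a ≤ b → ∑ a f ≤ ∑ b f
∑-≤-split {a} {b} f h = subst (λ x → ∑ a f ≤ ∑ x f) (m+[n∸m]≡n h)
  (≤-trans (m≤m+n _ _) (≤-reflexive (sym (∑-split a (b ∸ a) f))))

∑-term : ∀ n f i → i < n → f i ≤ ∑ n f
∑-term (suc n) f i h with i ≟ n
... | yes refl = m≤n+m (f n) (∑ n f)
... | no i≢n = ≤-trans (∑-term n f i (≤∧≢⇒< (s≤s⁻¹ h) i≢n)) (m≤m+n _ _)

∑-zero : ∀ n {f} → (∀ i → i < n → f i ≡ 0) → ∑ n f ≡ 0
∑-zero n h = trans (∑-cong n h) (trans (∑-const n 0) (*-zeroʳ n))

∑-rows : ∀ J m f → ∑ (J * m) f ≡ ∑ J (λ j → ∑ m (λ i → f (i + j * m)))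
∑-rows zero    m f = refl
∑-rows (suc J) m f = trans (cong (λ x → ∑ x f) (+-comm m (J * m)))
  (trans (∑-split (J * m) m f)
    (cong₂ _+_ (∑-rows J m f) (∑-cong m (λ i _ → cong f (+-comm (J * m) i)))))

∑-rev : ∀ x f → ∑ (suc x) (λ y → f (x ∸ y)) ≡ ∑ (suc x) f
∑-rev zero    f = refl
∑-rev (suc x) f = trans (∑-head (suc x) (λ y → f (suc x ∸ y)))
  (trans (cong (f (suc x) +_) (∑-rev x f)) (+-comm (f (suc x)) _))

∏-cong : ∀ n {f h} → (∀ i → 1 ≤ i → i ≤ n → f i ≡ h i) → ∏ n f ≡ ∏ n h
∏-cong zero    e = refl
∏-cong (suc n) e = cong₂ _*_ (∏-cong n (λ i p l → e i p (m≤n⇒m≤1+n l))) (e (suc n) (s≤s z≤n) ≤-refl)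

∏-* : ∀ n f h → ∏ n (λ i → f i * h i) ≡ ∏ n f * ∏ n h
∏-* zero    f h = refl
∏-* (suc n) f h = trans (cong (_* (f (suc n) * h (suc n))) (∏-* n f h)) (lem (∏ n f) (∏ n h) (f (suc n)) (h (suc n)))
  where
  lem : ∀ a b c d → a * b * (c * d) ≡ a * c * (b * d)
  lem = solve-∀

∏-const : ∀ n c → ∏ n (λ _ → c) ≡ c ^ n
∏-const zero    c = refl
∏-const (suc n) c = trans (cong (_* c) (∏-const n c)) (*-comm (c ^ n) c)

∏-^ : ∀ n c (e : ℕ → ℕ) → ∏ n (λ i → c ^ e i) ≡ c ^ ∑ n (λ i → e (suc i))
∏-^ zero    c e = refl
∏-^ (suc n) c e = trans (cong (_* c ^ e (suc n)) (∏-^ n c e)) (sym (^-distribˡ-+-* c (∑ n (λ i → e (suc i))) (e (suc n))))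

module _ {A : Set} where

  sumL : (A → ℕ) → List A → ℕ
  sumL f []       = 0
  sumL f (x ∷ xs) = f x + sumL f xs

  sumL-cong : ∀ {f h} xs → (∀ x → x ∈ xs → f x ≡ h x) → sumL f xs ≡ sumL h xs
  sumL-cong []       e = refl
  sumL-cong (x ∷ xs) e = cong₂ _+_ (e x (here refl)) (sumL-cong xs (λ y p → e y (there p)))

  sumL-mono : ∀ {f h} xs → (∀ x → x ∈ xs → f x ≤ h x) → sumL f xs ≤ sumL h xs
  sumL-mono []       e = z≤n
  sumL-mono (x ∷ xs) e = +-mono-≤ (e x (here refl)) (sumL-mono xs (λ y p → e y (there p)))

  sumL-+ : ∀ f h xs → sumL (λ x → f x + h x) xs ≡ sumL f xs + sumL h xs
  sumL-+ f h []       = refl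
  sumL-+ f h (x ∷ xs) = trans (cong (f x + h x +_) (sumL-+ f h xs)) (lem (f x) (h x) (sumL f xs) (sumL h xs))
    where
    lem : ∀ a b c d → a + b + (c + d) ≡ a + c + (b + d)
    lem = solve-∀

  sumL-*ˡ : ∀ c f xs → sumL (λ x → c * f x) xs ≡ c * sumL f xs
  sumL-*ˡ c f []       = sym (*-zeroʳ c)
  sumL-*ˡ c f (x ∷ xs) = trans (cong (c * f x +_) (sumL-*ˡ c f xs)) (sym (*-distribˡ-+ c (f x) _))

  sumL-*ʳ : ∀ c f xs → sumL (λ x → f x * c) xs ≡ sumL f xs * c
  sumL-*ʳ c f xs = trans (sumL-cong xs (λ x _ → *-comm (f x) c)) (trans (sumL-*ˡ c f xs) (*-comm c _))

  sumL-++ : ∀ f xs ys → sumL f (xs ++ ys) ≡ sumL f xs + sumL f ys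
  sumL-++ f []       ys = refl
  sumL-++ f (x ∷ xs) ys = trans (cong (f x +_) (sumL-++ f xs ys)) (sym (+-assoc (f x) _ _))

  sumL-zero : ∀ {f} xs → (∀ x → x ∈ xs → f x ≡ 0) → sumL f xs ≡ 0
  sumL-zero []       e = refl
  sumL-zero (x ∷ xs) e = cong₂ _+_ (e x (here refl)) (sumL-zero xs (λ y p → e y (there p)))

  sumL-1 : ∀ xs → sumL (λ _ → 1) xs ≡ length xs
  sumL-1 []       = refl
  sumL-1 (x ∷ xs) = cong suc (sumL-1 xs)

  sumL-∑ : ∀ n (f : ℕ → A → ℕ) xs → sumL (λ x → ∑ n (λ j → f j x)) xs ≡ ∑ n (λ j → sumL (f j) xs)
  sumL-∑ zero    f xs = sumL-zero xs (λ _ _ → refl)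
  sumL-∑ (suc n) f xs = trans (sumL-+ _ _ xs) (cong (_+ sumL (f n) xs) (sumL-∑ n f xs))

module _ {A B : Set} where

  sumL-map : ∀ (f : B → ℕ) (h : A → B) xs → sumL f (map h xs) ≡ sumL (f ∘ h) xs
  sumL-map f h []       = refl
  sumL-map f h (x ∷ xs) = cong (f (h x) +_) (sumL-map f h xs)

  sumL-concatMap : ∀ (f : B → ℕ) (h : A → List B) xs → sumL f (concatMap h xs) ≡ sumL (λ x → sumL f (h x)) xs
  sumL-concatMap f h []       = refl
  sumL-concatMap f h (x ∷ xs) = trans (sumL-++ f (h x) (concatMap h xs)) (cong (sumL f (h x) +_) (sumL-concatMap f h xs))

  sumL-swap : ∀ (f : A → B → ℕ) xs ys → sumL (λ x → sumL (f x) ys) xs ≡ sumL (λ y → sumL (λ x → f x y) xs) ys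
  sumL-swap f []       ys = sym (sumL-zero ys (λ _ _ → refl))
  sumL-swap f (x ∷ xs) ys = trans (cong (sumL (f x) ys +_) (sumL-swap f xs ys)) (sym (sumL-+ (f x) _ ys))

  ∈-concatMap : ∀ {h : A → List B} {xs x y} → x ∈ xs → y ∈ h x → y ∈ concatMap h xs
  ∈-concatMap {h} {x ∷ xs} (here refl) q = ∈-++⁺ˡ q
  ∈-concatMap {h} {x ∷ xs} (there p) q = ∈-++⁺ʳ (h x) (∈-concatMap {h} {xs} p q)

  ∈-concatMap⁻ : ∀ {h : A → List B} {xs y} → y ∈ concatMap h xs → ∃[ x ] (x ∈ xs × y ∈ h x)
  ∈-concatMap⁻ {h} {x ∷ xs} p with ∈-++⁻ (h x) p
  ... | inj₁ q = x , here refl , q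
  ... | inj₂ q with ∈-concatMap⁻ {h} {xs} q
  ... | y , r , s = y , there r , s

  private
    remove : ∀ {y z : B} ys zs → z ∈ ys ++ y ∷ zs → z ≢ y → z ∈ ys ++ zs
    remove ys zs p ne with ∈-++⁻ ys p
    ... | inj₁ q = ∈-++⁺ˡ q
    ... | inj₂ (here e) = ⊥-elim (ne e)
    ... | inj₂ (there q) = ∈-++⁺ʳ ys q

  -- Each counted element of `xs` uses up one occurrence of its code, which is removed from `ys`
  -- before the induction goes on; so only `xs` has to be free of repetitions. The upper bounds for
  -- rare classes of semigroups all pass through this injection into a list of words.
  sumL-inj : ∀ (p : A → Bool) (code : A → B) (f : B → ℕ) xs ys → Unique xs →
    (∀ x → x ∈ xs → T (p x) → code x ∈ ys) →
    (∀ x x′ → x ∈ xs → x′ ∈ xs → T (p x) → T (p x′) → code x ≡ code x′ → x ≡ x′) →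
    sumL (λ x → χ (p x) * f (code x)) xs ≤ sumL f ys
  sumL-inj p code f []       ys u m i = z≤n
  sumL-inj p code f (x ∷ xs) ys (x∉ ∷ u) m i with T-dec (p x)
  ... | inj₂ e rewrite e = sumL-inj p code f xs ys u (λ z r → m z (there r)) (λ z z′ r r′ → i z z′ (there r) (there r′))
  ... | inj₁ t rewrite T⇒≡ t with ∈-∃++ (m x (here refl) t)
  ... | ys₁ , ys₂ , refl = begin
    f (code x) + 0 + sumL (λ x → χ (p x) * f (code x)) xs  ≡⟨ cong (_+ sumL (λ x → χ (p x) * f (code x)) xs) (+-identityʳ (f (code x))) ⟩
    f (code x) + sumL (λ x → χ (p x) * f (code x)) xs      ≤⟨ +-monoʳ-≤ (f (code x)) ih ⟩
    f (code x) + sumL f (ys₁ ++ ys₂)                       ≡⟨ cong (f (code x) +_) (sumL-++ f ys₁ ys₂) ⟩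
    f (code x) + (sumL f ys₁ + sumL f ys₂)                 ≡⟨ lem (f (code x)) (sumL f ys₁) (sumL f ys₂) ⟩
    sumL f ys₁ + sumL f (code x ∷ ys₂)                     ≡⟨ sym (sumL-++ f ys₁ (code x ∷ ys₂)) ⟩
    sumL f (ys₁ ++ code x ∷ ys₂)                           ∎
    where
    open ≤-Reasoning
    lem : ∀ a b c → a + (b + c) ≡ b + (a + c)
    lem = solve-∀
    ih = sumL-inj p code f xs (ys₁ ++ ys₂) u
      (λ z r tz → remove ys₁ ys₂ (m z (there r) tz)
        (λ e → All.lookup x∉ r (sym (i z x (there r) (here refl) tz t e))))
      (λ z z′ r r′ → i z z′ (there r) (there r′))

-- Counting with Boolean predicates

module _ {A : Set} where

  count : (A → Bool) → List A → ℕ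
  count p = sumL (χ ∘ p)

  count-mono : ∀ {p r : A → Bool} xs → (∀ x → x ∈ xs → T (p x) → T (r x)) → count p xs ≤ count r xs
  count-mono xs h = sumL-mono xs (λ x i → χ-mono (h x i))

  count-∨ : ∀ {p r s : A → Bool} xs → (∀ x → x ∈ xs → T (p x) → T (r x) ⊎ T (s x)) →
    count p xs ≤ count r xs + count s xs
  count-∨ {p} {r} {s} xs h = ≤-trans (sumL-mono xs lem) (≤-reflexive (sumL-+ (χ ∘ r) (χ ∘ s) xs))
    where
    lem : ∀ x → x ∈ xs → χ (p x) ≤ χ (r x) + χ (s x)
    lem x i with p x in e
    ... | false = z≤n
    ... | true with h x i (≡⇒T e)
    ... | inj₁ t rewrite T⇒≡ t = s≤s z≤n
    ... | inj₂ t rewrite T⇒≡ t = m≤n+m 1 (χ (r x))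

  private
    ∑-χ≡ : ∀ n k → k < n → 1 ≤ ∑ n (λ j → χ (k ≡ᵇ j))
    ∑-χ≡ n k h = ≤-trans (≤-reflexive (sym (cong χ (T⇒≡ (≡⇒≡ᵇ k k refl))))) (∑-term n (λ j → χ (k ≡ᵇ j)) k h)

    χ-∧ : ∀ a b → χ (a ∧ b) ≡ χ a * χ b
    χ-∧ true  b = sym (+-identityʳ _)
    χ-∧ false b = refl

  -- A union bound over the values of the key. Multiplicity, maximum, last peak and first unit are
  -- fixed in this way; each takes at most 2g + 2 values, so the loss is polynomial in the genus.
  count-keys : ∀ c N B (p : A → Bool) (key : A → ℕ) xs → (∀ x → x ∈ xs → T (p x) → key x < N) →
    (∀ j → j < N → c * count (λ x → p x ∧ (key x ≡ᵇ j)) xs ≤ B) → c * count p xs ≤ N * B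
  count-keys c N B p key xs h b = begin
    c * count p xs                                             ≤⟨ *-monoʳ-≤ c (sumL-mono xs lem) ⟩
    c * sumL (λ x → ∑ N (λ j → χ (p x ∧ (key x ≡ᵇ j)))) xs     ≡⟨ cong (c *_) (sumL-∑ N _ xs) ⟩
    c * ∑ N (λ j → count (λ x → p x ∧ (key x ≡ᵇ j)) xs)        ≡⟨ sym (∑-*ˡ N c _) ⟩
    ∑ N (λ j → c * count (λ x → p x ∧ (key x ≡ᵇ j)) xs)        ≤⟨ ∑-bound N B b ⟩
    N * B                                                      ∎
    where
    open ≤-Reasoning
    lem : ∀ x → x ∈ xs → χ (p x) ≤ ∑ N (λ j → χ (p x ∧ (key x ≡ᵇ j)))
    lem x i with p x in e
    ... | false = z≤n
    ... | true  = ∑-χ≡ N (key x) (h x i (≡⇒T e))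

module _ {A K : Set} where

  -- Exactly one key of the list matches each counted element, so this splitting is an equality. The
  -- two-sided estimates need that; a union bound would not do.
  count-split : ∀ (p : A → Bool) (eq : A → K → Bool) xs (ks : List K) →
    (∀ x → x ∈ xs → T (p x) → count (eq x) ks ≡ 1) →
    count p xs ≡ sumL (λ k → count (λ x → p x ∧ eq x k) xs) ks
  count-split p eq xs ks h = trans (sumL-cong xs lem) (sumL-swap (λ x k → χ (p x ∧ eq x k)) xs ks)
    where
    lem : ∀ x → x ∈ xs → χ (p x) ≡ sumL (λ k → χ (p x ∧ eq x k)) ks
    lem x i with p x in e
    ... | false = sym (sumL-zero ks (λ _ _ → refl))
    ... | true  = sym (h x i (≡⇒T e))

module _ {A B : Set} where

  count-inj : ∀ (p : A → Bool) (r : B → Bool) (code : A → B) xs ys → Unique xs →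
    (∀ x → x ∈ xs → T (p x) → code x ∈ ys × T (r (code x))) →
    (∀ x x′ → x ∈ xs → x′ ∈ xs → T (p x) → T (p x′) → code x ≡ code x′ → x ≡ x′) →
    count p xs ≤ count r ys
  count-inj p r code xs ys u m i = ≤-trans (sumL-mono xs lem)
    (sumL-inj p code (χ ∘ r) xs ys u (λ x z t → proj₁ (m x z t)) i)
    where
    lem : ∀ x → x ∈ xs → χ (p x) ≤ χ (p x) * χ (r (code x))
    lem x z with p x in e
    ... | false = z≤n
    ... | true  rewrite T⇒≡ (proj₂ (m x z (≡⇒T e))) = ≤-refl

-- Numerical semigroups and Kunz coordinates

record IsSemigroup (g : ℕ) (G : ℕ → Bool) : Set where
  field
    zero∈   : G 0 ≡ false
    closed  : ∀ x y → G x ≡ false → G y ≡ false → G (x + y) ≡ false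
    bounded : ∀ n → 2 * g < n → G n ≡ false
    genus   : ∑ (suc (2 * g)) (χ ∘ G) ≡ g

not-T⁻ : ∀ {b} → T (not b) → b ≡ false
not-T⁻ {false} _ = refl

not-T⁺ : ∀ {b} → b ≡ false → T (not b)
not-T⁺ refl = tt

allB⁻ : ∀ {A : Set} (p : A → Bool) xs → T (allB p xs) → ∀ x → x ∈ xs → T (p x)
allB⁻ p (y ∷ xs) t x (here refl) = proj₁ (T-∧⁻ t)
allB⁻ p (y ∷ xs) t x (there i)   = allB⁻ p xs (proj₂ (T-∧⁻ {p y} t)) x i

allB⁺ : ∀ {A : Set} (p : A → Bool) xs → (∀ x → x ∈ xs → T (p x)) → T (allB p xs)
allB⁺ p []       h = tt
allB⁺ p (y ∷ xs) h = T-∧⁺ {p y} (h y (here refl)) (allB⁺ p xs (λ x i → h x (there i)))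

isGap-≥ : ∀ gs n → length gs ≤ n → isGap gs n ≡ false
isGap-≥ []       n       h = refl
isGap-≥ (b ∷ gs) (suc n) h = isGap-≥ gs n (s≤s⁻¹ h)

countTrue-∑ : ∀ gs → countTrue gs ≡ ∑ (length gs) (χ ∘ isGap gs)
countTrue-∑ []           = refl
countTrue-∑ (true ∷ gs)  = trans (cong suc (countTrue-∑ gs)) (sym (∑-head (length gs) _))
countTrue-∑ (false ∷ gs) = trans (countTrue-∑ gs) (sym (∑-head (length gs) _))

isGap-ext : ∀ gs gs′ → length gs ≡ length gs′ → (∀ n → isGap gs n ≡ isGap gs′ n) → gs ≡ gs′
isGap-ext []       []         e h = refl
isGap-ext (b ∷ gs) (b′ ∷ gs′) e h = cong₂ _∷_ (h 0) (isGap-ext gs gs′ (suc-injective e) (λ n → h (suc n)))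

isGap-map : ∀ (G : ℕ → Bool) f L n → n < L → isGap (map G (Data.List.applyUpTo f L)) n ≡ G (f n)
isGap-map G f (suc L) zero    h = refl
isGap-map G f (suc L) (suc n) h = isGap-map G (f ∘ suc) L n (s≤s⁻¹ h)

allBits-length : ∀ k bs → bs ∈ allBits k → length bs ≡ k
allBits-length zero    .[] (here refl) = refl
allBits-length (suc k) bs  i with ∈-concatMap⁻ {xs = allBits k} i
... | cs , j , here refl         = cong suc (allBits-length k cs j)
... | cs , j , there (here refl) = cong suc (allBits-length k cs j)

∈-allBits : ∀ bs → bs ∈ allBits (length bs)
∈-allBits []           = here refl
∈-allBits (false ∷ bs) = ∈-concatMap (∈-allBits bs) (here refl)
∈-allBits (true ∷ bs)  = ∈-concatMap (∈-allBits bs) (there (here refl))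

allBits-unique : ∀ k → Unique (allBits k)
allBits-unique zero    = [] ∷ []
allBits-unique (suc k) = go (allBits k) (allBits-unique k)
  where
  ext : List Bool → List (List Bool)
  ext bs = (false ∷ bs) ∷ (true ∷ bs) ∷ []
  fresh : ∀ b bs css → All (bs ≢_) css → All ((b ∷ bs) ≢_) (concatMap ext css)
  fresh b bs []         []       = []
  fresh b bs (cs ∷ css) (n ∷ ns) = (λ { refl → n refl }) ∷ (λ { refl → n refl }) ∷ fresh b bs css ns
  go : ∀ css → Unique css → Unique (concatMap ext css)
  go []         []       = []
  go (cs ∷ css) (n ∷ ns) = ((λ ()) ∷ fresh false cs css n) ∷ fresh true cs css n ∷ go css ns

module _ (g : ℕ) where

  𝒮-unique : Unique (𝒮 g)
  𝒮-unique = Uniqueₚ.filter⁺ (λ gs → T? (isNSg g gs)) (allBits-unique (suc (2 * g)))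

  private
    rng = upTo (suc (2 * g))

    cell : List Bool → ℕ → ℕ → Bool
    cell gs a b = not (inS gs a ∧ inS gs b) ∨ inS gs (a + b)

    row : List Bool → ℕ → Bool
    row gs a = allB (cell gs a) rng

  𝒮⇒semigroup : ∀ gs → gs ∈ 𝒮 g → length gs ≡ suc (2 * g) × IsSemigroup g (isGap gs)
  𝒮⇒semigroup gs i = len , record
    { zero∈ = z ; closed = cl ; bounded = bd
    ; genus = trans (trans (cong (λ L → ∑ L (χ ∘ isGap gs)) (sym len)) (sym (countTrue-∑ gs))) (toWitness {a? = countTrue gs ≟ g} (proj₂ (T-∧⁻ {allB (row gs) rng} (proj₂ (T-∧⁻ {inS gs 0} ok))))) }
    where
    both = ∈-filter⁻ (λ gs → T? (isNSg g gs)) {xs = allBits (suc (2 * g))} i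
    len = allBits-length (suc (2 * g)) gs (proj₁ both)
    ok : T (isNSg g gs)
    ok = proj₂ both
    z = not-T⁻ (proj₁ (T-∧⁻ {inS gs 0} ok))
    bd : ∀ n → 2 * g < n → isGap gs n ≡ false
    bd n h = isGap-≥ gs n (subst (_≤ n) (sym len) h)
    cl : ∀ x y → isGap gs x ≡ false → isGap gs y ≡ false → isGap gs (x + y) ≡ false
    cl x y gx gy with x ≤? 2 * g | y ≤? 2 * g
    ... | no ¬p | _     = bd (x + y) (≤-trans (≰⇒> ¬p) (m≤m+n x y))
    ... | yes _ | no ¬p = bd (x + y) (≤-trans (≰⇒> ¬p) (m≤n+m y x))
    ... | yes p | yes r = use (allB⁻ (cell gs x) rng (allB⁻ (row gs) rng (proj₁ (T-∧⁻ {allB (row gs) rng} (proj₂ (T-∧⁻ {inS gs 0} ok)))) x (∈-upTo⁺ (s≤s p))) y (∈-upTo⁺ (s≤s r)))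
      where
      use : T (not (inS gs x ∧ inS gs y) ∨ inS gs (x + y)) → isGap gs (x + y) ≡ false
      use t rewrite gx | gy = not-T⁻ t

  semigroup⇒𝒮 : ∀ gs → length gs ≡ suc (2 * g) → IsSemigroup g (isGap gs) → gs ∈ 𝒮 g
  semigroup⇒𝒮 gs len S = ∈-filter⁺ (λ gs → T? (isNSg g gs)) (subst (λ L → gs ∈ allBits L) len (∈-allBits gs))
    (T-∧⁺ {inS gs 0} (not-T⁺ zero∈) (T-∧⁺ {allB (row gs) rng} (allB⁺ (row gs) rng λ x _ → allB⁺ (cell gs x) rng λ y _ → cl x y)
      (fromWitness (trans (countTrue-∑ gs) (trans (cong (λ L → ∑ L (χ ∘ isGap gs)) len) genus)))))
    where
    open IsSemigroup S
    cl : ∀ x y → T (not (inS gs x ∧ inS gs y) ∨ inS gs (x + y))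
    cl x y with isGap gs x in e₁ | isGap gs y in e₂
    ... | true  | _     = tt
    ... | false | true  = tt
    ... | false | false = not-T⁺ (closed x y e₁ e₂)

-- least p n is n if p fails everywhere below n.

least : (ℕ → Bool) → ℕ → ℕ
least p zero    = zero
least p (suc n) = if p 0 then 0 else suc (least (p ∘ suc) n)

least-≤ : ∀ p n → least p n ≤ n
least-≤ p zero = z≤n
least-≤ p (suc n) with p 0
... | true  = z≤n
... | false = s≤s (least-≤ (p ∘ suc) n)

least-min : ∀ p n i → i < least p n → p i ≡ false
least-min p (suc n) i h with p 0 in e
least-min p (suc n) zero    h | false = e
least-min p (suc n) (suc i) h | false = least-min (p ∘ suc) n i (s≤s⁻¹ h)

least-hit : ∀ p n → least p n < n → p (least p n) ≡ true
least-hit p (suc n) h with p 0 in e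
... | true  = e
... | false = least-hit (p ∘ suc) n (s≤s⁻¹ h)

-- By `dec` the true indices are closed downwards, so their number is also the first false index.
-- Along a residue class modulo the multiplicity this identifies the number of gaps with the row of
-- the Apéry element.
initial-segment : ∀ (h : ℕ → Bool) J → (∀ j → h (suc j) ≡ true → h j ≡ true) →
  (∀ j → J ≤ j → h j ≡ false) → ∀ j → h j ≡ (j <ᵇ ∑ J (χ ∘ h))
initial-segment h J dec end j with h j in e
... | true = sym (<ᵇ-true (≤-trans (≤-reflexive (trans (sym (*-identityʳ (suc j))) (trans (sym (∑-const (suc j) 1))
               (∑-cong (suc j) (λ i l → cong χ (sym (down (s≤s⁻¹ l)))))))) (∑-≤-split _ j<J)))
  where
  down : ∀ {i} → i ≤ j → h i ≡ true
  down {i} l = go j e (j ∸ i) i (m∸n+n≡m l)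
    where
    go : ∀ j → h j ≡ true → ∀ d i → d + i ≡ j → h i ≡ true
    go j e zero    i refl = e
    go j e (suc d) i refl = go (d + i) (dec (d + i) e) d i refl
  j<J : j < J
  j<J = ≰⇒> (λ l → λ-absurd (trans (sym e) (end j l)))
    where
    λ-absurd : true ≡ false → ⊥
    λ-absurd ()
... | false = sym (<ᵇ-false few)
  where
  up : ∀ d → h (j + d) ≡ false
  up zero = trans (cong h (+-identityʳ j)) e
  up (suc d) with h (j + suc d) in e′
  ... | false = refl
  ... | true  = trans (sym (dec (j + d) (trans (cong h (sym (+-suc j d))) e′))) (up d)
  few : ∑ J (χ ∘ h) ≤ j
  few with ≤-total J j
  ... | inj₁ l = ≤-trans (≤-trans (∑-bound J 1 (λ i _ → χ≤1 (h i))) (≤-reflexive (*-identityʳ J))) l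
  ... | inj₂ l = ≤-trans (≤-reflexive (trans (cong (λ x → ∑ x (χ ∘ h)) (sym (m+[n∸m]≡n l)))
      (trans (∑-split j (J ∸ j) (χ ∘ h)) (trans (cong (∑ j (χ ∘ h) +_) (∑-zero (J ∸ j) (λ i _ → cong χ (up i)))) (+-identityʳ _)))))
      (≤-trans (∑-bound j 1 (λ i _ → χ≤1 (h i))) (≤-reflexive (*-identityʳ j)))

∑-<ᵇ : ∀ J c → c ≤ J → ∑ J (λ j → χ (j <ᵇ c)) ≡ c
∑-<ᵇ J c h = trans (cong (λ x → ∑ x (λ j → χ (j <ᵇ c))) (sym (m+[n∸m]≡n h)))
  (trans (∑-split c (J ∸ c) _)
  (trans (cong₂ _+_ (trans (∑-cong c (λ i l → cong χ (<ᵇ-true l))) (trans (∑-const c 1) (*-identityʳ c)))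
                    (∑-zero (J ∸ c) (λ i _ → cong χ (<ᵇ-false (m≤m+n c i))))) (+-identityʳ c)))

∑-vanish : ∀ a b f → (∀ i → a ≤ i → f i ≡ 0) → (∀ i → b ≤ i → f i ≡ 0) → ∑ a f ≡ ∑ b f
∑-vanish a b f ha hb with ≤-total a b
... | inj₁ l = sym (trans (cong (λ x → ∑ x f) (sym (m+[n∸m]≡n l))) (trans (∑-split a (b ∸ a) f)
                 (trans (cong (∑ a f +_) (∑-zero (b ∸ a) (λ i _ → ha (a + i) (m≤m+n a i)))) (+-identityʳ _))))
... | inj₂ l = trans (cong (λ x → ∑ x f) (sym (m+[n∸m]≡n l))) (trans (∑-split b (a ∸ b) f)
                 (trans (cong (∑ b f +_) (∑-zero (a ∸ b) (λ i _ → hb (b + i) (m≤m+n b i)))) (+-identityʳ _)))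

-- k i is the number of gaps congruent to i modulo the multiplicity m

record IsKunz (G : ℕ → Bool) (m : ℕ) (k : ℕ → ℕ) : Set where
  field
    m>0  : 0 < m
    k₀   : k 0 ≡ 0
    spec : ∀ i j → i < m → G (i + j * m) ≡ (j <ᵇ k i)
    pos  : ∀ i → 0 < i → i < m → 0 < k i

  gap-below : ∀ i → 0 < i → i < m → G i ≡ true
  gap-below i p l = trans (cong G (sym (+-identityʳ i))) (trans (spec i 0 l) (<ᵇ-true (pos i p l)))

  m∈ : G m ≡ false
  m∈ = trans (cong G (sym (+-identityʳ m))) (trans (spec 0 1 m>0) (cong (1 <ᵇ_) k₀))

  apery∈ : ∀ i → i < m → G (i + k i * m) ≡ false
  apery∈ i l = trans (spec i (k i) l) (<ᵇ-false {k i} ≤-refl)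

  not-gap : ∀ i j → i < m → G (i + j * m) ≡ false → k i ≤ j
  not-gap i j l e = ≮⇒≥ (λ lt → absurd (trans (sym (trans (spec i j l) (<ᵇ-true lt))) e))
    where
    absurd : true ≡ false → ⊥
    absurd ()

module _ {G : ℕ → Bool} {m k m′ k′} (K : IsKunz G m k) (K′ : IsKunz G m′ k′) where
  private
    module K = IsKunz K
    module K′ = IsKunz K′

  -- The modulus is forced: it is a non-gap, while every smaller positive number is a gap.
  kunz-unique-m : m ≡ m′
  kunz-unique-m with <-cmp m m′
  ... | tri< l _ _ with trans (sym (K′.gap-below m K.m>0 l)) K.m∈
  ...   | ()
  kunz-unique-m | tri≈ _ e _ = e
  kunz-unique-m | tri> _ _ l with trans (sym (K.gap-below m′ K′.m>0 l)) K′.m∈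
  ...   | ()

  kunz-unique-k : ∀ i → i < m → k i ≡ k′ i
  kunz-unique-k i l with kunz-unique-m
  ... | refl = ≤-antisym (K.not-gap i (k′ i) l (K′.apery∈ i l)) (K′.not-gap i (k i) l (K.apery∈ i l))

module _ {G G′ : ℕ → Bool} {m k k′} (K : IsKunz G m k) (K′ : IsKunz G′ m k′) (e : ∀ i → 0 < i → i < m → k i ≡ k′ i) where
  private
    module K = IsKunz K
    module K′ = IsKunz K′

  kunz-determines : ∀ n → G n ≡ G′ n
  kunz-determines n = subst (λ x → G x ≡ G′ x) (sym (m≡m%n+[m/n]*n n m)) (trans (K.spec _ (n / m) l) (trans (cong (n / m <ᵇ_) (eq (n % m) l)) (sym (K′.spec _ (n / m) l))))
    where
    instance
      nz : NonZero m
      nz = >-nonZero K.m>0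
    l = m%n<n n m
    eq : ∀ i → i < m → k i ≡ k′ i
    eq zero    _ = trans K.k₀ (sym K′.k₀)
    eq (suc i) l = e (suc i) (s≤s z≤n) l

-- If the search finds nothing, `least` returns its bound and the value is 2g + 1, which is a
-- non-gap because all gaps are at most 2g.
multiplicity : ℕ → (ℕ → Bool) → ℕ
multiplicity g G = suc (least (λ n → not (G (suc n))) (2 * g))

-- The sum stops at row 2g, since from row 2g + 1 on the number `i + j * m` exceeds 2g and is no
-- gap.
kunz : ℕ → (ℕ → Bool) → ℕ → ℕ
kunz g G i = ∑ (suc (2 * g)) (λ j → χ (G (i + j * multiplicity g G)))

module _ {g : ℕ} {G : ℕ → Bool} (S : IsSemigroup g G) where
  open IsSemigroup S

  private
    m = multiplicity g G
    k = kunz g G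

    not-false : ∀ {b} → not b ≡ false → b ≡ true
    not-false {true} _ = refl

    not-true : ∀ {b} → not b ≡ true → b ≡ false
    not-true {false} _ = refl

    mult∈ : G m ≡ false
    mult∈ with m≤n⇒m<n∨m≡n (least-≤ (λ n → not (G (suc n))) (2 * g))
    ... | inj₁ l = not-true (least-hit (λ n → not (G (suc n))) (2 * g) l)
    ... | inj₂ e = bounded m (s≤s (≤-reflexive (sym e)))

    below : ∀ i → 0 < i → i < m → G i ≡ true
    below (suc i) _ l = not-false (least-min (λ n → not (G (suc n))) (2 * g) i (s≤s⁻¹ l))

    row∈ : ∀ j → G (j * m) ≡ false
    row∈ zero    = zero∈
    row∈ (suc j) = closed m (j * m) mult∈ (row∈ j)

    step : ∀ i j → G (i + suc j * m) ≡ true → G (i + j * m) ≡ true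
    step i j h with G (i + j * m) in e
    ... | true  = refl
    ... | false = trans (sym (trans (cong G (lem i j m)) (closed (i + j * m) m e mult∈))) h
      where
      lem : ∀ i j m → i + (m + j * m) ≡ i + j * m + m
      lem = solve-∀

    end : ∀ i j → suc (2 * g) ≤ j → G (i + j * m) ≡ false
    end i j h = bounded _ (≤-trans h (≤-trans (m≤m*n j m) (m≤n+m (j * m) i)))

    spec : ∀ i j → G (i + j * m) ≡ (j <ᵇ k i)
    spec i j = initial-segment (λ j → G (i + j * m)) (suc (2 * g)) (step i) (end i) j

  mult-≤ : m ≤ suc (2 * g)
  mult-≤ = s≤s (least-≤ (λ n → not (G (suc n))) (2 * g))

  isKunz : IsKunz G m k
  isKunz = record
    { m>0  = s≤s z≤n
    ; k₀   = ∑-zero (suc (2 * g)) (λ j _ → cong χ (row∈ j))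
    ; spec = λ i j _ → spec i j
    ; pos  = λ i p l → <ᵇ⇒< 0 (k i) (≡⇒T (trans (sym (spec i 0)) (trans (cong G (+-identityʳ i)) (below i p l))))
    }

module KunzProps {g : ℕ} {G : ℕ → Bool} {m k} (S : IsSemigroup g G) (K : IsKunz G m k) where
  open IsSemigroup S
  open IsKunz K

  private
    instance
      nz : NonZero m
      nz = >-nonZero m>0

    true≢false : true ≡ false → ⊥
    true≢false ()

  k-≤ : ∀ i → i < m → k i ≤ suc (2 * g)
  k-≤ i l = not-gap i (suc (2 * g)) l (bounded _ (≤-trans (m≤m*n (suc (2 * g)) m) (m≤n+m _ i)))

  gap-bound : ∀ i j → i < m → j < k i → i + j * m ≤ 2 * g
  gap-bound i j l h = ≮⇒≥ (λ lt → true≢false (trans (sym (trans (spec i j l) (<ᵇ-true h))) (bounded _ lt)))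

  ∑k : ∑ m k ≡ g
  ∑k = trans (sym (trans (∑-rows (suc (2 * g)) m (χ ∘ G))
      (trans (∑-swap (suc (2 * g)) m (λ j i → χ (G (i + j * m))))
        (∑-cong m (λ i l → trans (∑-cong (suc (2 * g)) (λ j _ → cong χ (spec i j l))) (∑-<ᵇ _ _ (k-≤ i l)))))))
    (trans (∑-vanish (suc (2 * g) * m) (suc (2 * g)) (χ ∘ G)
             (λ i h → cong χ (bounded i (≤-trans (m≤m*n (suc (2 * g)) m) h))) (λ i h → cong χ (bounded i h))) genus)

  subadditive : ∀ i j → i + j < m → k (i + j) ≤ k i + k j
  subadditive i j l = not-gap (i + j) (k i + k j) l
    (trans (cong G (lem i j (k i) (k j) m)) (closed _ _ (apery∈ i (≤-<-trans (m≤m+n i j) l)) (apery∈ j (≤-<-trans (m≤n+m j i) l))))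
    where
    lem : ∀ i j a b m → i + j + (a + b) * m ≡ i + a * m + (j + b * m)
    lem = solve-∀

  -- The carry gives the extra 1: the Apéry elements of i and j add up to l + m + (k i + k j) m.
  subadditive-wrap : ∀ i j l → i < m → j < m → l < m → i + j ≡ l + m → k l ≤ suc (k i + k j)
  subadditive-wrap i j l p r s e = not-gap l (suc (k i + k j)) s
    (trans (cong G (trans (lem l m (k i) (k j)) (trans (cong (_+ (k i * m + k j * m)) (sym e)) (lem′ i j (k i * m) (k j * m))))) (closed _ _ (apery∈ i p) (apery∈ j r)))
    where
    lem : ∀ l m a b → l + (m + (a + b) * m) ≡ l + m + (a * m + b * m)
    lem = solve-∀
    lem′ : ∀ i j a b → i + j + (a + b) ≡ i + a + (j + b)
    lem′ = solve-∀

-- the semigroup with prescribed Kunz coordinates at most 3; then the inequalities for sums that wrap around m hold automatically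

record Coordinates (g m : ℕ) (k : ℕ → ℕ) : Set where
  field
    m>0 : 0 < m
    k₀  : k 0 ≡ 0
    pos : ∀ i → 0 < i → i < m → 0 < k i
    ≤3  : ∀ i → i < m → k i ≤ 3
    sub : ∀ i j → i + j < m → k (i + j) ≤ k i + k j
    tot : ∑ m k ≡ g

gapOf : ∀ m .{{_ : NonZero m}} → (ℕ → ℕ) → ℕ → Bool
gapOf m k n = n / m <ᵇ k (n % m)

module _ {g m : ℕ} {k : ℕ → ℕ} (W : Coordinates g m k) where
  open Coordinates W

  private
    instance
      nz : NonZero m
      nz = >-nonZero m>0

    G = gapOf m k

    spec : ∀ i j → i < m → G (i + j * m) ≡ (j <ᵇ k i)
    spec i j l = cong₂ (λ a b → a <ᵇ k b)
      (trans (+-distrib-/ i (j * m) (subst (_< m) (sym (trans (cong₂ _+_ (m<n⇒m%n≡m l) (m*n%n≡0 j m)) (+-identityʳ i))) l))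
        (cong₂ _+_ (m<n⇒m/n≡0 l) (m*n/n≡m j m)))
      (trans ([m+kn]%n≡m%n i j m) (m<n⇒m%n≡m l))

    decomp : ∀ n → n ≡ n % m + n / m * m
    decomp n = m≡m%n+[m/n]*n n m

    from-res : ∀ n i j → i < m → n ≡ i + j * m → k i ≤ j → G n ≡ false
    from-res n i j l refl h = trans (spec i j l) (<ᵇ-false h)

    to-res : ∀ n → G n ≡ false → k (n % m) ≤ n / m
    to-res n e = ≮⇒≥ (λ lt → absurd (trans (sym (<ᵇ-true lt)) e))
      where
      absurd : true ≡ false → ⊥
      absurd ()

    pos′ : ∀ i → i < m → i ≢ 0 → 0 < k i
    pos′ i l ne = pos i (n≢0⇒n>0 ne) l

    cl : ∀ x y → G x ≡ false → G y ≡ false → G (x + y) ≡ false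
    cl x y gx gy with x % m + y % m <? m
    ... | yes l = from-res (x + y) _ _ l (trans (cong₂ _+_ (decomp x) (decomp y)) (lem (x % m) (y % m) (x / m) (y / m) m))
                    (≤-trans (sub _ _ l) (+-mono-≤ (to-res x gx) (to-res y gy)))
      where
      lem : ∀ i j a b m → i + a * m + (j + b * m) ≡ i + j + (a + b) * m
      lem = solve-∀
    ... | no ¬l = from-res (x + y) r (suc (x / m + y / m)) r<m
          (trans (cong₂ _+_ (decomp x) (decomp y)) (trans (lem (x % m) (y % m) (x / m) (y / m) m) (trans (cong (_+ (x / m + y / m) * m) (sym r+m)) (+-assoc r m _))))
          -- A carry is possible only if both residues are nonzero, so both quotients are at least
          -- 1; with the carry the row is at least 3.
          (≤-trans (≤3 r r<m) (s≤s (+-mono-≤ (≤-trans (pos′ _ (m%n<n x m) x≢0) (to-res x gx)) (≤-trans (pos′ _ (m%n<n y m) y≢0) (to-res y gy)))))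
      where
      lem : ∀ i j a b m → i + a * m + (j + b * m) ≡ i + j + (a + b) * m
      lem = solve-∀
      m≤ : m ≤ x % m + y % m
      m≤ = ≮⇒≥ ¬l
      r = x % m + y % m ∸ m
      r+m : r + m ≡ x % m + y % m
      r+m = m∸n+n≡m m≤
      r<m : r < m
      r<m = +-cancelʳ-< m r m (subst (_< m + m) (sym r+m) (+-mono-< (m%n<n x m) (m%n<n y m)))
      x≢0 : x % m ≢ 0
      x≢0 e = <⇒≱ (m%n<n y m) (subst (λ z → m ≤ z + y % m) e m≤)
      y≢0 : y % m ≢ 0
      y≢0 e = <⇒≱ (m%n<n x m) (≤-trans (subst (λ z → m ≤ x % m + z) e m≤) (≤-reflexive (+-identityʳ _)))

    far : ∀ n → 3 * m ≤ n → G n ≡ false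
    far n h = from-res n (n % m) (n / m) (m%n<n n m) (decomp n) (≤-trans (≤3 _ (m%n<n n m)) (≮⇒≥ nope))
      where
      nope : ¬ n / m < 3
      nope l = <⇒≱ (≤-trans (≤-reflexive (cong suc (decomp n))) (≤-trans (+-monoˡ-≤ (n / m * m) (m%n<n n m)) (*-monoˡ-≤ m l))) h

    total : ∑ (3 * m) (χ ∘ G) ≡ g
    total = trans (∑-rows 3 m (χ ∘ G)) (trans (∑-swap 3 m (λ j i → χ (G (i + j * m))))
      (trans (∑-cong m (λ i l → trans (∑-cong 3 (λ j _ → cong χ (spec i j l))) (∑-<ᵇ 3 _ (≤3 i l)))) tot))

    -- If x is a gap, then for every y ≤ x one of y and x - y is a gap, since the set of non-gaps is
    -- closed under addition. Summed over y this gives x + 1 ≤ 2g, because there are g gaps.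
    bd : ∀ n → 2 * g < n → G n ≡ false
    bd x h with G x in gx
    ... | false = refl
    ... | true  = ⊥-elim (<⇒≱ h (≤-trans (n≤1+n x) bnd))
      where
      x<3m : x < 3 * m
      x<3m = ≰⇒> (λ l → absurd (trans (sym gx) (far x l)))
        where
        absurd : true ≡ false → ⊥
        absurd ()
      one : ∀ y → y < suc x → 1 ≤ χ (G y) + χ (G (x ∸ y))
      one y l with G y in e₁ | G (x ∸ y) in e₂
      ... | true  | _     = s≤s z≤n
      ... | false | true  = s≤s z≤n
      ... | false | false with trans (sym gx) (trans (cong G (sym (m+[n∸m]≡n (s≤s⁻¹ l)))) (cl y (x ∸ y) e₁ e₂))
      ... | ()
      open ≤-Reasoning
      bnd : suc x ≤ 2 * g
      bnd = begin
        suc x                                              ≡⟨ sym (trans (∑-const (suc x) 1) (*-identityʳ (suc x))) ⟩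
        ∑ (suc x) (λ _ → 1)                                ≤⟨ ∑-mono (suc x) one ⟩
        ∑ (suc x) (λ y → χ (G y) + χ (G (x ∸ y)))          ≡⟨ ∑-+ (suc x) _ _ ⟩
        ∑ (suc x) (χ ∘ G) + ∑ (suc x) (λ y → χ (G (x ∸ y)))  ≡⟨ cong (∑ (suc x) (χ ∘ G) +_) (trans (∑-rev x (χ ∘ G)) (sym (+-identityʳ _))) ⟩
        2 * ∑ (suc x) (χ ∘ G)                              ≤⟨ *-monoʳ-≤ 2 (∑-≤-split (χ ∘ G) x<3m) ⟩
        2 * ∑ (3 * m) (χ ∘ G)                              ≡⟨ cong (2 *_) total ⟩
        2 * g                                              ∎

    sg : IsSemigroup g G
    sg = record
      { zero∈ = from-res 0 0 0 m>0 refl (≤-reflexive k₀)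
      ; closed = cl
      ; bounded = bd
      ; genus = trans (∑-vanish (suc (2 * g)) (3 * m) (χ ∘ G) (λ i h → cong χ (bd i h)) (λ i h → cong χ (far i h))) total
      }

  decode : List Bool
  decode = map G (upTo (suc (2 * g)))

  private
    isGap-decode : ∀ n → isGap decode n ≡ G n
    isGap-decode n with n <? suc (2 * g)
    ... | yes l = isGap-map G id (suc (2 * g)) n l
    ... | no ¬l = trans (isGap-≥ decode n (≤-trans (≤-reflexive len) (≮⇒≥ ¬l))) (sym (bd n (≮⇒≥ ¬l)))
      where
      len = trans (length-map G (upTo (suc (2 * g)))) (length-upTo (suc (2 * g)))

    transport : ∀ {H} → (∀ n → H n ≡ G n) → IsSemigroup g H × IsKunz H m k
    transport {H} e = record
      { zero∈ = trans (e 0) (IsSemigroup.zero∈ sg)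
      ; closed = λ x y p r → trans (e (x + y)) (cl x y (trans (sym (e x)) p) (trans (sym (e y)) r))
      ; bounded = λ n h → trans (e n) (bd n h)
      ; genus = trans (∑-cong (suc (2 * g)) (λ i _ → cong χ (e i))) (IsSemigroup.genus sg)
      } , record { m>0 = m>0 ; k₀ = k₀ ; spec = λ i j l → trans (e _) (spec i j l) ; pos = pos }

  decode-kunz : IsKunz (isGap decode) m k
  decode-kunz = proj₂ (transport isGap-decode)

  decode∈𝒮 : decode ∈ 𝒮 g
  decode∈𝒮 = semigroup⇒𝒮 g decode (trans (length-map G (upTo (suc (2 * g)))) (length-upTo (suc (2 * g)))) (proj₁ (transport isGap-decode))

filterᵇ-sum : ∀ {A : Set} (p : A → Bool) (f : A → ℕ) xs → sumL f (filterᵇ p xs) ≡ sumL (λ x → χ (p x) * f x) xs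
filterᵇ-sum p f []       = refl
filterᵇ-sum p f (x ∷ xs) with p x
... | true  = cong₂ _+_ (sym (+-identityʳ (f x))) (filterᵇ-sum p f xs)
... | false = filterᵇ-sum p f xs

filterᵇ-sum-≤ : ∀ {A : Set} (p : A → Bool) (f : A → ℕ) xs → sumL f (filterᵇ p xs) ≤ sumL f xs
filterᵇ-sum-≤ p f xs = ≤-trans (≤-reflexive (filterᵇ-sum p f xs))
  (sumL-mono xs (λ x _ → ≤-trans (*-monoˡ-≤ (f x) (χ≤1 (p x))) (≤-reflexive (+-identityʳ (f x)))))

-- Total weight of words with links at a fixed distance

-- Words s_H … s_1 (latest letter first) in which s_i is constrained by s_{i-b}, b = suc b′.
-- The letters form b interleaved Markov chains; eliminating them from the last one down to
-- the first bounds the total weight by the potentials of the letters that have no successor yet.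

module ChainedWords {State : Set} (letters : List State) (b′ : ℕ) (admit : ℕ → State → Bool)
  (link : State → State → Bool) (wt : State → ℕ) where

  b = suc b′

  fits : List State → State → Bool
  fits w s with drop b′ w
  ... | []    = true
  ... | t ∷ _ = link t s

  next : ℕ → List State → List (List State)
  next i w = map (_∷ w) (filterᵇ (fits w) (filterᵇ (admit i) letters))

  chained : ℕ → List (List State)
  chained zero    = [] ∷ []
  chained (suc i) = concatMap (next (suc i)) (chained i)

  weight : List State → ℕ
  weight []      = 1
  weight (s ∷ w) = wt s * weight w

  word : (ℕ → State) → ℕ → List State
  word st zero    = []
  word st (suc i) = st (suc i) ∷ word st i

  weight-word : ∀ st n → weight (word st n) ≡ ∏ n (wt ∘ st)
  weight-word st zero    = refl
  weight-word st (suc n) = trans (cong (wt (st (suc n)) *_) (weight-word st n)) (*-comm (wt (st (suc n))) _)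

  word-injective : ∀ st st′ n → word st n ≡ word st′ n → ∀ i → 1 ≤ i → i ≤ n → st i ≡ st′ i
  word-injective st st′ zero    e i p l = ⊥-elim (<⇒≱ p l)
  word-injective st st′ (suc n) e i p l with m≤n⇒m<n∨m≡n l
  ... | inj₁ h = word-injective st st′ n (∷-injectiveʳ e) i p (s≤s⁻¹ h)
  ... | inj₂ refl = ∷-injectiveˡ e

  drop-word : ∀ st d n → drop d (word st n) ≡ word st (n ∸ d)
  drop-word st zero    n       = refl
  drop-word st (suc d) zero    = refl
  drop-word st (suc d) (suc n) = drop-word st d n

  word∈chained : ∀ st n → (∀ i → 1 ≤ i → i ≤ n → st i ∈ letters × T (admit i (st i))) →
    (∀ i → b < i → i ≤ n → T (link (st (i ∸ b)) (st i))) → word st n ∈ chained n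
  word∈chained st zero    a l = here refl
  word∈chained st (suc n) a l = ∈-concatMap
    (word∈chained st n (λ i p q → a i p (m≤n⇒m≤1+n q)) (λ i p q → l i p (m≤n⇒m≤1+n q)))
    (∈-map⁺ (_∷ word st n) (∈-filter⁺ (T? ∘ fits (word st n))
      (∈-filter⁺ (T? ∘ admit (suc n)) (proj₁ ok) (proj₂ ok)) fit))
    where
    ok = a (suc n) (s≤s z≤n) ≤-refl
    fit : T (fits (word st n) (st (suc n)))
    fit rewrite drop-word st b′ n with n ∸ b′ in e
    ... | zero  = tt
    ... | suc r = subst (λ x → T (link (st x) (st (suc n)))) e (l (suc n) (s≤s b<) ≤-refl)
      where
      b< : b ≤ n
      b< = ≮⇒≥ (λ h → 1+n≢0 (trans (sym e) (m≤n⇒m∸n≡0 (s≤s⁻¹ h))))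

  chained-shape : ∀ n w → w ∈ chained n → length w ≡ n × (∀ s → s ∈ w → s ∈ letters)
  chained-shape zero    .[] (here refl) = refl , λ s ()
  chained-shape (suc n) w   i with ∈-concatMap⁻ {h = next (suc n)} {xs = chained n} i
  ... | v , j , q with ∈-map⁻ (_∷ v) q
  ... | s , r , refl = cong suc (proj₁ ih) ,
        λ { x (here refl) → proj₁ (∈-filter⁻ (T? ∘ admit (suc n)) {xs = letters} (proj₁ (∈-filter⁻ (T? ∘ fits v) {xs = filterᵇ (admit (suc n)) letters} r)))
          ; x (there h) → proj₂ ih x h }
    where ih = chained-shape n v j

  -- The potential of a letter bounds the weight of everything that may still follow it in its
  -- chain; a letter without future has potential at least K. The first b letters have no
  -- predecessor whose potential could pay for them, so each brings a factor K into the total. The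
  -- last letters, one in each chain, give these factors back, and only the quotient of the products
  -- of `num` and `den` remains.
  module Bound (H K : ℕ) (K>0 : 0 < K) (pot : ℕ → State → ℕ) (num den : ℕ → ℕ)
    (initial : ∀ i → 1 ≤ i → i ≤ b → i ≤ H →
      den i * sumL (λ s → wt s * pot i s) (filterᵇ (admit i) letters) ≤ K * num i)
    (chain : ∀ i t → b < i → i ≤ H → t ∈ letters →
      den i * sumL (λ s → wt s * pot i s) (filterᵇ (link t) (filterᵇ (admit i) letters)) ≤ num i * pot (i ∸ b) t)
    (leaf : ∀ i s → 1 ≤ i → i ≤ H → H < i + b → K ≤ pot i s) where

    private
      open-ends : ℕ → List State → ℕ
      open-ends zero    w       = 1
      open-ends (suc f) []      = 1
      open-ends (suc f) (s ∷ w) = pot (suc (length w)) s * open-ends f w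

      open-ends-all : ∀ d w → drop d w ≡ [] → open-ends (suc d) w ≡ open-ends d w
      open-ends-all zero    []      e = refl
      open-ends-all (suc d) []      e = refl
      open-ends-all (suc d) (s ∷ w) e = cong (pot (suc (length w)) s *_) (open-ends-all d w e)

      open-ends-last : ∀ d w t v → drop d w ≡ t ∷ v → open-ends (suc d) w ≡ open-ends d w * pot (length w ∸ d) t
      open-ends-last zero    (s ∷ w) .s .w refl = *-comm (pot (suc (length w)) s) 1
      open-ends-last (suc d) (s ∷ w) t v e = trans (cong (pot (suc (length w)) s *_) (open-ends-last d w t v e))
        (sym (*-assoc (pot (suc (length w)) s) _ _))

      open-ends-leaf : ∀ f w → length w ≤ H → H + f ≤ length w + b → K ^ (f ⊓ length w) ≤ open-ends f w
      open-ends-leaf zero    w       l h = ≤-refl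
      open-ends-leaf (suc f) []      l h = ≤-refl
      open-ends-leaf (suc f) (s ∷ w) l h = *-mono-≤
        (leaf _ s (s≤s z≤n) l (≤-trans (s≤s (m≤m+n H f)) (≤-trans (≤-reflexive (sym (+-suc H f))) h)))
        (open-ends-leaf f w (≤-trans (n≤1+n _) l) (s≤s⁻¹ (≤-trans (≤-reflexive (sym (+-suc H f))) h)))

      Z : ℕ → ℕ
      Z i = sumL (λ w → weight w * open-ends b w) (chained i)

      inner : ℕ → List State → ℕ
      inner i w = sumL (λ s → wt s * pot i s) (filterᵇ (fits w) (filterᵇ (admit i) letters))

      factor : ℕ → ℕ
      factor i with i ≤? b
      ... | yes _ = K
      ... | no  _ = 1

      -- A new letter opens one end and closes the end at distance b, whose potential pays for it.
      -- Among the first b indices nothing is closed, and the payment is the constant K.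
      one : ∀ i w → i < H → length w ≡ i → (∀ s → s ∈ w → s ∈ letters) →
        den (suc i) * (open-ends b′ w * inner (suc i) w) ≤ factor (suc i) * num (suc i) * open-ends b w
      one i w l refl ∈l with drop b′ w in e
      ... | [] with suc i ≤? b
      ...   | yes q = begin
        d * (o * sumL f (filterᵇ (λ _ → true) as)) ≤⟨ *-monoʳ-≤ d (*-monoʳ-≤ o (filterᵇ-sum-≤ (λ _ → true) f as)) ⟩
        d * (o * sumL f as)   ≡⟨ swap d o (sumL f as) ⟩
        d * sumL f as * o     ≤⟨ *-monoˡ-≤ o (initial (suc i) (s≤s z≤n) q l) ⟩
        K * num (suc i) * o   ≡⟨ cong (K * num (suc i) *_) (sym (open-ends-all b′ w e)) ⟩
        K * num (suc i) * open-ends b w ∎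
        where
        open ≤-Reasoning
        d = den (suc i)
        o = open-ends b′ w
        as = filterᵇ (admit (suc i)) letters
        f = λ s → wt s * pot (suc i) s
        swap : ∀ x y z → x * (y * z) ≡ x * z * y
        swap = solve-∀
      ...   | no ¬q = ⊥-elim (¬q (s≤s (m∸n≡0⇒m≤n (trans (sym (length-drop b′ w)) (cong length e)))))
      one i w l refl ∈l | t ∷ v with suc i ≤? b
      ...   | yes q = ⊥-elim (1+n≢0 (trans (sym (cong length e)) (trans (length-drop b′ w) (m≤n⇒m∸n≡0 (s≤s⁻¹ q)))))
      ...   | no ¬q = begin
        d * (o * sumL f (filterᵇ (link t) as))  ≡⟨ swap d o _ ⟩
        d * sumL f (filterᵇ (link t) as) * o    ≤⟨ *-monoˡ-≤ o (chain (suc i) t (≰⇒> ¬q) l (∈l t (drop-∈ b′ w e))) ⟩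
        num (suc i) * pot (i ∸ b′) t * o        ≡⟨ swap′ (num (suc i)) (pot (i ∸ b′) t) o ⟩
        1 * num (suc i) * (o * pot (i ∸ b′) t)  ≡⟨ cong (1 * num (suc i) *_) (sym (open-ends-last b′ w t v e)) ⟩
        1 * num (suc i) * open-ends b w         ∎
        where
        open ≤-Reasoning
        d = den (suc i)
        o = open-ends b′ w
        as = filterᵇ (admit (suc i)) letters
        f = λ s → wt s * pot (suc i) s
        swap : ∀ x y z → x * (y * z) ≡ x * z * y
        swap = solve-∀
        swap′ : ∀ x y z → x * y * z ≡ 1 * x * (z * y)
        swap′ = solve-∀
        drop-∈ : ∀ d w → drop d w ≡ t ∷ v → t ∈ w
        drop-∈ zero    (x ∷ w) refl = here refl
        drop-∈ (suc d) (x ∷ w) e    = there (drop-∈ d w e)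

      step : ∀ i → i < H → den (suc i) * Z (suc i) ≤ factor (suc i) * num (suc i) * Z i
      step i l = begin
        d * Z (suc i)
          ≡⟨ cong (d *_) (trans (sumL-concatMap F (next (suc i)) (chained i)) (sumL-cong (chained i) expand)) ⟩
        d * sumL (λ w → weight w * (open-ends b′ w * inner (suc i) w)) (chained i)
          ≡⟨ sym (sumL-*ˡ d _ (chained i)) ⟩
        sumL (λ w → d * (weight w * (open-ends b′ w * inner (suc i) w))) (chained i)
          ≤⟨ sumL-mono (chained i) bound ⟩
        sumL (λ w → factor (suc i) * num (suc i) * (weight w * open-ends b w)) (chained i)
          ≡⟨ sumL-*ˡ (factor (suc i) * num (suc i)) _ (chained i) ⟩
        factor (suc i) * num (suc i) * Z i ∎
        where
        open ≤-Reasoning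
        d = den (suc i)
        F = λ w → weight w * open-ends b w
        expand : ∀ w → w ∈ chained i → sumL F (next (suc i) w) ≡ weight w * (open-ends b′ w * inner (suc i) w)
        expand w j = trans (sumL-map F (_∷ w) fs) (trans (sumL-cong fs (λ s _ → term s))
          (trans (sumL-*ˡ (weight w * open-ends b′ w) _ fs) (*-assoc (weight w) (open-ends b′ w) _)))
          where
          fs = filterᵇ (fits w) (filterᵇ (admit (suc i)) letters)
          rearr : ∀ x y z u → x * y * (z * u) ≡ y * u * (x * z)
          rearr = solve-∀
          term : ∀ s → wt s * weight w * (pot (suc (length w)) s * open-ends b′ w) ≡ weight w * open-ends b′ w * (wt s * pot (suc i) s)
          term s = trans (cong (λ n → wt s * weight w * (pot (suc n) s * open-ends b′ w)) (proj₁ (chained-shape i w j)))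
            (rearr (wt s) (weight w) (pot (suc i) s) (open-ends b′ w))
        comm : ∀ x y z → x * (y * z) ≡ y * (x * z)
        comm = solve-∀
        bound : ∀ w → w ∈ chained i → d * (weight w * (open-ends b′ w * inner (suc i) w)) ≤ factor (suc i) * num (suc i) * (weight w * open-ends b w)
        bound w j = begin
          d * (weight w * (open-ends b′ w * inner (suc i) w)) ≡⟨ comm d (weight w) _ ⟩
          weight w * (d * (open-ends b′ w * inner (suc i) w)) ≤⟨ *-monoʳ-≤ (weight w) (one i w l (proj₁ (chained-shape i w j)) (proj₂ (chained-shape i w j))) ⟩
          weight w * (factor (suc i) * num (suc i) * open-ends b w) ≡⟨ comm (weight w) (factor (suc i) * num (suc i)) _ ⟩
          factor (suc i) * num (suc i) * (weight w * open-ends b w) ∎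

      factor-power : ∀ i → factor (suc i) * K ^ (b ⊓ i) ≡ K ^ (b ⊓ suc i)
      factor-power i with suc i ≤? b
      ... | yes q = trans (cong (λ n → K * K ^ n) (m≥n⇒m⊓n≡n (≤-trans (n≤1+n i) q))) (cong (K ^_) (sym (m≥n⇒m⊓n≡n q)))
      ... | no ¬q = trans (+-identityʳ _) (cong (K ^_) (trans (m≤n⇒m⊓n≡m (s≤s⁻¹ (≰⇒> ¬q))) (sym (m≤n⇒m⊓n≡m (≤-trans (s≤s⁻¹ (≰⇒> ¬q)) (n≤1+n i))))))

      iterate : ∀ i → i ≤ H → ∏ i den * Z i ≤ K ^ (b ⊓ i) * ∏ i num
      iterate zero    l = ≤-refl
      iterate (suc i) l = begin
        ∏ i den * den (suc i) * Z (suc i)                       ≡⟨ *-assoc (∏ i den) (den (suc i)) _ ⟩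
        ∏ i den * (den (suc i) * Z (suc i))                     ≤⟨ *-monoʳ-≤ (∏ i den) (step i l) ⟩
        ∏ i den * (factor (suc i) * num (suc i) * Z i)          ≡⟨ comm (∏ i den) (factor (suc i) * num (suc i)) (Z i) ⟩
        factor (suc i) * num (suc i) * (∏ i den * Z i)          ≤⟨ *-monoʳ-≤ (factor (suc i) * num (suc i)) (iterate i (≤-trans (n≤1+n i) l)) ⟩
        factor (suc i) * num (suc i) * (K ^ (b ⊓ i) * ∏ i num)  ≡⟨ rearr (factor (suc i)) (num (suc i)) (K ^ (b ⊓ i)) (∏ i num) ⟩
        factor (suc i) * K ^ (b ⊓ i) * (∏ i num * num (suc i))  ≡⟨ cong (_* (∏ i num * num (suc i))) (factor-power i) ⟩
        K ^ (b ⊓ suc i) * (∏ i num * num (suc i))               ∎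
        where
        open ≤-Reasoning
        comm : ∀ x y z → x * (y * z) ≡ y * (x * z)
        comm = solve-∀
        rearr : ∀ x y z u → x * y * (z * u) ≡ x * z * (u * y)
        rearr = solve-∀

    chained-bound : ∏ H den * sumL weight (chained H) ≤ ∏ H num
    chained-bound = cancel*ˡ (K ^ (b ⊓ H)) (^>0 K (b ⊓ H) K>0) (begin
      K ^ (b ⊓ H) * (∏ H den * sumL weight (chained H))  ≡⟨ comm (K ^ (b ⊓ H)) (∏ H den) _ ⟩
      ∏ H den * (K ^ (b ⊓ H) * sumL weight (chained H))  ≡⟨ cong (∏ H den *_) (sym (sumL-*ˡ (K ^ (b ⊓ H)) weight (chained H))) ⟩
      ∏ H den * sumL (λ w → K ^ (b ⊓ H) * weight w) (chained H)  ≤⟨ *-monoʳ-≤ (∏ H den) (sumL-mono (chained H) leaves) ⟩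
      ∏ H den * Z H               ≤⟨ iterate H ≤-refl ⟩
      K ^ (b ⊓ H) * ∏ H num       ∎)
      where
      open ≤-Reasoning
      comm : ∀ x y z → x * (y * z) ≡ y * (x * z)
      comm = solve-∀
      leaves : ∀ w → w ∈ chained H → K ^ (b ⊓ H) * weight w ≤ weight w * open-ends b w
      leaves w j = ≤-trans (≤-reflexive (trans (*-comm _ (weight w)) (cong (λ n → weight w * K ^ (b ⊓ n)) (sym len))))
        (*-monoʳ-≤ (weight w) (open-ends-leaf b w (≤-reflexive len) (≤-reflexive (cong (_+ b) (sym len)))))
        where len = proj₁ (chained-shape H w j)

-- Folded Kunz words and the numerical checks

-- Letters (u , v) are values of the coordinates at i and L − i.  A coordinate of value u has weight (13/21)^u,
-- a rational number slightly larger than 1/φ, scaled by 21^c.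

Letter : Set
Letter = ℕ × ℕ

entry : ℕ → ℕ → ℕ
entry c u = 13 ^ u * 21 ^ (c ∸ u)

scale : ℕ → ℕ
scale c = 21 ^ c * 21 ^ c

weightOf : ℕ → Letter → ℕ
weightOf c (u , v) = entry c u * entry c v

-- The condition c ≤ u + v is the reflection inequality: c is the maximum itself for the region
-- before the last peak, and the maximum minus 1 for the region after it, where the sum carries.
lettersOf : ℕ → List Letter
lettersOf c = filterᵇ (λ s → c ≤ᵇ proj₁ s + proj₂ s) (concatMap (λ u → map (u ,_) (applyUpTo suc c)) (applyUpTo suc c))

-- The second entries run backwards: index L - i comes b steps after index L - i - b, so there the
-- old entry is bounded by the new one.
follows : Letter → Letter → Bool
follows (u , v) (u′ , v′) = (u′ ≤ᵇ suc u) ∧ (v ≤ᵇ suc v′)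

atLeast : ℕ → ℕ → Letter → Bool
atLeast u₀ v₀ (u , v) = (u₀ ≤ᵇ u) ∧ (v₀ ≤ᵇ v)

-- potential of a letter that still has a successor, where a last letter has potential p · scale c; a chain contracts by p / q per step
successors : ℕ → ℕ → ℕ → Letter → ℕ
successors p q c t = if c ≤ᵇ 4 then q * sumL (weightOf c) (filterᵇ (follows t) (lettersOf c)) else p * scale c

-- The two inequalities treat a follower that ends its chain and a follower with successors. For c =
-- 3 and c = 4 every letter follows (3 , 1) and all letters together weigh more than `scale c`, so a
-- constant potential cannot contract; there `successors` is one step of power iteration for the
-- transfer matrix. From c = 5 on the total weight is below 98/100 and a constant suffices.
chainCheck : ℕ → ℕ → ℕ → Bool
chainCheck p q c = allB (λ t → (q * sumL (weightOf c) (filterᵇ (follows t) (lettersOf c)) ≤ᵇ successors p q c t)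
  ∧ (q * sumL (λ s → weightOf c s * successors p q c s) (filterᵇ (follows t) (lettersOf c)) ≤ᵇ p * scale c * successors p q c t)) (lettersOf c)

-- The fraction `n / d` bounds, in units of `scale c`, what a letter contributes when no predecessor
-- restricts it. The two inequalities separate last letters from letters with successors, as in
-- `chainCheck`.
startCheck : ℕ → ℕ → ℕ → ℕ → ℕ → ℕ → ℕ → Bool
startCheck p q c u₀ v₀ n d = (d * sumL (weightOf c) starts ≤ᵇ n * scale c)
  ∧ (d * sumL (λ s → weightOf c s * successors p q c s) starts ≤ᵇ p * scale c * (n * scale c))
  where starts = filterᵇ (atLeast u₀ v₀) (lettersOf c)

record StartBound (p q c u₀ v₀ n d : ℕ) : Set where
  constructor startBound
  field holds : T (startCheck p q c u₀ v₀ n d)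

-- The three starts say how many of the two coordinates of a pair lie before index b and hence are
-- at least 2: each of them is worth 6/7, and two are worth 36/49. The start with factor 3 is used
-- only for index b itself, so it occurs once.
lowerCheck : ℕ → Bool
lowerCheck q = chainCheck 98 100 q ∧ startCheck 98 100 q 1 1 3 1 ∧ startCheck 98 100 q 2 1 6 7 ∧ startCheck 98 100 q 2 2 36 49

-- The fraction 7/6 is dictated by c = 3, where all letters together weigh about 1.153. It is the
-- reciprocal of the gain in `lowerCheck`, so that gains and losses can be cancelled by counting.
upperCheck : ℕ → Bool
upperCheck q = chainCheck 98 100 q ∧ startCheck 98 100 q 1 1 7 6 ∧ startCheck 98 100 q 2 1 1 1

-- Here the starts contract by 98/100 as well, apart from one factor 3 at index b (294 = 3 · 98). So
-- the whole length of the chain counts as gain, however large b is.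
topCheck : ℕ → Bool
topCheck q = chainCheck 98 100 q ∧ startCheck 98 100 q 1 1 294 100 ∧ startCheck 98 100 q 2 1 98 100

abstract
  topCheck-3 : T (topCheck 3)
  topCheck-3 = tt

  bothChecks : ∀ q → 4 ≤ q → q ≤ 11 → T (lowerCheck q) × T (upperCheck (q ∸ 1))
  bothChecks 4  _ _ = tt , tt
  bothChecks 5  _ _ = tt , tt
  bothChecks 6  _ _ = tt , tt
  bothChecks 7  _ _ = tt , tt
  bothChecks 8  _ _ = tt , tt
  bothChecks 9  _ _ = tt , tt
  bothChecks 10 _ _ = tt , tt
  bothChecks 11 _ _ = tt , tt
  bothChecks (suc (suc (suc (suc (suc (suc (suc (suc (suc (suc (suc (suc _)))))))))))) _ h =
    ⊥-elim (<⇒≱ (s≤s (s≤s (s≤s (s≤s (s≤s (s≤s (s≤s (s≤s (s≤s (s≤s (s≤s (s≤s z≤n)))))))))))) h)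
  bothChecks 0 () _
  bothChecks 1 (s≤s ()) _
  bothChecks 2 (s≤s (s≤s ())) _
  bothChecks 3 (s≤s (s≤s (s≤s ()))) _

scale>0 : ∀ c → 0 < scale c
scale>0 c = *>0 (^>0 21 c (s≤s z≤n)) (^>0 21 c (s≤s z≤n))

cross-multiply : ∀ p q d n X R S → 0 < q → p * d ≤ q * n → q * X ≤ p * R * S → d * X ≤ n * R * S
cross-multiply p q d n X R S q>0 h k = cancel*ˡ q q>0 (begin
  q * (d * X)      ≡⟨ swap q d X ⟩
  d * (q * X)      ≤⟨ *-monoʳ-≤ d k ⟩
  d * (p * R * S)  ≡⟨ swap′ d p R S ⟩
  p * d * (R * S)  ≤⟨ *-monoˡ-≤ (R * S) h ⟩
  q * n * (R * S)  ≡⟨ swap″ q n R S ⟩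
  q * (n * R * S)  ∎)
  where
  open ≤-Reasoning
  swap : ∀ x y z → x * (y * z) ≡ y * (x * z)
  swap = solve-∀
  swap′ : ∀ d p R S → d * (p * R * S) ≡ p * d * (R * S)
  swap′ = solve-∀
  swap″ : ∀ q n R S → q * n * (R * S) ≡ q * (n * R * S)
  swap″ = solve-∀

-- The fraction `n i / d i` is what index i contributes. Up to index b it comes from a start check;
-- beyond b the contraction p / q is available, and `later` only asks that the recorded factor is no
-- smaller.
module Region (p q : ℕ) (p>0 : 0 < p) (q>0 : 0 < q) (c b′ H : ℕ) (u₀ v₀ n d : ℕ → ℕ) (chk : T (chainCheck p q c))
  (starts : ∀ i → 1 ≤ i → i ≤ suc b′ → i ≤ H → StartBound p q c (u₀ i) (v₀ i) (n i) (d i))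
  (later : ∀ i → suc b′ < i → i ≤ H → p * d i ≤ q * n i) where

  open ChainedWords (lettersOf c) b′ (λ i → atLeast (u₀ i) (v₀ i)) follows (weightOf c) public

  private
    R = scale c
    K = p * R

    admissible : ℕ → List Letter
    admissible i = filterᵇ (atLeast (u₀ i) (v₀ i)) (lettersOf c)

    pot : ℕ → Letter → ℕ
    pot i s = if H <ᵇ i + b then K else successors p q c s

    initial : ∀ i → 1 ≤ i → i ≤ b → i ≤ H →
      d i * sumL (λ s → weightOf c s * pot i s) (filterᵇ (atLeast (u₀ i) (v₀ i)) (lettersOf c)) ≤ K * (n i * R)
    initial i 1≤i i≤b l with T-∧⁻ {d i * sumL (weightOf c) (filterᵇ (atLeast (u₀ i) (v₀ i)) (lettersOf c)) ≤ᵇ n i * R} (StartBound.holds (starts i 1≤i i≤b l))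
    ... | t₁ , t₂ with H <ᵇ i + b
    ...   | false = ≤ᵇ⇒≤ (d i * sumL (λ s → weightOf c s * successors p q c s) (admissible i)) (p * R * (n i * R)) t₂
    ...   | true  = ≤-trans (≤-reflexive (trans (cong (d i *_) (sumL-*ʳ K (weightOf c) (admissible i))) (swap (d i) (sumL (weightOf c) (admissible i)) K)))
                      (*-monoʳ-≤ K (≤ᵇ⇒≤ (d i * sumL (weightOf c) (admissible i)) (n i * R) t₁))
      where
      swap : ∀ x y z → x * (y * z) ≡ z * (x * y)
      swap = solve-∀

    nested : ∀ (p r : Letter → Bool) (f : Letter → ℕ) xs → sumL f (filterᵇ p (filterᵇ r xs)) ≤ sumL f (filterᵇ p xs)
    nested p r f xs = ≤-trans (≤-reflexive (filterᵇ-sum p f (filterᵇ r xs)))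
      (≤-trans (filterᵇ-sum-≤ r (λ x → χ (p x) * f x) xs) (≤-reflexive (sym (filterᵇ-sum p f xs))))

    chain : ∀ i t → b < i → i ≤ H → t ∈ lettersOf c →
      d i * sumL (λ s → weightOf c s * pot i s) (filterᵇ (follows t) (filterᵇ (atLeast (u₀ i) (v₀ i)) (lettersOf c)))
        ≤ n i * R * pot (i ∸ b) t
    chain i t b< l j rewrite <ᵇ-false {H} (subst (_≤ H) (sym (m∸n+n≡m (<⇒≤ b<))) l) =
      cross-multiply p q (d i) (n i) X R S q>0 (later i b< l)
        (≤-trans (*-monoʳ-≤ q (nested (follows t) (atLeast (u₀ i) (v₀ i)) f (lettersOf c))) hundred)
      where
      S = successors p q c t
      f = λ s → weightOf c s * pot i s
      X = sumL f (filterᵇ (follows t) (filterᵇ (atLeast (u₀ i) (v₀ i)) (lettersOf c)))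
      Σs = sumL (λ s → weightOf c s * successors p q c s) (filterᵇ (follows t) (lettersOf c))
      Σw = sumL (weightOf c) (filterᵇ (follows t) (lettersOf c))
      both = T-∧⁻ {q * Σw ≤ᵇ S} (allB⁻ (λ t → (q * sumL (weightOf c) (filterᵇ (follows t) (lettersOf c)) ≤ᵇ successors p q c t)
        ∧ (q * sumL (λ s → weightOf c s * successors p q c s) (filterᵇ (follows t) (lettersOf c)) ≤ᵇ p * scale c * successors p q c t)) (lettersOf c) chk t j)
      hundred : q * sumL f (filterᵇ (follows t) (lettersOf c)) ≤ p * R * S
      hundred with H <ᵇ i + b
      ... | false = ≤ᵇ⇒≤ (q * Σs) (p * R * S) (proj₂ both)
      ... | true  = ≤-trans (≤-reflexive (trans (cong (q *_) (sumL-*ʳ K (weightOf c) (filterᵇ (follows t) (lettersOf c)))) (swap‴ q Σw K))) (*-monoʳ-≤ K (≤ᵇ⇒≤ (q * Σw) S (proj₁ both)))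
        where
        swap‴ : ∀ x y z → x * (y * z) ≡ z * (x * y)
        swap‴ = solve-∀

    leaf : ∀ i s → 1 ≤ i → i ≤ H → H < i + b → K ≤ pot i s
    leaf i s _ _ h rewrite <ᵇ-true h = ≤-refl

  region-bound : ∏ H d * sumL weight (chained H) ≤ ∏ H n * R ^ H
  region-bound = subst (∏ H d * sumL weight (chained H) ≤_)
    (trans (∏-* H n (λ _ → R)) (cong (∏ H n *_) (∏-const H R)))
    (Bound.chained-bound H K (*>0 p>0 (scale>0 c)) pot (λ i → n i * R) d initial chain leaf)

entry-power : ∀ c u → u ≤ c → entry c u * 21 ^ u ≡ 13 ^ u * 21 ^ c
entry-power c u h = trans (*-assoc (13 ^ u) _ _) (cong (13 ^ u *_)
  (trans (sym (^-distribˡ-+-* 21 (c ∸ u) u)) (cong (21 ^_) (m∸n+n≡m h))))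

-- A run κ 1, …, κ (L − 1) of coordinates folded into the letters (κ i , κ (L − i)), i ≤ ⌊L/2⌋.
-- If L is even the middle coordinate is counted twice.

module Folded (κ : ℕ → ℕ) (L : ℕ) where

  H = ⌊ L /2⌋

  fold : ℕ → Letter
  fold i = κ i , κ (L ∸ i)

  mirror< : ∀ {i} → 1 ≤ i → i ≤ H → 1 ≤ L ∸ i × L ∸ i < L × i < L × i ≤ L ∸ i
  mirror< {i} p l = ≤-trans p i≤ , ∸-monoʳ-< p (≤-trans l (⌊n/2⌋≤n L)) , i<L , i≤
    where
    2i≤L : i + i ≤ L
    2i≤L = ≤-trans (+-mono-≤ l (≤-trans l (⌊n/2⌋≤⌈n/2⌉ L))) (≤-reflexive (⌊n/2⌋+⌈n/2⌉≡n L))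
    i≤ : i ≤ L ∸ i
    i≤ = +-cancelʳ-≤ i i (L ∸ i) (≤-trans 2i≤L (≤-reflexive (sym (m∸n+n≡m (≤-trans (m≤m+n i i) 2i≤L)))))
    i<L : i < L
    i<L = ≤-trans (+-monoˡ-≤ i p) 2i≤L

  private
    halves : ∀ L → (L ≡ suc (⌊ L /2⌋ + ⌊ L /2⌋)) ⊎ (L ≡ ⌊ L /2⌋ + ⌊ L /2⌋)
    halves zero          = inj₂ refl
    halves (suc zero)    = inj₁ refl
    halves (suc (suc L)) with halves L
    ... | inj₁ e = inj₁ (cong suc (trans (cong suc e) (cong suc (sym (+-suc ⌊ L /2⌋ ⌊ L /2⌋)))))
    ... | inj₂ e = inj₂ (cong suc (trans (cong suc e) (sym (+-suc ⌊ L /2⌋ ⌊ L /2⌋))))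

  pair-sum : ∀ (f : ℕ → ℕ) → ∃[ e ] ((∑ H (λ i → f (suc i) + f (L ∸ suc i)) ≡ ∑ (L ∸ 1) (f ∘ suc) + e)
    × ((e ≡ 0) ⊎ (1 ≤ H × e ≡ f H)))
  pair-sum f with halves L
  ... | inj₁ eq = 0 , trans (∑-+ H _ _) (trans (cong (∑ H (f ∘ suc) +_) (upper H eq)) (trans (sym (∑-split H H (f ∘ suc))) (trans (cong (λ n → ∑ n (f ∘ suc)) (sym (cong (_∸ 1) eq))) (sym (+-identityʳ _))))) , inj₁ refl
    where
    upper : ∀ h → L ≡ suc (h + h) → ∑ h (λ i → f (L ∸ suc i)) ≡ ∑ h (λ i → f (suc (h + i)))
    upper zero    _    = refl
    upper (suc x) refl = trans (∑-cong (suc x) (λ i l → cong f (trans (cong (λ z → suc z ∸ i) (+-suc x x)) (+-∸-assoc (suc (suc x)) (s≤s⁻¹ l)))))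
      (∑-rev x (λ y → f (suc (suc x + y))))
  ... | inj₂ eq = go H eq refl
    where
    go : ∀ h → L ≡ h + h → H ≡ h → ∃[ e ] ((∑ H (λ i → f (suc i) + f (L ∸ suc i)) ≡ ∑ (L ∸ 1) (f ∘ suc) + e)
      × ((e ≡ 0) ⊎ (1 ≤ H × e ≡ f H)))
    go zero    refl e = 0 , refl , inj₁ refl
    go (suc x) refl e rewrite e = f (suc x) , trans (∑-+ (suc x) _ _) (trans (cong (∑ (suc x) (f ∘ suc) +_) upper)
         (trans (lem (∑ (suc x) (f ∘ suc)) (f (suc x)) (∑ x (λ i → f (suc (suc x + i)))))
           (cong (_+ f (suc x)) (trans (sym (∑-split (suc x) x (f ∘ suc))) (cong (λ n → ∑ n (f ∘ suc)) (sym (+-suc x x))))))) , inj₂ (s≤s z≤n , refl)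
      where
      lem : ∀ a b c → a + (b + c) ≡ a + c + b
      lem = solve-∀
      upper : ∑ (suc x) (λ i → f (x + suc x ∸ i)) ≡ f (suc x) + ∑ x (λ i → f (suc (suc x + i)))
      upper = trans (∑-cong (suc x) (λ i l → cong f (trans (cong (_∸ i) (+-comm x (suc x))) (+-∸-assoc (suc x) (s≤s⁻¹ l)))))
        (trans (∑-rev x (λ y → f (suc x + y)))
          (trans (∑-head x (λ y → f (suc x + y))) (cong₂ _+_ (cong f (+-identityʳ (suc x))) (∑-cong x (λ i _ → cong f (+-suc (suc x) i))))))

  folded-weight : ∀ c → (∀ i → 1 ≤ i → i < L → κ i ≤ c) →
    ∏ H (weightOf c ∘ fold) * 21 ^ ∑ H (λ i → κ (suc i) + κ (L ∸ suc i)) ≡ 13 ^ ∑ H (λ i → κ (suc i) + κ (L ∸ suc i)) * scale c ^ H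
  folded-weight c h = trans (cong (∏ H (weightOf c ∘ fold) *_) (sym (∏-^ H 21 e)))
    (trans (sym (∏-* H _ _)) (trans (∏-cong H one) (trans (∏-* H _ _) (cong₂ _*_ (∏-^ H 13 e) (∏-const H (scale c))))))
    where
    e : ℕ → ℕ
    e i = κ i + κ (L ∸ i)
    lem : ∀ a b x y → a * b * (x * y) ≡ a * x * (b * y)
    lem = solve-∀
    lem′ : ∀ a b x y → a * x * (b * y) ≡ a * b * (x * y)
    lem′ = solve-∀
    one : ∀ i → 1 ≤ i → i ≤ H → weightOf c (fold i) * 21 ^ e i ≡ 13 ^ e i * scale c
    one i p l with mirror< p l
    ... | q , r , s , _ = trans (cong (weightOf c (fold i) *_) (^-distribˡ-+-* 21 (κ i) _)) (trans (lem (entry c (κ i)) _ (21 ^ κ i) _)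
        (trans (cong₂ _*_ (entry-power c (κ i) (h i p s)) (entry-power c (κ (L ∸ i)) (h (L ∸ i) q r)))
        (trans (lem′ (13 ^ κ i) _ (21 ^ c) _) (cong (_* scale c) (sym (^-distribˡ-+-* 13 (κ i) _))))))

  module _ (c b′ : ℕ) (u₀ v₀ : ℕ → ℕ)
    (range : ∀ i → 1 ≤ i → i < L → 1 ≤ κ i × κ i ≤ c)
    (reflect : ∀ i → 1 ≤ i → i < L → c ≤ κ i + κ (L ∸ i))
    (shift : ∀ i → 1 ≤ i → i + suc b′ < L → κ (i + suc b′) ≤ suc (κ i))
    (admitted : ∀ i → 1 ≤ i → i ≤ H → u₀ i ≤ κ i × v₀ i ≤ κ (L ∸ i)) where

    open ChainedWords (lettersOf c) b′ (λ i → atLeast (u₀ i) (v₀ i)) follows (weightOf c)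

    private
      ∈-suc : ∀ {u} → 1 ≤ u → u ≤ c → u ∈ applyUpTo suc c
      ∈-suc {suc u} p l = subst (suc u ∈_) refl (∈-applyUpTo⁺ suc l)

    folded∈chained : word fold H ∈ chained H
    folded∈chained = word∈chained fold H letter link
      where
      letter : ∀ i → 1 ≤ i → i ≤ H → fold i ∈ lettersOf c × T (atLeast (u₀ i) (v₀ i) (fold i))
      letter i p l with mirror< p l
      ... | q , r , s , _ = ∈-filter⁺ (T? ∘ λ s → c ≤ᵇ proj₁ s + proj₂ s)
              (∈-concatMap {xs = applyUpTo suc c} (∈-suc (proj₁ (range i p s)) (proj₂ (range i p s)))
                (∈-map⁺ (κ i ,_) (∈-suc (proj₁ (range (L ∸ i) q r)) (proj₂ (range (L ∸ i) q r)))))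
              (≤⇒≤ᵇ (reflect i p s))
            , T-∧⁺ {u₀ i ≤ᵇ κ i} (≤⇒≤ᵇ (proj₁ (admitted i p l))) (≤⇒≤ᵇ (proj₂ (admitted i p l)))
      link : ∀ i → suc b′ < i → i ≤ H → T (follows (fold (i ∸ suc b′)) (fold i))
      link i p l = T-∧⁺ {κ i ≤ᵇ suc (κ j)}
          (≤⇒≤ᵇ (subst (λ x → κ x ≤ suc (κ j)) back (shift j 1≤j (subst (_< L) (sym back) (proj₁ (proj₂ (proj₂ mi))))))) 
          (≤⇒≤ᵇ (subst (λ x → κ x ≤ suc (κ (L ∸ i))) up (shift (L ∸ i) (proj₁ mi) (subst (_< L) (sym up) (∸-monoʳ-< 1≤j (≤-trans (m∸n≤m i (suc b′)) (<⇒≤ (proj₁ (proj₂ (proj₂ mi))))))))))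
        where
        j = i ∸ suc b′
        1≤j : 1 ≤ j
        1≤j = m<n⇒0<n∸m p
        back : j + suc b′ ≡ i
        back = m∸n+n≡m (<⇒≤ p)
        mi = mirror< (≤-trans (s≤s z≤n) p) l
        up : L ∸ i + suc b′ ≡ L ∸ j
        up = sym (trans (cong (_∸ j) (sym (m∸n+n≡m (<⇒≤ (proj₁ (proj₂ (proj₂ mi)))))))
               (trans (cong (λ x → L ∸ i + x ∸ j) (sym back)) (trans (cong (_∸ j) (trans (cong (L ∸ i +_) (+-comm j (suc b′))) (sym (+-assoc (L ∸ i) (suc b′) j)))) (m+n∸n≡m _ j))))

module _ (κ κ′ : ℕ → ℕ) (L : ℕ) where
  private
    module F = Folded κ L
    module F′ = Folded κ′ L

  fold-determines : (∀ i → 1 ≤ i → i ≤ F.H → F.fold i ≡ F′.fold i) → ∀ j → 1 ≤ j → j < L → κ j ≡ κ′ j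
  fold-determines e j p l with j ≤? F.H
  ... | yes q = cong proj₁ (e j p q)
  ... | no ¬q = subst (λ x → κ x ≡ κ′ x) (m∸[m∸n]≡n (<⇒≤ l)) (cong proj₂ (e (L ∸ j) (m<n⇒0<n∸m l) small))
    where
    ceil≤ : ∀ n → ⌈ n /2⌉ ≤ suc ⌊ n /2⌋
    ceil≤ zero          = z≤n
    ceil≤ (suc zero)    = ≤-refl
    ceil≤ (suc (suc n)) = s≤s (ceil≤ n)
    small : L ∸ j ≤ ⌊ L /2⌋
    small = ≤-trans (∸-monoʳ-≤ L (≰⇒> ¬q)) (≤-trans (≤-reflexive (cong (_∸ suc ⌊ L /2⌋) (sym (⌊n/2⌋+⌈n/2⌉≡n L))))
      (≤-trans (∸-monoˡ-≤ (suc ⌊ L /2⌋) (+-monoʳ-≤ ⌊ L /2⌋ (ceil≤ L)))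
        (≤-reflexive (trans (cong (_∸ suc ⌊ L /2⌋) (+-suc ⌊ L /2⌋ ⌊ L /2⌋)) (m+n∸m≡n (suc ⌊ L /2⌋) ⌊ L /2⌋)))))

∑-<ᵇ-≤ : ∀ n c → ∑ n (λ i → χ (i <ᵇ c)) ≤ c
∑-<ᵇ-≤ n c with ≤-total c n
... | inj₁ h = ≤-reflexive (∑-<ᵇ n c h)
... | inj₂ h = ≤-trans (∑-bound n 1 (λ i _ → χ≤1 _)) (≤-trans (≤-reflexive (*-identityʳ n)) h)

∑-<ᵇ-min : ∀ n c r → r ≤ n → r ≤ c → r ≤ ∑ n (λ i → χ (i <ᵇ c))
∑-<ᵇ-min n c r p q = ≤-trans (≤-reflexive (sym (trans (∑-cong r (λ i l → cong χ (<ᵇ-true (≤-trans l q)))) (trans (∑-const r 1) (*-identityʳ r)))))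
  (∑-≤-split _ p)

pairs : ∀ {A B : Set} → List A → List B → List (A × B)
pairs xs ys = concatMap (λ x → map (x ,_) ys) xs

sumL-pairs : ∀ {A B : Set} (f : A → ℕ) (h : B → ℕ) xs ys → sumL (λ z → f (proj₁ z) * h (proj₂ z)) (pairs xs ys) ≡ sumL f xs * sumL h ys
sumL-pairs f h xs ys = trans (sumL-concatMap _ _ xs) (trans (sumL-cong xs (λ x _ → trans (sumL-map _ _ ys) (sumL-*ˡ (f x) h ys))) (sumL-*ʳ (sumL h ys) f xs))

∈-pairs : ∀ {A B : Set} {x : A} {y : B} {xs ys} → x ∈ xs → y ∈ ys → (x , y) ∈ pairs xs ys
∈-pairs i j = ∈-concatMap i (∈-map⁺ _ j)

-- The equation says w / r = (13/21)^s, and a power of 13/21 does not decrease when its exponent is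
-- lowered from e to s.
power-trade : ∀ s e w r → s ≤ e → w * 21 ^ s ≡ 13 ^ s * r → 13 ^ e * r ≤ 21 ^ e * w
power-trade s e w r h eq = begin
  13 ^ e * r                          ≡⟨ cong (λ x → 13 ^ x * r) (sym d+s) ⟩
  13 ^ (d + s) * r                    ≡⟨ cong (_* r) (^-distribˡ-+-* 13 d s) ⟩
  13 ^ d * 13 ^ s * r                 ≡⟨ *-assoc (13 ^ d) _ _ ⟩
  13 ^ d * (13 ^ s * r)               ≡⟨ cong (13 ^ d *_) (sym eq) ⟩
  13 ^ d * (w * 21 ^ s)               ≤⟨ *-monoˡ-≤ (w * 21 ^ s) (^-monoˡ-≤ d (≤ᵇ⇒≤ 13 21 tt)) ⟩
  21 ^ d * (w * 21 ^ s)               ≡⟨ lem (21 ^ d) w (21 ^ s) ⟩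
  21 ^ d * 21 ^ s * w                 ≡⟨ cong (_* w) (sym (^-distribˡ-+-* 21 d s)) ⟩
  21 ^ (d + s) * w                    ≡⟨ cong (λ x → 21 ^ x * w) d+s ⟩
  21 ^ e * w                          ∎
  where
  open ≤-Reasoning
  d = e ∸ s
  d+s : d + s ≡ e
  d+s = m∸n+n≡m h
  lem : ∀ x y z → x * (y * z) ≡ x * z * y
  lem = solve-∀

indicator-product : ∀ H b → ∏ H (λ i → if i ≡ᵇ b then 3 else 1) ≤ 3
indicator-product H b = proj₁ (go H)
  where
  f = λ i → if i ≡ᵇ b then 3 else 1
  go : ∀ H → ∏ H f ≤ 3 × (H < b → ∏ H f ≤ 1)
  go zero    = s≤s z≤n , λ _ → ≤-refl
  go (suc H) with suc H ≡ᵇ b in e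
  ... | false = ≤-trans (≤-reflexive (*-identityʳ _)) (proj₁ (go H)) , λ l → ≤-trans (≤-reflexive (*-identityʳ _)) (proj₂ (go H) (<⇒≤ l))
  ... | true  = *-monoˡ-≤ 3 (proj₂ (go H) (≤-reflexive (≡ᵇ⇒≡ (suc H) b (≡⇒T e)))) , λ l → ⊥-elim (<⇒≢ l (≡ᵇ⇒≡ (suc H) b (≡⇒T e)))

-- Semigroups whose largest coordinate lies between 4 and 11

-- k has maximum q, attained for the last time at a; suc b′ is the first index with value 1 (or m)

record Shape (m : ℕ) (k : ℕ → ℕ) (q a b′ : ℕ) : Set where
  field
    1≤a    : 1 ≤ a
    a<m    : a < m
    peak   : k a ≡ q
    pos    : ∀ i → 1 ≤ i → i < m → 1 ≤ k i
    max    : ∀ i → i < m → k i ≤ q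
    after  : ∀ i → a < i → i < m → k i < q
    sub    : ∀ i j → i + j < m → k (i + j) ≤ k i + k j
    wrap   : ∀ i j l → i < m → j < m → l < m → i + j ≡ l + m → k l ≤ suc (k i + k j)
    before : ∀ j → 1 ≤ j → j ≤ b′ → 2 ≤ k j
    unit   : suc b′ < m → k (suc b′) ≡ 1

low : ℕ → ℕ → ℕ
low b′ j = if j ≤ᵇ b′ then 2 else 1

low-≤ : ∀ b′ j {x} → 1 ≤ x → (j ≤ b′ → 2 ≤ x) → low b′ j ≤ x
low-≤ b′ j h h′ with j ≤ᵇ b′ in e
... | true  = h′ (≤ᵇ⇒≤ j b′ (≡⇒T e))
... | false = h

≤ᵇ-true : ∀ {m n} → m ≤ n → (m ≤ᵇ n) ≡ true
≤ᵇ-true h = T⇒≡ (≤⇒≤ᵇ h)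

≤ᵇ-false : ∀ {m n} → n < m → (m ≤ᵇ n) ≡ false
≤ᵇ-false {m} {n} h = ¬T⇒≡ (λ t → <⇒≱ h (≤ᵇ⇒≤ m n t))

module Lower {m k q a b′} (S : Shape m k q a b′) where
  open Shape S
  open Folded k a

  lower-range : ∀ i → 1 ≤ i → i < a → 1 ≤ k i × k i ≤ q
  lower-range i p l = pos i p (<-trans l a<m) , max i (<-trans l a<m)

  lower-reflect : ∀ i → 1 ≤ i → i < a → q ≤ k i + k (a ∸ i)
  lower-reflect i p l = subst₂ (λ x y → x ≤ k i + y) peak refl
    (subst (λ x → k x ≤ k i + k (a ∸ i)) (m+[n∸m]≡n (<⇒≤ l)) (sub i (a ∸ i) (subst (_< m) (sym (m+[n∸m]≡n (<⇒≤ l))) a<m)))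

  lower-shift : ∀ i → 1 ≤ i → i + suc b′ < a → k (i + suc b′) ≤ suc (k i)
  lower-shift i p l = ≤-trans (sub i (suc b′) (<-trans l a<m))
    (≤-reflexive (trans (cong (k i +_) (unit (<-trans (≤-trans (s≤s (m≤n+m (suc b′) i)) l) a<m))) (+-comm (k i) 1)))

  lower-low : ∀ j → 1 ≤ j → j < a → low b′ j ≤ k j
  lower-low j p l = low-≤ b′ j (pos j p (<-trans l a<m)) (before j p)

module Upper {m k q a b′} (S : Shape m k q a b′) where
  open Shape S

  private
    L = m ∸ a
    in-range : ∀ {i} → i < L → a + i < m
    in-range {i} l = subst (a + i <_) (m+[n∸m]≡n (<⇒≤ a<m)) (+-monoʳ-< a l)

  upper-range : ∀ i → 1 ≤ i → i < L → 1 ≤ k (a + i) × k (a + i) ≤ q ∸ 1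
  upper-range i p l = pos (a + i) (≤-trans p (m≤n+m i a)) (in-range l)
    , s≤s⁻¹ (≤-trans (after (a + i) (subst (_≤ a + i) (+-comm a 1) (+-monoʳ-≤ a p)) (in-range l)) (m≤n+m∸n q 1))

  upper-reflect : ∀ i → 1 ≤ i → i < L → q ∸ 1 ≤ k (a + i) + k (a + (L ∸ i))
  upper-reflect i p l = ∸-monoˡ-≤ 1 (subst (_≤ suc (k (a + i) + k (a + (L ∸ i)))) peak
    (wrap (a + i) (a + (L ∸ i)) a (in-range l) (in-range (∸-monoʳ-< p (<⇒≤ l))) a<m
      (trans (lem a i (L ∸ i)) (cong (a +_) (trans (cong (a +_) (m+[n∸m]≡n (<⇒≤ l))) (m+[n∸m]≡n (<⇒≤ a<m)))))))
    where
    lem : ∀ a i j → a + i + (a + j) ≡ a + (a + (i + j))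
    lem = solve-∀

  upper-shift : ∀ i → 1 ≤ i → i + suc b′ < L → k (a + (i + suc b′)) ≤ suc (k (a + i))
  upper-shift i p l = subst (λ x → k x ≤ suc (k (a + i))) (+-assoc a i (suc b′))
    (≤-trans (sub (a + i) (suc b′) (subst (_< m) (sym (+-assoc a i (suc b′))) (in-range l)))
      (≤-reflexive (trans (cong (k (a + i) +_) (unit (≤-trans (s≤s (≤-trans (m≤n+m (suc b′) i) (m≤n+m _ a))) (in-range l)))) (+-comm _ 1))))

  upper-low : ∀ i → 1 ≤ i → i < L → low b′ (a + i) ≤ k (a + i)
  upper-low i p l = low-≤ b′ (a + i) (proj₁ (upper-range i p l)) (before (a + i) (≤-trans p (m≤n+m i a)))

start-eq : ∀ {p r c u v n d u′ v′ n′ d′} → u′ ≡ u → v′ ≡ v → n′ ≡ n → d′ ≡ d → StartBound p r c u v n d → StartBound p r c u′ v′ n′ d′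
start-eq refl refl refl refl t = t

low-yes : ∀ {b j} → j ≤ b → low b j ≡ 2
low-yes h = cong (if_then 2 else 1) (≤ᵇ-true h)

low-no : ∀ {b j} → b < j → low b j ≡ 1
low-no h = cong (if_then 2 else 1) (≤ᵇ-false h)

module TwoRegions (m q a b′ : ℕ) (q≥4 : 4 ≤ q) (q≤11 : q ≤ 11) where

  L₁ = a
  L₂ = m ∸ a
  H₁ = ⌊ L₁ /2⌋
  H₂ = ⌊ L₂ /2⌋

  -- The number of coordinates of the i-th lower pair that lie before index b. Summed over i this is
  -- the exponent of the gain 6/7.
  restricted : ℕ → ℕ
  restricted i = χ (i ≤ᵇ b′) + χ (a ∸ i ≤ᵇ b′)

  -- Equal to 1 when the i-th upper pair has no predecessor and its coordinate at a + i is not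
  -- before index b. Summed over i this is the exponent of the loss 7/6.
  free : ℕ → ℕ
  free i = χ (i ≤ᵇ suc b′) * χ (b′ <ᵇ a + i)

  u₁ v₁ u₂ v₂ n₁ d₁ n₂ d₂ : ℕ → ℕ
  u₁ = low b′
  v₁ i = low b′ (a ∸ i)
  n₁ i = (if i ≡ᵇ suc b′ then 3 else 1) * 6 ^ restricted i
  d₁ i = 7 ^ restricted i
  u₂ i = low b′ (a + i)
  v₂ _ = 1
  n₂ i = 7 ^ free i
  d₂ i = 6 ^ free i

  private
    checks = bothChecks q q≥4 q≤11
    lower-checks = T-∧⁻ {chainCheck 98 100 q} (proj₁ checks)
    lower-starts = T-∧⁻ {startCheck 98 100 q 1 1 3 1} (proj₂ lower-checks)
    lower-starts′ = T-∧⁻ {startCheck 98 100 q 2 1 6 7} (proj₂ lower-starts)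
    upper-checks = T-∧⁻ {chainCheck 98 100 (q ∸ 1)} (proj₂ checks)
    upper-starts = T-∧⁻ {startCheck 98 100 (q ∸ 1) 1 1 7 6} (proj₂ upper-checks)

    mirror≥ : ∀ {i} → 1 ≤ i → i ≤ H₁ → i ≤ a ∸ i
    mirror≥ p l = proj₂ (proj₂ (proj₂ (Folded.mirror< (λ x → x) a p l)))

    starts₁ : ∀ i → 1 ≤ i → i ≤ suc b′ → i ≤ H₁ → StartBound 98 100 q (u₁ i) (v₁ i) (n₁ i) (d₁ i)
    starts₁ i p r l with m≤n⇒m<n∨m≡n r
    ... | inj₂ refl = start-eq (low-no {b′} ≤-refl) (low-no (mirror≥ p l))
            (cong₂ (λ x e → (if x then 3 else 1) * 6 ^ e) (T⇒≡ (≡⇒≡ᵇ i i refl)) e0) (cong (7 ^_) e0) (startBound (proj₁ lower-starts))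
      where e0 = cong₂ (λ x y → χ x + χ y) (≤ᵇ-false (≤-refl {suc b′})) (≤ᵇ-false (mirror≥ p l))
    ... | inj₁ (s≤s r′) with ≤-total (a ∸ i) b′
    ...   | inj₁ h = start-eq (low-yes r′) (low-yes h) (cong₂ (λ x e → (if x then 3 else 1) * 6 ^ e) i≢ e2) (cong (7 ^_) e2) (startBound (proj₂ lower-starts′))
      where
      i≢ = ¬T⇒≡ (λ t → <⇒≢ (s≤s r′) (≡ᵇ⇒≡ i (suc b′) t))
      e2 = cong₂ (λ x y → χ x + χ y) (≤ᵇ-true r′) (≤ᵇ-true h)
    ...   | inj₂ h with m≤n⇒m<n∨m≡n h
    ...     | inj₁ h′ = start-eq (low-yes r′) (low-no h′) (cong₂ (λ x e → (if x then 3 else 1) * 6 ^ e) i≢ e1) (cong (7 ^_) e1) (startBound (proj₁ lower-starts′))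
      where
      i≢ = ¬T⇒≡ (λ t → <⇒≢ (s≤s r′) (≡ᵇ⇒≡ i (suc b′) t))
      e1 = cong₂ (λ x y → χ x + χ y) (≤ᵇ-true r′) (≤ᵇ-false h′)
    ...     | inj₂ h′ = start-eq (low-yes r′) (low-yes (≤-reflexive (sym h′))) (cong₂ (λ x e → (if x then 3 else 1) * 6 ^ e) i≢ e2) (cong (7 ^_) e2) (startBound (proj₂ lower-starts′))
      where
      i≢ = ¬T⇒≡ (λ t → <⇒≢ (s≤s r′) (≡ᵇ⇒≡ i (suc b′) t))
      e2 = cong₂ (λ x y → χ x + χ y) (≤ᵇ-true r′) (≤ᵇ-true (≤-reflexive (sym h′)))

    later₁ : ∀ i → suc b′ < i → i ≤ H₁ → 98 * d₁ i ≤ 100 * n₁ i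
    later₁ i r l rewrite ≤ᵇ-false (<⇒≤ r) | ≤ᵇ-false (≤-trans (<⇒≤ r) (mirror≥ (≤-trans (s≤s z≤n) r) l)) | ¬T⇒≡ (λ t → <⇒≢ r (sym (≡ᵇ⇒≡ i (suc b′) t))) = ≤ᵇ⇒≤ 98 100 tt

    starts₂ : ∀ i → 1 ≤ i → i ≤ suc b′ → i ≤ H₂ → StartBound 98 100 (q ∸ 1) (u₂ i) (v₂ i) (n₂ i) (d₂ i)
    starts₂ i p r l with b′ <? a + i
    ... | no h  = start-eq (low-yes (≮⇒≥ h)) refl (cong (7 ^_) f0) (cong (6 ^_) f0) (startBound (proj₂ upper-starts))
      where f0 = trans (cong (λ x → χ (i ≤ᵇ suc b′) * χ x) (<ᵇ-false (≮⇒≥ h))) (*-zeroʳ (χ (i ≤ᵇ suc b′)))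
    ... | yes h = start-eq (low-no h) refl (cong (7 ^_) f1) (cong (6 ^_) f1) (startBound (proj₁ upper-starts))
      where f1 = cong₂ (λ x y → χ x * χ y) (≤ᵇ-true r) (<ᵇ-true h)

    later₂ : ∀ i → suc b′ < i → i ≤ H₂ → 98 * d₂ i ≤ 100 * n₂ i
    later₂ i r l rewrite ≤ᵇ-false r = ≤ᵇ⇒≤ 98 100 tt

  module R₁ = Region 98 100 (s≤s z≤n) (s≤s z≤n) q b′ H₁ u₁ v₁ n₁ d₁ (proj₁ lower-checks) starts₁ later₁
  module R₂ = Region 98 100 (s≤s z≤n) (s≤s z≤n) (q ∸ 1) b′ H₂ u₂ v₂ n₂ d₂ (proj₁ upper-checks) starts₂ later₂

  T₁ = sumL R₁.weight (R₁.chained H₁)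
  T₂ = sumL R₂.weight (R₂.chained H₂)
  ℛ = scale q ^ H₁ * scale (q ∸ 1) ^ H₂

  private
    E₁ = ∑ H₁ (λ i → restricted (suc i))
    E₂ = ∑ H₂ (λ i → free (suc i))

    restricted-many : ∀ r → r ≤ a ∸ 1 → r ≤ b′ → r ≤ E₁
    restricted-many r p l with Folded.pair-sum (λ x → x) a (λ j → χ (j ≤ᵇ b′))
    ... | e , eq , _ = ≤-trans (∑-<ᵇ-min (a ∸ 1) b′ r p l) (≤-trans (m≤m+n _ e) (≤-reflexive (sym eq)))

    -- If b′ ≤ a, there are at most b′ + 1 free starts, and at least b′ - 1 lower coordinates lie
    -- before b. If b′ > a, a free start needs b′ - a < i ≤ b′ + 1, which leaves a + 1 indices, and
    -- all a - 1 lower coordinates lie before b.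
    free-few : 1 ≤ a → E₂ ≤ E₁ + 2
    free-few 1≤a with suc a ≤? b′
    ... | no ¬h = ≤-trans (∑-mono H₂ (λ i _ → ≤-trans (*-monoʳ-≤ (χ (i <ᵇ suc b′)) (χ≤1 (b′ <ᵇ a + suc i))) (≤-reflexive (*-identityʳ (χ (i <ᵇ suc b′))))))
            (≤-trans (∑-<ᵇ-≤ H₂ (suc b′)) (≤-trans (≤-trans (s≤s (m≤n+m∸n b′ 1)) (≤-reflexive (+-comm 2 (b′ ∸ 1))))
              (+-monoˡ-≤ 2 (restricted-many (b′ ∸ 1) (∸-monoˡ-≤ 1 (s≤s⁻¹ (≰⇒> ¬h))) (m∸n≤m b′ 1)))))
    ... | yes h = ≤-trans (∑-≤-split {H₂} {s + H₂} _ (m≤n+m H₂ s)) (≤-trans (≤-reflexive (∑-split s H₂ _))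
            (≤-trans (+-mono-≤ (≤-reflexive (∑-zero s none)) (≤-trans (∑-mono H₂ some) (∑-<ᵇ-≤ H₂ (suc a))))
              (≤-trans (≤-reflexive (sucpred a 1≤a)) (+-monoˡ-≤ 2 (restricted-many (a ∸ 1) ≤-refl (≤-trans (m∸n≤m a 1) (≤-trans (n≤1+n a) h)))))))
      where
      s = b′ ∸ a
      s+a : s + a ≡ b′
      s+a = m∸n+n≡m (≤-trans (n≤1+n a) h)
      sucpred : ∀ a → 1 ≤ a → suc a ≡ a ∸ 1 + 2
      sucpred (suc a) _ = sym (+-comm a 2)
      none : ∀ i → i < s → free (suc i) ≡ 0
      none i l = trans (cong (λ x → χ (i <ᵇ suc b′) * χ x) (<ᵇ-false (≤-trans (+-monoʳ-≤ a l) (≤-reflexive (trans (+-comm a s) s+a))))) (*-zeroʳ (χ (i <ᵇ suc b′)))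
      some : ∀ i → i < H₂ → free (suc (s + i)) ≤ χ (i <ᵇ suc a)
      some i _ = ≤-trans (*-monoʳ-≤ (χ (s + i <ᵇ suc b′)) (χ≤1 (b′ <ᵇ a + suc (s + i)))) (≤-trans (≤-reflexive (*-identityʳ (χ (s + i <ᵇ suc b′))))
        (χ-mono {s + i <ᵇ suc b′} (λ t → <⇒<ᵇ (s≤s (+-cancelˡ-≤ s i a (≤-trans (s≤s⁻¹ (<ᵇ⇒< (s + i) (suc b′) t)) (≤-reflexive (sym s+a))))))))

    -- With f ≤ e + 2 the gains and losses leave at most (7/6)², and the single factor 3 makes this
    -- 3 · 49 / 36 = 147 / 36.
    cancel-θ : ∀ e f T R → f ≤ e + 2 → 7 ^ e * 6 ^ f * T ≤ 3 * 6 ^ e * 7 ^ f * R → 36 * T ≤ 147 * R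
    cancel-θ e f T R h k = cancel*ˡ (6 ^ e * 7 ^ e) (*>0 (^>0 6 e (s≤s z≤n)) (^>0 7 e (s≤s z≤n))) (begin
      6 ^ e * 7 ^ e * (36 * T)               ≡⟨ lem₁ (6 ^ e) (7 ^ e) 36 T ⟩
      7 ^ e * (6 ^ e * 36) * T               ≡⟨ cong (λ z → 7 ^ e * z * T) (trans (sym (^-distribˡ-+-* 6 e 2)) (trans (cong (6 ^_) (sym f+δ)) (^-distribˡ-+-* 6 f δ))) ⟩
      7 ^ e * (6 ^ f * 6 ^ δ) * T            ≤⟨ *-monoˡ-≤ T (*-monoʳ-≤ (7 ^ e) (*-monoʳ-≤ (6 ^ f) (^-monoˡ-≤ δ (≤ᵇ⇒≤ 6 7 tt)))) ⟩
      7 ^ e * (6 ^ f * 7 ^ δ) * T            ≡⟨ lem₂ (7 ^ e) (6 ^ f) (7 ^ δ) T ⟩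
      7 ^ δ * (7 ^ e * 6 ^ f * T)            ≤⟨ *-monoʳ-≤ (7 ^ δ) k ⟩
      7 ^ δ * (3 * 6 ^ e * 7 ^ f * R)        ≡⟨ lem₃ (7 ^ δ) 3 (6 ^ e) (7 ^ f) R ⟩
      6 ^ e * (7 ^ f * 7 ^ δ) * (3 * R)      ≡⟨ cong (λ z → 6 ^ e * z * (3 * R)) (trans (sym (^-distribˡ-+-* 7 f δ)) (trans (cong (7 ^_) f+δ) (^-distribˡ-+-* 7 e 2))) ⟩
      6 ^ e * (7 ^ e * 49) * (3 * R)         ≡⟨ lem₄ (6 ^ e) (7 ^ e) 49 3 R ⟩
      6 ^ e * 7 ^ e * (147 * R)              ∎)
      where
      open ≤-Reasoning
      δ = e + 2 ∸ f
      f+δ : f + δ ≡ e + 2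
      f+δ = m+[n∸m]≡n h
      lem₁ : ∀ a b c t → a * b * (c * t) ≡ b * (a * c) * t
      lem₁ = solve-∀
      lem₂ : ∀ a b c t → a * (b * c) * t ≡ c * (a * b * t)
      lem₂ = solve-∀
      lem₃ : ∀ a t b c r → a * (t * b * c * r) ≡ b * (c * a) * (t * r)
      lem₃ = solve-∀
      lem₄ : ∀ a b c d r → a * (b * c) * (d * r) ≡ a * b * (c * d * r)
      lem₄ = solve-∀

  regions-bound : 1 ≤ a → 36 * (T₁ * T₂) ≤ 147 * ℛ
  regions-bound 1≤a = cancel-θ E₁ E₂ (T₁ * T₂) ℛ (free-few 1≤a) (begin
    7 ^ E₁ * 6 ^ E₂ * (T₁ * T₂)              ≡⟨ lem (7 ^ E₁) (6 ^ E₂) T₁ T₂ ⟩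
    7 ^ E₁ * T₁ * (6 ^ E₂ * T₂)              ≡⟨ cong₂ (λ x y → x * T₁ * (y * T₂)) (sym (∏-^ H₁ 7 restricted)) (sym (∏-^ H₂ 6 free)) ⟩
    ∏ H₁ d₁ * T₁ * (∏ H₂ d₂ * T₂)            ≤⟨ *-mono-≤ R₁.region-bound R₂.region-bound ⟩
    ∏ H₁ n₁ * ρ₁ * (∏ H₂ n₂ * ρ₂)            ≤⟨ *-mono-≤ (*-monoˡ-≤ ρ₁ n₁-bound) (≤-reflexive (cong (_* ρ₂) (∏-^ H₂ 7 free))) ⟩
    3 * 6 ^ E₁ * ρ₁ * (7 ^ E₂ * ρ₂)          ≡⟨ lem′ (3 * 6 ^ E₁) ρ₁ (7 ^ E₂) ρ₂ ⟩
    3 * 6 ^ E₁ * 7 ^ E₂ * ℛ                  ∎)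
    where
    open ≤-Reasoning
    ρ₁ = scale q ^ H₁
    ρ₂ = scale (q ∸ 1) ^ H₂
    n₁-bound : ∏ H₁ n₁ ≤ 3 * 6 ^ E₁
    n₁-bound = ≤-trans (≤-reflexive (∏-* H₁ _ _)) (*-mono-≤ (indicator-product H₁ (suc b′)) (≤-reflexive (∏-^ H₁ 6 restricted)))
    lem : ∀ a b s t → a * b * (s * t) ≡ a * s * (b * t)
    lem = solve-∀
    lem′ : ∀ a r b s → a * r * (b * s) ≡ a * b * (r * s)
    lem′ = solve-∀

maxBelow : (ℕ → ℕ) → ℕ → ℕ
maxBelow f zero    = 0
maxBelow f (suc n) = maxBelow f n ⊔ f n

maxBelow-≥ : ∀ f n i → i < n → f i ≤ maxBelow f n
maxBelow-≥ f (suc n) i l with m≤n⇒m<n∨m≡n (s≤s⁻¹ l)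
... | inj₁ h    = ≤-trans (maxBelow-≥ f n i h) (m≤m⊔n _ _)
... | inj₂ refl = m≤n⊔m (maxBelow f n) (f n)

maxBelow-attained : ∀ f n → 0 < maxBelow f n → ∃[ i ] (i < n × f i ≡ maxBelow f n)
maxBelow-attained f (suc n) p with ≤-total (f n) (maxBelow f n)
... | inj₂ h = n , ≤-refl , sym (m≤n⇒m⊔n≡n h)
... | inj₁ h with maxBelow-attained f n (subst (0 <_) (m≥n⇒m⊔n≡m h) p)
... | i , l , e = i , m<n⇒m<1+n l , trans e (sym (m≥n⇒m⊔n≡m h))

lastBelow : (ℕ → Bool) → ℕ → ℕ
lastBelow p zero    = 0
lastBelow p (suc n) = if p n then n else lastBelow p n

lastBelow-spec : ∀ p n i → i < n → p i ≡ true →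
  lastBelow p n < n × p (lastBelow p n) ≡ true × (∀ j → lastBelow p n < j → j < n → p j ≡ false)
lastBelow-spec p (suc n) i l e with p n in en
... | true  = ≤-refl , en , λ j a b → ⊥-elim (<⇒≱ a (s≤s⁻¹ b))
... | false with m≤n⇒m<n∨m≡n (s≤s⁻¹ l)
...   | inj₂ refl with trans (sym en) e
...     | ()
lastBelow-spec p (suc n) i l e | false | inj₁ h with lastBelow-spec p n i h e
...   | x , y , z = m<n⇒m<1+n x , y , rest
  where
  rest : ∀ j → lastBelow p n < j → j < suc n → p j ≡ false
  rest j a b with m≤n⇒m<n∨m≡n (s≤s⁻¹ b)
  ... | inj₁ b′   = z j a b′
  ... | inj₂ refl = en

peak : ℕ → (ℕ → Bool) → ℕ
peak g G = maxBelow (kunz g G) (multiplicity g G)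

lastPeak : ℕ → (ℕ → Bool) → ℕ
lastPeak g G = lastBelow (λ i → kunz g G i ≡ᵇ peak g G) (multiplicity g G)

firstUnit : ℕ → (ℕ → Bool) → ℕ
firstUnit g G = least (λ i → kunz g G (suc i) ≡ᵇ 1) (multiplicity g G ∸ 1)

module _ {g : ℕ} {G : ℕ → Bool} (S : IsSemigroup g G) (q≥2 : 2 ≤ peak g G) where
  private
    m = multiplicity g G
    k = kunz g G
    q = peak g G
    a = lastPeak g G
    b′ = firstUnit g G
    K = isKunz S
    open IsKunz K
    open KunzProps S K

    top = maxBelow-attained k m (≤-trans (s≤s z≤n) q≥2)
    last = lastBelow-spec (λ i → k i ≡ᵇ q) m (proj₁ top) (proj₁ (proj₂ top)) (T⇒≡ (≡⇒≡ᵇ _ _ (proj₂ (proj₂ top))))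

    ka : k a ≡ q
    ka = ≡ᵇ⇒≡ (k a) q (≡⇒T (proj₁ (proj₂ last)))

    a≢0 : a ≢ 0
    a≢0 e with () ← ≤-trans q≥2 (≤-reflexive (trans (sym ka) (trans (cong k e) k₀)))

    not-one : ∀ j → 1 ≤ j → j ≤ b′ → k j ≢ 1
    not-one (suc j) _ l e with trans (sym (least-min (λ i → k (suc i) ≡ᵇ 1) (m ∸ 1) j l)) (T⇒≡ (≡⇒≡ᵇ (k (suc j)) 1 e))
    ... | ()

  shape : Shape m k q a b′
  shape = record
    { 1≤a = n≢0⇒n>0 a≢0
    ; a<m = proj₁ last
    ; peak = ka
    ; pos = pos
    ; max = maxBelow-≥ k m
    ; after = λ i p l → ≤∧≢⇒< (maxBelow-≥ k m i l) (λ e → absurd (trans (sym (proj₂ (proj₂ last) i p l)) (T⇒≡ (≡⇒≡ᵇ (k i) q e))))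
    ; sub = subadditive
    ; wrap = subadditive-wrap
    ; before = λ j p l → ≤∧≢⇒< (pos j p (s≤s (≤-trans l (least-≤ _ (m ∸ 1))))) (λ e → not-one j p l (sym e))
    ; unit = λ l → ≡ᵇ⇒≡ (k (suc b′)) 1 (≡⇒T (least-hit (λ i → k (suc i) ≡ᵇ 1) (m ∸ 1) (s≤s⁻¹ l)))
    }
    where
    absurd : false ≡ true → ⊥
    absurd ()

mult# peak# last# unit# : ℕ → List Bool → ℕ
mult# g gs = multiplicity g (isGap gs)
peak# g gs = peak g (isGap gs)
last# g gs = lastPeak g (isGap gs)
unit# g gs = firstUnit g (isGap gs)

kunz# : ℕ → List Bool → ℕ → ℕ
kunz# g gs = kunz g (isGap gs)

semigroup-determined : ∀ g gs gs′ → gs ∈ 𝒮 g → gs′ ∈ 𝒮 g → mult# g gs ≡ mult# g gs′ →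
  (∀ i → 0 < i → i < mult# g gs → kunz# g gs i ≡ kunz# g gs′ i) → gs ≡ gs′
semigroup-determined g gs gs′ i i′ em ek with 𝒮⇒semigroup g gs i | 𝒮⇒semigroup g gs′ i′
... | len , S | len′ , S′ = isGap-ext gs gs′ (trans len (sym len′))
  (kunz-determines (isKunz S) (subst (λ m → IsKunz (isGap gs′) m (kunz# g gs′)) (sym em) (isKunz S′)) ek)

∑-around : ∀ m a (k : ℕ → ℕ) → 1 ≤ a → a < m →
  ∑ m k ≡ k 0 + ∑ (a ∸ 1) (k ∘ suc) + k a + ∑ (m ∸ a ∸ 1) (λ i → k (a + suc i))
∑-around m (suc a) k _ l = trans (cong (λ x → ∑ x k) (sym m≡)) (trans (∑-split (suc (suc a)) r k)
  (cong₂ _+_ (cong (_+ k (suc a)) (∑-head a k)) (∑-cong r (λ i _ → cong k (sym (+-suc (suc a) i))))))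
  where
  r = m ∸ suc a ∸ 1
  m≡ : suc (suc a) + r ≡ m
  m≡ = trans (cong (suc (suc a) +_) (trans (∸-+-assoc m (suc a) 1) (cong (m ∸_) (+-comm (suc a) 1)))) (m+[n∸m]≡n l)

module _ (g m q a b′ : ℕ) (q≥4 : 4 ≤ q) (q≤11 : q ≤ 11) (p : List Bool → Bool)
  (inv : ∀ gs → T (p gs) → mult# g gs ≡ m × peak# g gs ≡ q × last# g gs ≡ a × unit# g gs ≡ b′) where

  private
    module TR = TwoRegions m q a b′ q≥4 q≤11
    open TR using (L₁; L₂; H₁; H₂; T₁; T₂; ℛ)

    shape-of : ∀ gs → gs ∈ 𝒮 g → T (p gs) → Shape m (kunz# g gs) q a b′
    shape-of gs i t with inv gs t
    ... | refl , refl , refl , refl = shape (proj₂ (𝒮⇒semigroup g gs i)) (≤-trans (s≤s (s≤s z≤n)) q≥4)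

    code : List Bool → List Letter × List Letter
    code gs = TR.R₁.word (Folded.fold (kunz# g gs) L₁) H₁ , TR.R₂.word (Folded.fold (λ i → kunz# g gs (a + i)) L₂) H₂

    words = pairs (TR.R₁.chained H₁) (TR.R₂.chained H₂)

    weight : List Letter × List Letter → ℕ
    weight z = TR.R₁.weight (proj₁ z) * TR.R₂.weight (proj₂ z)

    code∈ : ∀ gs → gs ∈ 𝒮 g → T (p gs) → code gs ∈ words
    code∈ gs i t = ∈-pairs {xs = TR.R₁.chained H₁}
      (F₁.folded∈chained q b′ TR.u₁ TR.v₁ lower-range lower-reflect lower-shift
        (λ i s l → let _ , y , z , w = F₁.mirror< s l in lower-low i s z , lower-low (a ∸ i) (≤-trans s w) y))
      (F₂.folded∈chained (q ∸ 1) b′ TR.u₂ TR.v₂ upper-range upper-reflect upper-shift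
        (λ i s l → let x , y , z , w = F₂.mirror< s l in upper-low i s z , proj₁ (upper-range (L₂ ∸ i) x y)))
      where
      k = kunz# g gs
      S = shape-of gs i t
      open Lower S
      open Upper S
      module F₁ = Folded k L₁
      module F₂ = Folded (λ i → k (a + i)) L₂

    code-inj : ∀ gs gs′ → gs ∈ 𝒮 g → gs′ ∈ 𝒮 g → T (p gs) → T (p gs′) → code gs ≡ code gs′ → gs ≡ gs′
    code-inj gs gs′ i i′ t t′ e = semigroup-determined g gs gs′ i i′ (trans (proj₁ (inv gs t)) (sym (proj₁ (inv gs′ t′)))) same
      where
      k = kunz# g gs
      k′ = kunz# g gs′
      same : ∀ j → 0 < j → j < mult# g gs → k j ≡ k′ j
      same j p l with <-cmp j a
      ... | tri< h _ _ = fold-determines k k′ L₁ (TR.R₁.word-injective _ _ H₁ (cong proj₁ e)) j p h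
      ... | tri≈ _ refl _ = trans (Shape.peak (shape-of gs i t)) (sym (Shape.peak (shape-of gs′ i′ t′)))
      ... | tri> _ _ h = subst (λ x → k x ≡ k′ x) (m+[n∸m]≡n (<⇒≤ h))
            (fold-determines (λ i → k (a + i)) (λ i → k′ (a + i)) L₂ (TR.R₂.word-injective _ _ H₂ (cong proj₂ e)) (j ∸ a) (m<n⇒0<n∸m h)
              (∸-monoˡ-< (subst (j <_) (proj₁ (inv gs t)) l) (<⇒≤ h)))

    -- Folding can count a middle coordinate twice. Below the peak this is made up for by the peak,
    -- which is not part of the folded word and is at least as large. Above the peak the surplus is
    -- at most 11, whence g + 11.
    heavy : ∀ gs → gs ∈ 𝒮 g → T (p gs) → 13 ^ (g + 11) * ℛ ≤ 21 ^ (g + 11) * weight (code gs)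
    heavy gs i t = power-trade (s₁ + s₂) (g + 11) (weight (code gs)) ℛ s≤ (begin
      TR.R₁.weight w₁ * TR.R₂.weight w₂ * 21 ^ (s₁ + s₂)        ≡⟨ cong₂ _*_ (cong₂ _*_ (TR.R₁.weight-word F₁.fold H₁) (TR.R₂.weight-word F₂.fold H₂)) (^-distribˡ-+-* 21 s₁ s₂) ⟩
      π₁ * π₂ * (21 ^ s₁ * 21 ^ s₂)                             ≡⟨ lem π₁ π₂ (21 ^ s₁) (21 ^ s₂) ⟩
      π₁ * 21 ^ s₁ * (π₂ * 21 ^ s₂)                             ≡⟨ cong₂ _*_ (F₁.folded-weight q (λ i s l → proj₂ (lower-range i s l))) (F₂.folded-weight (q ∸ 1) (λ i s l → proj₂ (upper-range i s l))) ⟩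
      13 ^ s₁ * ρ₁ * (13 ^ s₂ * ρ₂)                             ≡⟨ lem′ (13 ^ s₁) ρ₁ (13 ^ s₂) ρ₂ ⟩
      13 ^ s₁ * 13 ^ s₂ * ℛ                                     ≡⟨ cong (_* ℛ) (sym (^-distribˡ-+-* 13 s₁ s₂)) ⟩
      13 ^ (s₁ + s₂) * ℛ                                        ∎)
      where
      open ≡-Reasoning
      k = kunz# g gs
      S = shape-of gs i t
      open Lower S
      open Upper S
      open Shape S using (1≤a; a<m)
      module F₁ = Folded k L₁
      module F₂ = Folded (λ i → k (a + i)) L₂
      w₁ = proj₁ (code gs)
      w₂ = proj₂ (code gs)
      π₁ = ∏ H₁ (weightOf q ∘ F₁.fold)
      π₂ = ∏ H₂ (weightOf (q ∸ 1) ∘ F₂.fold)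
      ρ₁ = scale q ^ H₁
      ρ₂ = scale (q ∸ 1) ^ H₂
      s₁ = ∑ H₁ (λ i → k (suc i) + k (L₁ ∸ suc i))
      s₂ = ∑ H₂ (λ i → k (a + suc i) + k (a + (L₂ ∸ suc i)))
      lem : ∀ a b s t → a * b * (s * t) ≡ a * s * (b * t)
      lem = solve-∀
      lem′ : ∀ a r b s → a * r * (b * s) ≡ a * b * (r * s)
      lem′ = solve-∀
      x₁ = ∑ (a ∸ 1) (k ∘ suc)
      x₂ = ∑ (m ∸ a ∸ 1) (λ i → k (a + suc i))
      s₁≤ : s₁ ≤ x₁ + k a
      s₁≤ with F₁.pair-sum k
      ... | e , eq , inj₁ refl = ≤-trans (≤-reflexive eq) (+-monoʳ-≤ x₁ z≤n)
      ... | e , eq , inj₂ (h , refl) = ≤-trans (≤-reflexive eq) (+-monoʳ-≤ x₁ (≤-trans (proj₂ (lower-range H₁ h (proj₁ (proj₂ (proj₂ (F₁.mirror< h ≤-refl)))))) (≤-reflexive (sym (Shape.peak S)))))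
      s₂≤ : s₂ ≤ x₂ + 11
      s₂≤ with F₂.pair-sum (λ i → k (a + i))
      ... | e , eq , inj₁ refl = ≤-trans (≤-reflexive eq) (+-monoʳ-≤ x₂ z≤n)
      ... | e , eq , inj₂ (h , refl) = ≤-trans (≤-reflexive eq) (+-monoʳ-≤ x₂ (≤-trans (proj₂ (upper-range H₂ h (proj₁ (proj₂ (proj₂ (F₂.mirror< h ≤-refl)))))) (≤-trans (m∸n≤m q 1) q≤11)))
      total : x₁ + k a + x₂ ≤ g
      total = ≤-trans (≤-trans (+-monoˡ-≤ x₂ (+-monoˡ-≤ (k a) (m≤n+m x₁ (k 0)))) (≤-reflexive (sym (∑-around m a k 1≤a a<m))))
        (≤-reflexive (subst (λ x → ∑ x k ≡ g) (proj₁ (inv gs t)) (KunzProps.∑k (proj₂ (𝒮⇒semigroup g gs i)) (isKunz (proj₂ (𝒮⇒semigroup g gs i))))))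
      s≤ : s₁ + s₂ ≤ g + 11
      s≤ = ≤-trans (+-mono-≤ s₁≤ s₂≤) (≤-trans (≤-reflexive (sym (+-assoc (x₁ + k a) x₂ 11))) (+-monoˡ-≤ 11 total))

  few-of-shape : 36 * 13 ^ (g + 11) * count p (𝒮 g) ≤ 147 * 21 ^ (g + 11)
  few-of-shape with T-dec (0 <ᵇ count p (𝒮 g))
  -- The bound on the regions needs 1 ≤ a, which is read off from a member of the class; so an empty
  -- class is treated apart.
  ... | inj₂ e = ≤-trans (≤-reflexive (trans (cong (36 * 13 ^ (g + 11) *_) (n≤0⇒n≡0 (≮⇒≥ λ l → absurd (trans (sym (<ᵇ-true l)) e)))) (*-zeroʳ (36 * 13 ^ (g + 11))))) z≤n
    where
    absurd : true ≡ false → ⊥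
    absurd ()
  ... | inj₁ t = cancel*ˡ ℛ ℛ>0 (begin
    ℛ * (36 * A * count p (𝒮 g))                         ≡⟨ lem ℛ 36 A (count p (𝒮 g)) ⟩
    36 * (A * ℛ * count p (𝒮 g))                         ≡⟨ cong (36 *_) (sym (sumL-*ˡ (A * ℛ) (χ ∘ p) (𝒮 g))) ⟩
    36 * sumL (λ gs → A * ℛ * χ (p gs)) (𝒮 g)            ≤⟨ *-monoʳ-≤ 36 (sumL-mono (𝒮 g) one) ⟩
    36 * sumL (λ gs → B * (χ (p gs) * weight (code gs))) (𝒮 g) ≡⟨ cong (36 *_) (sumL-*ˡ B _ (𝒮 g)) ⟩
    36 * (B * sumL (λ gs → χ (p gs) * weight (code gs)) (𝒮 g)) ≤⟨ *-monoʳ-≤ 36 (*-monoʳ-≤ B (sumL-inj p code weight (𝒮 g) words (𝒮-unique g) code∈ code-inj)) ⟩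
    36 * (B * sumL weight words)                         ≡⟨ cong (λ x → 36 * (B * x)) (sumL-pairs TR.R₁.weight TR.R₂.weight (TR.R₁.chained H₁) (TR.R₂.chained H₂)) ⟩
    36 * (B * (T₁ * T₂))                                 ≡⟨ lem′ 36 B (T₁ * T₂) ⟩
    B * (36 * (T₁ * T₂))                                 ≤⟨ *-monoʳ-≤ B (TR.regions-bound (1≤a′ (𝒮 g) (λ _ i → i) (<ᵇ⇒< 0 _ t))) ⟩
    B * (147 * ℛ)                                        ≡⟨ lem″ B 147 ℛ ⟩
    ℛ * (147 * B)                                        ∎)
    where
    open ≤-Reasoning
    A = 13 ^ (g + 11)
    B = 21 ^ (g + 11)
    lem : ∀ r c a n → r * (c * a * n) ≡ c * (a * r * n)
    lem = solve-∀
    lem′ : ∀ c b t → c * (b * t) ≡ b * (c * t)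
    lem′ = solve-∀
    lem″ : ∀ b c r → b * (c * r) ≡ r * (c * b)
    lem″ = solve-∀
    ℛ>0 : 0 < ℛ
    ℛ>0 = *>0 (^>0 _ H₁ (scale>0 q)) (^>0 _ H₂ (scale>0 (q ∸ 1)))
    1≤a′ : ∀ xs → (∀ gs → gs ∈ xs → gs ∈ 𝒮 g) → 0 < count p xs → 1 ≤ a
    1≤a′ (gs ∷ xs) sub h with p gs in e
    ... | true  = Shape.1≤a (shape-of gs (sub gs (here refl)) (≡⇒T e))
    ... | false = 1≤a′ xs (λ z i → sub z (there i)) h
    one : ∀ gs → gs ∈ 𝒮 g → A * ℛ * χ (p gs) ≤ B * (χ (p gs) * weight (code gs))
    one gs i with p gs in e
    ... | false = ≤-trans (≤-reflexive (*-zeroʳ (A * ℛ))) z≤n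
    ... | true  = ≤-trans (≤-reflexive (*-identityʳ (A * ℛ))) (≤-trans (heavy gs i (≡⇒T e)) (*-monoʳ-≤ B (≤-reflexive (sym (+-identityʳ _)))))

module _ (g : ℕ) where
  private
    N = suc (suc (2 * g))

    mult-bound : ∀ gs → gs ∈ 𝒮 g → mult# g gs < N
    mult-bound gs i = s≤s (mult-≤ (proj₂ (𝒮⇒semigroup g gs i)))

  middle : List Bool → Bool
  middle gs = (3 <ᵇ peak# g gs) ∧ (peak# g gs <ᵇ 12)

  few-middle : 36 * 13 ^ (g + 11) * count middle (𝒮 g) ≤ N * (12 * (N * (N * (147 * 21 ^ (g + 11)))))
  few-middle = count-keys A N _ middle (mult# g) (𝒮 g) (λ gs i _ → mult-bound gs i) λ m _ →
    count-keys A 12 _ _ (peak# g) (𝒮 g) (λ gs i t → <ᵇ⇒< _ 12 (proj₂ (T-∧⁻ {3 <ᵇ peak# g gs} (proj₁ (T-∧⁻ {middle gs} t))))) λ q q<12 →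
    count-keys A N _ _ (last# g) (𝒮 g) (λ gs i t → <-trans (Shape.a<m (shape (proj₂ (𝒮⇒semigroup g gs i))
        (≤-trans (s≤s (s≤s z≤n)) (<ᵇ⇒< 3 _ (proj₁ (T-∧⁻ {3 <ᵇ peak# g gs} (proj₁ (T-∧⁻ {middle gs} (proj₁ (T-∧⁻ {middle gs ∧ (mult# g gs ≡ᵇ m)} t)))))))))) (mult-bound gs i)) λ a _ →
    count-keys A N _ _ (unit# g) (𝒮 g) (λ gs i _ → ≤-trans (s≤s (least-≤ _ (mult# g gs ∸ 1))) (≤-trans (s≤s (m∸n≤m (mult# g gs) 1)) (mult-bound gs i))) λ b′ _ →
    final m q a b′ q<12
    where
    A = 36 * 13 ^ (g + 11)
    final : ∀ m q a b′ → q < 12 → A * count (λ gs → (((middle gs ∧ (mult# g gs ≡ᵇ m)) ∧ (peak# g gs ≡ᵇ q)) ∧ (last# g gs ≡ᵇ a)) ∧ (unit# g gs ≡ᵇ b′)) (𝒮 g) ≤ 147 * 21 ^ (g + 11)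
    final m q a b′ q<12 with 4 ≤? q
    ... | yes h = few-of-shape g m q a b′ h (s≤s⁻¹ q<12) _ λ gs t →
          let t₁ , eb = T-∧⁻ {((middle gs ∧ (mult# g gs ≡ᵇ m)) ∧ (peak# g gs ≡ᵇ q)) ∧ (last# g gs ≡ᵇ a)} t
              t₂ , ea = T-∧⁻ {(middle gs ∧ (mult# g gs ≡ᵇ m)) ∧ (peak# g gs ≡ᵇ q)} t₁
              t₃ , eq = T-∧⁻ {middle gs ∧ (mult# g gs ≡ᵇ m)} t₂
              t₄ , em = T-∧⁻ {middle gs} t₃
          in ≡ᵇ⇒≡ _ _ em , ≡ᵇ⇒≡ _ _ eq , ≡ᵇ⇒≡ _ _ ea , ≡ᵇ⇒≡ _ _ eb
    ... | no ¬h = ≤-trans (≤-reflexive (trans (cong (A *_) (sumL-zero (𝒮 g) none)) (*-zeroʳ A))) z≤n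
      where
      none : ∀ gs → gs ∈ 𝒮 g → χ ((((middle gs ∧ (mult# g gs ≡ᵇ m)) ∧ (peak# g gs ≡ᵇ q)) ∧ (last# g gs ≡ᵇ a)) ∧ (unit# g gs ≡ᵇ b′)) ≡ 0
      none gs i = cong χ (¬T⇒≡ λ t →
        let t₁ , eb = T-∧⁻ {((middle gs ∧ (mult# g gs ≡ᵇ m)) ∧ (peak# g gs ≡ᵇ q)) ∧ (last# g gs ≡ᵇ a)} t
            t₂ , ea = T-∧⁻ {(middle gs ∧ (mult# g gs ≡ᵇ m)) ∧ (peak# g gs ≡ᵇ q)} t₁
            t₃ , eq = T-∧⁻ {middle gs ∧ (mult# g gs ≡ᵇ m)} t₂
            t₄ , em = T-∧⁻ {middle gs} t₃
        in ¬h (subst (4 ≤_) (≡ᵇ⇒≡ (peak# g gs) q eq) (<ᵇ⇒< 3 _ (proj₁ (T-∧⁻ {3 <ᵇ peak# g gs} t₄)))))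

-- Semigroups whose largest coordinate is at least 12

listsOver : ∀ {A : Set} → List A → ℕ → List (List A)
listsOver as zero    = [] ∷ []
listsOver as (suc n) = concatMap (λ w → map (_∷ w) as) (listsOver as n)

∈-listsOver : ∀ {A : Set} (as : List A) w → (∀ x → x ∈ w → x ∈ as) → w ∈ listsOver as (length w)
∈-listsOver as []      h = here refl
∈-listsOver as (x ∷ w) h = ∈-concatMap (∈-listsOver as w (λ y i → h y (there i))) (∈-map⁺ (_∷ w) (h x (here refl)))

productL : ∀ {A : Set} → (A → ℕ) → List A → ℕ
productL f []      = 1
productL f (x ∷ w) = f x * productL f w

sumL-productL : ∀ {A : Set} (f : A → ℕ) as n → sumL (productL f) (listsOver as n) ≡ sumL f as ^ n
sumL-productL f as zero    = refl
sumL-productL f as (suc n) = trans (sumL-concatMap _ _ (listsOver as n))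
  (trans (sumL-cong (listsOver as n) (λ w _ → trans (sumL-map _ _ as) (sumL-*ʳ (productL f w) f as)))
    (trans (sumL-*ˡ (sumL f as) _ (listsOver as n)) (cong (sumL f as *_) (sumL-productL f as n))))

applyUpTo-injective : ∀ {A : Set} (f h : ℕ → A) n → applyUpTo f n ≡ applyUpTo h n → ∀ i → i < n → f i ≡ h i
applyUpTo-injective f h (suc n) e zero    l = ∷-injectiveˡ e
applyUpTo-injective f h (suc n) e (suc i) l = applyUpTo-injective (f ∘ suc) (h ∘ suc) n (∷-injectiveʳ e) i (s≤s⁻¹ l)

∈-applyUpTo : ∀ {A : Set} (f : ℕ → A) n x → x ∈ applyUpTo f n → ∃[ i ] (i < n × x ≡ f i)
∈-applyUpTo f (suc n) x (here e) = 0 , s≤s z≤n , e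
∈-applyUpTo f (suc n) x (there j) with ∈-applyUpTo (f ∘ suc) n x j
... | i , l , e = suc i , s≤s l , e

sumL-applyUpTo : ∀ {A : Set} (φ : A → ℕ) f n → sumL φ (applyUpTo f n) ≡ ∑ n (φ ∘ f)
sumL-applyUpTo φ f zero    = refl
sumL-applyUpTo φ f (suc n) = trans (cong (φ (f 0) +_) (sumL-applyUpTo φ (f ∘ suc) n)) (sym (∑-head n (φ ∘ f)))

-- A coordinate u ≥ 1 gets weight 4^(u−1) / 5^u (scaled by 5^E); these weights sum to at most 1.

module Geometric (E : ℕ) where

  geo : ℕ → ℕ
  geo u = 4 ^ (u ∸ 1) * 5 ^ (E ∸ u)

  private
    -- The sum telescopes: what the first n weights leave over from 1 is exactly (4/5)^n.
    partial : ∀ n → n ≤ E → ∑ n (geo ∘ suc) + 4 ^ n * 5 ^ (E ∸ n) ≤ 5 ^ E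
    partial zero    l = ≤-reflexive (+-identityʳ _)
    partial (suc n) l = ≤-trans (≤-reflexive (trans (+-assoc (∑ n (geo ∘ suc)) _ _) (cong (∑ n (geo ∘ suc) +_)
      (trans (lem (4 ^ n) (5 ^ (E ∸ suc n))) (cong (λ x → 4 ^ n * 5 ^ x) (sym (+-∸-assoc 1 l))))))) (partial n (≤-trans (n≤1+n n) l))
      where
      lem : ∀ a b → a * b + (4 * a) * b ≡ a * (5 * b)
      lem = solve-∀

  geo-sum : sumL geo (applyUpTo suc E) ≤ 5 ^ E
  geo-sum = ≤-trans (≤-reflexive (sumL-applyUpTo geo suc E)) (≤-trans (m≤m+n _ _) (partial E ≤-refl))

  geo-product : ∀ w → (∀ x → x ∈ w → 1 ≤ x × x ≤ E) →
    productL geo w * 5 ^ sumL id w * 4 ^ length w ≡ 4 ^ sumL id w * (5 ^ E) ^ length w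
  geo-product []      h = refl
  geo-product (u ∷ w) h = trans (cong (λ x → geo u * productL geo w * x * (4 * 4 ^ length w)) (^-distribˡ-+-* 5 u _))
    (trans (lem (4 ^ (u ∸ 1)) (5 ^ (E ∸ u)) (productL geo w) (5 ^ u) (5 ^ sumL id w) (4 ^ length w))
    (trans (cong₂ _*_ (cong₂ _*_ p4 p5) (geo-product w (λ x i → h x (there i))))
    (trans (lem′ (4 ^ u) (5 ^ E) (4 ^ sumL id w) ((5 ^ E) ^ length w)) (cong (_* (5 ^ E * (5 ^ E) ^ length w)) (sym (^-distribˡ-+-* 4 u _))))))
    where
    p4 : 4 * 4 ^ (u ∸ 1) ≡ 4 ^ u
    p4 = cong (4 ^_) (m+[n∸m]≡n (proj₁ (h u (here refl))))
    p5 : 5 ^ (E ∸ u) * 5 ^ u ≡ 5 ^ E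
    p5 = trans (sym (^-distribˡ-+-* 5 (E ∸ u) u)) (cong (5 ^_) (m∸n+n≡m (proj₂ (h u (here refl)))))
    lem : ∀ a b p c d l → a * b * p * (c * d) * (4 * l) ≡ 4 * a * (b * c) * (p * d * l)
    lem = solve-∀
    lem′ : ∀ a b c d → a * b * (c * d) ≡ a * c * (b * d)
    lem′ = solve-∀

*-^ : ∀ a b n → (a * b) ^ n ≡ a ^ n * b ^ n
*-^ a b zero    = refl
*-^ a b (suc n) = trans (cong (a * b *_) (*-^ a b n)) (lem a b (a ^ n) (b ^ n))
  where
  lem : ∀ a b x y → a * b * (x * y) ≡ a * x * (b * y)
  lem = solve-∀

power-below : ∀ n e → 11 * n ≤ e → 4 ^ n * 200 ^ e ≤ 227 ^ e
power-below n e h = begin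
  4 ^ n * 200 ^ e                       ≡⟨ cong (λ x → 4 ^ n * 200 ^ x) (sym d≡) ⟩
  4 ^ n * 200 ^ (11 * n + d)            ≡⟨ cong (4 ^ n *_) (trans (^-distribˡ-+-* 200 (11 * n) d) (cong (_* 200 ^ d) (sym (^-*-assoc 200 11 n)))) ⟩
  4 ^ n * ((200 ^ 11) ^ n * 200 ^ d)    ≡⟨ sym (*-assoc (4 ^ n) _ _) ⟩
  4 ^ n * (200 ^ 11) ^ n * 200 ^ d      ≡⟨ cong (_* 200 ^ d) (sym (*-^ 4 (200 ^ 11) n)) ⟩
  (4 * 200 ^ 11) ^ n * 200 ^ d          ≤⟨ *-mono-≤ (^-monoˡ-≤ n (≤ᵇ⇒≤ (4 * 200 ^ 11) (227 ^ 11) tt)) (^-monoˡ-≤ d (≤ᵇ⇒≤ 200 227 tt)) ⟩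
  (227 ^ 11) ^ n * 227 ^ d              ≡⟨ trans (cong (_* 227 ^ d) (^-*-assoc 227 11 n)) (sym (^-distribˡ-+-* 227 (11 * n) d)) ⟩
  227 ^ (11 * n + d)                    ≡⟨ cong (227 ^_) d≡ ⟩
  227 ^ e                               ∎
  where
  open ≤-Reasoning
  d = e ∸ 11 * n
  d≡ : 11 * n + d ≡ e
  d≡ = m+[n∸m]≡n h

∑k-of : ∀ g gs → gs ∈ 𝒮 g → ∑ (mult# g gs) (kunz# g gs) ≡ g
∑k-of g gs i = KunzProps.∑k (proj₂ (𝒮⇒semigroup g gs i)) (isKunz (proj₂ (𝒮⇒semigroup g gs i)))

module _ (g m : ℕ) (p : List Bool → Bool) (inv : ∀ gs → T (p gs) → mult# g gs ≡ m × 12 ≤ peak# g gs) where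
  private
    E = suc (2 * g)
    n = m ∸ 1
    open Geometric E

    code : List Bool → List ℕ
    code gs = applyUpTo (λ i → kunz# g gs (suc i)) n

    m≡ : ∀ gs → T (p gs) → suc n ≡ mult# g gs
    m≡ gs t with inv gs t
    ... | refl , _ = refl

    index< : ∀ gs → T (p gs) → ∀ {i} → i < n → suc i < mult# g gs
    index< gs t {i} l = subst (suc i <_) (m≡ gs t) (s≤s l)

    entries : ∀ gs → gs ∈ 𝒮 g → T (p gs) → ∀ x → x ∈ code gs → 1 ≤ x × x ≤ E
    entries gs i t x j with ∈-applyUpTo _ n x j
    ... | r , l , refl = IsKunz.pos K (suc r) (s≤s z≤n) (index< gs t l) , KunzProps.k-≤ S K (suc r) (index< gs t l)
      where
      S = proj₂ (𝒮⇒semigroup g gs i)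
      K = isKunz S

    code-sum : ∀ gs → gs ∈ 𝒮 g → T (p gs) → sumL id (code gs) ≡ g
    code-sum gs i t = trans (sumL-applyUpTo id _ n) (trans (sym (cong (_+ ∑ n (λ i → kunz# g gs (suc i))) (IsKunz.k₀ (isKunz (proj₂ (𝒮⇒semigroup g gs i))))))
      (trans (sym (∑-head n (kunz# g gs))) (trans (cong (λ x → ∑ x (kunz# g gs)) (m≡ gs t)) (∑k-of g gs i))))

    short : ∀ gs → gs ∈ 𝒮 g → T (p gs) → 11 * n ≤ 2 * g
    short gs i t = ≤-trans (*-monoʳ-≤ 11 (≤-trans (n≤1+n n) (≤-reflexive (m≡ gs t)))) (≤-trans (m≤n+m _ (last# g gs))
      (KunzProps.gap-bound S (isKunz S) (last# g gs) 11 (Shape.a<m sh) (≤-trans (proj₂ (inv gs t)) (≤-reflexive (sym (Shape.peak sh))))))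
      where
      S = proj₂ (𝒮⇒semigroup g gs i)
      sh = shape S (≤-trans (s≤s (s≤s z≤n)) (proj₂ (inv gs t)))

    code-inj : ∀ gs gs′ → gs ∈ 𝒮 g → gs′ ∈ 𝒮 g → T (p gs) → T (p gs′) → code gs ≡ code gs′ → gs ≡ gs′
    code-inj gs gs′ i i′ t t′ e = semigroup-determined g gs gs′ i i′ (trans (sym (m≡ gs t)) (m≡ gs′ t′)) same
      where
      same : ∀ j → 0 < j → j < mult# g gs → kunz# g gs j ≡ kunz# g gs′ j
      same (suc j) _ l = applyUpTo-injective _ _ n e j (s≤s⁻¹ (subst (suc j <_) (sym (m≡ gs t)) l))

  -- A word of n coordinates with sum g has weight 4^(g - n) / 5^g. A coordinate of at least 12 puts
  -- a gap beyond 11 m, so 11 n ≤ 2g, and 4^(1/11) < 227/200 bounds the count by (5/4 ·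
  -- (227/200)²)^g, about 1.6103^g. This is why 12 is the threshold: from a maximum of 11 one gets
  -- only 10 n ≤ 2g, and 5/4 · 4^(1/5) exceeds φ.
  few-of-mult : 4 ^ g * 200 ^ (2 * g) * count p (𝒮 g) ≤ 5 ^ g * 227 ^ (2 * g)
  few-of-mult = cancel*ˡ D (^>0 (5 ^ E) n (^>0 5 E (s≤s z≤n))) (begin
    D * (A * count p (𝒮 g))                                   ≡⟨ sym (*-assoc D A _) ⟩
    D * A * count p (𝒮 g)                                     ≡⟨ sym (sumL-*ˡ (D * A) (χ ∘ p) (𝒮 g)) ⟩
    sumL (λ gs → D * A * χ (p gs)) (𝒮 g)                      ≤⟨ sumL-mono (𝒮 g) one ⟩
    sumL (λ gs → B * (χ (p gs) * productL geo (code gs))) (𝒮 g) ≡⟨ sumL-*ˡ B _ (𝒮 g) ⟩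
    B * sumL (λ gs → χ (p gs) * productL geo (code gs)) (𝒮 g) ≤⟨ *-monoʳ-≤ B (sumL-inj p code (productL geo) (𝒮 g) (listsOver (applyUpTo suc E) n) (𝒮-unique g) code∈ code-inj) ⟩
    B * sumL (productL geo) (listsOver (applyUpTo suc E) n)   ≡⟨ cong (B *_) (sumL-productL geo (applyUpTo suc E) n) ⟩
    B * sumL geo (applyUpTo suc E) ^ n                        ≤⟨ *-monoʳ-≤ B (^-monoˡ-≤ n geo-sum) ⟩
    B * D                                                     ≡⟨ *-comm B D ⟩
    D * B                                                     ∎)
    where
    open ≤-Reasoning
    A = 4 ^ g * 200 ^ (2 * g)
    B = 5 ^ g * 227 ^ (2 * g)
    D = (5 ^ E) ^ n
    ∈-range : ∀ {x} → 1 ≤ x → x ≤ E → x ∈ applyUpTo suc E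
    ∈-range {suc x} _ l = ∈-applyUpTo⁺ suc l
    code∈ : ∀ gs → gs ∈ 𝒮 g → T (p gs) → code gs ∈ listsOver (applyUpTo suc E) n
    code∈ gs i t = subst (λ x → code gs ∈ listsOver (applyUpTo suc E) x) (length-applyUpTo _ n)
      (∈-listsOver (applyUpTo suc E) (code gs) (λ x j → ∈-range (proj₁ (entries gs i t x j)) (proj₂ (entries gs i t x j))))
    heavy : ∀ gs → gs ∈ 𝒮 g → T (p gs) → D * A ≤ B * productL geo (code gs)
    heavy gs i t = begin
      D * (4 ^ g * 200 ^ (2 * g))               ≡⟨ lem D (4 ^ g) (200 ^ (2 * g)) ⟩
      4 ^ g * D * 200 ^ (2 * g)                 ≡⟨ cong (_* 200 ^ (2 * g)) (sym identity) ⟩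
      w * 5 ^ g * 4 ^ n * 200 ^ (2 * g)         ≡⟨ *-assoc (w * 5 ^ g) (4 ^ n) _ ⟩
      w * 5 ^ g * (4 ^ n * 200 ^ (2 * g))       ≤⟨ *-monoʳ-≤ (w * 5 ^ g) (power-below n (2 * g) (short gs i t)) ⟩
      w * 5 ^ g * 227 ^ (2 * g)                 ≡⟨ lem′ w (5 ^ g) (227 ^ (2 * g)) ⟩
      5 ^ g * 227 ^ (2 * g) * w                 ∎
      where
      w = productL geo (code gs)
      lem : ∀ d a b → d * (a * b) ≡ a * d * b
      lem = solve-∀
      lem′ : ∀ w a b → w * a * b ≡ a * b * w
      lem′ = solve-∀
      identity : w * 5 ^ g * 4 ^ n ≡ 4 ^ g * D
      identity = subst₂ (λ s l → w * 5 ^ s * 4 ^ l ≡ 4 ^ s * (5 ^ E) ^ l) (code-sum gs i t) (length-applyUpTo _ n) (geo-product (code gs) (entries gs i t))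
    one : ∀ gs → gs ∈ 𝒮 g → D * A * χ (p gs) ≤ B * (χ (p gs) * productL geo (code gs))
    one gs i with p gs in e
    ... | false = ≤-trans (≤-reflexive (*-zeroʳ (D * A))) z≤n
    ... | true  = ≤-trans (≤-reflexive (*-identityʳ (D * A))) (≤-trans (heavy gs i (≡⇒T e)) (*-monoʳ-≤ B (≤-reflexive (sym (+-identityʳ _)))))

huge : ℕ → List Bool → Bool
huge g gs = 11 <ᵇ peak# g gs

few-huge : ∀ g → 4 ^ g * 200 ^ (2 * g) * count (huge g) (𝒮 g) ≤ suc (suc (2 * g)) * (5 ^ g * 227 ^ (2 * g))
few-huge g = count-keys (4 ^ g * 200 ^ (2 * g)) (suc (suc (2 * g))) (5 ^ g * 227 ^ (2 * g)) (huge g) (mult# g) (𝒮 g) (λ gs i _ → s≤s (mult-≤ (proj₂ (𝒮⇒semigroup g gs i)))) λ m _ →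
  few-of-mult g m _ λ gs t → let h , e = T-∧⁻ {huge g gs} t in ≡ᵇ⇒≡ (mult# g gs) m e , <ᵇ⇒< 11 (peak# g gs) h

-- Fibonacci growth, and semigroups with a late coordinate 3

F : ℕ → ℕ
F zero          = 1
F (suc zero)    = 1
F (suc (suc n)) = F (suc n) + F n

comps : ℕ → List (List ℕ)
comps zero          = [] ∷ []
comps (suc zero)    = (1 ∷ []) ∷ []
comps (suc (suc n)) = map (1 ∷_) (comps (suc n)) ++ map (2 ∷_) (comps n)

comps-length : ∀ n → length (comps n) ≡ F n
comps-length zero          = refl
comps-length (suc zero)    = refl
comps-length (suc (suc n)) = trans (length-++ (map (1 ∷_) (comps (suc n)))) (cong₂ _+_
  (trans (length-map (1 ∷_) (comps (suc n))) (comps-length (suc n))) (trans (length-map (2 ∷_) (comps n)) (comps-length n)))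

∈-comps : ∀ w → (∀ x → x ∈ w → 1 ≤ x × x ≤ 2) → w ∈ comps (sumL id w)
∈-comps []      h = here refl
∈-comps (x ∷ w) h with h x (here refl)
∈-comps (1 ∷ w) h | _ = one (sumL id w) (∈-comps w (λ y i → h y (there i)))
  where
  one : ∀ n → w ∈ comps n → (1 ∷ w) ∈ comps (suc n)
  one zero    (here refl) = here refl
  one (suc n) i = ∈-++⁺ˡ (∈-map⁺ (1 ∷_) i)
∈-comps (2 ∷ w) h | _ = ∈-++⁺ʳ (map (1 ∷_) (comps (suc (sumL id w)))) (∈-map⁺ (2 ∷_) (∈-comps w (λ y i → h y (there i))))
∈-comps (suc (suc (suc x)) ∷ w) h | _ , s≤s (s≤s ())

F>0 : ∀ n → 0 < F n
F>0 zero          = ≤-refl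
F>0 (suc zero)    = ≤-refl
F>0 (suc (suc n)) = ≤-trans (F>0 (suc n)) (m≤m+n _ _)

F-mono-suc : ∀ n → F n ≤ F (suc n)
F-mono-suc zero    = ≤-refl
F-mono-suc (suc n) = m≤m+n _ _

F-mono : ∀ {m n} → m ≤ n → F m ≤ F n
F-mono {m} {n} h = subst (λ x → F m ≤ F x) (m+[n∸m]≡n h) (go (n ∸ m))
  where
  go : ∀ d → F m ≤ F (m + d)
  go zero    = ≤-reflexive (cong F (sym (+-identityʳ m)))
  go (suc d) = ≤-trans (go d) (≤-trans (F-mono-suc (m + d)) (≤-reflexive (cong F (sym (+-suc m d)))))

-- A sequence with u (s+2) = u (s+1) + u s grows at least like (p/q)^s whenever (p/q)² ≤ p/q + 1.

module _ (p q : ℕ) (q≤p : q ≤ p) (h : p * p ≤ p * q + q * q) (u : ℕ → ℕ)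
  (rec : ∀ s → u (suc (suc s)) ≡ u (suc s) + u s) (up : u 0 ≤ u 1) where

  growth : ∀ s → p ^ s * q * u 0 ≤ p * q ^ s * u s × p ^ suc s * q * u 0 ≤ p * q ^ suc s * u (suc s)
  growth zero    = ≤-trans (≤-reflexive (lem q (u 0))) (*-monoˡ-≤ (u 0) (≤-trans q≤p (≤-reflexive (sym (*-identityʳ p)))))
                 , ≤-trans (≤-reflexive (lem′ p q (u 0))) (*-monoʳ-≤ (p * (q * 1)) up)
    where
    lem : ∀ q u → 1 * q * u ≡ q * u
    lem = solve-∀
    lem′ : ∀ p q u → p * 1 * q * u ≡ p * (q * 1) * u
    lem′ = solve-∀
  growth (suc s) = proj₂ (growth s) , (begin
    p * (p * P) * q * u 0                              ≡⟨ l₁ p P q (u 0) ⟩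
    p * p * (P * q * u 0)                              ≤⟨ *-monoˡ-≤ (P * q * u 0) h ⟩
    (p * q + q * q) * (P * q * u 0)                    ≡⟨ l₂ p q P (u 0) ⟩
    q * (p * P * q * u 0) + q * q * (P * q * u 0)      ≤⟨ +-mono-≤ (*-monoʳ-≤ q (proj₂ (growth s))) (*-monoʳ-≤ (q * q) (proj₁ (growth s))) ⟩
    q * (p * (q * Q) * u (suc s)) + q * q * (p * Q * u s)  ≡⟨ l₃ p q Q (u (suc s)) (u s) ⟩
    p * (q * (q * Q)) * (u (suc s) + u s)              ≡⟨ cong (p * (q * (q * Q)) *_) (sym (rec s)) ⟩
    p * (q * (q * Q)) * u (suc (suc s))                ∎)
    where
    open ≤-Reasoning
    P = p ^ s
    Q = q ^ s
    l₁ : ∀ p P q u → p * (p * P) * q * u ≡ p * p * (P * q * u)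
    l₁ = solve-∀
    l₂ : ∀ p q P u → (p * q + q * q) * (P * q * u) ≡ q * (p * P * q * u) + q * q * (P * q * u)
    l₂ = solve-∀
    l₃ : ∀ p q Q v u → q * (p * (q * Q) * v) + q * q * (p * Q * u) ≡ p * (q * (q * Q)) * (v + u)
    l₃ = solve-∀

-- The quotient 55/34 lies below φ by the smallest possible margin: 55² = 3025 and 55 · 34 + 34² =
-- 3026.
F-growth : ∀ n → 55 ^ n * 34 ≤ 55 * 34 ^ n * F n
F-growth n = ≤-trans (≤-reflexive (sym (*-identityʳ _))) (proj₁ (growth 55 34 (≤ᵇ⇒≤ 34 55 tt) (≤ᵇ⇒≤ (55 * 55) (55 * 34 + 34 * 34) tt) F (λ _ → refl) ≤-refl n))

-- The rate 21/13 is the reciprocal of the weight of a unit of a coordinate. So when a prefix of sum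
-- s is split off, the number of remaining words drops at least as fast as the weight of the prefix,
-- up to the constant 21/13.
F-shift : ∀ n s → 21 ^ s * 13 * F n ≤ 21 * 13 ^ s * F (n + s)
F-shift n s = subst (λ x → 21 ^ s * 13 * F x ≤ 21 * 13 ^ s * F (n + s)) (+-identityʳ n)
  (proj₁ (growth 21 13 (≤ᵇ⇒≤ 13 21 tt) (≤ᵇ⇒≤ (21 * 21) (21 * 13 + 13 * 13) tt) (λ s → F (n + s))
    (λ s → trans (cong F (trans (+-suc n (suc s)) (cong suc (+-suc n s)))) (cong (λ x → F x + F (n + s)) (sym (+-suc n s))))
    (≤-trans (≤-reflexive (cong F (+-identityʳ n))) (≤-trans (F-mono-suc n) (≤-reflexive (cong F (+-comm 1 n))))) s))

module _ (c : ℕ) where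

  private
    letterSum : List Letter → ℕ
    letterSum = sumL (λ s → proj₁ s + proj₂ s)

    letter-≤ : ∀ s → s ∈ lettersOf c → proj₁ s ≤ c × proj₂ s ≤ c
    letter-≤ s i with ∈-concatMap⁻ {h = λ u → map (u ,_) (applyUpTo suc c)} {xs = applyUpTo suc c} (proj₁ (∈-filter⁻ (T? ∘ λ s → c ≤ᵇ proj₁ s + proj₂ s) {xs = concatMap (λ u → map (u ,_) (applyUpTo suc c)) (applyUpTo suc c)} i))
    ... | u , j , r with ∈-map⁻ (u ,_) r
    ... | v , t , refl with ∈-applyUpTo suc c u j | ∈-applyUpTo suc c v t
    ... | _ , l , refl | _ , l′ , refl = l , l′

  word-weight : ∀ w (weight : List Letter → ℕ) → weight [] ≡ 1 → (∀ s w → weight (s ∷ w) ≡ weightOf c s * weight w) →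
    (∀ s → s ∈ w → s ∈ lettersOf c) →
    weight w * 21 ^ letterSum w ≡ 13 ^ letterSum w * scale c ^ length w
  word-weight []            weight e₀ e₁ h = trans (cong (_* 1) e₀) refl
  word-weight ((u , v) ∷ w) weight e₀ e₁ h = trans (cong₂ _*_ (e₁ (u , v) w) (trans (^-distribˡ-+-* 21 (u + v) _) (cong (_* 21 ^ letterSum w) (^-distribˡ-+-* 21 u v))))
    (trans (lem (entry c u) (entry c v) (weight w) (21 ^ u) (21 ^ v) (21 ^ letterSum w))
    (trans (cong₂ _*_ (cong₂ _*_ (entry-power c u (proj₁ uv)) (entry-power c v (proj₂ uv))) (word-weight w weight e₀ e₁ (λ s i → h s (there i))))
    (trans (lem′ (13 ^ u) (21 ^ c) (13 ^ v) (13 ^ letterSum w) (scale c ^ length w))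
      (cong (_* (scale c * scale c ^ length w)) (trans (cong (_* 13 ^ letterSum w) (sym (^-distribˡ-+-* 13 u v))) (sym (^-distribˡ-+-* 13 (u + v) _)))))))
    where
    uv = letter-≤ (u , v) (h (u , v) (here refl))
    lem : ∀ a b w x y z → a * b * w * (x * y * z) ≡ a * x * (b * y) * (w * z)
    lem = solve-∀
    lem′ : ∀ a k b z r → a * k * (b * k) * (z * r) ≡ a * b * z * (k * k * r)
    lem′ = solve-∀

module _ (g a b′ : ℕ) (p : List Bool → Bool)
  (inv : ∀ gs → T (p gs) → peak# g gs ≡ 3 × last# g gs ≡ a × unit# g gs ≡ b′) where

  private
    H = ⌊ a /2⌋

    n d : ℕ → ℕ
    n i = (if i ≡ᵇ suc b′ then 3 else 1) * 98
    d _ = 100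

    top-checks = T-∧⁻ {chainCheck 98 100 3} topCheck-3
    top-starts = T-∧⁻ {startCheck 98 100 3 1 1 294 100} (proj₂ top-checks)

    starts : ∀ i → 1 ≤ i → i ≤ suc b′ → i ≤ H → StartBound 98 100 3 (low b′ i) 1 (n i) (d i)
    starts i 1≤i i≤b _ with m≤n⇒m<n∨m≡n i≤b
    ... | inj₂ refl = start-eq (low-no {b′} ≤-refl) refl (cong (λ x → (if x then 3 else 1) * 98) (T⇒≡ (≡⇒≡ᵇ i i refl))) refl (startBound (proj₁ top-starts))
    ... | inj₁ (s≤s l) = start-eq (low-yes l) refl (cong (λ x → (if x then 3 else 1) * 98) (¬T⇒≡ (λ t → <⇒≢ (s≤s l) (≡ᵇ⇒≡ i (suc b′) t)))) refl (startBound (proj₂ top-starts))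

    later : ∀ i → suc b′ < i → i ≤ H → 98 * d i ≤ 100 * n i
    later i l _ rewrite ¬T⇒≡ (λ t → <⇒≢ l (sym (≡ᵇ⇒≡ i (suc b′) t))) = ≤-refl

    module R = Region 98 100 (s≤s z≤n) (s≤s z≤n) 3 b′ H (low b′) (λ _ → 1) n d (proj₁ top-checks) starts later

    letterSum : List Letter → ℕ
    letterSum = sumL (λ s → proj₁ s + proj₂ s)

    tails : List Letter → ℕ → List (List ℕ)
    tails w e = if e + letterSum w ≤ᵇ g then comps (g ∸ (e + letterSum w)) else []

    -- The folded word omits the peak 3 but may count a middle coordinate twice. What lies between
    -- the letter sum plus the tail sum and g is 3 minus that coordinate, or 3 if there is none.
    offsets : List ℕ
    offsets = 0 ∷ 1 ∷ 2 ∷ 3 ∷ []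

    3∸e∈offsets : ∀ e → e ≤ 3 → 3 ∸ e ∈ offsets
    3∸e∈offsets 0 _ = there (there (there (here refl)))
    3∸e∈offsets 1 _ = there (there (here refl))
    3∸e∈offsets 2 _ = there (here refl)
    3∸e∈offsets 3 _ = here refl
    3∸e∈offsets (suc (suc (suc (suc _)))) (s≤s (s≤s (s≤s ())))

    completions : List Letter → List (List Letter × List ℕ)
    completions w = map (w ,_) (concatMap (tails w) offsets)

    codes = concatMap completions (R.chained H)

    ℛ = scale 3 ^ H

    tails-bound : ∀ w e → 21 ^ letterSum w * 13 * length (tails w e) ≤ 21 * 13 ^ letterSum w * F g
    tails-bound w e with e + letterSum w ≤ᵇ g in eq
    ... | false = ≤-trans (≤-reflexive (*-zeroʳ (21 ^ letterSum w * 13))) z≤n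
    ... | true  = ≤-trans (≤-reflexive (cong (21 ^ σ * 13 *_) (comps-length r))) (≤-trans (F-shift r σ)
                    (*-monoʳ-≤ (21 * 13 ^ σ) (F-mono (≤-trans (m≤n+m (r + σ) e) (≤-reflexive (trans (lem e r σ) (m∸n+n≡m (≤ᵇ⇒≤ (e + σ) g (≡⇒T eq)))))))))
      where
      σ = letterSum w
      r = g ∸ (e + σ)
      lem : ∀ e r s → e + (r + s) ≡ r + (e + s)
      lem = solve-∀

    completions-bound : ∀ w → w ∈ R.chained H → 13 * ℛ * length (completions w) ≤ 84 * F g * R.weight w
    completions-bound w i = cancel*ˡ (13 ^ σ) (^>0 13 σ (s≤s z≤n)) (begin
      13 ^ σ * (13 * ℛ * length (completions w))              ≡⟨ cong (λ x → 13 ^ σ * (13 * ℛ * x)) (length-map (w ,_) (concatMap (tails w) offsets)) ⟩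
      13 ^ σ * (13 * ℛ * ℓ)                                   ≡⟨ l₁ (13 ^ σ) 13 ℛ ℓ ⟩
      13 ^ σ * ℛ * (13 * ℓ)                                   ≡⟨ cong (_* (13 * ℓ)) (sym weight-id) ⟩
      R.weight w * 21 ^ σ * (13 * ℓ)                          ≡⟨ l₂ (R.weight w) (21 ^ σ) 13 ℓ ⟩
      R.weight w * (21 ^ σ * 13 * ℓ)                          ≤⟨ *-monoʳ-≤ (R.weight w) four ⟩
      R.weight w * (4 * (21 * 13 ^ σ * F g))                  ≡⟨ l₃ (R.weight w) (13 ^ σ) (F g) ⟩
      13 ^ σ * (84 * F g * R.weight w)                        ∎)
      where
      open ≤-Reasoning
      σ = letterSum w
      ℓ = length (concatMap (tails w) offsets)
      l₁ : ∀ a b c x → a * (b * c * x) ≡ a * c * (b * x)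
      l₁ = solve-∀
      l₂ : ∀ a b c x → a * b * (c * x) ≡ a * (b * c * x)
      l₂ = solve-∀
      l₃ : ∀ a b c → a * (4 * (21 * b * c)) ≡ b * (84 * c * a)
      l₃ = solve-∀
      weight-id : R.weight w * 21 ^ σ ≡ 13 ^ σ * ℛ
      weight-id = trans (word-weight 3 w R.weight refl (λ _ _ → refl) (proj₂ (R.chained-shape H w i)))
        (cong (λ x → 13 ^ σ * scale 3 ^ x) (proj₁ (R.chained-shape H w i)))
      four : 21 ^ σ * 13 * ℓ ≤ 4 * (21 * 13 ^ σ * F g)
      four = begin
        21 ^ σ * 13 * ℓ                                             ≡⟨ cong (21 ^ σ * 13 *_) (trans (sym (sumL-1 (concatMap (tails w) offsets))) (sumL-concatMap (λ _ → 1) (tails w) offsets)) ⟩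
        21 ^ σ * 13 * sumL (λ e → sumL (λ _ → 1) (tails w e)) offsets ≡⟨ sym (sumL-*ˡ (21 ^ σ * 13) (λ e → sumL (λ _ → 1) (tails w e)) offsets) ⟩
        sumL (λ e → 21 ^ σ * 13 * sumL (λ _ → 1) (tails w e)) offsets ≤⟨ sumL-mono offsets (λ e _ → ≤-trans (≤-reflexive (cong (21 ^ σ * 13 *_) (sumL-1 (tails w e)))) (tails-bound w e)) ⟩
        sumL (λ _ → 21 * 13 ^ σ * F g) offsets                      ≡⟨⟩
        4 * (21 * 13 ^ σ * F g)                                     ∎

    shape-of : ∀ gs → gs ∈ 𝒮 g → T (p gs) → Shape (mult# g gs) (kunz# g gs) 3 a b′
    shape-of gs i t = subst₂ (λ x y → Shape (mult# g gs) (kunz# g gs) 3 x y) (proj₁ (proj₂ (inv gs t))) (proj₂ (proj₂ (inv gs t)))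
      (subst (λ q → Shape (mult# g gs) (kunz# g gs) q (last# g gs) (unit# g gs)) (proj₁ (inv gs t))
        (shape (proj₂ (𝒮⇒semigroup g gs i)) (≤-trans (s≤s (s≤s z≤n)) (≤-reflexive (sym (proj₁ (inv gs t)))))))

    rest : List Bool → ℕ
    rest gs = mult# g gs ∸ a ∸ 1

    tail : List Bool → List ℕ
    tail gs = applyUpTo (λ i → kunz# g gs (a + suc i)) (rest gs)

    code : List Bool → List Letter × List ℕ
    code gs = R.word (Folded.fold (kunz# g gs) a) H , tail gs

    in-tail : ∀ gs → gs ∈ 𝒮 g → T (p gs) → ∀ {i} → i < rest gs → a + suc i < mult# g gs
    in-tail gs i t {j} l = ≤-trans (s≤s (+-monoʳ-≤ a l)) (≤-reflexive
      (trans (cong (λ x → suc (a + x)) (trans (∸-+-assoc (mult# g gs) a 1) (cong (mult# g gs ∸_) (+-comm a 1)))) (m+[n∸m]≡n (Shape.a<m (shape-of gs i t)))))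

    word-letterSum : ∀ st h → letterSum (R.word st h) ≡ ∑ h (λ i → proj₁ (st (suc i)) + proj₂ (st (suc i)))
    word-letterSum st zero    = refl
    word-letterSum st (suc h) = trans (cong (proj₁ (st (suc h)) + proj₂ (st (suc h)) +_) (word-letterSum st h)) (+-comm (proj₁ (st (suc h)) + proj₂ (st (suc h))) _)

    code∈ : ∀ gs → gs ∈ 𝒮 g → T (p gs) → code gs ∈ codes
    code∈ gs i t = ∈-concatMap {h = completions} {xs = R.chained H}
      (F₁.folded∈chained 3 b′ (low b′) (λ _ → 1) lower-range lower-reflect lower-shift
        (λ i s l → let x , y , z , w = F₁.mirror< s l in lower-low i s z , proj₁ (lower-range (a ∸ i) x y)))
      (∈-map⁺ (w ,_) (find (F₁.pair-sum k)))
      where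
      k = kunz# g gs
      S = shape-of gs i t
      open Lower S
      open Shape S using (1≤a; a<m)
      module F₁ = Folded k a
      w = R.word F₁.fold H
      x₁ = ∑ (a ∸ 1) (k ∘ suc)
      x₂ = sumL id (tail gs)
      total : x₁ + 3 + x₂ ≡ g
      total = trans (cong₂ (λ x y → x₁ + x + y) (sym (Shape.peak S)) (sumL-applyUpTo id _ (rest gs)))
        (trans (cong (λ z → z + x₁ + k a + ∑ (rest gs) (λ i → k (a + suc i))) (sym (IsKunz.k₀ (isKunz (proj₂ (𝒮⇒semigroup g gs i))))))
          (trans (sym (∑-around (mult# g gs) a k 1≤a a<m)) (∑k-of g gs i)))
      small : ∀ x → x ∈ tail gs → 1 ≤ x × x ≤ 2
      small x j with ∈-applyUpTo _ (rest gs) x j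
      ... | r , l , refl = Shape.pos S (a + suc r) (≤-trans 1≤a (m≤m+n a _)) (in-tail gs i t l)
          , s≤s⁻¹ (Shape.after S (a + suc r) (≤-trans (≤-reflexive (+-comm 1 a)) (+-monoʳ-≤ a (s≤s z≤n))) (in-tail gs i t l))
      member : ∀ e → e ∈ offsets → e + letterSum w + x₂ ≡ g → tail gs ∈ concatMap (tails w) offsets
      member e j eq = ∈-concatMap {h = tails w} {xs = offsets} j here′
        where
        here′ : tail gs ∈ tails w e
        here′ rewrite ≤ᵇ-true {e + letterSum w} {g} (≤-trans (m≤m+n _ x₂) (≤-reflexive eq)) =
          subst (λ n → tail gs ∈ comps n) (trans (sym (m+n∸m≡n (e + letterSum w) x₂)) (cong (_∸ (e + letterSum w)) eq)) (∈-comps (tail gs) small)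
      find : ∃[ e ] ((∑ F₁.H (λ i → k (suc i) + k (a ∸ suc i)) ≡ x₁ + e) × ((e ≡ 0) ⊎ (1 ≤ F₁.H × e ≡ k F₁.H))) → tail gs ∈ concatMap (tails w) offsets
      find (e , eq , r) = member (3 ∸ e) (3∸e∈offsets e (e≤3 r)) (trans (cong (λ x → 3 ∸ e + x + x₂) (trans (word-letterSum F₁.fold H) eq))
          (trans (cong (_+ x₂) (trans (+-comm (3 ∸ e) _) (trans (+-assoc x₁ e (3 ∸ e)) (cong (x₁ +_) (m+[n∸m]≡n (e≤3 r)))))) total))
        where
        e≤3 : (e ≡ 0) ⊎ (1 ≤ F₁.H × e ≡ k F₁.H) → e ≤ 3
        e≤3 (inj₁ refl) = z≤n
        e≤3 (inj₂ (h , refl)) = proj₂ (lower-range H h (proj₁ (proj₂ (proj₂ (F₁.mirror< h ≤-refl)))))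

    code-inj : ∀ gs gs′ → gs ∈ 𝒮 g → gs′ ∈ 𝒮 g → T (p gs) → T (p gs′) → code gs ≡ code gs′ → gs ≡ gs′
    code-inj gs gs′ i i′ t t′ e = semigroup-determined g gs gs′ i i′ em same
      where
      k = kunz# g gs
      k′ = kunz# g gs′
      S = shape-of gs i t
      S′ = shape-of gs′ i′ t′
      er : rest gs ≡ rest gs′
      er = trans (sym (length-applyUpTo _ (rest gs))) (trans (cong length (cong proj₂ e)) (length-applyUpTo _ (rest gs′)))
      unrest : ∀ gs → a < mult# g gs → a + suc (rest gs) ≡ mult# g gs
      unrest gs l = trans (+-suc a (rest gs)) (trans (cong (λ x → suc (a + x)) (trans (∸-+-assoc (mult# g gs) a 1) (cong (mult# g gs ∸_) (+-comm a 1)))) (m+[n∸m]≡n l))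
      em : mult# g gs ≡ mult# g gs′
      em = trans (sym (unrest gs (Shape.a<m S))) (trans (cong (λ x → a + suc x) er) (unrest gs′ (Shape.a<m S′)))
      et : applyUpTo (λ i → k (a + suc i)) (rest gs) ≡ applyUpTo (λ i → k′ (a + suc i)) (rest gs)
      et = trans (cong proj₂ e) (cong (applyUpTo (λ i → k′ (a + suc i))) (sym er))
      same : ∀ j → 0 < j → j < mult# g gs → k j ≡ k′ j
      same j p l with <-cmp j a
      ... | tri< h _ _ = fold-determines k k′ a (R.word-injective _ _ H (cong proj₁ e)) j p h
      ... | tri≈ _ refl _ = trans (Shape.peak S) (sym (Shape.peak S′))
      ... | tri> _ _ h = subst (λ x → k x ≡ k′ x) j≡
            (applyUpTo-injective _ _ (rest gs) et (j ∸ a ∸ 1) (≤-trans (s≤s (∸-monoˡ-≤ 1 (≤-refl {j ∸ a}))) (small (m<n⇒0<n∸m h))))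
        where
        j≡ : a + suc (j ∸ a ∸ 1) ≡ j
        j≡ = trans (+-suc a _) (trans (cong (λ x → suc (a + x)) (trans (∸-+-assoc j a 1) (cong (j ∸_) (+-comm a 1)))) (m+[n∸m]≡n h))
        small : 0 < j ∸ a → suc (j ∸ a ∸ 1) ≤ rest gs
        small z = +-cancelˡ-≤ (suc a) (suc (j ∸ a ∸ 1)) (rest gs) (≤-trans (≤-reflexive (cong suc j≡)) (≤-trans l (≤-reflexive (trans (sym (unrest gs (Shape.a<m S))) (+-suc a (rest gs))))))

  -- After the last 3 the word consists of ones and twos, so the prefix is completed in Fibonacci
  -- many ways. By `F-shift` these numbers turn into the weight of the prefix times F g, and the
  -- contraction of the chain remains as gain over F g. The constant 252 is 4 · 21 · 3, from the
  -- offsets, the loss in `F-shift` and the start at index b.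
  few-of-top-shape : 13 * 100 ^ ⌊ a /2⌋ * count p (𝒮 g) ≤ 252 * 98 ^ ⌊ a /2⌋ * F g
  few-of-top-shape = cancel*ˡ ℛ (^>0 (scale 3) H (scale>0 3)) (begin
    ℛ * (13 * 100 ^ H * count p (𝒮 g))                          ≡⟨ l₁ ℛ 13 (100 ^ H) (count p (𝒮 g)) ⟩
    100 ^ H * (13 * ℛ * count p (𝒮 g))                          ≤⟨ *-monoʳ-≤ (100 ^ H) (*-monoʳ-≤ (13 * ℛ) (≤-trans (count-inj p (λ _ → true) code (𝒮 g) codes (𝒮-unique g) (λ gs i t → code∈ gs i t , tt) code-inj) (≤-reflexive (sumL-concatMap (λ _ → 1) completions (R.chained H))))) ⟩
    100 ^ H * (13 * ℛ * sumL (λ w → sumL (λ _ → 1) (completions w)) (R.chained H)) ≡⟨ cong (100 ^ H *_) (sym (sumL-*ˡ (13 * ℛ) _ (R.chained H))) ⟩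
    100 ^ H * sumL (λ w → 13 * ℛ * sumL (λ _ → 1) (completions w)) (R.chained H) ≤⟨ *-monoʳ-≤ (100 ^ H) (sumL-mono (R.chained H) (λ w i → ≤-trans (≤-reflexive (cong (13 * ℛ *_) (sumL-1 (completions w)))) (completions-bound w i))) ⟩
    100 ^ H * sumL (λ w → 84 * F g * R.weight w) (R.chained H)  ≡⟨ cong (100 ^ H *_) (sumL-*ˡ (84 * F g) R.weight (R.chained H)) ⟩
    100 ^ H * (84 * F g * sumL R.weight (R.chained H))          ≡⟨ l₂ (100 ^ H) (84 * F g) (sumL R.weight (R.chained H)) ⟩
    84 * F g * (100 ^ H * sumL R.weight (R.chained H))          ≡⟨ cong (λ x → 84 * F g * (x * sumL R.weight (R.chained H))) (sym (∏-const H 100)) ⟩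
    84 * F g * (∏ H d * sumL R.weight (R.chained H))            ≤⟨ *-monoʳ-≤ (84 * F g) R.region-bound ⟩
    84 * F g * (∏ H n * ℛ)                                      ≤⟨ *-monoʳ-≤ (84 * F g) (*-monoˡ-≤ ℛ (≤-trans (≤-reflexive (∏-* H _ _)) (*-mono-≤ (indicator-product H (suc b′)) (≤-reflexive (∏-const H 98))))) ⟩
    84 * F g * (3 * 98 ^ H * ℛ)                                 ≡⟨ l₃ (F g) (98 ^ H) ℛ ⟩
    ℛ * (252 * 98 ^ H * F g)                                    ∎)
    where
    open ≤-Reasoning
    l₁ : ∀ r c a x → r * (c * a * x) ≡ a * (c * r * x)
    l₁ = solve-∀
    l₂ : ∀ a b c → a * (b * c) ≡ b * (a * c)
    l₂ = solve-∀
    l₃ : ∀ f x r → 84 * f * (3 * x * r) ≡ r * (252 * x * f)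
    l₃ = solve-∀

module _ (g k₀ : ℕ) where
  private
    N = suc (suc (2 * g))
    h = ⌊ k₀ /2⌋

  late : List Bool → Bool
  late gs = (peak# g gs ≡ᵇ 3) ∧ (k₀ <ᵇ last# g gs)

  few-late : 13 * 50 ^ h * count late (𝒮 g) ≤ N * (N * (252 * 49 ^ h * F g))
  few-late = count-keys A N (N * B) late (last# g) (𝒮 g)
    (λ gs i t → <-trans (Shape.a<m (shape (proj₂ (𝒮⇒semigroup g gs i)) (≤-trans (s≤s (s≤s z≤n)) (≤-reflexive (sym (≡ᵇ⇒≡ (peak# g gs) 3 (proj₁ (T-∧⁻ {peak# g gs ≡ᵇ 3} t)))))))) (s≤s (mult-≤ (proj₂ (𝒮⇒semigroup g gs i)))))
    λ a _ → count-keys A N B _ (unit# g) (𝒮 g)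
      (λ gs i _ → ≤-trans (s≤s (least-≤ _ (mult# g gs ∸ 1))) (≤-trans (s≤s (m∸n≤m (mult# g gs) 1)) (s≤s (mult-≤ (proj₂ (𝒮⇒semigroup g gs i))))))
      λ b′ _ → final a b′
    where
    A = 13 * 50 ^ h
    B = 252 * 49 ^ h * F g
    class : ℕ → ℕ → List Bool → Bool
    class a b′ gs = (late gs ∧ (last# g gs ≡ᵇ a)) ∧ (unit# g gs ≡ᵇ b′)
    parts : ∀ a b′ gs → T (class a b′ gs) → (peak# g gs ≡ 3 × last# g gs ≡ a × unit# g gs ≡ b′) × k₀ < last# g gs
    parts a b′ gs t =
      let t₁ , eb = T-∧⁻ {late gs ∧ (last# g gs ≡ᵇ a)} t
          t₂ , ea = T-∧⁻ {late gs} t₁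
          e3 , l  = T-∧⁻ {peak# g gs ≡ᵇ 3} t₂
      in (≡ᵇ⇒≡ _ 3 e3 , ≡ᵇ⇒≡ _ a ea , ≡ᵇ⇒≡ _ b′ eb) , <ᵇ⇒< k₀ _ l
    final : ∀ a b′ → A * count (class a b′) (𝒮 g) ≤ B
    final a b′ with k₀ <? a
    ... | no ¬l = ≤-trans (≤-reflexive (trans (cong (A *_) (sumL-zero (𝒮 g) (λ gs _ → cong χ (¬T⇒≡ {class a b′ gs} λ t →
            ¬l (subst (k₀ <_) (proj₁ (proj₂ (proj₁ (parts a b′ gs t)))) (proj₂ (parts a b′ gs t))))))) (*-zeroʳ A))) z≤n
    ... | yes l = trade H (⌊n/2⌋-mono (<⇒≤ l)) (few-of-top-shape g a b′ (class a b′) (λ gs t → proj₁ (parts a b′ gs t)))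
      where
      H = ⌊ a /2⌋
      c = count (class a b′) (𝒮 g)
      trade : ∀ H → h ≤ H → 13 * 100 ^ H * c ≤ 252 * 98 ^ H * F g → A * c ≤ B
      trade H h≤H bound = cancel*ˡ (2 ^ h * 100 ^ e) (*>0 (^>0 2 h (s≤s z≤n)) (^>0 100 e (s≤s z≤n))) (begin
        2 ^ h * 100 ^ e * (13 * 50 ^ h * c)        ≡⟨ m₁ (2 ^ h) (50 ^ h) (100 ^ e) 13 c ⟩
        13 * (2 ^ h * 50 ^ h * 100 ^ e) * c        ≡⟨ cong (λ x → 13 * x * c) (trans (cong (_* 100 ^ e) (sym (*-^ 2 50 h))) (trans (sym (^-distribˡ-+-* 100 h e)) (cong (100 ^_) h+e))) ⟩
        13 * 100 ^ H * c                           ≤⟨ bound ⟩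
        252 * 98 ^ H * F g                         ≡⟨ cong (λ x → 252 * x * F g) (trans (cong (98 ^_) (sym h+e)) (trans (^-distribˡ-+-* 98 h e) (cong (_* 98 ^ e) (*-^ 2 49 h)))) ⟩
        252 * (2 ^ h * 49 ^ h * 98 ^ e) * F g      ≤⟨ *-monoˡ-≤ (F g) (*-monoʳ-≤ 252 (*-monoʳ-≤ (2 ^ h * 49 ^ h) (^-monoˡ-≤ e (≤ᵇ⇒≤ 98 100 tt)))) ⟩
        252 * (2 ^ h * 49 ^ h * 100 ^ e) * F g     ≡⟨ sym (m₁ (2 ^ h) (49 ^ h) (100 ^ e) 252 (F g)) ⟩
        2 ^ h * 100 ^ e * (252 * 49 ^ h * F g)     ∎)
        where
        open ≤-Reasoning
        e = H ∸ h
        h+e : h + e ≡ H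
        h+e = m+[n∸m]≡n h≤H
        m₁ : ∀ t x y d c → t * y * (d * x * c) ≡ d * (t * x * y) * c
        m₁ = solve-∀

-- Exponentially rare classes are negligible

-- Bernoulli's inequality (1 + 1/α)^h ≥ 1 + h/α, cleared of denominators.
bernoulli : ∀ α h → α ^ h * (α + h) ≤ α * suc α ^ h
bernoulli α zero    = ≤-reflexive (lem α)
  where
  lem : ∀ a → 1 * (a + 0) ≡ a * 1
  lem = solve-∀
bernoulli α (suc h) = begin
  α * α ^ h * (α + suc h)            ≤⟨ lin (h * α ^ h) (≤-refl {0}) (lem α (α ^ h) h) ⟩
  suc α * (α ^ h * (α + h))          ≤⟨ *-monoʳ-≤ (suc α) (bernoulli α h) ⟩
  suc α * (α * suc α ^ h)            ≡⟨ swap (suc α) α (suc α ^ h) ⟩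
  α * (suc α * suc α ^ h)            ∎
  where
  open ≤-Reasoning
  lem : ∀ a p h → a * p * (a + suc h) + 0 + h * p ≡ suc a * (p * (a + h)) + 0
  lem = solve-∀
  swap : ∀ x y z → x * (y * z) ≡ y * (x * z)
  swap = solve-∀

-- Write s = r + h e with e = d + 1. Bernoulli gives h α^h ≤ α β^h, and the e-th power of this
-- bounds (β/α)^s from below by h^(d+1) / α^e, one power of h more than the polynomial has. The
-- constant `h₀` is what this spare power has to absorb.
exp-beats-poly : ∀ α β K d → 0 < α → α < β → ∃[ s₀ ] (∀ s → s₀ ≤ s → K * suc s ^ d * α ^ s ≤ β ^ s)
exp-beats-poly α β K d α>0 α<β = e * suc h₀ , main
  where
  e = suc d
  h₀ = α ^ e * K * (2 * e) ^ d
  main : ∀ s → e * suc h₀ ≤ s → K * suc s ^ d * α ^ s ≤ β ^ s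
  main s s≥ = cancel*ˡ (α ^ e) (^>0 α e α>0) (begin
    α ^ e * (K * suc s ^ d * α ^ s)              ≡⟨ l₁ (α ^ e) K (suc s ^ d) (α ^ s) ⟩
    α ^ e * K * suc s ^ d * α ^ s                ≤⟨ *-monoˡ-≤ (α ^ s) poly ⟩
    h ^ e * α ^ s                                ≡⟨ cong (λ x → h ^ e * α ^ x) s≡ ⟩
    h ^ e * α ^ (r + h * e)                      ≡⟨ cong (h ^ e *_) (trans (^-distribˡ-+-* α r (h * e)) (cong (α ^ r *_) (sym (^-*-assoc α h e)))) ⟩
    h ^ e * (α ^ r * (α ^ h) ^ e)                ≡⟨ l₄ (h ^ e) (α ^ r) ((α ^ h) ^ e) ⟩
    α ^ r * ((α ^ h) ^ e * h ^ e)                ≡⟨ cong (α ^ r *_) (sym (*-^ (α ^ h) h e)) ⟩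
    α ^ r * (α ^ h * h) ^ e                      ≤⟨ *-mono-≤ (^-monoˡ-≤ r (<⇒≤ α<β)) (^-monoˡ-≤ e (≤-trans (*-monoʳ-≤ (α ^ h) (m≤n+m h α)) (≤-trans (bernoulli α h) (*-monoʳ-≤ α (^-monoˡ-≤ h α<β))))) ⟩
    β ^ r * (α * β ^ h) ^ e                      ≡⟨ cong (β ^ r *_) (*-^ α (β ^ h) e) ⟩
    β ^ r * (α ^ e * (β ^ h) ^ e)                ≡⟨ l₂ (β ^ r) (α ^ e) ((β ^ h) ^ e) ⟩
    α ^ e * (β ^ r * (β ^ h) ^ e)                ≡⟨ cong (α ^ e *_) (trans (cong (β ^ r *_) (^-*-assoc β h e)) (sym (^-distribˡ-+-* β r (h * e)))) ⟩
    α ^ e * β ^ (r + h * e)                      ≡⟨ cong (λ x → α ^ e * β ^ x) (sym s≡) ⟩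
    α ^ e * β ^ s                                ∎)
    where
    open ≤-Reasoning
    h = s / e
    r = s % e
    s≡ : s ≡ r + h * e
    s≡ = m≡m%n+[m/n]*n s e
    s<  : suc s ≤ e * suc h
    s< = ≤-trans (s≤s (≤-reflexive s≡)) (≤-trans (+-monoˡ-≤ (h * e) (m%n<n s e)) (≤-reflexive (*-comm (suc h) e)))
    h₀<h : suc h₀ ≤ h
    h₀<h = s≤s⁻¹ (*-cancelˡ-< e (suc h₀) (suc h) (≤-trans (s≤s s≥) s<))
    l₁ : ∀ a k p x → a * (k * p * x) ≡ a * k * p * x
    l₁ = solve-∀
    l₂ : ∀ x y z → x * (y * z) ≡ y * (x * z)
    l₂ = solve-∀
    l₄ : ∀ x y z → x * (y * z) ≡ y * (z * x)
    l₄ = solve-∀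
    s≤2eh : suc s ≤ 2 * e * h
    s≤2eh = ≤-trans s< (≤-trans (*-monoʳ-≤ e (≤-trans (s≤s (≤-refl {h})) (+-monoˡ-≤ h (≤-trans (s≤s z≤n) h₀<h)))) (≤-reflexive (l₃ e h)))
      where
      l₃ : ∀ e h → e * (h + h) ≡ 2 * e * h
      l₃ = solve-∀
    poly : α ^ e * K * suc s ^ d ≤ h ^ e
    poly = begin
      α ^ e * K * suc s ^ d          ≤⟨ *-monoʳ-≤ (α ^ e * K) (^-monoˡ-≤ d s≤2eh) ⟩
      α ^ e * K * (2 * e * h) ^ d    ≡⟨ cong (α ^ e * K *_) (*-^ (2 * e) h d) ⟩
      α ^ e * K * ((2 * e) ^ d * h ^ d) ≡⟨ sym (*-assoc (α ^ e * K) _ _) ⟩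
      h₀ * h ^ d                     ≤⟨ *-monoˡ-≤ (h ^ d) (≤-trans (n≤1+n h₀) h₀<h) ⟩
      h * h ^ d                      ∎

exp-beats-poly-div : ∀ α β K d D .{{_ : NonZero D}} → 0 < α → α < β →
  ∃[ M ] (∀ g → M ≤ g → K * suc g ^ d * α ^ (g / D) ≤ β ^ (g / D))
exp-beats-poly-div α β K d D α>0 α<β with exp-beats-poly α β (K * D ^ d) d α>0 α<β
... | s₀ , f = D * s₀ , main
  where
  main : ∀ g → D * s₀ ≤ g → K * suc g ^ d * α ^ (g / D) ≤ β ^ (g / D)
  main g h = ≤-trans (*-monoˡ-≤ (α ^ s) (≤-trans (*-monoʳ-≤ K (≤-trans (^-monoˡ-≤ d g<) (≤-reflexive (*-^ D (suc s) d)))) (≤-reflexive (sym (*-assoc K _ _)))))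
    (f s (s≤s⁻¹ (*-cancelˡ-< D s₀ (suc s) (≤-trans (s≤s h) g<))))
    where
    s = g / D
    g< : suc g ≤ D * suc s
    g< = ≤-trans (s≤s (≤-reflexive (m≡m%n+[m/n]*n g D))) (≤-trans (+-monoˡ-≤ (s * D) (m%n<n g D)) (≤-reflexive (*-comm (suc s) D)))

negligible : ∀ c₁ c₂ p q d (c : ℕ → ℕ) → 0 < c₁ → 0 < q → q * 34 < p * 55 →
  (∀ g → c₁ * p ^ g * c g ≤ c₂ * suc g ^ d * q ^ g) → ∀ K → ∃[ M ] (∀ g → M ≤ g → K * c g ≤ F g)
negligible c₁ c₂ p q d c c₁>0 q>0 r bound K with exp-beats-poly (q * 34) (p * 55) (K * 55 * c₂) d (*>0 q>0 (s≤s z≤n)) r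
... | M , f = M , λ g h → cancel*ˡ (X g) (X>0 g) (begin
    X g * (K * c g)                                    ≡⟨ l₁ c₁ (p ^ g) 55 (34 ^ g) K (c g) ⟩
    K * 55 * 34 ^ g * (c₁ * p ^ g * c g)               ≤⟨ *-monoʳ-≤ (K * 55 * 34 ^ g) (bound g) ⟩
    K * 55 * 34 ^ g * (c₂ * suc g ^ d * q ^ g)         ≡⟨ l₂ (K * 55) (34 ^ g) c₂ (suc g ^ d) (q ^ g) ⟩
    K * 55 * c₂ * suc g ^ d * (q ^ g * 34 ^ g)         ≡⟨ cong (K * 55 * c₂ * suc g ^ d *_) (sym (*-^ q 34 g)) ⟩
    K * 55 * c₂ * suc g ^ d * (q * 34) ^ g             ≤⟨ f g h ⟩
    (p * 55) ^ g                                       ≡⟨ *-^ p 55 g ⟩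
    p ^ g * 55 ^ g                                     ≤⟨ *-mono-≤ (≤-trans (≤-reflexive (sym (+-identityʳ _))) (*-monoˡ-≤ (p ^ g) c₁>0)) (≤-trans (≤-trans (≤-reflexive (sym (*-identityʳ _))) (*-monoʳ-≤ (55 ^ g) (s≤s z≤n))) (F-growth g)) ⟩
    c₁ * p ^ g * (55 * 34 ^ g * F g)                   ≡⟨ sym (*-assoc (c₁ * p ^ g) (55 * 34 ^ g) (F g)) ⟩
    X g * F g                                          ∎)
  where
  open ≤-Reasoning
  X : ℕ → ℕ
  X g = c₁ * p ^ g * (55 * 34 ^ g)
  p>0 : 0 < p
  p>0 = n≢0⇒n>0 (λ { refl → n≮0 r })
  X>0 : ∀ g → 0 < X g
  X>0 g = *>0 (*>0 c₁>0 (^>0 p g p>0)) (*>0 {55} (s≤s z≤n) (^>0 34 g (s≤s z≤n)))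
  l₁ : ∀ a b e f k c → a * b * (e * f) * (k * c) ≡ k * e * f * (a * b * c)
  l₁ = solve-∀
  l₂ : ∀ k f c s q → k * f * (c * s * q) ≡ k * c * s * (q * f)
  l₂ = solve-∀

cubic-negligible : ∀ a p b c q e (n : ℕ → ℕ) → 0 < a → 0 < p → 0 < q → q * 34 < p * 55 →
  (∀ g → let N = suc (suc (2 * g)) in a * p ^ (g + e) * n g ≤ N * (b * (N * (N * (c * q ^ (g + e)))))) →
  ∀ K → ∃[ M ] (∀ g → M ≤ g → K * n g ≤ F g)
cubic-negligible a p b c q e n a>0 p>0 q>0 r h = negligible (a * p ^ e) (8 * b * c * q ^ e) p q 3 n (*>0 a>0 (^>0 p e p>0)) q>0 r
  λ g → subst₂ _≤_
    (trans (cong (λ x → a * x * n g) (^-distribˡ-+-* p g e)) (m₁ a (p ^ g) (p ^ e) (n g)))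
    (trans (cong (λ x → suc (suc (2 * g)) * (b * (suc (suc (2 * g)) * (suc (suc (2 * g)) * (c * x))))) (^-distribˡ-+-* q g e)) (m₂ g b c (q ^ g) (q ^ e))) (h g)
  where
  m₁ : ∀ a x y n → a * (x * y) * n ≡ a * y * x * n
  m₁ = solve-∀
  m₂ : ∀ g b c x y → suc (suc (2 * g)) * (b * (suc (suc (2 * g)) * (suc (suc (2 * g)) * (c * (x * y))))) ≡ 8 * b * c * y * (suc g * (suc g * (suc g * 1))) * x
  m₂ = solve-∀

middle-negligible : ∀ K → ∃[ M ] (∀ g → M ≤ g → K * count (middle g) (𝒮 g) ≤ F g)
middle-negligible = cubic-negligible 36 13 12 147 21 11 (λ g → count (middle g) (𝒮 g)) (s≤s z≤n) (s≤s z≤n) (s≤s z≤n) (≤ᵇ⇒≤ 715 715 tt) few-middle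

linear-negligible : ∀ a b c d (n : ℕ → ℕ) → 0 < c * d ^ 2 → c * d ^ 2 * 34 < a * b ^ 2 * 55 →
  (∀ g → a ^ g * b ^ (2 * g) * n g ≤ suc (suc (2 * g)) * (c ^ g * d ^ (2 * g))) →
  ∀ K → ∃[ M ] (∀ g → M ≤ g → K * n g ≤ F g)
linear-negligible a b c d n q>0 r h = negligible 1 2 (a * b ^ 2) (c * d ^ 2) 1 n (s≤s z≤n) q>0 r
  λ g → subst₂ _≤_ (cong (_* n g) (trans (square-power a b g) (sym (+-identityʳ _))))
    (trans (cong (suc (suc (2 * g)) *_) (square-power c d g)) (cong (_* (c * d ^ 2) ^ g) (m g))) (h g)
  where
  square-power : ∀ a b g → a ^ g * b ^ (2 * g) ≡ (a * b ^ 2) ^ g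
  square-power a b g = trans (cong (a ^ g *_) (sym (^-*-assoc b 2 g))) (sym (*-^ a (b ^ 2) g))
  m : ∀ g → suc (suc (2 * g)) ≡ 2 * (suc g * 1)
  m = solve-∀

huge-negligible : ∀ K → ∃[ M ] (∀ g → M ≤ g → K * count (huge g) (𝒮 g) ≤ F g)
huge-negligible = linear-negligible 4 200 5 227 (λ g → count (huge g) (𝒮 g)) (≤ᵇ⇒≤ 1 (5 * 227 ^ 2) tt) (≤ᵇ⇒≤ (suc (5 * 227 ^ 2 * 34)) (4 * 200 ^ 2 * 55) tt) few-huge

-- Good semigroups may have coordinate 3 only at indices up to the cutoff.
cutoff : ∀ D .{{_ : NonZero D}} → ℕ → ℕ
cutoff D g = g / D + g / D

-- Here F g already stands in the bound, so no comparison of growth rates is needed and any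
-- contraction in g / D suffices.
quadratic-negligible : ∀ a p c q D .{{_ : NonZero D}} (n : ℕ → ℕ) → 0 < a → 0 < q → q < p →
  (∀ g → let N = suc (suc (2 * g)) in a * p ^ (g / D) * n g ≤ N * (N * (c * q ^ (g / D) * F g))) →
  ∀ K → ∃[ M ] (∀ g → M ≤ g → K * n g ≤ F g)
quadratic-negligible a p c q D n a>0 q>0 q<p h K = proj₁ M , λ g l → finish g (g / D) (n g) (F g) (h g) (proj₂ M g l)
  where
  M = exp-beats-poly-div q p (4 * c * K) 2 D q>0 q<p
  N : ℕ → ℕ
  N g = suc (suc (2 * g))
  finish : ∀ g s n f → a * p ^ s * n ≤ N g * (N g * (c * q ^ s * f)) → 4 * c * K * suc g ^ 2 * q ^ s ≤ p ^ s → K * n ≤ f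
  finish g s n f h k = cancel*ˡ (a * p ^ s) (*>0 a>0 (^>0 p s (<-trans q>0 q<p))) (begin
    a * p ^ s * (K * n)                       ≡⟨ m₁ (a * p ^ s) K n ⟩
    K * (a * p ^ s * n)                       ≤⟨ *-monoʳ-≤ K h ⟩
    K * (N g * (N g * (c * q ^ s * f)))       ≡⟨ m₂ g K c (q ^ s) f ⟩
    4 * c * K * (suc g * (suc g * 1)) * q ^ s * f ≤⟨ *-monoˡ-≤ f k ⟩
    p ^ s * f                                 ≤⟨ *-monoˡ-≤ f (≤-trans (≤-reflexive (sym (+-identityʳ _))) (*-monoˡ-≤ (p ^ s) a>0)) ⟩
    a * p ^ s * f                             ∎)
    where
    open ≤-Reasoning
    m₁ : ∀ x k n → x * (k * n) ≡ k * (x * n)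
    m₁ = solve-∀
    m₂ : ∀ g k c q f → k * (suc (suc (2 * g)) * (suc (suc (2 * g)) * (c * q * f))) ≡ 4 * c * k * (suc g * (suc g * 1)) * q * f
    m₂ = solve-∀

halved-cutoff : ∀ a p b q x (n f : ℕ) N → a * p ^ ⌊ x + x /2⌋ * n ≤ N * (N * (b * q ^ ⌊ x + x /2⌋ * f)) → a * p ^ x * n ≤ N * (N * (b * q ^ x * f))
halved-cutoff a p b q x n f N h = subst (λ y → a * p ^ y * n ≤ N * (N * (b * q ^ y * f))) (sym (n≡⌊n+n/2⌋ x)) h

late-negligible : ∀ D .{{_ : NonZero D}} K → ∃[ M ] (∀ g → M ≤ g → K * count (late g (cutoff D g)) (𝒮 g) ≤ F g)
late-negligible D = quadratic-negligible 13 50 252 49 D (λ g → count (late g (cutoff D g)) (𝒮 g)) (s≤s z≤n) (s≤s z≤n) (≤ᵇ⇒≤ 50 50 tt)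
  λ g → halved-cutoff 13 50 252 49 (g / D) (count (late g (cutoff D g)) (𝒮 g)) (F g) (suc (suc (2 * g))) (few-late g (cutoff D g))

bad : ℕ → ℕ → List Bool → Bool
bad g k₀ gs = middle g gs ∨ (huge g gs ∨ late g k₀ gs)

union-negligible : ∀ {A : ℕ → Set} (xs : ∀ g → List (A g)) (p r s : ∀ g → A g → Bool) →
  (∀ K → ∃[ M ] (∀ g → M ≤ g → K * count (p g) (xs g) ≤ F g)) →
  (∀ K → ∃[ M ] (∀ g → M ≤ g → K * count (r g) (xs g) ≤ F g)) →
  (∀ K → ∃[ M ] (∀ g → M ≤ g → K * count (s g) (xs g) ≤ F g)) →
  ∀ K → ∃[ M ] (∀ g → M ≤ g → K * count (λ x → p g x ∨ (r g x ∨ s g x)) (xs g) ≤ F g)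
union-negligible xs p r s f₁ f₂ f₃ K = M₁ + (M₂ + M₃) , λ g h →
  let x = count (p g) (xs g) ; y = count (r g) (xs g) ; z = count (s g) (xs g)
  in cancel*ˡ 3 (s≤s z≤n) (≤-trans (*-monoʳ-≤ 3 (*-monoʳ-≤ K (≤-trans (count-∨ {r = p g} {s = λ x → r g x ∨ s g x} (xs g) (λ _ _ → T-∨⁻)) (+-monoʳ-≤ x (count-∨ {r = r g} {s = s g} (xs g) (λ _ _ → T-∨⁻))))))
       (≤-trans (≤-reflexive (m K x y z)) (≤-trans (+-mono-≤ (proj₂ (f₁ (3 * K)) g (≤-trans (m≤m+n M₁ _) h)) (+-mono-≤ (proj₂ (f₂ (3 * K)) g (≤-trans (≤-trans (m≤m+n M₂ M₃) (m≤n+m _ M₁)) h)) (proj₂ (f₃ (3 * K)) g (≤-trans (≤-trans (m≤n+m M₃ M₂) (m≤n+m _ M₁)) h)))) (≤-reflexive (m′ (F g))))))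
  where
  M₁ = proj₁ (f₁ (3 * K))
  M₂ = proj₁ (f₂ (3 * K))
  M₃ = proj₁ (f₃ (3 * K))
  T-∨⁻ : ∀ {a b} → T (a ∨ b) → T a ⊎ T b
  T-∨⁻ {true}  t = inj₁ tt
  T-∨⁻ {false} t = inj₂ t
  m : ∀ k x y z → 3 * (k * (x + (y + z))) ≡ 3 * k * x + (3 * k * y + 3 * k * z)
  m = solve-∀
  m′ : ∀ f → f + (f + f) ≡ 3 * f
  m′ = solve-∀

bad-negligible : ∀ D .{{_ : NonZero D}} K → ∃[ M ] (∀ g → M ≤ g → K * count (bad g (cutoff D g)) (𝒮 g) ≤ F g)
bad-negligible D = union-negligible 𝒮 middle huge (λ g → late g (cutoff D g)) middle-negligible huge-negligible (late-negligible D)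

-- Words with given numbers of ones and twos

W : ℕ → ℕ → List (List ℕ)
W zero    zero    = [] ∷ []
W (suc a) zero    = map (1 ∷_) (W a zero)
W zero    (suc b) = map (2 ∷_) (W zero b)
W (suc a) (suc b) = map (1 ∷_) (W a (suc b)) ++ map (2 ∷_) (W (suc a) b)

-- The binomial coefficient of a + b over b, by Pascal's rule.
B : ℕ → ℕ → ℕ
B zero    b       = 1
B (suc a) zero    = 1
B (suc a) (suc b) = B a (suc b) + B (suc a) b

-- Bm ℓ a b counts the words with a ones and b twos in which ℓ prescribed places carry ones.
Bm : ℕ → ℕ → ℕ → ℕ
Bm zero    a       b = B a b
Bm (suc ℓ) zero    b = 0
Bm (suc ℓ) (suc a) b = Bm ℓ a b

ones twos : List ℕ → ℕ
ones = count (_≡ᵇ 1)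
twos = count (_≡ᵇ 2)

W-shape : ∀ a b w → w ∈ W a b → (∀ x → x ∈ w → 1 ≤ x × x ≤ 2) × ones w ≡ a × twos w ≡ b
W-shape zero zero .[] (here refl) = (λ x ()) , refl , refl
W-shape (suc a) zero w i with ∈-map⁻ (1 ∷_) i
... | v , j , refl with W-shape a zero v j
... | h , e₁ , e₂ = (λ { x (here refl) → ≤-refl , s≤s z≤n ; x (there q) → h x q }) , cong suc e₁ , e₂
W-shape zero (suc b) w i with ∈-map⁻ (2 ∷_) i
... | v , j , refl with W-shape zero b v j
... | h , e₁ , e₂ = (λ { x (here refl) → s≤s z≤n , ≤-refl ; x (there q) → h x q }) , e₁ , cong suc e₂
W-shape (suc a) (suc b) w i with ∈-++⁻ (map (1 ∷_) (W a (suc b))) i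
... | inj₁ i′ with ∈-map⁻ (1 ∷_) i′
...   | v , j , refl with W-shape a (suc b) v j
...   | h , e₁ , e₂ = (λ { x (here refl) → ≤-refl , s≤s z≤n ; x (there q) → h x q }) , cong suc e₁ , e₂
W-shape (suc a) (suc b) w i | inj₂ i′ with ∈-map⁻ (2 ∷_) i′
...   | v , j , refl with W-shape (suc a) b v j
...   | h , e₁ , e₂ = (λ { x (here refl) → s≤s z≤n , ≤-refl ; x (there q) → h x q }) , e₁ , cong suc e₂

∈-W : ∀ w → (∀ x → x ∈ w → 1 ≤ x × x ≤ 2) → w ∈ W (ones w) (twos w)
∈-W []      h = here refl
∈-W (x ∷ w) h with h x (here refl) | ∈-W w (λ y i → h y (there i))
∈-W (1 ∷ w) h | _ | i with twos w
... | zero  = ∈-map⁺ (1 ∷_) i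
... | suc b = ∈-++⁺ˡ (∈-map⁺ (1 ∷_) i)
∈-W (2 ∷ w) h | _ | i with ones w
... | zero  = ∈-map⁺ (2 ∷_) i
... | suc a = ∈-++⁺ʳ (map (1 ∷_) (W a (suc (twos w)))) (∈-map⁺ (2 ∷_) i)
∈-W (suc (suc (suc _)) ∷ w) h | _ , s≤s (s≤s ()) | _

sum-ones-twos : ∀ w → (∀ x → x ∈ w → 1 ≤ x × x ≤ 2) → sumL id w ≡ ones w + 2 * twos w × length w ≡ ones w + twos w
sum-ones-twos []      h = refl , refl
sum-ones-twos (x ∷ w) h with h x (here refl) | sum-ones-twos w (λ y i → h y (there i))
sum-ones-twos (1 ∷ w) h | _ | e₁ , e₂ = cong suc e₁ , cong suc e₂
sum-ones-twos (2 ∷ w) h | _ | e₁ , e₂ = trans (cong (2 +_) e₁) (lem (ones w) (twos w)) , trans (cong suc e₂) (sym (+-suc (ones w) (twos w)))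
  where
  lem : ∀ a b → 2 + (a + 2 * b) ≡ a + 2 * suc b
  lem = solve-∀
sum-ones-twos (suc (suc (suc _)) ∷ w) h | _ , s≤s (s≤s ()) | _

W-unique : ∀ a b → Unique (W a b)
W-unique zero    zero    = [] ∷ []
W-unique (suc a) zero    = Uniqueₚ.map⁺ ∷-injectiveʳ (W-unique a zero)
W-unique zero    (suc b) = Uniqueₚ.map⁺ ∷-injectiveʳ (W-unique zero b)
W-unique (suc a) (suc b) = Uniqueₚ.++⁺ (Uniqueₚ.map⁺ ∷-injectiveʳ (W-unique a (suc b))) (Uniqueₚ.map⁺ ∷-injectiveʳ (W-unique (suc a) b)) disjoint
  where
  disjoint : ∀ {w} → ¬ (w ∈ map (1 ∷_) (W a (suc b)) × w ∈ map (2 ∷_) (W (suc a) b))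
  disjoint (i , j) with ∈-map⁻ (1 ∷_) i | ∈-map⁻ (2 ∷_) j
  ... | _ , _ , refl | _ , _ , ()

count-W : ∀ a b → count (λ _ → true) (W a b) ≡ B a b
count-W zero    zero    = refl
count-W (suc a) zero    = trans (sumL-map _ (1 ∷_) (W a zero)) (trans (count-W a zero) (B-zero a))
  where
  B-zero : ∀ a → B a zero ≡ 1
  B-zero zero    = refl
  B-zero (suc a) = refl
count-W zero    (suc b) = trans (sumL-map _ (2 ∷_) (W zero b)) (count-W zero b)
count-W (suc a) (suc b) = trans (sumL-++ _ (map (1 ∷_) (W a (suc b))) _) (cong₂ _+_
  (trans (sumL-map _ (1 ∷_) (W a (suc b))) (count-W a (suc b))) (trans (sumL-map _ (2 ∷_) (W (suc a) b)) (count-W (suc a) b)))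

fits-mask : List Bool → List ℕ → Bool
fits-mask []           w       = true
fits-mask (m ∷ ms)     []      = true
fits-mask (true ∷ ms)  (x ∷ w) = (x ≡ᵇ 1) ∧ fits-mask ms w
fits-mask (false ∷ ms) (x ∷ w) = fits-mask ms w

trues : List Bool → ℕ
trues = count id

trues≤length : ∀ ms → trues ms ≤ length ms
trues≤length []       = z≤n
trues≤length (m ∷ ms) = +-mono-≤ (χ≤1 m) (trues≤length ms)

Bm-pascal : ∀ ℓ a b → Bm ℓ (suc a) (suc b) ≡ Bm ℓ a (suc b) + Bm ℓ (suc a) b
Bm-pascal zero    a       b = refl
Bm-pascal (suc ℓ) (suc a) b = Bm-pascal ℓ a b
Bm-pascal (suc zero)    zero b = refl
Bm-pascal (suc (suc ℓ)) zero b = refl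

Bm-no-ones : ∀ ℓ b → Bm ℓ 0 (suc b) ≡ Bm ℓ 0 b
Bm-no-ones zero    b = refl
Bm-no-ones (suc ℓ) b = refl

Bm-no-twos : ∀ ℓ a → ℓ ≤ a → Bm ℓ (suc a) 0 ≡ Bm ℓ a 0
Bm-no-twos zero    zero    h = refl
Bm-no-twos zero    (suc a) h = refl
Bm-no-twos (suc ℓ) (suc a) h = Bm-no-twos ℓ a (s≤s⁻¹ h)

-- A masked place forces the letter 1 and uses up one prescribed one; an unmasked place is Pascal's
-- rule. Hence only the number of prescribed places matters and not their position, which is why the
-- limit probability is a power.
count-mask : ∀ a b ms → length ms ≡ a + b → count (fits-mask ms) (W a b) ≡ Bm (trues ms) a b
count-mask zero    zero    []           e = refl
count-mask (suc a) zero    (true ∷ ms)  e = trans (sumL-map _ (1 ∷_) (W a zero)) (count-mask a zero ms (suc-injective e))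
count-mask (suc a) zero    (false ∷ ms) e = trans (sumL-map _ (1 ∷_) (W a zero)) (trans (count-mask a zero ms (suc-injective e))
  (sym (Bm-no-twos (trues ms) a (≤-trans (trues≤length ms) (≤-reflexive (trans (suc-injective e) (+-identityʳ a)))))))
count-mask zero    (suc b) (true ∷ ms)  e = trans (sumL-map _ (2 ∷_) (W zero b)) (sumL-zero (W zero b) (λ _ _ → refl))
count-mask zero    (suc b) (false ∷ ms) e = trans (sumL-map _ (2 ∷_) (W zero b)) (trans (count-mask zero b ms (suc-injective e)) (sym (Bm-no-ones (trues ms) b)))
count-mask (suc a) (suc b) (true ∷ ms)  e = trans (sumL-++ _ (map (1 ∷_) (W a (suc b))) _) (trans (cong₂ _+_
  (trans (sumL-map _ (1 ∷_) (W a (suc b))) (count-mask a (suc b) ms (suc-injective e)))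
  (trans (sumL-map _ (2 ∷_) (W (suc a) b)) (sumL-zero (W (suc a) b) (λ _ _ → refl)))) (+-identityʳ _))
count-mask (suc a) (suc b) (false ∷ ms) e = trans (sumL-++ _ (map (1 ∷_) (W a (suc b))) _) (trans (cong₂ _+_
  (trans (sumL-map _ (1 ∷_) (W a (suc b))) (count-mask a (suc b) ms (suc-injective e)))
  (trans (sumL-map _ (2 ∷_) (W (suc a) b)) (count-mask (suc a) b ms (trans (suc-injective e) (+-suc a b))))) (sym (Bm-pascal (trues ms) a b)))

eqL : List ℕ → List ℕ → Bool
eqL []      []      = true
eqL []      (_ ∷ _) = false
eqL (_ ∷ _) []      = false
eqL (x ∷ u) (y ∷ v) = (x ≡ᵇ y) ∧ eqL u v

eqL-sound : ∀ u v → T (eqL u v) → u ≡ v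
eqL-sound []      []      t = refl
eqL-sound (x ∷ u) (y ∷ v) t = cong₂ _∷_ (≡ᵇ⇒≡ x y (proj₁ (T-∧⁻ t))) (eqL-sound u v (proj₂ (T-∧⁻ {x ≡ᵇ y} t)))

eqL-refl : ∀ u → T (eqL u u)
eqL-refl []      = tt
eqL-refl (x ∷ u) = T-∧⁺ {x ≡ᵇ x} (≡⇒≡ᵇ x x refl) (eqL-refl u)

χ-∧ : ∀ a b → χ (a ∧ b) ≡ χ a * χ b
χ-∧ true  b = sym (+-identityʳ _)
χ-∧ false b = refl

count-eqL : ∀ as u → (∀ x → x ∈ u → count (x ≡ᵇ_) as ≡ 1) → count (eqL u) (listsOver as (length u)) ≡ 1
count-eqL as []      h = refl
count-eqL as (x ∷ u) h = trans (sumL-concatMap _ _ (listsOver as (length u)))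
  (trans (sumL-cong (listsOver as (length u)) (λ w _ → trans (sumL-map _ (_∷ w) as) (trans (sumL-cong as (λ a _ → χ-∧ (x ≡ᵇ a) (eqL u w)))
      (trans (sumL-*ʳ (χ (eqL u w)) _ as) (trans (cong (_* χ (eqL u w)) (h x (here refl))) (+-identityʳ _))))))
    (count-eqL as u (λ y i → h y (there i))))

count-witness : ∀ {A : Set} (p : A → Bool) xs → 0 < count p xs → ∃[ x ] (x ∈ xs × T (p x))
count-witness p (x ∷ xs) h with p x in e
... | true  = x , here refl , ≡⇒T e
... | false with count-witness p xs h
... | y , i , t = y , there i , t

nth : List ℕ → ℕ → ℕ
nth []      i       = 0
nth (x ∷ v) zero    = x
nth (x ∷ v) (suc i) = nth v i

nth-∈ : ∀ v i → i < length v → nth v i ∈ v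
nth-∈ (x ∷ v) zero    l = here refl
nth-∈ (x ∷ v) (suc i) l = there (nth-∈ v i (s≤s⁻¹ l))

nth-++ˡ : ∀ u v i → i < length u → nth (u ++ v) i ≡ nth u i
nth-++ˡ (x ∷ u) v zero    l = refl
nth-++ˡ (x ∷ u) v (suc i) l = nth-++ˡ u v i (s≤s⁻¹ l)

nth-++ʳ : ∀ u v i → nth (u ++ v) (length u + i) ≡ nth v i
nth-++ʳ []      v i = refl
nth-++ʳ (x ∷ u) v i = nth-++ʳ u v i

nth-applyUpTo : ∀ f n i → i < n → nth (applyUpTo f n) i ≡ f i
nth-applyUpTo f (suc n) zero    l = refl
nth-applyUpTo f (suc n) (suc i) l = nth-applyUpTo (f ∘ suc) n i (s≤s⁻¹ l)

applyUpTo-nth : ∀ v (f : ℕ → ℕ) → (∀ i → i < length v → f i ≡ nth v i) → applyUpTo f (length v) ≡ v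
applyUpTo-nth []      f h = refl
applyUpTo-nth (x ∷ v) f h = cong₂ _∷_ (h 0 (s≤s z≤n)) (applyUpTo-nth v (f ∘ suc) (λ i l → h (suc i) (s≤s l)))

∑-nth : ∀ v → ∑ (length v) (nth v) ≡ sumL id v
∑-nth []      = refl
∑-nth (x ∷ v) = trans (∑-head (length v) (nth (x ∷ v))) (cong (x +_) (∑-nth v))

-- Good semigroups, sorted by initial pattern and number of twos

module Blocks (g k₀ : ℕ) (3k₀<g : 3 * k₀ < g) where

  good : List Bool → Bool
  good gs = not (bad g k₀ gs)

  pattern# tail# : List Bool → List ℕ
  pattern# gs = applyUpTo (λ i → kunz# g gs (suc i)) k₀
  tail# gs = applyUpTo (λ i → kunz# g gs (suc (k₀ + i))) (mult# g gs ∸ suc k₀)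

  record Good (gs : List Bool) : Set where
    field
      ≤3  : ∀ i → i < mult# g gs → kunz# g gs i ≤ 3
      ≤2  : ∀ i → k₀ < i → i < mult# g gs → kunz# g gs i ≤ 2
      k₀< : k₀ < mult# g gs

  -- A coordinate 3 beyond k₀ would make 3 the maximum, attained for the last time beyond k₀, so the
  -- semigroup would be `late`. That k₀ is below the multiplicity m follows from 3 k₀ < g ≤ 3 m.
  good-sound : ∀ gs → gs ∈ 𝒮 g → T (good gs) → Good gs
  good-sound gs i t = record { ≤3 = b3 ; ≤2 = b2 ; k₀< = ≰⇒> λ h → <⇒≱ 3k₀<g (≤-trans (≤-reflexive (sym (∑k-of g gs i))) (≤-trans (∑-bound m 3 b3) (≤-trans (≤-reflexive (*-comm m 3)) (*-monoʳ-≤ 3 h)))) }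
    where
    m = mult# g gs
    k = kunz# g gs
    or⁻ : ∀ {a b} → T (not (a ∨ b)) → a ≡ false × b ≡ false
    or⁻ {false} {false} _ = refl , refl
    nm : middle g gs ≡ false
    nm = proj₁ (or⁻ t)
    nhl : huge g gs ≡ false × late g k₀ gs ≡ false
    nhl = or⁻ (not-T⁺ (proj₂ (or⁻ {middle g gs} t)))
    absurd : true ≡ false → ⊥
    absurd ()
    peak≤3 : peak# g gs ≤ 3
    peak≤3 = ≮⇒≥ λ h → absurd (trans (sym (T⇒≡ (T-∧⁺ {3 <ᵇ peak# g gs} (<⇒<ᵇ h) (<⇒<ᵇ {peak# g gs} {12} (s≤s peak≤11))))) nm)
      where
      peak≤11 : peak# g gs ≤ 11
      peak≤11 = ≮⇒≥ λ h → absurd (trans (sym (<ᵇ-true {11} {peak# g gs} h)) (proj₁ nhl))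
    b3 : ∀ i → i < m → k i ≤ 3
    b3 i l = ≤-trans (maxBelow-≥ k m i l) peak≤3
    b2 : ∀ i → k₀ < i → i < m → k i ≤ 2
    b2 i p l with m≤n⇒m<n∨m≡n (b3 i l)
    ... | inj₁ h = s≤s⁻¹ h
    ... | inj₂ e = ⊥-elim (absurd (trans (sym (T⇒≡ (T-∧⁺ {peak# g gs ≡ᵇ 3} (≡⇒≡ᵇ _ 3 pk) (<⇒<ᵇ (≤-trans p after))))) (proj₂ nhl)))
      where
      pk : peak# g gs ≡ 3
      pk = ≤-antisym peak≤3 (subst (_≤ peak# g gs) e (maxBelow-≥ k m i l))
      hit : (k i ≡ᵇ peak# g gs) ≡ true
      hit = T⇒≡ (≡⇒≡ᵇ (k i) _ (trans e (sym pk)))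
      after : i ≤ last# g gs
      after = ≮⇒≥ λ h → absurd (trans (sym hit) (proj₂ (proj₂ (lastBelow-spec (λ j → k j ≡ᵇ peak# g gs) m i l hit)) i h l))

  good-complete : ∀ gs → gs ∈ 𝒮 g → Good gs → T (good gs)
  good-complete gs i G = not-T⁺ (or⁺ (¬T⇒≡ λ t → <⇒≱ (<ᵇ⇒< 3 _ (proj₁ (T-∧⁻ {3 <ᵇ peak# g gs} t))) peak≤3)
      (or⁺ (<ᵇ-false {11} (≤-trans peak≤3 (s≤s (s≤s (s≤s z≤n))))) (¬T⇒≡ λ t → lateness (T-∧⁻ {peak# g gs ≡ᵇ 3} t))))
    where
    open Good G
    m = mult# g gs
    k = kunz# g gs
    or⁺ : ∀ {a b} → a ≡ false → b ≡ false → a ∨ b ≡ false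
    or⁺ refl refl = refl
    bounded-max : ∀ n → n ≤ m → maxBelow k n ≤ 3
    bounded-max zero    _ = z≤n
    bounded-max (suc n) l = ⊔-lub (bounded-max n (<⇒≤ l)) (≤3 n l)
    peak≤3 : peak# g gs ≤ 3
    peak≤3 = bounded-max m ≤-refl
    lateness : T (peak# g gs ≡ᵇ 3) × T (k₀ <ᵇ last# g gs) → ⊥
    lateness (t₁ , t₂) = <⇒≱ (s≤s (s≤s (s≤s z≤n))) (subst (_≤ 2) (trans (Shape.peak sh) e3) (≤2 (last# g gs) (<ᵇ⇒< k₀ _ t₂) (Shape.a<m sh)))
      where
      e3 = ≡ᵇ⇒≡ (peak# g gs) 3 t₁
      sh = shape (proj₂ (𝒮⇒semigroup g gs i)) (≤-trans (s≤s (s≤s z≤n)) (≤-reflexive (sym e3)))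

  block : List ℕ → ℕ → List Bool → Bool
  block P b gs = good gs ∧ (eqL (pattern# gs) P ∧ (twos (tail# gs) ≡ᵇ b))

  tail-length : ∀ gs → length (tail# gs) ≡ mult# g gs ∸ suc k₀
  tail-length gs = length-applyUpTo _ (mult# g gs ∸ suc k₀)

  tail-index : ∀ {gs} → Good gs → ∀ {i} → i < mult# g gs ∸ suc k₀ → suc (k₀ + i) < mult# g gs
  tail-index {gs} G {i} l = ≤-trans (s≤s (s≤s (≤-reflexive (+-comm k₀ i)))) (≤-trans (s≤s (+-monoˡ-≤ k₀ l)) (≤-reflexive
    (trans (sym (+-suc (mult# g gs ∸ suc k₀) k₀)) (m∸n+n≡m (Good.k₀< G)))))

  tail-entries : ∀ gs → gs ∈ 𝒮 g → Good gs → ∀ x → x ∈ tail# gs → 1 ≤ x × x ≤ 2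
  tail-entries gs i G x j with ∈-applyUpTo _ (mult# g gs ∸ suc k₀) x j
  ... | r , l , refl = IsKunz.pos (isKunz (proj₂ (𝒮⇒semigroup g gs i))) _ (s≤s z≤n) (tail-index G l) , Good.≤2 G _ (s≤s (m≤m+n k₀ r)) (tail-index G l)

  pattern-entries : ∀ gs → gs ∈ 𝒮 g → Good gs → ∀ x → x ∈ pattern# gs → 1 ≤ x × x ≤ 3
  pattern-entries gs i G x j with ∈-applyUpTo _ k₀ x j
  ... | r , l , refl = IsKunz.pos (isKunz (proj₂ (𝒮⇒semigroup g gs i))) _ (s≤s z≤n) (≤-<-trans l (Good.k₀< G)) , Good.≤3 G _ (≤-<-trans l (Good.k₀< G))

  split-sum : ∀ gs → gs ∈ 𝒮 g → Good gs → sumL id (pattern# gs) + sumL id (tail# gs) ≡ g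
  split-sum gs i G = trans (cong₂ _+_ (sumL-applyUpTo id _ k₀) (sumL-applyUpTo id _ r))
    (trans (cong (_+ ∑ r (λ i → k (suc (k₀ + i)))) (trans (cong (_+ ∑ k₀ (k ∘ suc)) (sym (IsKunz.k₀ (isKunz (proj₂ (𝒮⇒semigroup g gs i)))))) (sym (∑-head k₀ k))))
    (trans (sym (∑-split (suc k₀) r k)) (trans (cong (λ x → ∑ x k) (m+[n∸m]≡n (Good.k₀< G))) (∑k-of g gs i))))
    where
    k = kunz# g gs
    r = mult# g gs ∸ suc k₀

  patterns : List (List ℕ)
  patterns = listsOver (1 ∷ 2 ∷ 3 ∷ []) k₀

  private
    small-count : ∀ x → 1 ≤ x × x ≤ 3 → count (x ≡ᵇ_) (1 ∷ 2 ∷ 3 ∷ []) ≡ 1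
    small-count 1 _ = refl
    small-count 2 _ = refl
    small-count 3 _ = refl
    small-count (suc (suc (suc (suc _)))) (_ , s≤s (s≤s (s≤s ())))

  pattern-once : ∀ gs → gs ∈ 𝒮 g → Good gs → count (eqL (pattern# gs)) patterns ≡ 1
  pattern-once gs i G = subst (λ n → count (eqL (pattern# gs)) (listsOver (1 ∷ 2 ∷ 3 ∷ []) n) ≡ 1) (length-applyUpTo _ k₀)
    (count-eqL (1 ∷ 2 ∷ 3 ∷ []) (pattern# gs) (λ x j → small-count x (pattern-entries gs i G x j)))

  twos-≤ : ∀ gs → gs ∈ 𝒮 g → Good gs → 2 * twos (tail# gs) ≤ g ∸ sumL id (pattern# gs)
  twos-≤ gs i G = ≤-trans (m≤n+m _ (ones (tail# gs))) (≤-reflexive (trans (sym (proj₁ (sum-ones-twos (tail# gs) (tail-entries gs i G))))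
    (trans (sym (m+n∸m≡n (sumL id (pattern# gs)) _)) (cong (_∸ sumL id (pattern# gs)) (split-sum gs i G)))))

  count-blocks : ∀ (r : List Bool → Bool) → count (λ gs → good gs ∧ r gs) (𝒮 g) ≡
    sumL (λ P → ∑ (suc g) (λ b → count (λ gs → block P b gs ∧ r gs) (𝒮 g))) patterns
  count-blocks r = trans (count-split (λ gs → good gs ∧ r gs) (λ gs P → eqL (pattern# gs) P) (𝒮 g) patterns
      (λ gs i t → pattern-once gs i (good-sound gs i (proj₁ (T-∧⁻ t)))))
    (sumL-cong patterns λ P _ → trans (sumL-cong (𝒮 g) (inner P)) (sumL-∑ (suc g) _ (𝒮 g)))
    where
    regroup : ∀ a e t r → χ ((a ∧ (e ∧ t)) ∧ r) ≡ χ ((a ∧ r) ∧ e) * χ t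
    regroup false e     t r     = refl
    regroup true  false t false = refl
    regroup true  false t true  = refl
    regroup true  true  t false = cong χ (Data.Bool.Properties.∧-zeroʳ t)
    regroup true  true  t true  = trans (cong χ (Data.Bool.Properties.∧-identityʳ t)) (sym (+-identityʳ _))
    inner : ∀ P gs → gs ∈ 𝒮 g → χ ((good gs ∧ r gs) ∧ eqL (pattern# gs) P) ≡ ∑ (suc g) (λ b → χ (block P b gs ∧ r gs))
    inner P gs i = sym (trans (∑-cong (suc g) (λ b _ → regroup (good gs) (eqL (pattern# gs) P) (twos (tail# gs) ≡ᵇ b) (r gs)))
      (trans (∑-*ˡ (suc g) (χ ((good gs ∧ r gs) ∧ eqL (pattern# gs) P)) _) once))
      where
      once : χ ((good gs ∧ r gs) ∧ eqL (pattern# gs) P) * ∑ (suc g) (λ b → χ (twos (tail# gs) ≡ᵇ b)) ≡ χ ((good gs ∧ r gs) ∧ eqL (pattern# gs) P)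
      once with good gs in e
      ... | false = refl
      ... | true  = trans (cong (χ (r gs ∧ eqL (pattern# gs) P) *_) (∑-≡ᵇ (suc g) (twos (tail# gs)) (s≤s
          (≤-trans (m≤n*m (twos (tail# gs)) 2) (≤-trans (twos-≤ gs i (good-sound gs i (≡⇒T e))) (m∸n≤m g (sumL id (pattern# gs)))))))) (*-identityʳ _)
        where
        ∑-≡ᵇ : ∀ n k → k < n → ∑ n (λ j → χ (k ≡ᵇ j)) ≡ 1
        ∑-≡ᵇ (suc n) k l with m≤n⇒m<n∨m≡n (s≤s⁻¹ l)
        ... | inj₁ h = cong₂ _+_ (∑-≡ᵇ n k h) (cong χ (¬T⇒≡ (λ t → <⇒≢ h (≡ᵇ⇒≡ k n t))))
        ... | inj₂ refl = cong₂ _+_ (∑-zero n (λ j l → cong χ (¬T⇒≡ (λ t → <⇒≢ l (sym (≡ᵇ⇒≡ k j t)))))) (cong χ (T⇒≡ (≡⇒≡ᵇ k k refl)))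

  -- given one good semigroup with pattern P, every completion of P by ones and twos is admissible

  module Block (gs₀ : List Bool) (i₀ : gs₀ ∈ 𝒮 g) (G₀ : Good gs₀) where

    P = pattern# gs₀
    n = g ∸ sumL id P

    block-sound : ∀ b gs → gs ∈ 𝒮 g → T (block P b gs) → Good gs × pattern# gs ≡ P × twos (tail# gs) ≡ b
    block-sound b gs i t =
      let tg , t′ = T-∧⁻ {good gs} t
          tp , tb = T-∧⁻ {eqL (pattern# gs) P} t′
      in good-sound gs i tg , eqL-sound _ P tp , ≡ᵇ⇒≡ _ b tb

    tail-ones : ∀ b gs → gs ∈ 𝒮 g → T (block P b gs) → ones (tail# gs) ≡ n ∸ 2 * b
    tail-ones b gs i t with block-sound b gs i t
    ... | G , eP , refl = sym (trans (cong (_∸ 2 * twos w) n≡) (m+n∸n≡m (ones w) (2 * twos w)))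
      where
      w = tail# gs
      n≡ : n ≡ ones w + 2 * twos w
      n≡ = trans (cong₂ _∸_ (sym (split-sum gs i G)) (cong (sumL id) (sym eP))) (trans (m+n∸m≡n (sumL id (pattern# gs)) (sumL id w)) (proj₁ (sum-ones-twos w (tail-entries gs i G))))

    private
      module Completion (b : ℕ) (2b≤n : 2 * b ≤ n) (w : List ℕ) (w∈ : w ∈ W (n ∸ 2 * b) b) where
        v = P ++ w
        m = suc (length v)
        P-length : length P ≡ k₀
        P-length = length-applyUpTo _ k₀

        k : ℕ → ℕ
        k zero    = 0
        k (suc i) = nth v i

        w-entries = proj₁ (W-shape (n ∸ 2 * b) b w w∈)

        k-low : ∀ i → i ≤ k₀ → k i ≡ kunz# g gs₀ i
        k-low zero    l = sym (IsKunz.k₀ (isKunz (proj₂ (𝒮⇒semigroup g gs₀ i₀))))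
        k-low (suc i) l = trans (nth-++ˡ P w i (subst (i <_) (sym P-length) l)) (nth-applyUpTo _ k₀ i l)

        k-high : ∀ i → k (suc (k₀ + i)) ≡ nth w i
        k-high i = trans (cong (λ x → nth v (x + i)) (sym P-length)) (nth-++ʳ P w i)

        length-v : length v ≡ k₀ + length w
        length-v = trans (length-++ P) (cong (_+ length w) P-length)

        above : ∀ i → k₀ < i → i < m → 1 ≤ k i × k i ≤ 2
        above i p l = subst (λ x → 1 ≤ k x × k x ≤ 2) (m+[n∸m]≡n p)
          (subst (λ x → 1 ≤ x × x ≤ 2) (sym (k-high (i ∸ suc k₀))) (w-entries _ (nth-∈ w (i ∸ suc k₀)
            (+-cancelˡ-< (suc k₀) _ _ (subst₂ _<_ (sym (m+[n∸m]≡n p)) (cong suc length-v) l)))))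

        range : ∀ i → 0 < i → i < m → 1 ≤ k i × k i ≤ 3
        range i p l with i ≤? k₀
        ... | no h  = proj₁ (above i (≰⇒> h) l) , ≤-trans (proj₂ (above i (≰⇒> h) l)) (s≤s (s≤s z≤n))
        ... | yes h = subst (λ x → 1 ≤ x × x ≤ 3) (sym (k-low i h))
            (IsKunz.pos (isKunz (proj₂ (𝒮⇒semigroup g gs₀ i₀))) i p (≤-<-trans h (Good.k₀< G₀)) , Good.≤3 G₀ i (≤-<-trans h (Good.k₀< G₀)))

        -- If i + j ≤ k₀, all three coordinates are those of the given semigroup. If i + j > k₀, the
        -- left side is at most 2 and the right side at least 1 + 1.
        sub : ∀ i j → i + j < m → k (i + j) ≤ k i + k j
        sub zero    j l = ≤-refl
        sub (suc i) zero l = ≤-trans (≤-reflexive (cong k (+-identityʳ (suc i)))) (m≤m+n _ _)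
        sub (suc i) (suc j) l with suc i + suc j ≤? k₀
        ... | no h  = ≤-trans (proj₂ (above _ (≰⇒> h) l)) (+-mono-≤ (proj₁ (range (suc i) (s≤s z≤n) (≤-<-trans (m≤m+n _ _) l)))
                        (proj₁ (range (suc j) (s≤s z≤n) (≤-<-trans (m≤n+m (suc j) (suc i)) l))))
        ... | yes h = subst₂ _≤_ (sym (k-low _ h)) (cong₂ _+_ (sym (k-low (suc i) (≤-trans (m≤m+n _ _) h))) (sym (k-low (suc j) (≤-trans (m≤n+m (suc j) (suc i)) h))))
                        (KunzProps.subadditive (proj₂ (𝒮⇒semigroup g gs₀ i₀)) (isKunz (proj₂ (𝒮⇒semigroup g gs₀ i₀))) (suc i) (suc j) (≤-<-trans h (Good.k₀< G₀)))

        σ≤g : sumL id P ≤ g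
        σ≤g = ≤-trans (m≤m+n _ _) (≤-reflexive (split-sum gs₀ i₀ G₀))

        total : ∑ m k ≡ g
        total = trans (∑-head (length v) k) (trans (∑-nth v) (trans (sumL-++ id P w) (trans (cong (sumL id P +_) w-sum) (m+[n∸m]≡n σ≤g))))
          where
          w-sum : sumL id w ≡ n
          w-sum = trans (proj₁ (sum-ones-twos w w-entries)) (trans (cong₂ (λ x y → x + 2 * y) (proj₁ (proj₂ (W-shape (n ∸ 2 * b) b w w∈))) (proj₂ (proj₂ (W-shape (n ∸ 2 * b) b w w∈)))) (m∸n+n≡m 2b≤n))

        coordinates : Coordinates g m k
        coordinates = record
          { m>0 = s≤s z≤n ; k₀ = refl ; pos = λ i p l → proj₁ (range i p l)
          ; ≤3 = λ { zero _ → z≤n ; (suc i) l → proj₂ (range (suc i) (s≤s z≤n) l) } ; sub = sub ; tot = total }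

        gs = decode coordinates
        gs∈ = decode∈𝒮 coordinates
        K = decode-kunz coordinates
        K′ = isKunz (proj₂ (𝒮⇒semigroup g gs gs∈))
        m≡ : mult# g gs ≡ m
        m≡ = kunz-unique-m K′ K
        k≡ : ∀ i → i < m → kunz# g gs i ≡ k i
        k≡ i l = kunz-unique-k K′ K i (subst (i <_) (sym m≡) l)

        k₀<m : k₀ < m
        k₀<m = s≤s (≤-trans (m≤m+n k₀ _) (≤-reflexive (sym length-v)))

        G : Good gs
        G = record
          { ≤3 = λ { zero l → ≤-trans (≤-reflexive (k≡ 0 (s≤s z≤n))) z≤n ; (suc i) l → ≤-trans (≤-reflexive (k≡ (suc i) (subst (suc i <_) m≡ l))) (proj₂ (range (suc i) (s≤s z≤n) (subst (suc i <_) m≡ l))) }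
          ; ≤2 = λ i p l → ≤-trans (≤-reflexive (k≡ i (subst (i <_) m≡ l))) (proj₂ (above i p (subst (i <_) m≡ l)))
          ; k₀< = subst (k₀ <_) (sym m≡) k₀<m }

        pattern≡ : pattern# gs ≡ P
        pattern≡ = trans (cong (applyUpTo _) (sym P-length)) (applyUpTo-nth P _ λ i l →
          trans (k≡ (suc i) (≤-trans (s≤s (subst (i <_) P-length l)) k₀<m)) (nth-++ˡ P w i l))

        tail≡ : tail# gs ≡ w
        tail≡ = trans (cong (applyUpTo _) (trans (cong (_∸ suc k₀) m≡) (trans (cong (_∸ k₀) length-v) (m+n∸m≡n k₀ (length w)))))
          (applyUpTo-nth w _ λ i l → trans (k≡ (suc (k₀ + i)) (s≤s (≤-trans (+-monoʳ-< k₀ l) (≤-reflexive (sym length-v))))) (k-high i))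

        in-block : T (block P b gs)
        in-block = T-∧⁺ {good gs} (good-complete gs gs∈ G) (T-∧⁺ {eqL (pattern# gs) P} (subst (λ x → T (eqL x P)) (sym pattern≡) (eqL-refl P))
          (≡⇒≡ᵇ (twos (tail# gs)) b (trans (cong twos tail≡) (proj₂ (proj₂ (W-shape (n ∸ 2 * b) b w w∈))))))

    block-empty : ∀ b → n < 2 * b → ∀ (r : List Bool → Bool) → count (λ gs → block P b gs ∧ r gs) (𝒮 g) ≡ 0
    block-empty b h r = sumL-zero (𝒮 g) λ gs i → cong χ (¬T⇒≡ {block P b gs ∧ r gs} λ t → contra gs i (proj₁ (T-∧⁻ {block P b gs} t)))
      where
      contra : ∀ gs → gs ∈ 𝒮 g → T (block P b gs) → ⊥
      contra gs i t with block-sound b gs i t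
      ... | G , eP , refl = <⇒≱ h (subst (λ Q → 2 * twos (tail# gs) ≤ g ∸ sumL id Q) eP (twos-≤ gs i G))

    -- Two injections: pattern and tail determine the semigroup, and every word with b twos and the
    -- right sum is the tail of a `Completion`.
    block-count : ∀ b → 2 * b ≤ n → ∀ (p : List Bool → Bool) (r : List ℕ → Bool) →
      (∀ gs → gs ∈ 𝒮 g → T (block P b gs) → p gs ≡ r (tail# gs)) →
      count (λ gs → block P b gs ∧ p gs) (𝒮 g) ≡ count r (W (n ∸ 2 * b) b)
    block-count b 2b≤n p r pr = ≤-antisym
      (count-inj (λ gs → block P b gs ∧ p gs) r tail# (𝒮 g) (W (n ∸ 2 * b) b) (𝒮-unique g) forth forth-inj)
      (reverse-count (W (n ∸ 2 * b) b) (W-unique (n ∸ 2 * b) b) (λ w i → i))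
      where
      forth : ∀ gs → gs ∈ 𝒮 g → T (block P b gs ∧ p gs) → tail# gs ∈ W (n ∸ 2 * b) b × T (r (tail# gs))
      forth gs i t =
        let tb , tp = T-∧⁻ {block P b gs} t
            G , eP , eb = block-sound b gs i tb
        in subst₂ (λ x y → tail# gs ∈ W x y) (tail-ones b gs i tb) eb (∈-W (tail# gs) (tail-entries gs i G))
         , subst T (pr gs i tb) tp
      forth-inj : ∀ gs gs′ → gs ∈ 𝒮 g → gs′ ∈ 𝒮 g → T (block P b gs ∧ p gs) → T (block P b gs′ ∧ p gs′) → tail# gs ≡ tail# gs′ → gs ≡ gs′
      forth-inj gs gs′ i i′ t t′ e = semigroup-determined g gs gs′ i i′ em same
        where
        G = block-sound b gs i (proj₁ (T-∧⁻ {block P b gs} t))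
        G′ = block-sound b gs′ i′ (proj₁ (T-∧⁻ {block P b gs′} t′))
        er : mult# g gs ∸ suc k₀ ≡ mult# g gs′ ∸ suc k₀
        er = trans (sym (tail-length gs)) (trans (cong length e) (tail-length gs′))
        em : mult# g gs ≡ mult# g gs′
        em = trans (sym (m+[n∸m]≡n (Good.k₀< (proj₁ G)))) (trans (cong (suc k₀ +_) er) (m+[n∸m]≡n (Good.k₀< (proj₁ G′))))
        same : ∀ j → 0 < j → j < mult# g gs → kunz# g gs j ≡ kunz# g gs′ j
        same (suc j) _ l with suc j ≤? k₀
        ... | yes h = applyUpTo-injective _ _ k₀ (trans (proj₁ (proj₂ G)) (sym (proj₁ (proj₂ G′)))) j h
        ... | no ¬h = subst (λ x → kunz# g gs (suc x) ≡ kunz# g gs′ (suc x)) (m+[n∸m]≡n (s≤s⁻¹ (≰⇒> ¬h)))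
              (applyUpTo-injective _ _ (mult# g gs ∸ suc k₀) (trans e (cong (applyUpTo _) (sym er))) (j ∸ k₀) (∸-monoˡ-< {suc j} {suc k₀} {mult# g gs} l (≰⇒> ¬h)))
      -- decode needs the membership proof of the word, so the reverse injection is built along the list of words
      reverse-count : ∀ ws → Unique ws → (∀ w → w ∈ ws → w ∈ W (n ∸ 2 * b) b) → count r ws ≤ count (λ gs → block P b gs ∧ p gs) (𝒮 g)
      reverse-count ws u mem = ≤-trans (≤-reflexive (sym (sumL-tails r ws mem)))
        (≤-trans (count-inj (λ gs → r (tail# gs)) (λ gs → block P b gs ∧ p gs) id (decodes ws mem) (𝒮 g) (decodes-unique ws mem u)
          (λ gs i t → decodes-good ws mem gs i t) (λ _ _ _ _ _ _ e → e)) ≤-refl)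
        where
        decodes : ∀ ws → (∀ w → w ∈ ws → w ∈ W (n ∸ 2 * b) b) → List (List Bool)
        decodes []       mem = []
        decodes (w ∷ ws) mem = Completion.gs b 2b≤n w (mem w (here refl)) ∷ decodes ws (λ v i → mem v (there i))
        sumL-tails : ∀ r ws mem → count (λ gs → r (tail# gs)) (decodes ws mem) ≡ count r ws
        sumL-tails r []       mem = refl
        sumL-tails r (w ∷ ws) mem = cong₂ _+_ (cong (χ ∘ r) (Completion.tail≡ b 2b≤n w (mem w (here refl)))) (sumL-tails r ws _)
        decodes-good : ∀ ws mem gs → gs ∈ decodes ws mem → T (r (tail# gs)) → gs ∈ 𝒮 g × T (block P b gs ∧ p gs)
        decodes-good (w ∷ ws) mem gs (here refl) t = C.gs∈ , T-∧⁺ {block P b C.gs} C.in-block (subst T (sym (pr C.gs C.gs∈ C.in-block)) t)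
          where module C = Completion b 2b≤n w (mem w (here refl))
        decodes-good (w ∷ ws) mem gs (there i) t = decodes-good ws _ gs i t
        decodes-tail : ∀ ws mem gs → gs ∈ decodes ws mem → tail# gs ∈ ws
        decodes-tail (w ∷ ws) mem gs (here refl) = here (Completion.tail≡ b 2b≤n w (mem w (here refl)))
        decodes-tail (w ∷ ws) mem gs (there i) = there (decodes-tail ws _ gs i)
        decodes-unique : ∀ ws mem → Unique ws → Unique (decodes ws mem)
        decodes-unique []       mem []      = []
        decodes-unique (w ∷ ws) mem (f ∷ u) = All.tabulate (λ {gs} i e → All.lookup f (subst (λ x → tail# x ∈ ws) (sym e) (decodes-tail ws _ gs i)) (sym (Completion.tail≡ b 2b≤n w (mem w (here refl)))))
          ∷ decodes-unique ws _ u

-- Concentration of the number of twos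

B-zero : ∀ a → B a 0 ≡ 1
B-zero zero    = refl
B-zero (suc a) = refl

mutual
  B-more-ones : ∀ a b → suc a * B (suc a) b ≡ suc (a + b) * B a b
  B-more-ones a zero    = cong₂ _*_ (cong suc (sym (+-identityʳ a))) (sym (B-zero a))
  B-more-ones a (suc b) = begin
    suc a * (B a (suc b) + B (suc a) b)            ≡⟨ *-distribˡ-+ (suc a) (B a (suc b)) _ ⟩
    suc a * B a (suc b) + suc a * B (suc a) b      ≡⟨ cong (suc a * B a (suc b) +_) (trans (B-more-ones a b) (sym (B-more-twos a b))) ⟩
    suc a * B a (suc b) + suc b * B a (suc b)      ≡⟨ lem a b (B a (suc b)) ⟩
    suc (a + suc b) * B a (suc b)                  ∎
    where
    open ≡-Reasoning
    lem : ∀ a b x → suc a * x + suc b * x ≡ suc (a + suc b) * x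
    lem = solve-∀

  B-more-twos : ∀ a b → suc b * B a (suc b) ≡ suc (a + b) * B a b
  B-more-twos zero    b = refl
  B-more-twos (suc a) b = begin
    suc b * (B a (suc b) + B (suc a) b)            ≡⟨ *-distribˡ-+ (suc b) (B a (suc b)) _ ⟩
    suc b * B a (suc b) + suc b * B (suc a) b      ≡⟨ cong (_+ suc b * B (suc a) b) (trans (B-more-twos a b) (sym (B-more-ones a b))) ⟩
    suc a * B (suc a) b + suc b * B (suc a) b      ≡⟨ lem a b (B (suc a) b) ⟩
    suc (suc a + b) * B (suc a) b                  ∎
    where
    open ≡-Reasoning
    lem : ∀ a b x → suc a * x + suc b * x ≡ suc (suc a + b) * x
    lem = solve-∀

-- Trading a two for two ones keeps the sum of the word. With x = a / b the quotient of the two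
-- counts is close to 1/x + 1/x², which is 1 exactly at x = φ; so the counts increase towards this
-- ratio from both sides.
B-trade : ∀ a b → (2 + a) * (1 + a) * B (2 + a) b ≡ (2 + (a + b)) * (1 + b) * B a (suc b)
B-trade a b = begin
  (2 + a) * (1 + a) * B (2 + a) b                ≡⟨ l₁ (2 + a) (1 + a) (B (2 + a) b) ⟩
  (1 + a) * ((2 + a) * B (2 + a) b)              ≡⟨ cong ((1 + a) *_) (B-more-ones (suc a) b) ⟩
  (1 + a) * ((2 + (a + b)) * B (suc a) b)        ≡⟨ l₂ (1 + a) (2 + (a + b)) (B (suc a) b) ⟩
  (2 + (a + b)) * ((1 + a) * B (suc a) b)        ≡⟨ cong ((2 + (a + b)) *_) (trans (B-more-ones a b) (sym (B-more-twos a b))) ⟩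
  (2 + (a + b)) * ((1 + b) * B a (suc b))        ≡⟨ sym (*-assoc (2 + (a + b)) (1 + b) _) ⟩
  (2 + (a + b)) * (1 + b) * B a (suc b)          ∎
  where
  open ≡-Reasoning
  l₁ : ∀ x y z → x * y * z ≡ y * (x * z)
  l₁ = solve-∀
  l₂ : ∀ x y z → x * (y * z) ≡ y * (x * z)
  l₂ = solve-∀

trade-≤ : ∀ x y c d α β → 0 < c → c * x ≡ d * y → α * d ≤ β * c → α * x ≤ β * y
trade-≤ x y c d α β c>0 e h = cancel*ˡ c c>0 (begin
  c * (α * x)     ≡⟨ l c α x ⟩
  α * (c * x)     ≡⟨ cong (α *_) e ⟩
  α * (d * y)     ≡⟨ sym (*-assoc α d y) ⟩
  α * d * y       ≤⟨ *-monoˡ-≤ y h ⟩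
  β * c * y       ≡⟨ l′ β c y ⟩
  c * (β * y)     ∎)
  where
  open ≤-Reasoning
  l : ∀ c a x → c * (a * x) ≡ a * (c * x)
  l = solve-∀
  l′ : ∀ b c y → b * c * y ≡ c * (b * y)
  l′ = solve-∀

module _ (u v : ℕ) where

  too-many-ones : ∀ a b → u * suc b ≤ v * a → u * u * B (2 + a) b ≤ (u * v + v * v) * B a (suc b)
  too-many-ones a b h = trade-≤ (B (2 + a) b) (B a (suc b)) ((2 + a) * (1 + a)) ((2 + (a + b)) * (1 + b)) (u * u) (u * v + v * v) (s≤s z≤n) (B-trade a b) (begin
    u * u * ((2 + (a + b)) * (1 + b))                          ≡⟨ l₁ u a b ⟩
    u * suc b * (u * a + u * suc b) + u * (u * suc b)          ≤⟨ +-mono-≤ (*-mono-≤ h (+-monoʳ-≤ (u * a) h)) (*-monoʳ-≤ u h) ⟩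
    v * a * (u * a + v * a) + u * (v * a)                      ≤⟨ m≤m+n _ (2 * (u * v * a) + 2 * (u * v) + (3 * (v * v * a) + 2 * (v * v))) ⟩
    v * a * (u * a + v * a) + u * (v * a) + (2 * (u * v * a) + 2 * (u * v) + (3 * (v * v * a) + 2 * (v * v))) ≡⟨ l₂ u v a ⟩
    (u * v + v * v) * ((2 + a) * (1 + a))                      ∎)
    where
    open ≤-Reasoning
    l₁ : ∀ u a b → u * u * ((2 + (a + b)) * (1 + b)) ≡ u * suc b * (u * a + u * suc b) + u * (u * suc b)
    l₁ = solve-∀
    l₂ : ∀ u v a → v * a * (u * a + v * a) + u * (v * a) + (2 * (u * v * a) + 2 * (u * v) + (3 * (v * v * a) + 2 * (v * v))) ≡ (u * v + v * v) * ((2 + a) * (1 + a))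
    l₂ = solve-∀

  too-many-twos : ∀ a b → v * (2 + a) ≤ u * b → (u * v + v * v) * B a (suc b) ≤ u * u * B (2 + a) b
  too-many-twos a b h = trade-≤ (B a (suc b)) (B (2 + a) b) ((2 + (a + b)) * (1 + b)) ((2 + a) * (1 + a)) (u * v + v * v) (u * u) (s≤s z≤n) (sym (B-trade a b)) (begin
    (u * v + v * v) * ((2 + a) * (1 + a))                      ≤⟨ *-monoʳ-≤ (u * v + v * v) (*-monoʳ-≤ (2 + a) (n≤1+n (1 + a))) ⟩
    (u * v + v * v) * ((2 + a) * (2 + a))                      ≡⟨ l₁ u v (2 + a) ⟩
    v * (2 + a) * (u * (2 + a) + v * (2 + a))                  ≤⟨ *-mono-≤ h (+-monoʳ-≤ (u * (2 + a)) h) ⟩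
    u * b * (u * (2 + a) + u * b)                              ≤⟨ m≤m+n _ (u * u * (2 + (a + b))) ⟩
    u * b * (u * (2 + a) + u * b) + u * u * (2 + (a + b))      ≡⟨ l₂ u a b ⟩
    u * u * ((2 + (a + b)) * (1 + b))                          ∎)
    where
    open ≤-Reasoning
    l₁ : ∀ u v x → (u * v + v * v) * (x * x) ≡ v * x * (u * x + v * x)
    l₁ = solve-∀
    l₂ : ∀ u a b → u * b * (u * (2 + a) + u * b) + u * u * (2 + (a + b)) ≡ u * u * ((2 + (a + b)) * (1 + b))
    l₂ = solve-∀

  many-ones : ∀ s a b → u * (b + s) ≤ v * a → (u * u) ^ s * B (a + 2 * s) b ≤ (u * v + v * v) ^ s * B a (b + s)
  many-ones zero    a b h = ≤-reflexive (cong₂ (λ x y → 1 * B x y) (+-identityʳ a) (sym (+-identityʳ b)))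
  many-ones (suc s) a b h = begin
    u * u * (u * u) ^ s * B (a + 2 * suc s) b                  ≡⟨ trans (cong (λ x → u * u * (u * u) ^ s * B x b) (l₁ a s)) (l₂ (u * u) ((u * u) ^ s) _) ⟩
    (u * u) ^ s * (u * u * B (2 + (a + 2 * s)) b)              ≤⟨ *-monoʳ-≤ ((u * u) ^ s) (too-many-ones (a + 2 * s) b (≤-trans (*-monoʳ-≤ u (≤-trans (m≤m+n (suc b) s) (≤-reflexive (sym (+-suc b s))))) (≤-trans h (*-monoʳ-≤ v (m≤m+n a _))))) ⟩
    (u * u) ^ s * (ρ * B (a + 2 * s) (suc b))                  ≡⟨ l₃ ((u * u) ^ s) ρ _ ⟩
    ρ * ((u * u) ^ s * B (a + 2 * s) (suc b))                  ≤⟨ *-monoʳ-≤ ρ (many-ones s a (suc b) (subst (λ x → u * x ≤ v * a) (+-suc b s) h)) ⟩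
    ρ * (ρ ^ s * B a (suc b + s))                              ≡⟨ trans (sym (*-assoc ρ (ρ ^ s) _)) (cong (λ x → ρ * ρ ^ s * B a x) (sym (+-suc b s))) ⟩
    ρ * ρ ^ s * B a (b + suc s)                                ∎
    where
    open ≤-Reasoning
    ρ = u * v + v * v
    l₁ : ∀ a s → a + 2 * suc s ≡ 2 + (a + 2 * s)
    l₁ = solve-∀
    l₂ : ∀ x y z → x * y * z ≡ y * (x * z)
    l₂ = solve-∀
    l₃ : ∀ x y z → x * (y * z) ≡ y * (x * z)
    l₃ = solve-∀

  many-twos : ∀ s a b → v * (a + 2 * s) ≤ u * b → (u * v + v * v) ^ s * B a (b + s) ≤ (u * u) ^ s * B (a + 2 * s) b
  many-twos zero    a b h = ≤-reflexive (cong₂ (λ x y → 1 * B x y) (sym (+-identityʳ a)) (+-identityʳ b))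
  many-twos (suc s) a b h = begin
    ρ * ρ ^ s * B a (b + suc s)                                ≡⟨ trans (cong (λ x → ρ * ρ ^ s * B a x) (+-suc b s)) (l₂ ρ (ρ ^ s) _) ⟩
    ρ ^ s * (ρ * B a (suc (b + s)))                            ≤⟨ *-monoʳ-≤ (ρ ^ s) (too-many-twos a (b + s) (≤-trans (*-monoʳ-≤ v (≤-trans (m≤m+n (2 + a) (2 * s)) (≤-reflexive (l₁ a s)))) (≤-trans h (*-monoʳ-≤ u (m≤m+n b s))))) ⟩
    ρ ^ s * (u * u * B (2 + a) (b + s))                        ≡⟨ l₃ (ρ ^ s) (u * u) _ ⟩
    u * u * (ρ ^ s * B (2 + a) (b + s))                        ≤⟨ *-monoʳ-≤ (u * u) (many-twos s (2 + a) b (subst (λ x → v * x ≤ u * b) (sym (l₁ a s)) h)) ⟩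
    u * u * ((u * u) ^ s * B (2 + a + 2 * s) b)                ≡⟨ trans (sym (*-assoc (u * u) ((u * u) ^ s) _)) (cong (λ x → u * u * (u * u) ^ s * B x b) (l₁ a s)) ⟩
    u * u * (u * u) ^ s * B (a + 2 * suc s) b                  ∎
    where
    open ≤-Reasoning
    ρ = u * v + v * v
    l₁ : ∀ a s → 2 + a + 2 * s ≡ a + 2 * suc s
    l₁ = solve-∀
    l₂ : ∀ x y z → x * y * z ≡ y * (x * z)
    l₂ = solve-∀
    l₃ : ∀ x y z → x * (y * z) ≡ y * (x * z)
    l₃ = solve-∀

Tn : ℕ → ℕ → ℕ
Tn n b = if 2 * b ≤ᵇ n then B (n ∸ 2 * b) b else 0

Tn-eq : ∀ {n b} → 2 * b ≤ n → Tn n b ≡ B (n ∸ 2 * b) b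
Tn-eq {n} {b} h rewrite ≤ᵇ-true h = refl

Tn-zero : ∀ {n b} → n < 2 * b → Tn n b ≡ 0
Tn-zero {n} {b} h rewrite ≤ᵇ-false h = refl

B≤total : ∀ n g a b → n ≤ g → a + 2 * b ≡ n → B a b ≤ ∑ (suc g) (Tn n)
B≤total n g a b n≤g refl = ≤-trans (≤-reflexive (trans (cong (λ x → B x b) (sym (m+n∸n≡m a (2 * b)))) (sym (Tn-eq {a + 2 * b} {b} (m≤n+m (2 * b) a)))))
  (∑-term (suc g) (Tn n) b (s≤s (≤-trans (m≤m+n b (b + 0)) (≤-trans (m≤n+m (2 * b) a) n≤g))))

-- D and p with p ≤ √5 D < p + 1: the ratio of ones to twos is typically between (D + p ∓ 2) / 2D

module Concentration (D p : ℕ) (D≥2 : 2 ≤ D) (p² : p * p ≤ 5 * (D * D)) (p²> : 5 * (D * D) < suc p * suc p) where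

  -- The quotient `uₚ / v` lies above φ and `uₘ / v` below it, both within 1/D. Beyond these ratios
  -- one trade changes the count by a fixed factor; the window of `typical` is wider on both sides,
  -- which leaves room for many trades.
  v uₚ uₘ : ℕ
  v = 2 * D
  uₚ = suc (D + p)
  uₘ = D + p ∸ 1

  typical : ℕ → ℕ → Bool
  typical a b = ((D + p ∸ 2) * b ≤ᵇ v * a) ∧ (v * a ≤ᵇ (D + p + 2) * b)

  private
    -- An atypical pair passes the threshold `uₚ` or `uₘ` with a slack y ≥ b, and n ≤ (uₚ + 3) y.
    -- One trade uses up at most 2 v + uₚ of the slack, so n / c trades fit in before the threshold
    -- is reached.
    c = (uₚ + 3) * (2 * v + uₚ)

    p≥2 : 2 ≤ p
    p≥2 = ≮⇒≥ λ h → <⇒≱ p²> (≤-trans (*-mono-≤ {suc p} {2} h h) (≤-trans (≤ᵇ⇒≤ 4 20 tt) (*-monoʳ-≤ 5 (*-mono-≤ D≥2 D≥2))))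

    instance
      c≢0 : NonZero c
      c≢0 = >-nonZero (*>0 {uₚ + 3} {2 * v + uₚ} (s≤s z≤n) (≤-trans (s≤s z≤n) (m≤n+m uₚ (2 * v))))

    ratioₚ : uₚ * v + v * v < uₚ * uₚ
    ratioₚ = +-cancelʳ-< (5 * (D * D)) _ _ (subst (uₚ * v + v * v + 5 * (D * D) <_) (sym (lem D p)) (+-monoʳ-< (uₚ * v + v * v) p²>))
      where
      lem : ∀ D p → suc (D + p) * suc (D + p) + 5 * (D * D) ≡ suc (D + p) * (2 * D) + 2 * D * (2 * D) + suc p * suc p
      lem = solve-∀

    uₘ-eq : ∀ D p → 1 ≤ p → D + p ∸ 1 ≡ D + (p ∸ 1)
    uₘ-eq D p h = +-∸-assoc D h

    ratioₘ : uₘ * uₘ < uₘ * v + v * v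
    ratioₘ rewrite uₘ-eq D p (≤-trans (s≤s z≤n) p≥2) = +-cancelʳ-< (5 * (D * D)) ((D + (p ∸ 1)) * (D + (p ∸ 1))) ((D + (p ∸ 1)) * v + v * v)
      (subst (_< (D + (p ∸ 1)) * v + v * v + 5 * (D * D)) (sym (lem D (p ∸ 1)))
        (+-monoʳ-< ((D + (p ∸ 1)) * (2 * D) + 2 * D * (2 * D)) (≤-trans (*-mono-< p-1<p p-1<p) p²)))
      where
      p-1<p : p ∸ 1 < p
      p-1<p = ≤-reflexive (m+[n∸m]≡n (≤-trans (s≤s z≤n) p≥2))
      lem : ∀ D q → (D + q) * (D + q) + 5 * (D * D) ≡ (D + q) * (2 * D) + 2 * D * (2 * D) + q * q
      lem = solve-∀

    v≥1 : 1 ≤ v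
    v≥1 = ≤-trans (s≤s z≤n) (≤-trans D≥2 (m≤m+n D (D + 0)))

    sc≤n : ∀ n → n / c * c ≤ n
    sc≤n n = ≤-trans (m≤n+m (n / c * c) (n % c)) (≤-reflexive (sym (m≡m%n+[m/n]*n n c)))

    -- Moving n / c trades towards the ratio φ multiplies the count each time by a factor bounded
    -- away from 1, and the end point is again a term of the full sum.
    heavy-bound : ∀ n g a b → n ≤ g → a + 2 * b ≡ n → typical a b ≡ false →
      let s = n / c ; A = ∑ (suc g) (Tn n) in
      ((uₚ * uₚ) ^ s * B a b ≤ (uₚ * v + v * v) ^ s * A) ⊎ ((uₘ * v + v * v) ^ s * B a b ≤ (uₘ * uₘ) ^ s * A)
    heavy-bound n g a b n≤g e ty with v * a ≤? (D + p + 2) * b | (D + p ∸ 2) * b ≤? v * a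
    ... | yes h | yes h′ = ⊥-elim (absurd (trans (sym (T⇒≡ (T-∧⁺ {(D + p ∸ 2) * b ≤ᵇ v * a} (≤⇒≤ᵇ h′) (≤⇒≤ᵇ h)))) ty))
      where
      absurd : true ≡ false → ⊥
      absurd ()
    ... | no h | _ = inj₁ (≤-trans (subst (λ x → (uₚ * uₚ) ^ s * B x b ≤ (uₚ * v + v * v) ^ s * B a₀ (b + s)) a≡ (many-ones uₚ v s a₀ b room))
            (*-monoʳ-≤ ((uₚ * v + v * v) ^ s) (B≤total n g a₀ (b + s) n≤g (trans (lem₀ a₀ b s) (trans (cong (_+ 2 * b) a≡) e)))))
      where
      s = n / c
      big : (uₚ + 1) * b ≤ v * a
      big = ≤-trans (≤-reflexive (cong (_* b) (lem D p))) (<⇒≤ (≰⇒> h))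
        where
        lem : ∀ D p → suc (D + p) + 1 ≡ D + p + 2
        lem = solve-∀
      y = v * a ∸ uₚ * b
      y≡ : y + uₚ * b ≡ v * a
      y≡ = m∸n+n≡m (≤-trans (*-monoˡ-≤ b (m≤m+n uₚ 1)) big)
      b≤y : b ≤ y
      b≤y = +-cancelʳ-≤ (uₚ * b) b y (≤-trans (≤-reflexive (l uₚ b)) (≤-trans big (≤-reflexive (sym y≡))))
        where
        l : ∀ u b → b + u * b ≡ (u + 1) * b
        l = solve-∀
      n≤ : n ≤ (uₚ + 3) * y
      n≤ = ≤-trans (≤-reflexive (sym e)) (≤-trans (+-mono-≤ (≤-trans (m≤n*m a v {{>-nonZero v≥1}}) (≤-trans (≤-reflexive (sym y≡)) (+-monoʳ-≤ y (*-monoʳ-≤ uₚ b≤y)))) (*-monoʳ-≤ 2 b≤y)) (≤-reflexive (l uₚ y)))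
        where
        l : ∀ u y → y + u * y + 2 * y ≡ (u + 3) * y
        l = solve-∀
      sy : s * (2 * v + uₚ) ≤ y
      sy = *-cancelˡ-≤ (uₚ + 3) (≤-trans (≤-reflexive (l (uₚ + 3) s (2 * v + uₚ))) (≤-trans (sc≤n n) n≤))
        where
        l : ∀ x s z → x * (s * z) ≡ s * (x * z)
        l = solve-∀
      total : uₚ * (b + s) + v * (2 * s) ≤ v * a
      total = ≤-trans (≤-reflexive (l uₚ b s v)) (≤-trans (+-monoˡ-≤ (uₚ * b) sy) (≤-reflexive y≡))
        where
        l : ∀ u b s v → u * (b + s) + v * (2 * s) ≡ s * (2 * v + u) + u * b
        l = solve-∀
      2s≤a : 2 * s ≤ a
      2s≤a = cancel*ˡ v v≥1 (≤-trans (m≤n+m _ (uₚ * (b + s))) total)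
      a₀ = a ∸ 2 * s
      a≡ : a₀ + 2 * s ≡ a
      a≡ = m∸n+n≡m 2s≤a
      room : uₚ * (b + s) ≤ v * a₀
      room = +-cancelʳ-≤ (v * (2 * s)) _ _ (≤-trans total (≤-reflexive (trans (cong (v *_) (sym a≡)) (*-distribˡ-+ v a₀ (2 * s)))))
      lem₀ : ∀ a b s → a + 2 * (b + s) ≡ a + 2 * s + 2 * b
      lem₀ = solve-∀
    ... | yes _ | no h = inj₂ (≤-trans (subst (λ x → (uₘ * v + v * v) ^ s * B a x ≤ (uₘ * uₘ) ^ s * B (a + 2 * s) b₀) b≡ (many-twos uₘ v s a b₀ room))
            (*-monoʳ-≤ ((uₘ * uₘ) ^ s) (B≤total n g (a + 2 * s) b₀ n≤g (trans (lem₀ a b₀ s) (trans (cong (λ x → a + 2 * x) b≡) e)))))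
      where
      s = n / c
      uₘ≡ : suc (D + p ∸ 2) ≡ uₘ
      uₘ≡ = trans (sym (+-∸-assoc 1 {D + p} {2} (≤-trans p≥2 (m≤n+m p D)))) refl
      big : v * a + b ≤ uₘ * b
      big = ≤-trans (+-monoˡ-≤ b (<⇒≤ (≰⇒> h))) (≤-reflexive (trans (+-comm _ b) (cong (_* b) uₘ≡)))
      y = uₘ * b ∸ v * a
      y≡ : y + v * a ≡ uₘ * b
      y≡ = m∸n+n≡m (≤-trans (m≤m+n (v * a) b) big)
      b≤y : b ≤ y
      b≤y = +-cancelʳ-≤ (v * a) b y (≤-trans (≤-reflexive (+-comm b (v * a))) (≤-trans big (≤-reflexive (sym y≡))))
      n≤ : n ≤ (uₘ + 2) * y
      n≤ = ≤-trans (≤-reflexive (sym e)) (≤-trans (+-mono-≤ (≤-trans (m≤n*m a v {{>-nonZero v≥1}}) (≤-trans (≤-trans (m≤m+n (v * a) b) big) (*-monoʳ-≤ uₘ b≤y))) (*-monoʳ-≤ 2 b≤y)) (≤-reflexive (sym (*-distribʳ-+ y uₘ 2))))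
      uₘ≤uₚ : uₘ ≤ uₚ
      uₘ≤uₚ = ≤-trans (m∸n≤m (D + p) 1) (n≤1+n (D + p))
      sy : s * (2 * v + uₘ) ≤ y
      sy = *-cancelˡ-≤ (uₘ + 2) {{>-nonZero (m≤n+m 1 (uₘ + 1) ⟨≤≡⟩ +-assoc uₘ 1 1)}} (≤-trans (≤-trans (≤-reflexive (l (uₘ + 2) s (2 * v + uₘ))) (*-monoʳ-≤ s (*-mono-≤ {uₘ + 2} {uₚ + 3} (+-mono-≤ uₘ≤uₚ (s≤s (s≤s z≤n))) (+-monoʳ-≤ (2 * v) uₘ≤uₚ)))) (≤-trans (sc≤n n) n≤))
        where
        l : ∀ x s z → x * (s * z) ≡ s * (x * z)
        l = solve-∀
        _⟨≤≡⟩_ : ∀ {x y z} → x ≤ y → y ≡ z → x ≤ z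
        h ⟨≤≡⟩ refl = h
      total : v * (a + 2 * s) + uₘ * s ≤ uₘ * b
      total = ≤-trans (≤-reflexive (l uₘ a s v)) (≤-trans (+-monoˡ-≤ (v * a) sy) (≤-reflexive y≡))
        where
        l : ∀ u a s v → v * (a + 2 * s) + u * s ≡ s * (2 * v + u) + v * a
        l = solve-∀
      uₘ>0 : 0 < uₘ
      uₘ>0 = subst (0 <_) uₘ≡ (s≤s z≤n)
      s≤b : s ≤ b
      s≤b = cancel*ˡ uₘ uₘ>0 (≤-trans (m≤n+m _ (v * (a + 2 * s))) total)
      b₀ = b ∸ s
      b≡ : b₀ + s ≡ b
      b≡ = m∸n+n≡m s≤b
      room : v * (a + 2 * s) ≤ uₘ * b₀
      room = +-cancelʳ-≤ (uₘ * s) _ _ (≤-trans total (≤-reflexive (trans (cong (uₘ *_) (sym b≡)) (*-distribˡ-+ uₘ b₀ s))))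
      lem₀ : ∀ a b s → a + 2 * s + 2 * b ≡ a + 2 * (b + s)
      lem₀ = solve-∀

    drop-power : ∀ K g n α β x A s → 0 < α → α < β → K * 2 * suc n ^ 1 * α ^ s ≤ β ^ s → g ≤ 2 * n → β ^ s * x ≤ α ^ s * A → suc g * (K * x) ≤ A
    drop-power K g n α β x A s α>0 α<β h g≤ k = cancel*ˡ (β ^ s) (^>0 β s (<-trans α>0 α<β)) (begin
      β ^ s * (suc g * (K * x))         ≡⟨ l₁ (β ^ s) (suc g) K x ⟩
      suc g * K * (β ^ s * x)           ≤⟨ *-mono-≤ (*-monoˡ-≤ K (≤-trans (s≤s g≤) (≤-trans (n≤1+n _) (≤-reflexive (l₂ n))))) k ⟩
      2 * suc n * K * (α ^ s * A)       ≡⟨ l₃ n K (α ^ s) A ⟩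
      K * 2 * (suc n * 1) * α ^ s * A   ≤⟨ *-monoˡ-≤ A h ⟩
      β ^ s * A                         ∎)
      where
      open ≤-Reasoning
      l₁ : ∀ b g k x → b * (g * (k * x)) ≡ g * k * (b * x)
      l₁ = solve-∀
      l₂ : ∀ n → suc (suc (2 * n)) ≡ 2 * suc n
      l₂ = solve-∀
      l₃ : ∀ n k a A → 2 * suc n * k * (a * A) ≡ k * 2 * (suc n * 1) * a * A
      l₃ = solve-∀

  private
    ρ>0 : 0 < uₚ * v + v * v
    ρ>0 = ≤-trans (*>0 v≥1 v≥1) (m≤n+m (v * v) (uₚ * v))

    uₘ>0 : 0 < uₘ
    uₘ>0 = m<n⇒0<n∸m (≤-trans p≥2 (m≤n+m p D))

    module Rare (K : ℕ) where
      many = exp-beats-poly-div (uₚ * v + v * v) (uₚ * uₚ) (K * 2) 1 c ρ>0 ratioₚ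
      few  = exp-beats-poly-div (uₘ * uₘ) (uₘ * v + v * v) (K * 2) 1 c (*>0 uₘ>0 uₘ>0) ratioₘ
      M = proj₁ many + proj₁ few

      term : ∀ n g → M ≤ n → n ≤ g → g ≤ 2 * n → ∀ b ty → typical (n ∸ 2 * b) b ≡ ty → Dec (2 * b ≤ n) →
        suc g * (K * (χ (not ty) * Tn n b)) ≤ ∑ (suc g) (Tn n)
      term n g h n≤g g≤ b true  e _ = ≤-trans (≤-reflexive (trans (cong (suc g *_) (*-zeroʳ K)) (*-zeroʳ (suc g)))) z≤n
      term n g h n≤g g≤ b false e (no ¬l) = ≤-trans (≤-reflexive (trans (cong (λ x → suc g * (K * (1 * x))) (Tn-zero {n} {b} (≰⇒> ¬l)))
        (trans (cong (suc g *_) (*-zeroʳ K)) (*-zeroʳ (suc g))))) z≤n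
      term n g h n≤g g≤ b false e (yes l) = subst (λ x → suc g * (K * x) ≤ ∑ (suc g) (Tn n))
        (trans (sym (Tn-eq {n} {b} l)) (sym (+-identityʳ (Tn n b))))
        (split (heavy-bound n g (n ∸ 2 * b) b n≤g (m∸n+n≡m l) e))
        where
        x = B (n ∸ 2 * b) b
        A = ∑ (suc g) (Tn n)
        split : ((uₚ * uₚ) ^ (n / c) * x ≤ (uₚ * v + v * v) ^ (n / c) * A) ⊎ ((uₘ * v + v * v) ^ (n / c) * x ≤ (uₘ * uₘ) ^ (n / c) * A) → suc g * (K * x) ≤ A
        split (inj₁ k) = drop-power K g n (uₚ * v + v * v) (uₚ * uₚ) x A (n / c) ρ>0 ratioₚ (proj₂ many n (≤-trans (m≤m+n (proj₁ many) (proj₁ few)) h)) g≤ k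
        split (inj₂ k) = drop-power K g n (uₘ * uₘ) (uₘ * v + v * v) x A (n / c) (*>0 uₘ>0 uₘ>0) ratioₘ (proj₂ few n (≤-trans (m≤n+m (proj₁ few) (proj₁ many)) h)) g≤ k

  atypical-rare : ∀ K → ∃[ M ] (∀ n g → M ≤ n → n ≤ g → g ≤ 2 * n →
    K * ∑ (suc g) (λ b → χ (not (typical (n ∸ 2 * b) b)) * Tn n b) ≤ ∑ (suc g) (Tn n))
  atypical-rare K = Rare.M K , λ n g h n≤g g≤ → cancel*ˡ (suc g) (s≤s z≤n)
    (≤-trans (≤-reflexive (trans (cong (suc g *_) (sym (∑-*ˡ (suc g) K (λ b → χ (not (typical (n ∸ 2 * b) b)) * Tn n b)))) (sym (∑-*ˡ (suc g) (suc g) _))))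
      (∑-bound (suc g) (∑ (suc g) (Tn n)) (λ b _ → Rare.term K n g h n≤g g≤ b (typical (n ∸ 2 * b) b) refl (2 * b ≤? n))))

-- Words with prescribed ones, and the length of typical words

-- Prescribing a one in one place keeps the fraction a / (a + b) of the words and leaves a - 1 ones.
-- Removing a one does not raise the fraction of ones above q / x, because q ≤ x.
Bm-upper : ∀ x q ℓ a b → q ≤ x → x * a ≤ q * (a + b) → x ^ ℓ * Bm ℓ a b ≤ q ^ ℓ * B a b
Bm-upper x q zero    a       b h k = ≤-refl
Bm-upper x q (suc ℓ) zero    b h k = ≤-trans (≤-reflexive (*-zeroʳ (x * x ^ ℓ))) z≤n
Bm-upper x q (suc ℓ) (suc a) b h k = begin
  x * x ^ ℓ * Bm ℓ a b          ≡⟨ *-assoc x (x ^ ℓ) _ ⟩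
  x * (x ^ ℓ * Bm ℓ a b)        ≤⟨ *-monoʳ-≤ x (Bm-upper x q ℓ a b h smaller) ⟩
  x * (q ^ ℓ * B a b)           ≡⟨ l x (q ^ ℓ) (B a b) ⟩
  q ^ ℓ * (x * B a b)           ≤⟨ *-monoʳ-≤ (q ^ ℓ) (trade-≤ (B a b) (B (suc a) b) (suc (a + b)) (suc a) x q (s≤s z≤n) (sym (B-more-ones a b)) k) ⟩
  q ^ ℓ * (q * B (suc a) b)     ≡⟨ l′ (q ^ ℓ) q (B (suc a) b) ⟩
  q * q ^ ℓ * B (suc a) b       ∎
  where
  open ≤-Reasoning
  l : ∀ x y z → x * (y * z) ≡ y * (x * z)
  l = solve-∀
  l′ : ∀ x y z → x * (y * z) ≡ y * x * z
  l′ = solve-∀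
  smaller : x * a ≤ q * (a + b)
  smaller = +-cancelˡ-≤ x (x * a) (q * (a + b)) (≤-trans (≤-reflexive (sym (*-suc x a))) (≤-trans k (≤-trans (≤-reflexive (*-suc q (a + b))) (+-monoˡ-≤ _ h))))

-- Each removed one lowers the fraction of ones; the extra `x * ℓ` in the hypothesis keeps it at r /
-- x or more until all ℓ ones are placed.
Bm-lower : ∀ x r ℓ a b → 0 < x → r * (a + b) + x * ℓ ≤ x * a → r ^ ℓ * B a b ≤ x ^ ℓ * Bm ℓ a b
Bm-lower x r zero    a       b x>0 k = ≤-refl
Bm-lower x r (suc ℓ) zero    b x>0 k = ⊥-elim (<⇒≱ (*>0 {x} {suc ℓ} x>0 (s≤s z≤n)) (≤-trans (m≤n+m _ (r * b)) (≤-trans k (≤-reflexive (*-zeroʳ x)))))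
Bm-lower x r (suc ℓ) (suc a) b x>0 k = begin
  r * r ^ ℓ * B (suc a) b       ≡⟨ l r (r ^ ℓ) (B (suc a) b) ⟩
  r ^ ℓ * (r * B (suc a) b)     ≤⟨ *-monoʳ-≤ (r ^ ℓ) (trade-≤ (B (suc a) b) (B a b) (suc a) (suc (a + b)) r x (s≤s z≤n) (B-more-ones a b) (≤-trans (m≤m+n _ _) k)) ⟩
  r ^ ℓ * (x * B a b)           ≡⟨ l′ (r ^ ℓ) x (B a b) ⟩
  x * (r ^ ℓ * B a b)           ≤⟨ *-monoʳ-≤ x (Bm-lower x r ℓ a b x>0 smaller) ⟩
  x * (x ^ ℓ * Bm ℓ a b)        ≡⟨ sym (*-assoc x (x ^ ℓ) _) ⟩
  x * x ^ ℓ * Bm ℓ a b          ∎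
  where
  open ≤-Reasoning
  l : ∀ x y z → x * y * z ≡ y * (x * z)
  l = solve-∀
  l′ : ∀ x y z → x * (y * z) ≡ y * (x * z)
  l′ = solve-∀
  smaller : r * (a + b) + x * ℓ ≤ x * a
  smaller = lin r k (m x r a b ℓ)
    where
    m : ∀ x r a b ℓ → r * (a + b) + x * ℓ + x * suc a + r ≡ x * a + (r * (suc a + b) + x * suc ℓ)
    m = solve-∀

-- r / 2D is compared with (√5 − 1)/2 through (r + D)² and 5D²; t stands for 2D − r

module _ (D r t : ℕ) (2D : 2 * D ≡ r + t) (D>0 : 0 < D) where
  private
    difference : ∀ r t → t * (r + t + r) + r * r ≡ (r + t) * (r + t)
    difference = solve-∀
    square : ∀ D r → (r + D) * (r + D) + 3 * (D * D) ≡ r * r + 2 * D * r + 2 * D * (2 * D)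
    square = solve-∀
    l₁ : ∀ t x y → t * (x * y) ≡ x * (t * y)
    l₁ = solve-∀
    2D>0 : 0 < 2 * D
    2D>0 = *>0 {2} (s≤s z≤n) D>0

  ratio-upper : 5 * (D * D) ≤ (r + D) * (r + D) → ∀ a b → 2 * D * a ≤ (2 * D + r) * b → 2 * D * a ≤ r * (a + b)
  ratio-upper h a b k = ≤-trans (≤-reflexive (trans (cong (_* a) 2D) (*-distribʳ-+ a r t)))
    (≤-trans (+-monoʳ-≤ (r * a) ta≤rb) (≤-reflexive (sym (*-distribˡ-+ r a b))))
    where
    -- With x = r / 2D this is (1 - x)(1 + x) ≤ x, that is x² + x ≥ 1, or x ≥ 1/φ.
    key : t * (2 * D + r) ≤ 2 * D * r
    key = +-cancelʳ-≤ (r * r) _ _ (+-cancelʳ-≤ (2 * D * (2 * D)) _ _ (begin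
      t * (2 * D + r) + r * r + 2 * D * (2 * D)         ≡⟨ cong (_+ 2 * D * (2 * D)) (trans (cong (λ x → t * (x + r) + r * r) 2D) (trans (difference r t) (sym (cong (λ x → x * x) 2D)))) ⟩
      2 * D * (2 * D) + 2 * D * (2 * D)                 ≡⟨ m D ⟩
      5 * (D * D) + 3 * (D * D)                         ≤⟨ +-monoˡ-≤ (3 * (D * D)) h ⟩
      (r + D) * (r + D) + 3 * (D * D)                   ≡⟨ square D r ⟩
      r * r + 2 * D * r + 2 * D * (2 * D)               ≡⟨ cong (_+ 2 * D * (2 * D)) (+-comm (r * r) _) ⟩
      2 * D * r + r * r + 2 * D * (2 * D)               ∎))
      where
      open ≤-Reasoning
      m : ∀ D → 2 * D * (2 * D) + 2 * D * (2 * D) ≡ 5 * (D * D) + 3 * (D * D)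
      m = solve-∀
    ta≤rb : t * a ≤ r * b
    ta≤rb = cancel*ˡ (2 * D) 2D>0 (≤-trans (≤-reflexive (sym (l₁ t (2 * D) a))) (≤-trans (*-monoʳ-≤ t k)
      (≤-trans (≤-reflexive (sym (*-assoc t (2 * D + r) b))) (≤-trans (*-monoˡ-≤ b key) (≤-reflexive (*-assoc (2 * D) r b))))))

  ratio-lower : (r + D) * (r + D) ≤ 5 * (D * D) → ∀ a b → (2 * D + r) * b ≤ 2 * D * a → r * (a + b) ≤ 2 * D * a
  ratio-lower h a b k = ≤-trans (≤-reflexive (*-distribˡ-+ r a b)) (≤-trans (+-monoʳ-≤ (r * a) rb≤ta)
    (≤-reflexive (trans (sym (*-distribʳ-+ a r t)) (cong (_* a) (sym 2D)))))
    where
    key : 2 * D * r ≤ t * (2 * D + r)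
    key = +-cancelʳ-≤ (r * r) _ _ (+-cancelʳ-≤ (2 * D * (2 * D)) _ _ (begin
      2 * D * r + r * r + 2 * D * (2 * D)               ≡⟨ cong (_+ 2 * D * (2 * D)) (+-comm _ (r * r)) ⟩
      r * r + 2 * D * r + 2 * D * (2 * D)               ≡⟨ sym (square D r) ⟩
      (r + D) * (r + D) + 3 * (D * D)                   ≤⟨ +-monoˡ-≤ (3 * (D * D)) h ⟩
      5 * (D * D) + 3 * (D * D)                         ≡⟨ sym (m D) ⟩
      2 * D * (2 * D) + 2 * D * (2 * D)                 ≡⟨ cong (_+ 2 * D * (2 * D)) (trans (cong (λ x → x * x) 2D) (trans (sym (difference r t)) (cong (λ x → t * (x + r) + r * r) (sym 2D)))) ⟩
      t * (2 * D + r) + r * r + 2 * D * (2 * D)         ∎))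
      where
      open ≤-Reasoning
      m : ∀ D → 2 * D * (2 * D) + 2 * D * (2 * D) ≡ 5 * (D * D) + 3 * (D * D)
      m = solve-∀
    rb≤ta : r * b ≤ t * a
    rb≤ta = cancel*ˡ (2 * D) 2D>0 (≤-trans (≤-reflexive (sym (*-assoc (2 * D) r b))) (≤-trans (*-monoˡ-≤ b key)
      (≤-trans (≤-reflexive (*-assoc t (2 * D + r) b)) (≤-trans (*-monoʳ-≤ t k) (≤-reflexive (l₁ t (2 * D) a))))))

-- parameters: p = ⌊√5 D⌋ = R + D + 3

record Scale (D R : ℕ) : Set where
  field
    D≥12 : 12 ≤ D
    p²≤  : (R + D + 3) * (R + D + 3) ≤ 5 * (D * D)
    p²>  : 5 * (D * D) < suc (R + D + 3) * suc (R + D + 3)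

module Typical {D R : ℕ} (Sc : Scale D R) where
  open Scale Sc

  p : ℕ
  p = R + D + 3

  module C = Concentration D p (≤-trans (s≤s (s≤s z≤n)) D≥12) p²≤ p²>
  open C using (typical; atypical-rare) public

  private
    D>0 : 0 < D
    D>0 = ≤-trans (s≤s z≤n) D≥12

    square-≤ : ∀ {x y} → x * x ≤ y * y → x ≤ y
    square-≤ {x} {y} h = ≮⇒≥ λ l → <⇒≱ (*-mono-< l l) h

  t-bound : R + 5 ≤ 2 * D
  t-bound = +-cancelʳ-≤ D _ _ (≤-trans (≤-reflexive (m₁ R D)) (≤-trans (+-monoˡ-≤ 2 p≤) (≤-reflexive (m₂ D′ D D≡))))
    where
    D′ = D ∸ 2
    D≡ : D′ + 2 ≡ D
    D≡ = m∸n+n≡m (≤-trans (s≤s (s≤s z≤n)) D≥12)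
    m₁ : ∀ R D → R + 5 + D ≡ R + D + 3 + 2
    m₁ = solve-∀
    m₂ : ∀ D′ D → D′ + 2 ≡ D → 2 * D + D′ + 2 ≡ 2 * D + D
    m₂ D′ D e = trans (+-assoc (2 * D) D′ 2) (cong (2 * D +_) e)
    p≤ : p ≤ 2 * D + D′
    p≤ = square-≤ (≤-trans p²≤ (subst (λ d → 5 * (d * d) ≤ (2 * d + D′) * (2 * d + D′)) D≡
      (lin (4 * (D′ * D′)) (*-monoʳ-≤ 4 1≤D′) (m₃ D′))))
      where
      1≤D′ : 1 ≤ D′
      1≤D′ = ∸-monoˡ-≤ 2 (≤-trans (s≤s (s≤s (s≤s z≤n))) D≥12)
      m₃ : ∀ d → 5 * ((d + 2) * (d + 2)) + 4 * d + 4 * (d * d) ≡ (2 * (d + 2) + d) * (2 * (d + 2) + d) + 4 * 1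
      m₃ = solve-∀

  p≤3D : p ≤ 3 * D
  p≤3D = lin 2 (≤-trans t-bound (≤-refl {2 * D})) (m R D)
    where
    m : ∀ R D → R + D + 3 + 2 * D + 2 ≡ 3 * D + (R + 5)
    m = solve-∀

  private
    -- Chosen so that the window of `typical` reads (2D + r₋) b ≤ 2D a ≤ (2D + r₊) b. Since p = R +
    -- D + 3 is √5 D rounded down, 1/φ lies between r₋ / 2D and r₊ / 2D.
    r₊ r₋ t₊ t₋ : ℕ
    r₊ = R + 5
    r₋ = R + 1
    t₊ = 2 * D ∸ r₊
    t₋ = 2 * D ∸ r₋

    2D₊ : 2 * D ≡ r₊ + t₊
    2D₊ = sym (m+[n∸m]≡n t-bound)

    r₋≤r₊ : r₋ ≤ r₊
    r₋≤r₊ = +-monoʳ-≤ R (s≤s z≤n)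

    2D₋ : 2 * D ≡ r₋ + t₋
    2D₋ = sym (m+[n∸m]≡n (≤-trans r₋≤r₊ t-bound))

    product-identity : ∀ r t → (3 * (r + t) + r) * (r + t + t) + (r * r + (r + t) * r) ≡ 6 * ((r + t) * (r + t))
    product-identity = solve-∀

    -- With x = r / 2D this is (3 + x)(2 - x) = 6 - (x + x²). At x = 1/φ the value is 5, and (3 + x)
    -- / 5 = 1 / (2 - x) is γ.
    product-at : ∀ r t → 2 * D ≡ r + t → (6 * D + r) * (2 * D + t) + (r * r + 2 * D * r) ≡ 24 * (D * D)
    product-at r t e = trans (cong₂ (λ x y → (x + r) * (y + t) + (r * r + y * r)) (trans (m₁ D) (cong (3 *_) e)) e)
      (trans (product-identity r t) (trans (cong (λ x → 6 * (x * x)) (sym e)) (m₂ D)))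
      where
      m₁ : ∀ D → 6 * D ≡ 3 * (2 * D)
      m₁ = solve-∀
      m₂ : ∀ D → 6 * (2 * D * (2 * D)) ≡ 24 * (D * D)
      m₂ = solve-∀

  module _ (a b : ℕ) (ty : T (typical a b)) where
    private
      bounds = T-∧⁻ {(D + p ∸ 2) * b ≤ᵇ 2 * D * a} ty
      N = a + b
      n = a + 2 * b

    typical-upper : 2 * D * a ≤ r₊ * (a + b)
    typical-upper = ratio-upper D r₊ t₊ 2D₊ D>0 (≤-trans (<⇒≤ p²>) (≤-trans (*-mono-≤ p+1≤ p+1≤) ≤-refl)) a b
      (subst (λ x → 2 * D * a ≤ x * b) (m R D) (≤ᵇ⇒≤ (2 * D * a) ((D + p + 2) * b) (proj₂ bounds)))
      where
      p+1≤ : suc p ≤ r₊ + D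
      p+1≤ = lin 1 (≤-refl {0}) (m′ R D)
        where
        m′ : ∀ R D → suc (R + D + 3) + 0 + 1 ≡ R + 5 + D + 0
        m′ = solve-∀
      m : ∀ R D → D + (R + D + 3) + 2 ≡ 2 * D + (R + 5)
      m = solve-∀

    typical-lower : r₋ * (a + b) ≤ 2 * D * a
    typical-lower = ratio-lower D r₋ t₋ 2D₋ D>0 (≤-trans (*-mono-≤ ≤p ≤p) p²≤) a b
      (subst (λ x → x * b ≤ 2 * D * a) (trans (cong (_∸ 2) (m R D)) (m+n∸n≡m (2 * D + (R + 1)) 2)) (≤ᵇ⇒≤ ((D + p ∸ 2) * b) (2 * D * a) (proj₁ bounds)))
      where
      ≤p : r₋ + D ≤ p
      ≤p = lin 2 (≤-refl {0}) (m′ R D)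
        where
        m′ : ∀ R D → R + 1 + D + 0 + 2 ≡ R + D + 3 + 0
        m′ = solve-∀
      m : ∀ R D → D + (R + D + 3) ≡ 2 * D + (R + 1) + 2
      m = solve-∀

    private
      2D>0 : 0 < 2 * D
      2D>0 = *>0 {2} (s≤s z≤n) D>0

      length₊ : (2 * D + t₊) * N ≤ 2 * D * n
      length₊ = lin 0 typical-upper (trans (+-identityʳ _) (trans (cong (λ x → (2 * D + t₊) * N + x) refl)
        (trans (m₁ (2 * D) t₊ r₊ N) (trans (cong (λ x → (2 * D + x) * N) (trans (+-comm t₊ r₊) (sym 2D₊))) (m₂ D a b)))))
        where
        m₁ : ∀ x t r N → (x + t) * N + r * N ≡ (x + (t + r)) * N
        m₁ = solve-∀
        m₂ : ∀ D a b → (2 * D + 2 * D) * (a + b) ≡ 2 * D * (a + 2 * b) + 2 * D * a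
        m₂ = solve-∀

      length₋ : 2 * D * n ≤ (2 * D + t₋) * N
      length₋ = lin 0 typical-lower (trans (+-identityʳ _) (trans (sym (m₂ D a b)) (sym (trans (m₁ (2 * D) t₋ r₋ N) (cong (λ x → (2 * D + x) * N) (trans (+-comm t₋ r₋) (sym 2D₋)))))))
        where
        m₁ : ∀ x t r N → (x + t) * N + r * N ≡ (x + (t + r)) * N
        m₁ = solve-∀
        m₂ : ∀ D a b → (2 * D + 2 * D) * (a + b) ≡ 2 * D * (a + 2 * b) + 2 * D * a
        m₂ = solve-∀

    -- A word of N letters with sum n has n / N = 2 - a / N, and 1 / (2 - 1/φ) = γ. In integers 5 D
    -- + p = 6 D + R + 3, so `product-at` multiplies the two sides out; the 15 pays for the width of
    -- the window and for rounding √5.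
    length-upper : 10 * D * (a + b) ≤ (5 * D + p + 15) * (a + 2 * b)
    length-upper = cancel*ˡ (2 * D) 2D>0 (begin
      2 * D * (10 * D * N)                               ≡⟨ m₁ D N ⟩
      20 * (D * D) * N                                   ≤⟨ *-monoˡ-≤ N key ⟩
      (5 * D + p + 15) * (2 * D + t₊) * N                ≡⟨ *-assoc (5 * D + p + 15) _ N ⟩
      (5 * D + p + 15) * ((2 * D + t₊) * N)              ≤⟨ *-monoʳ-≤ (5 * D + p + 15) length₊ ⟩
      (5 * D + p + 15) * (2 * D * n)                     ≡⟨ m₂ (5 * D + p + 15) D n ⟩
      2 * D * ((5 * D + p + 15) * n)                     ∎)
      where
      open ≤-Reasoning
      m₁ : ∀ D N → 2 * D * (10 * D * N) ≡ 20 * (D * D) * N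
      m₁ = solve-∀
      m₂ : ∀ x D n → x * (2 * D * n) ≡ 2 * D * (x * n)
      m₂ = solve-∀
      q = r₊ * r₊ + 2 * D * r₊
      E₁ : (6 * D + r₊) * (2 * D + t₊) + q ≡ 24 * (D * D)
      E₁ = product-at r₊ t₊ 2D₊
      E₂ : q ≤ 4 * (D * D) + 4 * p + 4
      E₂ = lin 0 p²≤ (m R D)
        where
        m : ∀ R D → (R + 5) * (R + 5) + 2 * D * (R + 5) + 5 * (D * D) + 0 ≡ 4 * (D * D) + 4 * (R + D + 3) + 4 + (R + D + 3) * (R + D + 3)
        m = solve-∀
      E₃ : 4 * p + 4 ≤ 13 * (2 * D)
      E₃ = ≤-trans (+-mono-≤ (*-monoʳ-≤ 4 p≤3D) (≤-trans (s≤s (s≤s (s≤s (s≤s z≤n)))) D≥12)) (lin (13 * D) (≤-refl {0}) (m D))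
        where
        m : ∀ D → 4 * (3 * D) + D + 0 + 13 * D ≡ 13 * (2 * D) + 0
        m = solve-∀
      key : 20 * (D * D) ≤ (5 * D + p + 15) * (2 * D + t₊)
      key = ≤-trans (lin 0 (≤-trans E₂ (≤-trans (≤-reflexive (+-assoc (4 * (D * D)) (4 * p) 4)) (+-monoʳ-≤ (4 * (D * D)) E₃)))
              (trans (m₃ D) (trans (cong (_+ 13 * (2 * D)) (sym E₁)) (m₅ ((6 * D + r₊) * (2 * D + t₊)) q D))))
            (≤-trans (+-monoʳ-≤ ((6 * D + r₊) * (2 * D + t₊)) (*-monoʳ-≤ 13 (m≤m+n (2 * D) t₊))) (≤-reflexive (m₄ R D t₊)))
        where
        m₃ : ∀ D → 20 * (D * D) + (4 * (D * D) + 13 * (2 * D)) + 0 ≡ 24 * (D * D) + 13 * (2 * D)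
        m₃ = solve-∀
        m₅ : ∀ x q D → x + q + 13 * (2 * D) ≡ x + 13 * (2 * D) + q
        m₅ = solve-∀
        m₄ : ∀ R D t → (6 * D + (R + 5)) * (2 * D + t) + 13 * (2 * D + t) ≡ (5 * D + (R + D + 3) + 15) * (2 * D + t)
        m₄ = solve-∀

    length-lower : (5 * D + p) * (a + 2 * b) ≤ 10 * D * (a + b) + 15 * (a + 2 * b)
    length-lower = cancel*ˡ (2 * D) 2D>0 (begin
      2 * D * ((5 * D + p) * n)                          ≡⟨ m₁ D (5 * D + p) n ⟩
      (5 * D + p) * (2 * D * n)                          ≤⟨ *-monoʳ-≤ (5 * D + p) length₋ ⟩
      (5 * D + p) * ((2 * D + t₋) * N)                   ≡⟨ sym (*-assoc (5 * D + p) _ N) ⟩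
      (5 * D + p) * (2 * D + t₋) * N                     ≤⟨ *-monoˡ-≤ N key ⟩
      (20 * (D * D) + 30 * D) * N                        ≡⟨ m₂ D N ⟩
      2 * D * (10 * D * N + 15 * N)                      ≤⟨ *-monoʳ-≤ (2 * D) (+-monoʳ-≤ (10 * D * N) (*-monoʳ-≤ 15 (+-monoʳ-≤ a (m≤m+n b (b + 0))))) ⟩
      2 * D * (10 * D * N + 15 * n)                      ∎)
      where
      open ≤-Reasoning
      m₁ : ∀ D x n → 2 * D * (x * n) ≡ x * (2 * D * n)
      m₁ = solve-∀
      m₂ : ∀ D N → (20 * (D * D) + 30 * D) * N ≡ 2 * D * (10 * D * N + 15 * N)
      m₂ = solve-∀
      q = r₋ * r₋ + 2 * D * r₋
      E₁ : (6 * D + r₋) * (2 * D + t₋) + q ≡ 24 * (D * D)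
      E₁ = product-at r₋ t₋ 2D₋
      E₂ : 4 * (D * D) ≤ q + 6 * p
      E₂ = lin 4 (s≤s⁻¹ p²>) (m R D)
        where
        m : ∀ R D → 4 * (D * D) + (R + D + 3 + (R + D + 3) * suc (R + D + 3)) + 4 ≡ (R + 1) * (R + 1) + 2 * D * (R + 1) + 6 * (R + D + 3) + 5 * (D * D)
        m = solve-∀
      t₋≤ : t₋ ≤ 2 * D
      t₋≤ = m∸n≤m (2 * D) r₋
      key : (5 * D + p) * (2 * D + t₋) ≤ 20 * (D * D) + 30 * D
      key = ≤-trans (≤-reflexive (m₄ R D t₋)) (≤-trans (+-mono-≤ {(6 * D + r₋) * (2 * D + t₋)} {20 * (D * D) + 6 * p} first (*-monoʳ-≤ 2 (+-monoʳ-≤ (2 * D) t₋≤)))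
        (≤-trans (+-monoˡ-≤ (2 * (2 * D + 2 * D)) (+-monoʳ-≤ (20 * (D * D)) (*-monoʳ-≤ 6 p≤3D))) (lin (4 * D) (≤-refl {0}) (m₅ D))))
        where
        first : (6 * D + r₋) * (2 * D + t₋) ≤ 20 * (D * D) + 6 * p
        first = lin 0 E₂ (trans (m₆ ((6 * D + r₋) * (2 * D + t₋)) q (6 * p)) (trans (cong (_+ 6 * p) E₁) (m₇ D (6 * p))))
          where
          m₆ : ∀ x q y → x + (q + y) + 0 ≡ x + q + y
          m₆ = solve-∀
          m₇ : ∀ D y → 24 * (D * D) + y ≡ 20 * (D * D) + y + 4 * (D * D)
          m₇ = solve-∀
        m₄ : ∀ R D t → (5 * D + (R + D + 3)) * (2 * D + t) ≡ (6 * D + (R + 1)) * (2 * D + t) + 2 * (2 * D + t)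
        m₄ = solve-∀
        m₅ : ∀ D → 20 * (D * D) + 6 * (3 * D) + 2 * (2 * D + 2 * D) + 0 + 4 * D ≡ 20 * (D * D) + 30 * D + 0
        m₅ = solve-∀

-- The compositions of g into ones and twos are the Kunz words of pairwise distinct semigroups.

comps-shape : ∀ n w → w ∈ comps n → (∀ x → x ∈ w → 1 ≤ x × x ≤ 2) × sumL id w ≡ n
comps-shape zero          .[] (here refl) = (λ x ()) , refl
comps-shape (suc zero)    .(1 ∷ []) (here refl) = (λ { x (here refl) → ≤-refl , s≤s z≤n ; x (there ()) }) , refl
comps-shape (suc (suc n)) w i with ∈-++⁻ (map (1 ∷_) (comps (suc n))) i
... | inj₁ i′ with ∈-map⁻ (1 ∷_) i′
...   | v , j , refl with comps-shape (suc n) v j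
...   | h , e = (λ { x (here refl) → ≤-refl , s≤s z≤n ; x (there q) → h x q }) , cong suc e
comps-shape (suc (suc n)) w i | inj₂ i′ with ∈-map⁻ (2 ∷_) i′
...   | v , j , refl with comps-shape n v j
...   | h , e = (λ { x (here refl) → s≤s z≤n , ≤-refl ; x (there q) → h x q }) , cong (2 +_) e

comps-unique : ∀ n → Unique (comps n)
comps-unique zero          = [] ∷ []
comps-unique (suc zero)    = [] ∷ []
comps-unique (suc (suc n)) = Uniqueₚ.++⁺ (Uniqueₚ.map⁺ ∷-injectiveʳ (comps-unique (suc n))) (Uniqueₚ.map⁺ ∷-injectiveʳ (comps-unique n)) disjoint
  where
  disjoint : ∀ {w} → ¬ (w ∈ map (1 ∷_) (comps (suc n)) × w ∈ map (2 ∷_) (comps n))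
  disjoint (i , j) with ∈-map⁻ (1 ∷_) i | ∈-map⁻ (2 ∷_) j
  ... | _ , _ , refl | _ , _ , ()

module _ (g : ℕ) where
  private
    coordinate : List ℕ → ℕ → ℕ
    coordinate w zero    = 0
    coordinate w (suc i) = nth w i

    coordinates : ∀ w → w ∈ comps g → Coordinates g (suc (length w)) (coordinate w)
    coordinates w j = record
      { m>0 = s≤s z≤n ; k₀ = refl ; pos = pos
      ; ≤3 = λ { zero _ → z≤n ; (suc i) l → ≤-trans (proj₂ (h _ (nth-∈ w i (s≤s⁻¹ l)))) (s≤s (s≤s z≤n)) }
      ; sub = sub ; tot = trans (∑-head (length w) (coordinate w)) (trans (∑-nth w) (proj₂ (comps-shape g w j))) }
      where
      h = proj₁ (comps-shape g w j)
      pos : ∀ i → 0 < i → i < suc (length w) → 0 < coordinate w i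
      pos (suc i) _ l = proj₁ (h _ (nth-∈ w i (s≤s⁻¹ l)))
      sub : ∀ i i′ → i + i′ < suc (length w) → coordinate w (i + i′) ≤ coordinate w i + coordinate w i′
      sub zero    i′       l = ≤-refl
      sub (suc i) zero     l = ≤-trans (≤-reflexive (cong (nth w) (+-identityʳ i))) (m≤m+n _ 0)
      sub (suc i) (suc i′) l = ≤-trans (proj₂ (h _ (nth-∈ w (i + suc i′) (s≤s⁻¹ l))))
        (+-mono-≤ (pos (suc i) (s≤s z≤n) (≤-<-trans (m≤m+n (suc i) (suc i′)) l)) (pos (suc i′) (s≤s z≤n) (≤-<-trans (m≤n+m (suc i′) (suc i)) l)))

    word-of : List Bool → List ℕ
    word-of gs = applyUpTo (λ i → kunz# g gs (suc i)) (mult# g gs ∸ 1)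

    word-decode : ∀ w j → word-of (decode (coordinates w j)) ≡ w
    word-decode w j = trans (cong (applyUpTo _) (cong (_∸ 1) m≡)) (applyUpTo-nth w _ λ i l → kunz-unique-k K′ K (suc i) (subst (suc i <_) (sym m≡) (s≤s l)))
      where
      K = decode-kunz (coordinates w j)
      K′ = isKunz (proj₂ (𝒮⇒semigroup g _ (decode∈𝒮 (coordinates w j))))
      m≡ = kunz-unique-m K′ K

    decodes : ∀ ws → (∀ w → w ∈ ws → w ∈ comps g) → List (List Bool)
    decodes []       mem = []
    decodes (w ∷ ws) mem = decode (coordinates w (mem w (here refl))) ∷ decodes ws (λ v i → mem v (there i))

    decodes-length : ∀ ws mem → count (λ _ → true) (decodes ws mem) ≡ length ws
    decodes-length []       mem = refl
    decodes-length (w ∷ ws) mem = cong suc (decodes-length ws _)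

    decodes∈ : ∀ ws mem gs → gs ∈ decodes ws mem → gs ∈ 𝒮 g × word-of gs ∈ ws
    decodes∈ (w ∷ ws) mem gs (here refl) = decode∈𝒮 (coordinates w (mem w (here refl))) , here (word-decode w (mem w (here refl)))
    decodes∈ (w ∷ ws) mem gs (there i) = proj₁ (decodes∈ ws _ gs i) , there (proj₂ (decodes∈ ws _ gs i))

    decodes-unique : ∀ ws mem → Unique ws → Unique (decodes ws mem)
    decodes-unique []       mem []      = []
    decodes-unique (w ∷ ws) mem (f ∷ u) = All.tabulate (λ {gs} i e → All.lookup f (subst (λ x → word-of x ∈ ws) (sym e) (proj₂ (decodes∈ ws _ gs i)))
      (sym (word-decode w (mem w (here refl))))) ∷ decodes-unique ws _ u

  F≤genus-count : F g ≤ count (λ _ → true) (𝒮 g)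
  F≤genus-count = ≤-trans (≤-reflexive (trans (sym (comps-length g)) (sym (decodes-length (comps g) (λ w i → i)))))
    (count-inj (λ _ → true) (λ _ → true) id (decodes (comps g) (λ w i → i)) (𝒮 g) (decodes-unique (comps g) _ (comps-unique g))
      (λ gs i _ → proj₁ (decodes∈ (comps g) _ gs i) , tt) (λ _ _ _ _ _ _ e → e))

-- Which numbers lie in a good semigroup

-- membership of a number in a semigroup all of whose coordinates are at most 3, and at most 2 beyond k₀

module Membership (g k₀ : ℕ) (3k₀<g : 3 * k₀ < g) where
  open Blocks g k₀ 3k₀<g

  module _ (gs : List Bool) (i : gs ∈ 𝒮 g) (G : Good gs) where
    private
      m = mult# g gs
      k = kunz# g gs
      K = isKunz (proj₂ (𝒮⇒semigroup g gs i))
      open IsKunz K using (m>0; spec; pos; gap-below)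
      open Good G

    low∉ : ∀ c → 1 ≤ c → c < m → inS gs c ≡ false
    low∉ c p l = cong not (gap-below c p l)

    -- The number stands in row 1 of its residue class, so it is a gap exactly when the coordinate
    -- is at least 2; beyond k₀ only 1 and 2 occur.
    mid∈ : ∀ r → suc (k₀ + r) < m → inS gs (m + suc (k₀ + r)) ≡ (nth (tail# gs) r ≡ᵇ 1)
    mid∈ r l = trans (cong (λ x → not (isGap gs x)) (trans (+-comm m (suc (k₀ + r))) (cong (suc (k₀ + r) +_) (sym (+-identityʳ m)))))
      (trans (cong not (spec (suc (k₀ + r)) 1 l)) (trans (one-or-two (k (suc (k₀ + r))) (pos (suc (k₀ + r)) (s≤s z≤n) l) (≤2 _ (s≤s (m≤m+n k₀ r)) l))
        (cong (_≡ᵇ 1) (sym (nth-applyUpTo _ (m ∸ suc k₀) r (+-cancelˡ-< (suc k₀) r (m ∸ suc k₀) (subst (suc k₀ + r <_) (sym (m+[n∸m]≡n k₀<)) l)))))))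
      where
      one-or-two : ∀ x → 0 < x → x ≤ 2 → not (1 <ᵇ x) ≡ (x ≡ᵇ 1)
      one-or-two 1 _ _ = refl
      one-or-two 2 _ _ = refl
      one-or-two (suc (suc (suc _))) _ (s≤s (s≤s ()))

    -- Row 2 contains gaps only for coordinate 3, hence only for residues up to k₀, and no row from
    -- 3 on contains any.
    high∈ : ∀ c → 2 * m + k₀ < c → inS gs c ≡ true
    high∈ c l = cong not (trans (cong (isGap gs) c≡) (trans (spec r q r<m) (<ᵇ-false (k≤q q refl))))
      where
      instance
        m≢0 : NonZero m
        m≢0 = >-nonZero m>0
      r = c % m
      q = c / m
      r<m : r < m
      r<m = m%n<n c m
      c≡ : c ≡ r + q * m
      c≡ = m≡m%n+[m/n]*n c m
      k≤q : ∀ q′ → q ≡ q′ → k r ≤ q′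
      k≤q 0 e = ⊥-elim (<⇒≱ l (≤-trans (≤-trans (≤-reflexive (trans c≡ (trans (cong (λ x → r + x * m) e) (+-identityʳ r)))) (<⇒≤ r<m)) (≤-trans (m≤n*m m 2) (m≤m+n (2 * m) k₀))))
      k≤q 1 e = ⊥-elim (<⇒≱ l (≤-trans (≤-trans (≤-reflexive (trans c≡ (cong (λ x → r + x * m) e))) (+-monoˡ-≤ (1 * m) (<⇒≤ r<m))) (m≤m+n (2 * m) k₀)))
      k≤q 2 e = ≤2 r (+-cancelˡ-< (2 * m) k₀ r (≤-trans l (≤-reflexive (trans c≡ (trans (cong (λ x → r + x * m) e) (+-comm r _)))))) r<m
      k≤q (suc (suc (suc x))) e = ≤-trans (≤3 r r<m) (s≤s (s≤s (s≤s z≤n)))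

elem : ℕ → List ℕ → Bool
elem x []      = false
elem x (c ∷ C) = (c ≡ᵇ x) ∨ elem x C

elem⁺ : ∀ {x C} → x ∈ C → T (elem x C)
elem⁺ {x} {c ∷ C} (here refl) rewrite T⇒≡ (≡⇒≡ᵇ c c refl) = tt
elem⁺ {x} {c ∷ C} (there i) with c ≡ᵇ x
... | true  = tt
... | false = elem⁺ i

elem⁻ : ∀ x C → T (elem x C) → x ∈ C
elem⁻ x (c ∷ C) t with c ≡ᵇ x in e
... | true  = here (sym (≡ᵇ⇒≡ c x (≡⇒T e)))
... | false = there (elem⁻ x C t)

elem-count : ∀ x C → Unique C → χ (elem x C) ≡ count (_≡ᵇ x) C
elem-count x []      u = refl
elem-count x (c ∷ C) (f ∷ u) with c ≡ᵇ x in e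
... | false = elem-count x C u
... | true  = cong suc (sym (sumL-zero C (λ y i → cong χ (¬T⇒≡ {y ≡ᵇ x} (λ t → All.lookup f i (trans (≡ᵇ⇒≡ c x (≡⇒T e)) (sym (≡ᵇ⇒≡ y x t))))))))

mask : ℕ → ℕ → List ℕ → List Bool
mask s N C = applyUpTo (λ r → elem (s + r) C) N

trues-mask : ∀ s N C → Unique C → trues (mask s N C) ≡ count (λ c → (s ≤ᵇ c) ∧ (c <ᵇ s + N)) C
trues-mask s N C u = trans (sumL-applyUpTo χ _ N) (trans (∑-cong N (λ r _ → elem-count (s + r) C u)) (trans (sym (sumL-∑ N _ C)) (sumL-cong C (λ c _ → window c))))
  where
  none : ∀ n s c → (∀ r → r < n → c ≢ s + r) → ∑ n (λ r → χ (c ≡ᵇ s + r)) ≡ 0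
  none n s c h = ∑-zero n (λ r l → cong χ (¬T⇒≡ (λ t → h r l (≡ᵇ⇒≡ c (s + r) t))))
  once : ∀ n s r → r < n → ∑ n (λ i → χ (s + r ≡ᵇ s + i)) ≡ 1
  once (suc n) s r l with m≤n⇒m<n∨m≡n (s≤s⁻¹ l)
  ... | inj₁ h = cong₂ _+_ (once n s r h) (cong χ (¬T⇒≡ (λ t → <⇒≢ h (+-cancelˡ-≡ s r n (≡ᵇ⇒≡ (s + r) (s + n) t)))))
  ... | inj₂ refl = cong₂ _+_ (none n s (s + n) (λ i l e → <⇒≢ l (sym (+-cancelˡ-≡ s n i e)))) (cong χ (T⇒≡ (≡⇒≡ᵇ (s + n) (s + n) refl)))
  window : ∀ c → ∑ N (λ r → χ (c ≡ᵇ s + r)) ≡ χ ((s ≤ᵇ c) ∧ (c <ᵇ s + N))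
  window c with s ≤? c
  ... | no h  = trans (none N s c (λ r l e → h (≤-trans (m≤m+n s r) (≤-reflexive (sym e))))) (cong (λ x → χ (x ∧ (c <ᵇ s + N))) (sym (≤ᵇ-false (≰⇒> h))))
  ... | yes h with c <? s + N
  ...   | yes h′ = trans (subst (λ x → ∑ N (λ r → χ (x ≡ᵇ s + r)) ≡ 1) (m+[n∸m]≡n h) (once N s (c ∸ s) (+-cancelˡ-< s _ _ (subst (_< s + N) (sym (m+[n∸m]≡n h)) h′))))
                     (cong₂ (λ x y → χ (x ∧ y)) (sym (≤ᵇ-true h)) (sym (<ᵇ-true h′)))
  ...   | no h′  = trans (none N s c (λ r l e → h′ (≤-trans (s≤s (≤-reflexive e)) (+-monoʳ-< s l))))
                     (cong₂ (λ x y → χ (x ∧ y)) (sym (≤ᵇ-true h)) (sym (<ᵇ-false (≮⇒≥ h′))))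

fits-mask⁺ : ∀ f w → (∀ r → r < length w → T (f r) → nth w r ≡ 1) → T (fits-mask (applyUpTo f (length w)) w)
fits-mask⁺ f []      h = tt
fits-mask⁺ f (x ∷ w) h with f 0 in e
... | true  = T-∧⁺ {x ≡ᵇ 1} (≡⇒≡ᵇ x 1 (h 0 (s≤s z≤n) (≡⇒T e))) (fits-mask⁺ (f ∘ suc) w (λ r l → h (suc r) (s≤s l)))
... | false = fits-mask⁺ (f ∘ suc) w (λ r l → h (suc r) (s≤s l))

fits-mask⁻ : ∀ f w → T (fits-mask (applyUpTo f (length w)) w) → ∀ r → r < length w → T (f r) → nth w r ≡ 1
fits-mask⁻ f (x ∷ w) t r l tf with f 0 in e
fits-mask⁻ f (x ∷ w) t zero    l tf | true  = ≡ᵇ⇒≡ x 1 (proj₁ (T-∧⁻ {x ≡ᵇ 1} t))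
fits-mask⁻ f (x ∷ w) t zero    l tf | false = ⊥-elim (subst T e tf)
fits-mask⁻ f (x ∷ w) t (suc r) l tf | true  = fits-mask⁻ (f ∘ suc) w (proj₂ (T-∧⁻ {x ≡ᵇ 1} t)) r (s≤s⁻¹ l) tf
fits-mask⁻ f (x ∷ w) t (suc r) l tf | false = fits-mask⁻ (f ∘ suc) w t r (s≤s⁻¹ l) tf

-- The three zones of the theorem, as inequalities of integers: P / T with T = 10 D and P = 5 D + p approximates γ.

data Zone (D p g c : ℕ) : Set where
  lowZone  : 1 ≤ c → 10 * D * c + 200 * g ≤ (5 * D + p + 1) * g → Zone D p g c
  midZone  : (5 * D + p) * g + 200 * g ≤ 10 * D * c → 10 * D * c + 200 * g ≤ (2 * (5 * D + p) + 2) * g → Zone D p g c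
  highZone : 2 * (5 * D + p) * g + 200 * g ≤ 10 * D * c → Zone D p g c

isLow isMid : ∀ {D p g c} → Zone D p g c → Bool
isLow (lowZone _ _) = true
isLow (midZone _ _) = false
isLow (highZone _)  = false
isMid (lowZone _ _) = false
isMid (midZone _ _) = true
isMid (highZone _)  = false

anyLow : ∀ {D p g C} → All (Zone D p g) C → Bool
anyLow []       = false
anyLow (z ∷ zs) = isLow z ∨ anyLow zs

mids : ∀ {D p g C} → All (Zone D p g) C → ℕ
mids []       = 0
mids (z ∷ zs) = χ (isMid z) + mids zs

module Geography (D p g : ℕ) (g>0 : 0 < g) where

  -- m is within 64/(10D) · g of γ g, and k₀ is at most 2g/D
  record Near (m k₀ : ℕ) : Set where
    field
      below : 10 * D * m ≤ (5 * D + p) * g + 64 * g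
      above : (5 * D + p) * g ≤ 10 * D * m + 64 * g
      cut   : 10 * D * k₀ ≤ 20 * g

  module _ {m k₀ : ℕ} (N : Near m k₀) where
    open Near N

    private
      τ = 10 * D

      strict : ∀ {x y} → τ * x + g ≤ τ * y → x < y
      strict {x} {y} h = ≰⇒> λ l → <⇒≱ g>0 (+-cancelˡ-≤ (τ * y) g 0 (≤-trans (+-monoˡ-≤ g (*-monoʳ-≤ τ l)) (≤-trans h (≤-reflexive (sym (+-identityʳ _))))))

    low-place : ∀ {c} → τ * c + 200 * g ≤ (5 * D + p + 1) * g → c < m
    low-place {c} h = strict {c} {m} (lin (134 * g) (+-mono-≤ h above) (l (5 * D + p) g (τ * c) (τ * m)))
      where
      l : ∀ P g x y → x + g + ((P + 1) * g + (y + 64 * g)) + 134 * g ≡ y + (x + 200 * g + P * g)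
      l = solve-∀

    mid-place : ∀ {c} → (5 * D + p) * g + 200 * g ≤ τ * c → τ * c + 200 * g ≤ (2 * (5 * D + p) + 2) * g → m + k₀ < c × c < 2 * m
    mid-place {c} h h′ = strict {m + k₀} {c} (lin (115 * g) (+-mono-≤ h (+-mono-≤ below cut)) (l (5 * D + p) g (τ * c) τ m k₀))
        , strict {c} {2 * m} (lin (69 * g) (+-mono-≤ h′ (+-mono-≤ above above)) (l′ (5 * D + p) g (τ * c) τ m))
      where
      l : ∀ P g x τ m k → τ * (m + k) + g + (x + (P * g + 64 * g + 20 * g)) + 115 * g ≡ x + (P * g + 200 * g + (τ * m + τ * k))
      l = solve-∀
      l′ : ∀ P g x τ m → x + g + ((2 * P + 2) * g + (τ * m + 64 * g + (τ * m + 64 * g))) + 69 * g ≡ τ * (2 * m) + (x + 200 * g + (P * g + P * g))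
      l′ = solve-∀

    -- The margin 200 g has to cover twice the error 64 g of m, the 20 g of the cutoff, and one g
    -- for strictness. This is the most demanding of the three places.
    high-place : ∀ {c} → 2 * (5 * D + p) * g + 200 * g ≤ τ * c → 2 * m + k₀ < c
    high-place {c} h = strict {2 * m + k₀} {c} (lin (51 * g) (+-mono-≤ h (+-mono-≤ (+-mono-≤ below below) cut)) (l (5 * D + p) g (τ * c) τ m k₀))
      where
      l : ∀ P g x τ m k → τ * (2 * m + k) + g + (x + (P * g + 64 * g + (P * g + 64 * g) + 20 * g)) + 51 * g ≡ x + (2 * P * g + 200 * g + (τ * m + τ * m + τ * k))
      l = solve-∀

  module Window (m k₀ : ℕ) (k₀<m : k₀ < m) (N : Near m k₀) where
    -- The interval from s up to, but excluding, s + r = 2 m consists of the numbers whose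
    -- membership is decided by the tail, one letter for each.
    s r : ℕ
    s = m + suc k₀
    r = m ∸ suc k₀

    r≡ : suc k₀ + r ≡ m
    r≡ = m+[n∸m]≡n k₀<m

    s+r : s + r ≡ 2 * m
    s+r = trans (+-assoc m (suc k₀) r) (trans (cong (m +_) r≡) (cong (m +_) (sym (+-identityʳ m))))

    private
      inside : ∀ {c} → m + k₀ < c × c < 2 * m → χ ((s ≤ᵇ c) ∧ (c <ᵇ s + r)) ≡ 1
      inside (l , u) = cong₂ (λ x y → χ (x ∧ y)) (≤ᵇ-true (≤-trans (≤-reflexive (+-suc m k₀)) l)) (<ᵇ-true (≤-trans u (≤-reflexive (sym s+r))))

      outside : ∀ {c} → 2 * m + k₀ < c → χ ((s ≤ᵇ c) ∧ (c <ᵇ s + r)) ≡ 0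
      outside {c} l = trans (cong (λ x → χ ((s ≤ᵇ c) ∧ x)) (<ᵇ-false (≤-trans (≤-reflexive s+r) (≤-trans (m≤m+n (2 * m) k₀) (<⇒≤ l)))))
        (cong χ (Data.Bool.Properties.∧-zeroʳ (s ≤ᵇ c)))

    mids-window : ∀ {C} (zs : All (Zone D p g) C) → anyLow zs ≡ false → count (λ c → (s ≤ᵇ c) ∧ (c <ᵇ s + r)) C ≡ mids zs
    mids-window []                 e = refl
    mids-window (midZone h h′ ∷ zs) e = cong₂ _+_ (inside (mid-place N h h′)) (mids-window zs e)
    mids-window (highZone h ∷ zs)   e = cong₂ _+_ (outside (high-place N h)) (mids-window zs e)

  module _ (k₀ : ℕ) (3k₀<g : 3 * k₀ < g) where
    open Blocks g k₀ 3k₀<g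
    open Membership g k₀ 3k₀<g

    module _ (gs : List Bool) (i : gs ∈ 𝒮 g) (G : Good gs) (N : Near (mult# g gs) k₀) where
      private
        m = mult# g gs

      low-excluded : ∀ {C} (zs : All (Zone D p g) C) → T (anyLow zs) → allB (inS gs) C ≡ false
      low-excluded {c ∷ C} (lowZone p h ∷ zs) t = cong (_∧ allB (inS gs) C) (low∉ gs i G c p (low-place N h))
      low-excluded {c ∷ C} (midZone _ _ ∷ zs) t = trans (cong (inS gs c ∧_) (low-excluded zs t)) (Data.Bool.Properties.∧-zeroʳ (inS gs c))
      low-excluded {c ∷ C} (highZone _ ∷ zs)  t = trans (cong (inS gs c ∧_) (low-excluded zs t)) (Data.Bool.Properties.∧-zeroʳ (inS gs c))

      private
        open Window m k₀ (Good.k₀< G) N using (s; r; r≡; s+r)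

        index : ∀ {c} → m + k₀ < c → c < 2 * m → ∃[ j ] (j < r × c ≡ s + j)
        index {c} l u = c ∸ s , +-cancelˡ-< s (c ∸ s) r (subst₂ _<_ (sym c≡) (sym s+r) u) , sym c≡
          where
          c≡ : s + (c ∸ s) ≡ c
          c≡ = m+[n∸m]≡n (≤-trans (≤-reflexive (+-suc m k₀)) l)

        at : ∀ j → j < r → inS gs (s + j) ≡ (nth (tail# gs) j ≡ᵇ 1)
        at j l = trans (cong (inS gs) (+-assoc m (suc k₀) j)) (mid∈ gs i G j (subst (suc (k₀ + j) <_) r≡ (+-monoʳ-< (suc k₀) l)))

        zone-of : ∀ {C} (zs : All (Zone D p g) C) → anyLow zs ≡ false → ∀ c → c ∈ C → (m + k₀ < c × c < 2 * m) ⊎ (2 * m + k₀ < c)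
        zone-of (midZone h h′ ∷ zs) e c (here refl) = inj₁ (mid-place N h h′)
        zone-of (highZone h ∷ zs)   e c (here refl) = inj₂ (high-place N h)
        zone-of (midZone _ _ ∷ zs)  e c (there j)   = zone-of zs e c j
        zone-of (highZone _ ∷ zs)   e c (there j)   = zone-of zs e c j

      -- Without low elements the condition C ⊆ S concerns the tail only: elements beyond 2 m + k₀
      -- belong to S anyway, and every other element demands the letter 1 at its place.
      subset-mask : ∀ {C} (zs : All (Zone D p g) C) → anyLow zs ≡ false → allB (inS gs) C ≡ fits-mask (mask (m + suc k₀) (m ∸ suc k₀) C) (tail# gs)
      subset-mask {C} zs e = subst (λ n → allB (inS gs) C ≡ fits-mask (mask s n C) (tail# gs)) (tail-length gs) (T-⇔ forth back)
        where
        len : length (tail# gs) ≡ r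
        len = tail-length gs
        forth : T (allB (inS gs) C) → T (fits-mask (mask s (length (tail# gs)) C) (tail# gs))
        forth t = fits-mask⁺ (λ j → elem (s + j) C) (tail# gs) λ j l te →
          ≡ᵇ⇒≡ (nth (tail# gs) j) 1 (subst T (at j (subst (j <_) len l)) (allB⁻ (inS gs) C t (s + j) (elem⁻ (s + j) C te)))
        back : T (fits-mask (mask s (length (tail# gs)) C) (tail# gs)) → T (allB (inS gs) C)
        back t = allB⁺ (inS gs) C λ c j → place c j (zone-of zs e c j)
          where
          place : ∀ c → c ∈ C → (m + k₀ < c × c < 2 * m) ⊎ (2 * m + k₀ < c) → T (inS gs c)
          place c j (inj₂ h) = ≡⇒T (high∈ gs i G c h)
          place c j (inj₁ (l , u)) with index l u
          ... | x , x<r , refl = ≡⇒T (trans (at x x<r) (T⇒≡ (≡⇒≡ᵇ (nth (tail# gs) x) 1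
                (fits-mask⁻ (λ j → elem (s + j) C) (tail# gs) t x (subst (x <_) (sym len) x<r) (elem⁺ j)))))

-- Summation over blocks, patterns and bad semigroups

mids-≤ : ∀ {D p g C} (zs : All (Zone D p g) C) → mids zs ≤ length C
mids-≤ []       = z≤n
mids-≤ (z ∷ zs) = +-mono-≤ (χ≤1 (isMid z)) (mids-≤ zs)

-- In the application `f` counts the blocks of a pattern, `f′` their members containing C, and `t`
-- agrees with `f` on atypical blocks and vanishes elsewhere. There nothing better than `f′` ≤ `f`
-- is known, and the error is 1/K of the total.
weighted-upper : ∀ n K x y (f f′ t : ℕ → ℕ) → (∀ b → b < n → x * f′ b ≤ y * f b + x * t b) → K * ∑ n t ≤ ∑ n f →
  K * x * ∑ n f′ ≤ (K * y + x) * ∑ n f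
weighted-upper n K x y f f′ t h k = begin
  K * x * ∑ n f′                          ≡⟨ trans (*-assoc K x _) (cong (K *_) (sym (∑-*ˡ n x f′))) ⟩
  K * ∑ n (λ b → x * f′ b)                ≤⟨ *-monoʳ-≤ K (∑-mono n h) ⟩
  K * ∑ n (λ b → y * f b + x * t b)       ≡⟨ cong (K *_) (trans (∑-+ n (λ b → y * f b) (λ b → x * t b)) (cong₂ _+_ (∑-*ˡ n y f) (∑-*ˡ n x t))) ⟩
  K * (y * ∑ n f + x * ∑ n t)             ≡⟨ l K y x (∑ n f) (∑ n t) ⟩
  K * y * ∑ n f + x * (K * ∑ n t)         ≤⟨ +-monoʳ-≤ (K * y * ∑ n f) (*-monoʳ-≤ x k) ⟩
  K * y * ∑ n f + x * ∑ n f               ≡⟨ sym (*-distribʳ-+ (∑ n f) (K * y) x) ⟩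
  (K * y + x) * ∑ n f                     ∎
  where
  open ≤-Reasoning
  l : ∀ K y x a b → K * (y * a + x * b) ≡ K * y * a + x * (K * b)
  l = solve-∀

weighted-lower : ∀ n K x y (f f′ t : ℕ → ℕ) → (∀ b → b < n → y * f b ≤ x * f′ b + y * t b) → K * ∑ n t ≤ ∑ n f →
  K * y * ∑ n f ≤ K * x * ∑ n f′ + y * ∑ n f
weighted-lower n K x y f f′ t h k = begin
  K * y * ∑ n f                           ≡⟨ trans (*-assoc K y _) (cong (K *_) (sym (∑-*ˡ n y f))) ⟩
  K * ∑ n (λ b → y * f b)                 ≤⟨ *-monoʳ-≤ K (∑-mono n h) ⟩
  K * ∑ n (λ b → x * f′ b + y * t b)      ≡⟨ cong (K *_) (trans (∑-+ n (λ b → x * f′ b) (λ b → y * t b)) (cong₂ _+_ (∑-*ˡ n x f′) (∑-*ˡ n y t))) ⟩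
  K * (x * ∑ n f′ + y * ∑ n t)            ≡⟨ l K x y (∑ n f′) (∑ n t) ⟩
  K * x * ∑ n f′ + y * (K * ∑ n t)        ≤⟨ +-monoʳ-≤ (K * x * ∑ n f′) (*-monoʳ-≤ y k) ⟩
  K * x * ∑ n f′ + y * ∑ n f              ∎
  where
  open ≤-Reasoning
  l : ∀ K x y a b → K * (x * a + y * b) ≡ K * x * a + y * (K * b)
  l = solve-∀

module Estimate {D R : ℕ} (Sc : Scale D R) (K l : ℕ) where
  open Scale Sc
  open Typical Sc

  private
    instance
      D≢0 : NonZero D
      D≢0 = >-nonZero (≤-trans (s≤s z≤n) D≥12)

    rare = atypical-rare K
    scarce = bad-negligible D K

  M : ℕ
  -- The term 10 D pays for the 1 in m = k₀ + 1 + N, and 8 D l gives 2 D l ≤ N, the room needed by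
  -- `Bm-lower`. The bound for atypical blocks is doubled because it is applied to n, which is at
  -- least g / 2.
  M = suc (10 * D + (8 * D * l + (2 * proj₁ rare + proj₁ scarce)))

  module At (g : ℕ) (M≤g : M ≤ g) where

    g>0 : 0 < g
    g>0 = ≤-trans (s≤s z≤n) M≤g

    private
      M′ = ≤-trans (n≤1+n _) M≤g

      10D≤g : 10 * D ≤ g
      10D≤g = ≤-trans (m≤m+n (10 * D) _) M′

      8Dl≤g : 8 * D * l ≤ g
      8Dl≤g = ≤-trans (≤-trans (m≤m+n (8 * D * l) _) (m≤n+m _ (10 * D))) M′

      2rare≤g : 2 * proj₁ rare ≤ g
      2rare≤g = ≤-trans (≤-trans (m≤m+n _ (proj₁ scarce)) (≤-trans (m≤n+m _ (8 * D * l)) (m≤n+m _ (10 * D)))) M′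

      scarce≤g : proj₁ scarce ≤ g
      scarce≤g = ≤-trans (≤-trans (m≤n+m _ (2 * proj₁ rare)) (≤-trans (m≤n+m _ (8 * D * l)) (m≤n+m _ (10 * D)))) M′

    q k₀ : ℕ
    q = g / D
    k₀ = q + q

    private
      Dq≤g : D * q ≤ g
      Dq≤g = ≤-trans (≤-reflexive (*-comm D q)) (≤-trans (m≤n+m (q * D) (g % D)) (≤-reflexive (sym (m≡m%n+[m/n]*n g D))))

      12q≤g : 12 * q ≤ g
      12q≤g = ≤-trans (*-monoˡ-≤ q D≥12) Dq≤g

    3k₀<g : 3 * k₀ < g
    3k₀<g = halve (3 * k₀) g g>0 (≤-trans (≤-reflexive (m q)) 12q≤g)
      where
      m : ∀ q → 2 * (3 * (q + q)) ≡ 12 * q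
      m = solve-∀
      halve : ∀ x g → 0 < g → 2 * x ≤ g → x < g
      halve zero    g g>0 h = g>0
      halve (suc x) g g>0 h = ≤-trans (s≤s (m≤m+n (suc x) x)) (≤-trans (≤-reflexive (trans (cong suc (+-comm (suc x) x)) (m′ x))) h)
        where
        m′ : ∀ x → suc (x + suc x) ≡ 2 * suc x
        m′ = solve-∀

    open Blocks g k₀ 3k₀<g
    open Geography D p g g>0

    module OnePattern (gs₀ : List Bool) (i₀ : gs₀ ∈ 𝒮 g) (G₀ : Good gs₀) where
      open Block gs₀ i₀ G₀

      σ : ℕ
      σ = sumL id P

      σ≤ : σ ≤ 3 * k₀
      σ≤ = ≤-trans (≤-reflexive (sumL-applyUpTo id _ k₀)) (≤-trans (∑-bound k₀ 3 (λ i h → Good.≤3 G₀ (suc i) (≤-<-trans h (Good.k₀< G₀)))) (≤-reflexive (*-comm k₀ 3)))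

      n+σ : n + σ ≡ g
      n+σ = m∸n+n≡m (≤-trans σ≤ (<⇒≤ 3k₀<g))

      n≤g : n ≤ g
      n≤g = m∸n≤m g σ

      g≤2n : g ≤ 2 * n
      g≤2n = lin 0 (≤-trans (*-monoʳ-≤ 2 σ≤) (≤-trans (≤-reflexive (m q)) 12q≤g)) (trans (+-identityʳ (g + g)) (trans (cong₂ _+_ (sym n+σ) (sym n+σ)) (m′ n σ)))
        where
        m : ∀ q → 2 * (3 * (q + q)) ≡ 12 * q
        m = solve-∀
        m′ : ∀ n s → n + s + (n + s) ≡ 2 * n + 2 * s
        m′ = solve-∀

      module TypicalBlock (b : ℕ) (2b≤n : 2 * b ≤ n) (ty : T (typical (n ∸ 2 * b) b)) where
        a N m : ℕ
        a = n ∸ 2 * b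
        N = a + b
        m = suc k₀ + N

        a+2b : a + 2 * b ≡ n
        a+2b = m∸n+n≡m 2b≤n

        -- The pattern has sum at most 3 k₀ = 6 q, so passing from n to g costs at most 8 D · 6 q ≤
        -- 48 g. Together with the 15 g from the length of a typical word this stays below 64 g, in
        -- units of 1 / (10 D).
        near : Near m k₀
        near = record
          { below = ≤-trans (≤-reflexive (*-distribˡ-+ (10 * D) (suc k₀) N)) (≤-trans (+-mono-≤ first (≤-trans (length-upper a b ty) (*-monoʳ-≤ (5 * D + p + 15) (≤-trans (≤-reflexive a+2b) n≤g))))
                      (lin (28 * g) (≤-refl {0}) (m₁ (5 * D + p) g)))
          ; above = lin (10 * D * suc k₀ + g) (+-mono-≤ (length-lower a b ty) (+-mono-≤ (*-monoʳ-≤ 15 (≤-trans (≤-reflexive a+2b) n≤g)) Pσ))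
                      (trans (cong (λ x → (5 * D + p) * x + (10 * D * N + 15 * (a + 2 * b) + (15 * g + 48 * g)) + (10 * D * suc k₀ + g)) (sym (trans (cong (_+ σ) a+2b) n+σ))) (m₂ (5 * D + p) (10 * D) N (a + 2 * b) σ g k₀))
          ; cut = cut }
          where
          cut : 10 * D * k₀ ≤ 20 * g
          cut = ≤-trans (≤-reflexive (μ D q)) (*-monoʳ-≤ 20 Dq≤g)
            where
            μ : ∀ D q → 10 * D * (q + q) ≡ 20 * (D * q)
            μ = solve-∀
          first : 10 * D * suc k₀ ≤ 21 * g
          first = ≤-trans (≤-reflexive (*-suc (10 * D) k₀)) (+-mono-≤ 10D≤g cut)
          m₁ : ∀ P g → 21 * g + (P + 15) * g + 0 + 28 * g ≡ P * g + 64 * g + 0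
          m₁ = solve-∀
          Pσ : (5 * D + p) * σ ≤ 48 * g
          Pσ = ≤-trans (*-mono-≤ (+-monoʳ-≤ (5 * D) p≤3D) σ≤) (≤-trans (≤-reflexive (μ D q)) (*-monoʳ-≤ 48 Dq≤g))
            where
            μ : ∀ D q → (5 * D + 3 * D) * (3 * (q + q)) ≡ 48 * (D * q)
            μ = solve-∀
          m₂ : ∀ P τ N n s g k → P * (n + s) + (τ * N + 15 * n + (15 * g + 48 * g)) + (τ * suc k + g) ≡ τ * (suc k + N) + 64 * g + (P * n + (15 * n + P * s))
          m₂ = solve-∀

        k₀<m : k₀ < m
        k₀<m = m≤m+n (suc k₀) N

        r≡N : m ∸ suc k₀ ≡ N
        r≡N = m+n∸m≡n (suc k₀) N

        block-mult : ∀ gs → gs ∈ 𝒮 g → T (block P b gs) → Good gs × mult# g gs ≡ m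
        block-mult gs i t = G , trans (sym (m+[n∸m]≡n (Good.k₀< G))) (cong (suc k₀ +_) (trans (sym (tail-length gs))
            (trans (proj₂ (sum-ones-twos (tail# gs) (tail-entries gs i G))) (cong₂ _+_ (tail-ones b gs i t) (proj₂ (proj₂ (block-sound b gs i t)))))))
          where G = proj₁ (block-sound b gs i t)

        no-low-members : ∀ {C} (zs : All (Zone D p g) C) → T (anyLow zs) → count (λ gs → block P b gs ∧ allB (inS gs) C) (𝒮 g) ≡ 0
        no-low-members {C} zs t = sumL-zero (𝒮 g) λ gs i → cong χ (¬T⇒≡ {block P b gs ∧ allB (inS gs) C} λ tt′ →
          let tb , tc = T-∧⁻ {block P b gs} tt′
              G , em = block-mult gs i tb
          in subst T (low-excluded k₀ 3k₀<g gs i G (subst (λ x → Near x k₀) (sym em) near) zs t) tc)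

        members : ∀ {C} (zs : All (Zone D p g) C) → Unique C → anyLow zs ≡ false →
          count (λ gs → block P b gs ∧ allB (inS gs) C) (𝒮 g) ≡ Bm (mids zs) a b
        members {C} zs u e = trans (block-count b 2b≤n (λ gs → allB (inS gs) C) (fits-mask ms) same)
            (trans (count-mask a b ms (length-applyUpTo _ N)) (cong (λ x → Bm x a b) (trans (trues-mask (m + suc k₀) N C u) window)))
          where
          ms = mask (m + suc k₀) N C
          window : count (λ c → (m + suc k₀ ≤ᵇ c) ∧ (c <ᵇ m + suc k₀ + N)) C ≡ mids zs
          window = subst (λ x → count (λ c → (m + suc k₀ ≤ᵇ c) ∧ (c <ᵇ m + suc k₀ + x)) C ≡ mids zs) r≡N (Window.mids-window m k₀ k₀<m near zs e)
          same : ∀ gs → gs ∈ 𝒮 g → T (block P b gs) → allB (inS gs) C ≡ fits-mask ms (tail# gs)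
          same gs i t = trans (subset-mask k₀ 3k₀<g gs i G (subst (λ x → Near x k₀) (sym em) near) zs e)
            (trans (cong (λ x → fits-mask (mask (x + suc k₀) (x ∸ suc k₀) C) (tail# gs)) em) (cong (λ x → fits-mask (mask (m + suc k₀) x C) (tail# gs)) r≡N))
            where
            G = proj₁ (block-mult gs i t)
            em = proj₂ (block-mult gs i t)

        all-members : count (λ gs → block P b gs ∧ true) (𝒮 g) ≡ B a b
        all-members = trans (block-count b 2b≤n (λ _ → true) (λ _ → true) (λ _ _ _ → refl)) (count-W a b)

        long : ∀ ℓ → ℓ ≤ l → 2 * D * ℓ ≤ N
        long ℓ h = cancel*ˡ 4 (s≤s z≤n) (≤-trans (≤-reflexive (m₁ D ℓ)) (≤-trans (*-monoʳ-≤ (8 * D) h) (≤-trans 8Dl≤g (≤-trans g≤2n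
          (≤-trans (*-monoʳ-≤ 2 (≤-trans (≤-reflexive (sym a+2b)) (≤-trans (m≤m+n _ a) (≤-reflexive (m₂ a b))))) (≤-reflexive (m₃ N)))))))
          where
          m₁ : ∀ D ℓ → 4 * (2 * D * ℓ) ≡ 8 * D * ℓ
          m₁ = solve-∀
          m₂ : ∀ a b → a + 2 * b + a ≡ 2 * (a + b)
          m₂ = solve-∀
          m₃ : ∀ N → 2 * (2 * N) ≡ 4 * N
          m₃ = solve-∀

        upper : ∀ ℓ → (2 * D) ^ ℓ * Bm ℓ a b ≤ (R + 5) ^ ℓ * B a b
        upper ℓ = Bm-upper (2 * D) (R + 5) ℓ a b t-bound (typical-upper a b ty)

        -- The typical bound has R + 1; one unit, N in total, is given up as room for prescribing ℓ
        -- ones.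
        lower : ∀ ℓ → ℓ ≤ l → R ^ ℓ * B a b ≤ (2 * D) ^ ℓ * Bm ℓ a b
        lower ℓ h = Bm-lower (2 * D) R ℓ a b (≤-trans (s≤s z≤n) (≤-trans D≥12 (m≤m+n D (D + 0))))
          (≤-trans (+-monoʳ-≤ (R * N) (long ℓ h)) (≤-trans (≤-reflexive (m₁ R N)) (typical-lower a b ty)))
          where
          m₁ : ∀ R N → R * N + N ≡ (R + 1) * N
          m₁ = solve-∀

      f : ℕ → ℕ
      f b = count (λ gs → block P b gs ∧ true) (𝒮 g)

      t : ℕ → ℕ
      t b = χ (not (typical (n ∸ 2 * b) b)) * Tn n b

      f≡Tn : ∀ b → f b ≡ Tn n b
      f≡Tn b = go (2 * b ≤? n)
        where
        go : Dec (2 * b ≤ n) → f b ≡ Tn n b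
        go (yes h) = trans (trans (block-count b h (λ _ → true) (λ _ → true) (λ _ _ _ → refl)) (count-W (n ∸ 2 * b) b)) (sym (Tn-eq {n} {b} h))
        go (no h)  = trans (block-empty b (≰⇒> h) (λ _ → true)) (sym (Tn-zero {n} {b} (≰⇒> h)))

      rare-sum : K * ∑ (suc g) t ≤ ∑ (suc g) f
      rare-sum = ≤-trans (proj₂ rare n g (cancel*ˡ 2 (s≤s z≤n) (≤-trans 2rare≤g g≤2n)) n≤g g≤2n) (≤-reflexive (sym (∑-cong (suc g) (λ b _ → f≡Tn b))))

      module _ {C : List ℕ} (zs : All (Zone D p g) C) where
        f′ : ℕ → ℕ
        f′ b = count (λ gs → block P b gs ∧ allB (inS gs) C) (𝒮 g)

        f′≤f : ∀ b → f′ b ≤ f b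
        f′≤f b = count-mono (𝒮 g) λ gs _ h → T-∧⁺ {block P b gs} (proj₁ (T-∧⁻ {block P b gs} h)) tt

        -- An atypical b has `t b` equal to `f b`; for typical b either 2 b > n and all three
        -- numbers vanish, or the exact count of the block is available and `t b` is 0.
        cases : ∀ b (Q : ℕ → ℕ → ℕ → Set) → (f′ b ≤ f b → Q (f′ b) (f b) (f b)) → Q 0 0 0 →
          (∀ (h : 2 * b ≤ n) (ty : T (typical (n ∸ 2 * b) b)) → Q (f′ b) (f b) 0) → Q (f′ b) (f b) (t b)
        cases b Q atyp none typ = go (typical (n ∸ 2 * b) b) refl
          where
          go : ∀ ty → typical (n ∸ 2 * b) b ≡ ty → Q (f′ b) (f b) (t b)
          go false e = subst (Q (f′ b) (f b)) (sym (trans (cong (λ x → χ (not x) * Tn n b) e) (trans (+-identityʳ (Tn n b)) (sym (f≡Tn b))))) (atyp (f′≤f b))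
          go true e = subst (Q (f′ b) (f b)) (sym (cong (λ x → χ (not x) * Tn n b) e)) (inner (2 * b ≤? n))
            where
            inner : Dec (2 * b ≤ n) → Q (f′ b) (f b) 0
            inner (yes h) = typ h (≡⇒T e)
            inner (no h)  = subst₂ (λ x y → Q x y 0) (sym (n≤0⇒n≡0 (≤-trans (f′≤f b) (≤-reflexive f0)))) (sym f0) none
              where
              f0 : f b ≡ 0
              f0 = block-empty b (≰⇒> h) (λ _ → true)

        low-sum : T (anyLow zs) → K * 1 * ∑ (suc g) f′ ≤ (K * 0 + 1) * ∑ (suc g) f
        low-sum tl = weighted-upper (suc g) K 1 0 f f′ t (λ b _ → cases b (λ x y z → 1 * x ≤ 0 * y + 1 * z)
          (λ h → *-monoʳ-≤ 1 h) ≤-refl (λ h ty → ≤-reflexive (cong (1 *_) (TypicalBlock.no-low-members b h ty zs tl)))) rare-sum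

        module _ (u : Unique C) (e : anyLow zs ≡ false) where
          private
            ℓ = mids zs
            x = (2 * D) ^ ℓ

          upper-sum : K * x * ∑ (suc g) f′ ≤ (K * (R + 5) ^ ℓ + x) * ∑ (suc g) f
          upper-sum = weighted-upper (suc g) K x ((R + 5) ^ ℓ) f f′ t (λ b _ → cases b (λ X Y Z → x * X ≤ (R + 5) ^ ℓ * Y + x * Z)
            (λ h → ≤-trans (*-monoʳ-≤ x h) (m≤n+m _ _)) (≤-trans (≤-reflexive (*-zeroʳ x)) z≤n)
            (λ h ty → ≤-trans (subst₂ (λ X Y → x * X ≤ (R + 5) ^ ℓ * Y) (sym (TypicalBlock.members b h ty zs u e)) (sym (TypicalBlock.all-members b h ty)) (TypicalBlock.upper b h ty ℓ)) (m≤m+n _ _))) rare-sum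

          lower-sum : ℓ ≤ l → K * R ^ ℓ * ∑ (suc g) f ≤ K * x * ∑ (suc g) f′ + R ^ ℓ * ∑ (suc g) f
          lower-sum ℓ≤l = weighted-lower (suc g) K x (R ^ ℓ) f f′ t (λ b _ → cases b (λ X Y Z → R ^ ℓ * Y ≤ x * X + R ^ ℓ * Z)
            (λ h → m≤n+m _ _) (≤-trans (≤-reflexive (*-zeroʳ (R ^ ℓ))) z≤n)
            (λ h ty → ≤-trans (subst₂ (λ X Y → R ^ ℓ * Y ≤ x * X) (sym (TypicalBlock.members b h ty zs u e)) (sym (TypicalBlock.all-members b h ty)) (TypicalBlock.lower b h ty ℓ ℓ≤l)) (m≤m+n _ _))) rare-sum

    module _ {C : List ℕ} (zs : All (Zone D p g) C) where
      private
        all : List Bool → Bool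
        all _ = true
        contains : List Bool → Bool
        contains gs = allB (inS gs) C
        φ φ′ : List ℕ → ℕ
        φ P  = ∑ (suc g) (λ b → count (λ gs → block P b gs ∧ true) (𝒮 g))
        φ′ P = ∑ (suc g) (λ b → count (λ gs → block P b gs ∧ contains gs) (𝒮 g))

        -- A pattern carried by no good semigroup contributes 0 on both sides. Any other is the
        -- pattern of an actual semigroup, which is what makes all its completions admissible.
        per-pattern : (Q : ℕ → ℕ → Set) → Q 0 0 →
          (∀ gs₀ (i₀ : gs₀ ∈ 𝒮 g) (G₀ : Good gs₀) → Q (∑ (suc g) (OnePattern.f′ gs₀ i₀ G₀ zs)) (∑ (suc g) (OnePattern.f gs₀ i₀ G₀))) →
          ∀ P → Q (φ′ P) (φ P)
        per-pattern Q zero′ some P = go (count pat (𝒮 g)) refl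
          where
          pat : List Bool → Bool
          pat gs = good gs ∧ eqL (pattern# gs) P
          go : ∀ c → count pat (𝒮 g) ≡ c → Q (φ′ P) (φ P)
          go zero e = subst₂ Q (sym (vanish contains)) (sym (vanish all)) zero′
            where
            vanish : ∀ r → ∑ (suc g) (λ b → count (λ gs → block P b gs ∧ r gs) (𝒮 g)) ≡ 0
            vanish r = ∑-zero (suc g) λ b _ → n≤0⇒n≡0 (≤-trans (count-mono (𝒮 g) (λ gs _ h →
              let h₁ , h₂ = T-∧⁻ {good gs} (proj₁ (T-∧⁻ {block P b gs} h)) in T-∧⁺ {good gs} h₁ (proj₁ (T-∧⁻ {eqL (pattern# gs) P} h₂)))) (≤-reflexive e))
          go (suc c) e =
            let gs₀ , i₀ , h = count-witness pat (𝒮 g) (subst (0 <_) (sym e) (s≤s z≤n))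
                hg , hp = T-∧⁻ {good gs₀} h
            in subst (λ P → Q (φ′ P) (φ P)) (eqL-sound (pattern# gs₀) P hp) (some gs₀ i₀ (good-sound gs₀ i₀ hg))

        good-count : count (λ gs → good gs ∧ true) (𝒮 g) ≡ sumL φ patterns
        good-count = count-blocks all

        good-contains : count (λ gs → good gs ∧ contains gs) (𝒮 g) ≡ sumL φ′ patterns
        good-contains = count-blocks contains

        collect : ∀ x y z → (∀ P → x * φ′ P ≤ y * φ P + z * φ P) →
          x * count (λ gs → good gs ∧ contains gs) (𝒮 g) ≤ (y + z) * count (λ gs → good gs ∧ true) (𝒮 g)
        collect x y z h = subst₂ (λ X Y → x * X ≤ (y + z) * Y) (sym good-contains) (sym good-count)
          (subst₂ _≤_ (sumL-*ˡ x φ′ patterns) (sumL-*ˡ (y + z) φ patterns) (sumL-mono patterns (λ P _ → ≤-trans (h P) (≤-reflexive (sym (*-distribʳ-+ (φ P) y z))))))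

        collect′ : ∀ x y z → (∀ P → y * φ P ≤ x * φ′ P + z * φ P) →
          y * count (λ gs → good gs ∧ true) (𝒮 g) ≤ x * count (λ gs → good gs ∧ contains gs) (𝒮 g) + z * count (λ gs → good gs ∧ true) (𝒮 g)
        collect′ x y z h = subst₂ (λ X Y → y * Y ≤ x * X + z * Y) (sym good-contains) (sym good-count)
          (subst₂ _≤_ (sumL-*ˡ y φ patterns) (trans (sumL-+ _ _ patterns) (cong₂ _+_ (sumL-*ˡ x φ′ patterns) (sumL-*ˡ z φ patterns))) (sumL-mono patterns (λ P _ → h P)))

        S S′ Γ Γ′ β : ℕ
        S  = count all (𝒮 g)
        S′ = count contains (𝒮 g)
        Γ  = count (λ gs → good gs ∧ true) (𝒮 g)
        Γ′ = count (λ gs → good gs ∧ contains gs) (𝒮 g)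
        β  = count (bad g k₀) (𝒮 g)

        good-or-bad : ∀ (r : List Bool → Bool) → count r (𝒮 g) ≤ count (λ gs → good gs ∧ r gs) (𝒮 g) + β
        good-or-bad r = count-∨ (𝒮 g) λ gs _ h → dichotomy (bad g k₀ gs) h
          where
          dichotomy : ∀ x {y} → T y → T (not x ∧ y) ⊎ T x
          dichotomy true  h = inj₂ tt
          dichotomy false h = inj₁ h

        Γ≤S : Γ ≤ S
        Γ≤S = count-mono (𝒮 g) (λ _ _ _ → tt)

        Γ′≤S′ : Γ′ ≤ S′
        Γ′≤S′ = count-mono (𝒮 g) (λ gs _ h → proj₂ (T-∧⁻ {good gs} h))

        Kβ≤S : K * β ≤ S
        Kβ≤S = ≤-trans (proj₂ scarce g scarce≤g) (F≤genus-count g)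

        -- Two errors of relative size 1/K add up to the 2 x: one from atypical blocks, one from bad
        -- semigroups. The latter are negligible against F g, hence against the whole of `𝒮 g`.
        finish-upper : ∀ x y → K * x * Γ′ ≤ (y + x) * Γ → K * x * S′ ≤ (y + 2 * x) * S
        finish-upper x y h = begin
          K * x * S′                   ≤⟨ *-monoʳ-≤ (K * x) (good-or-bad contains) ⟩
          K * x * (Γ′ + β)             ≡⟨ m₁ K x Γ′ β ⟩
          K * x * Γ′ + x * (K * β)     ≤⟨ +-mono-≤ (≤-trans h (*-monoʳ-≤ (y + x) Γ≤S)) (*-monoʳ-≤ x Kβ≤S) ⟩
          (y + x) * S + x * S          ≡⟨ m₂ x y S ⟩
          (y + 2 * x) * S              ∎
          where
          open ≤-Reasoning
          m₁ : ∀ K x a b → K * x * (a + b) ≡ K * x * a + x * (K * b)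
          m₁ = solve-∀
          m₂ : ∀ x y s → (y + x) * s + x * s ≡ (y + 2 * x) * s
          m₂ = solve-∀

        finish-lower : ∀ x y → K * y * Γ ≤ K * x * Γ′ + y * Γ → K * y * S ≤ K * x * S′ + 2 * y * S
        finish-lower x y h = begin
          K * y * S                           ≤⟨ *-monoʳ-≤ (K * y) (≤-trans (good-or-bad all) ≤-refl) ⟩
          K * y * (Γ + β)                     ≡⟨ m₁ K y Γ β ⟩
          K * y * Γ + y * (K * β)             ≤⟨ +-mono-≤ (≤-trans h (+-mono-≤ (*-monoʳ-≤ (K * x) Γ′≤S′) (*-monoʳ-≤ y Γ≤S))) (*-monoʳ-≤ y Kβ≤S) ⟩
          K * x * S′ + y * S + y * S          ≡⟨ m₂ (K * x * S′) y S ⟩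
          K * x * S′ + 2 * y * S              ∎
          where
          open ≤-Reasoning
          m₁ : ∀ K x a b → K * x * (a + b) ≡ K * x * a + x * (K * b)
          m₁ = solve-∀
          m₂ : ∀ a y s → a + y * s + y * s ≡ a + 2 * y * s
          m₂ = solve-∀

      estimate-low : T (anyLow zs) → K * 1 * count contains (𝒮 g) ≤ (K * 0 + 2 * 1) * count all (𝒮 g)
      estimate-low tl = finish-upper 1 (K * 0) (collect (K * 1) (K * 0) 1 (λ P → per-pattern (λ X Y → K * 1 * X ≤ K * 0 * Y + 1 * Y)
        (≤-reflexive (trans (*-zeroʳ (K * 1)) (sym (trans (+-identityʳ (K * 0 * 0)) (*-zeroʳ (K * 0))))))
        (λ gs₀ i₀ G₀ → ≤-trans (OnePattern.low-sum gs₀ i₀ G₀ zs tl) (≤-reflexive (*-distribʳ-+ _ (K * 0) 1))) P))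

      module _ (u : Unique C) (e : anyLow zs ≡ false) where
        private
          ℓ = mids zs
          x = (2 * D) ^ ℓ

        estimate-upper : K * x * count contains (𝒮 g) ≤ (K * (R + 5) ^ ℓ + 2 * x) * count all (𝒮 g)
        estimate-upper = finish-upper x (K * (R + 5) ^ ℓ) (collect (K * x) (K * (R + 5) ^ ℓ) x (λ P → per-pattern (λ X Y → K * x * X ≤ K * (R + 5) ^ ℓ * Y + x * Y)
          (≤-trans (≤-reflexive (*-zeroʳ (K * x))) z≤n)
          (λ gs₀ i₀ G₀ → ≤-trans (OnePattern.upper-sum gs₀ i₀ G₀ zs u e) (≤-reflexive (*-distribʳ-+ _ (K * (R + 5) ^ ℓ) x))) P))

        estimate-lower : length C ≤ l → K * R ^ ℓ * count all (𝒮 g) ≤ K * x * count contains (𝒮 g) + 2 * R ^ ℓ * count all (𝒮 g)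
        estimate-lower h = finish-lower x (R ^ ℓ) (collect′ (K * x) (K * R ^ ℓ) (R ^ ℓ) (λ P → per-pattern (λ X Y → K * R ^ ℓ * Y ≤ K * x * X + R ^ ℓ * Y)
          (≤-trans (≤-reflexive (*-zeroʳ (K * R ^ ℓ))) z≤n)
          (λ gs₀ i₀ G₀ → OnePattern.lower-sum gs₀ i₀ G₀ zs u e (≤-trans (mids-≤ zs) h)) P))

-- Rational arithmetic and positivity in ℚ(√5)

<⇒≱ᵣ : ∀ {x y} → x <ᵣ y → ¬ y ≤ᵣ x
<⇒≱ᵣ h k = ℚ.<-irrefl refl (ℚ.<-≤-trans h k)

+≥0 : ∀ {a b} → 0ℚ ≤ᵣ a → 0ℚ ≤ᵣ b → 0ℚ ≤ᵣ a +ᵣ b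
+≥0 h k = ℚ.+-mono-≤ h k

+>0 : ∀ {a b} → 0ℚ <ᵣ a → 0ℚ ≤ᵣ b → 0ℚ <ᵣ a +ᵣ b
+>0 h k = ℚ.+-mono-<-≤ h k

*≥0 : ∀ {a b} → 0ℚ ≤ᵣ a → 0ℚ ≤ᵣ b → 0ℚ ≤ᵣ a *ᵣ b
*≥0 {a} {b} h k = subst (_≤ᵣ a *ᵣ b) (ℚ.*-zeroʳ a) (ℚ.*-monoˡ-≤-nonNeg a {{ℚ.nonNegative h}} k)

*ᵣ>0 : ∀ {a b} → 0ℚ <ᵣ a → 0ℚ <ᵣ b → 0ℚ <ᵣ a *ᵣ b
*ᵣ>0 {a} {b} h k = subst (_<ᵣ a *ᵣ b) (ℚ.*-zeroʳ a) (ℚ.*-monoʳ-<-pos a {{ℚ.positive h}} k)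

≤-from : ∀ {x y e} → 0ℚ ≤ᵣ e → y -ᵣ x ≡ e → x ≤ᵣ y
≤-from {x} {y} {e} h eq = subst₂ _≤ᵣ_ (ℚ.+-identityˡ x) (trans (cong (_+ᵣ x) (sym eq)) (lem x y)) (ℚ.+-monoˡ-≤ x h)
  where
  lem : ∀ x y → y -ᵣ x +ᵣ x ≡ y
  lem = solve 2 (λ x y → y :- x :+ x := y) refl

<-from : ∀ {x y e} → 0ℚ <ᵣ e → y -ᵣ x ≡ e → x <ᵣ y
<-from {x} {y} {e} h eq = subst₂ _<ᵣ_ (ℚ.+-identityˡ x) (trans (cong (_+ᵣ x) (sym eq)) (lem x y)) (ℚ.+-monoˡ-< x h)
  where
  lem : ∀ x y → y -ᵣ x +ᵣ x ≡ y
  lem = solve 2 (λ x y → y :- x :+ x := y) refl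

≤-diff : ∀ {x y} → x ≤ᵣ y → 0ℚ ≤ᵣ y -ᵣ x
≤-diff {x} {y} h = subst (_≤ᵣ y -ᵣ x) (ℚ.+-inverseʳ x) (ℚ.+-monoˡ-≤ (-ᵣ x) h)

<-diff : ∀ {x y} → x <ᵣ y → 0ℚ <ᵣ y -ᵣ x
<-diff {x} {y} h = subst (_<ᵣ y -ᵣ x) (ℚ.+-inverseʳ x) (ℚ.+-monoˡ-< (-ᵣ x) h)

cancel-pos : ∀ {a b} → 0ℚ <ᵣ a → 0ℚ <ᵣ a *ᵣ b → 0ℚ <ᵣ b
cancel-pos {a} {b} h k = ℚ.*-cancelˡ-<-nonNeg a {{ℚ.nonNegative (ℚ.<⇒≤ h)}} (subst (_<ᵣ a *ᵣ b) (sym (ℚ.*-zeroʳ a)) k)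

cancel-nonneg : ∀ {a b} → 0ℚ <ᵣ a → 0ℚ ≤ᵣ a *ᵣ b → 0ℚ ≤ᵣ b
cancel-nonneg {a} {b} h k = ℚ.*-cancelˡ-≤-pos a {{ℚ.positive h}} (subst (_≤ᵣ a *ᵣ b) (sym (ℚ.*-zeroʳ a)) k)

square≥0 : ∀ b → 0ℚ ≤ᵣ b *ᵣ b
square≥0 b with ℚ.≤-total 0ℚ b
... | inj₁ h = *≥0 h h
... | inj₂ h = subst (0ℚ ≤ᵣ_) (lem b) (*≥0 h′ h′)
  where
  lem : ∀ b → (0ℚ -ᵣ b) *ᵣ (0ℚ -ᵣ b) ≡ b *ᵣ b
  lem = solve 1 (λ b → (con 0ℚ :- b) :* (con 0ℚ :- b) := b :* b) refl
  h′ : 0ℚ ≤ᵣ 0ℚ -ᵣ b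
  h′ = ≤-diff h

ι : ℕ → ℚ
ι n = ℤ.+ n ℚ./ 1

private
  toℚᵘ-/ : ∀ i d → ℚ.toℚᵘ (i ℚ./ suc d) ℚᵘ.≃ ℚᵘ.mkℚᵘ i d
  toℚᵘ-/ i d = ℚ.toℚᵘ-fromℚᵘ (ℚᵘ.mkℚᵘ i d)

ι-+ : ∀ m n → ι (m + n) ≡ ι m +ᵣ ι n
ι-+ m n = ℚ.toℚᵘ-injective (ℚᵘ.≃-trans (toℚᵘ-/ (ℤ.+ (m + n)) 0) (ℚᵘ.≃-trans (ℚᵘ.*≡* eq)
  (ℚᵘ.≃-trans (ℚᵘ.+-cong (ℚᵘ.≃-sym (toℚᵘ-/ (ℤ.+ m) 0)) (ℚᵘ.≃-sym (toℚᵘ-/ (ℤ.+ n) 0))) (ℚᵘ.≃-sym (ℚ.toℚᵘ-homo-+ (ι m) (ι n))))))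
  where
  eq : ℤ.+ (m + n) ℤ.* ℤ.+ 1 ≡ (ℤ.+ m ℤ.* ℤ.+ 1 ℤ.+ ℤ.+ n ℤ.* ℤ.+ 1) ℤ.* ℤ.+ 1
  eq = cong (ℤ._* ℤ.+ 1) (cong₂ ℤ._+_ (sym (ℤ.*-identityʳ (ℤ.+ m))) (sym (ℤ.*-identityʳ (ℤ.+ n))))

ι-* : ∀ m n → ι (m * n) ≡ ι m *ᵣ ι n
ι-* m n = ℚ.toℚᵘ-injective (ℚᵘ.≃-trans (toℚᵘ-/ (ℤ.+ (m * n)) 0) (ℚᵘ.≃-trans (ℚᵘ.*≡* (cong (ℤ._* ℤ.+ 1) (ℤ.pos-* m n)))
  (ℚᵘ.≃-trans (ℚᵘ.*-cong (ℚᵘ.≃-sym (toℚᵘ-/ (ℤ.+ m) 0)) (ℚᵘ.≃-sym (toℚᵘ-/ (ℤ.+ n) 0))) (ℚᵘ.≃-sym (ℚ.toℚᵘ-homo-* (ι m) (ι n))))))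

quotient : ∀ n d → (ℤ.+ n ℚ./ suc d) *ᵣ ι (suc d) ≡ ι n
quotient n d = ℚ.toℚᵘ-injective (ℚᵘ.≃-trans (ℚ.toℚᵘ-homo-* (ℤ.+ n ℚ./ suc d) (ι (suc d)))
  (ℚᵘ.≃-trans (ℚᵘ.*-cong (toℚᵘ-/ (ℤ.+ n) d) (toℚᵘ-/ (ℤ.+ suc d) 0)) (ℚᵘ.≃-trans (ℚᵘ.*≡* eq) (ℚᵘ.≃-sym (toℚᵘ-/ (ℤ.+ n) 0)))))
  where
  eq : ℤ.+ n ℤ.* ℤ.+ suc d ℤ.* ℤ.+ 1 ≡ ℤ.+ n ℤ.* ℤ.+ suc (d * 1)
  eq = trans (ℤ.*-identityʳ (ℤ.+ n ℤ.* ℤ.+ suc d)) (cong (λ x → ℤ.+ n ℤ.* ℤ.+ suc x) (sym (*-identityʳ d)))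

ι-mono : ∀ {m n} → m ≤ n → ι m ≤ᵣ ι n
ι-mono {m} {n} h = ℚ.toℚᵘ-cancel-≤ (ℚᵘ.≤-respˡ-≃ (ℚᵘ.≃-sym (toℚᵘ-/ (ℤ.+ m) 0)) (ℚᵘ.≤-respʳ-≃ (ℚᵘ.≃-sym (toℚᵘ-/ (ℤ.+ n) 0))
  (ℚᵘ.*≤* (ℤ.*-monoʳ-≤-nonNeg (ℤ.+ 1) (ℤ.+≤+ h)))))

ι-cancel-< : ∀ {m n} → ι m <ᵣ ι n → m < n
ι-cancel-< {m} {n} h = ≰⇒> λ l → <⇒≱ᵣ h (ι-mono l)

ι≥0 : ∀ n → 0ℚ ≤ᵣ ι n
ι≥0 n = ι-mono {0} {n} z≤n

ι>0 : ∀ {n} → 0 < n → 0ℚ <ᵣ ι n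
ι>0 {n} h = ℚ.<-≤-trans {0ℚ} {ι 1} (ℚ.positive⁻¹ (ι 1)) (ι-mono h)

1/ : ℕ → ℚ
1/ n = ℤ.+ 1 ℚ./ suc (n ∸ 1)

1/-inverse : ∀ n → 0 < n → 1/ n *ᵣ ι n ≡ 1ℚ
1/-inverse (suc n) _ = quotient 1 n

1/>0 : ∀ n → 0 < n → 0ℚ <ᵣ 1/ n
1/>0 n h = cancel-pos (ι>0 h) (subst (0ℚ <ᵣ_) (trans (sym (1/-inverse n h)) (ℚ.*-comm (1/ n) (ι n))) (ℚ.positive⁻¹ 1ℚ))

-- a + b √5 is positive iff a + b t is positive for two rationals t on either side of √5

ev : ℚ → Q5 → ℚ
ev t z = re z +ᵣ ir z *ᵣ t

-- The function t ↦ a + b t is affine, so positivity at both ends gives positivity at √5 in between.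
-- For mixed signs the test compares a² with 5 b², and a² - 5 b² = (a + b t)(a - b t) + b² (t² - 5)
-- is used at the end where the last term has the right sign.
pos-intro : ∀ z lo hi → 0ℚ <ᵣ lo → lo *ᵣ lo ≤ᵣ five → 0ℚ <ᵣ hi → five ≤ᵣ hi *ᵣ hi → 0ℚ <ᵣ ev lo z → 0ℚ <ᵣ ev hi z → T (posB z)
pos-intro (a +√5· b) lo hi lo>0 lo² hi>0 hi² elo ehi with 0ℚ ℚ.≤? a | 0ℚ ℚ.≤? b
... | yes a≥0 | yes b≥0 with 0ℚ ℚ.<? a
...   | yes _ = tt
...   | no a≯0 with 0ℚ ℚ.<? b
...     | yes _ = tt
...     | no b≯0 = ⊥-elim (ℚ.<-irrefl refl (subst (0ℚ <ᵣ_) (cong₂ (λ x y → x +ᵣ y *ᵣ lo) (ℚ.≤-antisym (ℚ.≮⇒≥ a≯0) a≥0) (ℚ.≤-antisym (ℚ.≮⇒≥ b≯0) b≥0)) elo ⟨trans⟩ zero-eval))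
  where
  zero-eval : 0ℚ +ᵣ 0ℚ *ᵣ lo ≡ 0ℚ
  zero-eval = solve 1 (λ l → con 0ℚ :+ con 0ℚ :* l := con 0ℚ) refl lo
  _⟨trans⟩_ : ∀ {x y} → 0ℚ <ᵣ x → x ≡ y → 0ℚ <ᵣ y
  h ⟨trans⟩ refl = h
pos-intro (a +√5· b) lo hi lo>0 lo² hi>0 hi² elo ehi | yes a≥0 | no b<0 = fromWitness (<-from
    (+>0 (*ᵣ>0 ehi (subst (0ℚ <ᵣ_) (lem a b hi) (+>0 (*ᵣ>0 (<-diff (ℚ.≰⇒> b<0)) hi>0) a≥0))) (*≥0 (square≥0 b) (≤-diff hi²)))
    (lem′ a b hi))
  where
  lem : ∀ a b h → (0ℚ -ᵣ b) *ᵣ h +ᵣ a ≡ a -ᵣ b *ᵣ h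
  lem = solve 3 (λ a b h → (con 0ℚ :- b) :* h :+ a := a :- b :* h) refl
  lem′ : ∀ a b h → a *ᵣ a -ᵣ five *ᵣ (b *ᵣ b) ≡ (a +ᵣ b *ᵣ h) *ᵣ (a -ᵣ b *ᵣ h) +ᵣ b *ᵣ b *ᵣ (h *ᵣ h -ᵣ five)
  lem′ = solve 3 (λ a b h → a :* a :- con five :* (b :* b) := (a :+ b :* h) :* (a :- b :* h) :+ b :* b :* (h :* h :- con five)) refl
pos-intro (a +√5· b) lo hi lo>0 lo² hi>0 hi² elo ehi | no a<0 | yes b≥0 = fromWitness (<-from
    (+>0 (*ᵣ>0 elo (subst (0ℚ <ᵣ_) (lem a b lo) (+>0 (<-diff (ℚ.≰⇒> a<0)) (*≥0 b≥0 (ℚ.<⇒≤ lo>0))))) (*≥0 (square≥0 b) (≤-diff lo²)))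
    (lem′ a b lo))
  where
  lem : ∀ a b l → (0ℚ -ᵣ a) +ᵣ b *ᵣ l ≡ b *ᵣ l -ᵣ a
  lem = solve 3 (λ a b l → (con 0ℚ :- a) :+ b :* l := b :* l :- a) refl
  lem′ : ∀ a b l → five *ᵣ (b *ᵣ b) -ᵣ a *ᵣ a ≡ (a +ᵣ b *ᵣ l) *ᵣ (b *ᵣ l -ᵣ a) +ᵣ b *ᵣ b *ᵣ (five -ᵣ l *ᵣ l)
  lem′ = solve 3 (λ a b l → con five :* (b :* b) :- a :* a := (a :+ b :* l) :* (b :* l :- a) :+ b :* b :* (con five :- l :* l)) refl
pos-intro (a +√5· b) lo hi lo>0 lo² hi>0 hi² elo ehi | no a<0 | no b<0 = ⊥-elim (ℚ.<-asym elo
    (<-from (+>0 (<-diff (ℚ.≰⇒> a<0)) (*≥0 (≤-diff (ℚ.<⇒≤ (ℚ.≰⇒> b<0))) (ℚ.<⇒≤ lo>0))) (lem a b lo)))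
  where
  lem : ∀ a b l → 0ℚ -ᵣ (a +ᵣ b *ᵣ l) ≡ (0ℚ -ᵣ a) +ᵣ (0ℚ -ᵣ b) *ᵣ l
  lem = solve 3 (λ a b l → con 0ℚ :- (a :+ b :* l) := (con 0ℚ :- a) :+ (con 0ℚ :- b) :* l) refl

-- For b ≥ 0 the value at `hi` is at least the value at √5. The companion `pos-elim-lo` is the
-- mirror image for b ≤ 0 and the other end.
pos-elim-hi : ∀ a b hi → 0ℚ ≤ᵣ b → 0ℚ <ᵣ hi → five ≤ᵣ hi *ᵣ hi → T (posB (a +√5· b)) → 0ℚ <ᵣ a +ᵣ b *ᵣ hi
pos-elim-hi a b hi b≥0 hi>0 hi² t with 0ℚ ℚ.≤? a | 0ℚ ℚ.≤? b
... | _ | no b<0 = ⊥-elim (b<0 b≥0)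
... | yes a≥0 | yes _ with 0ℚ ℚ.<? a
...   | yes a>0 = +>0 a>0 (*≥0 b≥0 (ℚ.<⇒≤ hi>0))
...   | no _ = subst (0ℚ <ᵣ_) (ℚ.+-comm (b *ᵣ hi) a) (+>0 (*ᵣ>0 (toWitness t) hi>0) a≥0)
pos-elim-hi a b hi b≥0 hi>0 hi² t | no a<0 | yes _ = ℚ.≰⇒> λ le → <⇒≱ᵣ (toWitness t) (≤-from
    (+≥0 (*≥0 (≤-diff le) (subst (0ℚ ≤ᵣ_) (lem a b hi) (+≥0 (≤-diff (ℚ.<⇒≤ (ℚ.≰⇒> a<0))) (*≥0 b≥0 (ℚ.<⇒≤ hi>0))))) (*≥0 (square≥0 b) (≤-diff hi²)))
    (lem′ a b hi))
  where
  lem : ∀ a b h → (0ℚ -ᵣ a) +ᵣ b *ᵣ h ≡ b *ᵣ h -ᵣ a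
  lem = solve 3 (λ a b h → (con 0ℚ :- a) :+ b :* h := b :* h :- a) refl
  lem′ : ∀ a b h → a *ᵣ a -ᵣ five *ᵣ (b *ᵣ b) ≡ (0ℚ -ᵣ (a +ᵣ b *ᵣ h)) *ᵣ (b *ᵣ h -ᵣ a) +ᵣ b *ᵣ b *ᵣ (h *ᵣ h -ᵣ five)
  lem′ = solve 3 (λ a b h → a :* a :- con five :* (b :* b) := (con 0ℚ :- (a :+ b :* h)) :* (b :* h :- a) :+ b :* b :* (h :* h :- con five)) refl

pos-elim-lo : ∀ a b lo → b ≤ᵣ 0ℚ → 0ℚ <ᵣ lo → lo *ᵣ lo ≤ᵣ five → T (posB (a +√5· b)) → 0ℚ <ᵣ a +ᵣ b *ᵣ lo
pos-elim-lo a b lo b≤0 lo>0 lo² t with 0ℚ ℚ.≤? a | 0ℚ ℚ.≤? b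
... | yes a≥0 | yes b≥0 with 0ℚ ℚ.<? a
...   | yes a>0 = subst (λ x → 0ℚ <ᵣ a +ᵣ x) (sym (trans (cong (_*ᵣ lo) (ℚ.≤-antisym b≤0 b≥0)) (ℚ.*-zeroˡ lo))) (+>0 a>0 (ℚ.≤-refl {0ℚ}))
...   | no _ = ⊥-elim (<⇒≱ᵣ (toWitness t) b≤0)
pos-elim-lo a b lo b≤0 lo>0 lo² t | no a<0 | yes b≥0 = ⊥-elim (<⇒≱ᵣ (toWitness t) (subst (_≤ᵣ a *ᵣ a) (sym (trans (cong (λ x → five *ᵣ (x *ᵣ x)) (ℚ.≤-antisym b≤0 b≥0)) refl)) (square≥0 a)))
pos-elim-lo a b lo b≤0 lo>0 lo² t | yes a≥0 | no b<0 = ℚ.≰⇒> λ le → <⇒≱ᵣ (toWitness t) (≤-from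
    (+≥0 (*≥0 (≤-diff le) (subst (0ℚ ≤ᵣ_) (lem a b lo) (+≥0 (*≥0 (≤-diff b≤0) (ℚ.<⇒≤ lo>0)) a≥0))) (*≥0 (square≥0 b) (≤-diff lo²)))
    (lem′ a b lo))
  where
  lem : ∀ a b l → (0ℚ -ᵣ b) *ᵣ l +ᵣ a ≡ a -ᵣ b *ᵣ l
  lem = solve 3 (λ a b l → (con 0ℚ :- b) :* l :+ a := a :- b :* l) refl
  lem′ : ∀ a b l → five *ᵣ (b *ᵣ b) -ᵣ a *ᵣ a ≡ (0ℚ -ᵣ (a +ᵣ b *ᵣ l)) *ᵣ (a -ᵣ b *ᵣ l) +ᵣ b *ᵣ b *ᵣ (five -ᵣ l *ᵣ l)
  lem′ = solve 3 (λ a b l → con five :* (b :* b) :- a :* a := (con 0ℚ :- (a :+ b :* l)) :* (a :- b :* l) :+ b :* b :* (con five :- l :* l)) refl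
pos-elim-lo a b lo b≤0 lo>0 lo² () | no a<0 | no b<0

record Within (x e : ℚ) : Set where
  constructor _&_
  field
    ub : 0ℚ ≤ᵣ e -ᵣ x
    lb : 0ℚ ≤ᵣ e +ᵣ x

half : ℚ
half = ℤ.+ 1 ℚ./ 2

half≥0 : 0ℚ ≤ᵣ half
half≥0 = ℚ.<⇒≤ (ℚ.positive⁻¹ half)

within-+ : ∀ {x y e f} → Within x e → Within y f → Within (x +ᵣ y) (e +ᵣ f)
within-+ {x} {y} {e} {f} (a & b) (c & d) = subst (0ℚ ≤ᵣ_) (l x y e f) (+≥0 a c) & subst (0ℚ ≤ᵣ_) (l′ x y e f) (+≥0 b d)
  where
  l : ∀ x y e f → (e -ᵣ x) +ᵣ (f -ᵣ y) ≡ (e +ᵣ f) -ᵣ (x +ᵣ y)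
  l = solve 4 (λ x y e f → (e :- x) :+ (f :- y) := (e :+ f) :- (x :+ y)) refl
  l′ : ∀ x y e f → (e +ᵣ x) +ᵣ (f +ᵣ y) ≡ (e +ᵣ f) +ᵣ (x +ᵣ y)
  l′ = solve 4 (λ x y e f → (e :+ x) :+ (f :+ y) := (e :+ f) :+ (x :+ y)) refl

-- Both e f - x y and e f + x y are half sums of products of the nonnegative numbers e ± x and f ±
-- y.
within-* : ∀ {x y e f} → Within x e → Within y f → Within (x *ᵣ y) (e *ᵣ f)
within-* {x} {y} {e} {f} (a & b) (c & d) =
    subst (0ℚ ≤ᵣ_) (l x y e f) (*≥0 half≥0 (+≥0 (*≥0 a d) (*≥0 b c)))
  & subst (0ℚ ≤ᵣ_) (l′ x y e f) (*≥0 half≥0 (+≥0 (*≥0 a c) (*≥0 b d)))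
  where
  l : ∀ x y e f → half *ᵣ ((e -ᵣ x) *ᵣ (f +ᵣ y) +ᵣ (e +ᵣ x) *ᵣ (f -ᵣ y)) ≡ e *ᵣ f -ᵣ x *ᵣ y
  l = solve 4 (λ x y e f → con half :* ((e :- x) :* (f :+ y) :+ (e :+ x) :* (f :- y)) := e :* f :- x :* y) refl
  l′ : ∀ x y e f → half *ᵣ ((e -ᵣ x) *ᵣ (f -ᵣ y) +ᵣ (e +ᵣ x) *ᵣ (f +ᵣ y)) ≡ e *ᵣ f +ᵣ x *ᵣ y
  l′ = solve 4 (λ x y e f → con half :* ((e :- x) :* (f :- y) :+ (e :+ x) :* (f :+ y)) := e :* f :+ x :* y) refl

within-cong : ∀ {x y e f} → x ≡ y → e ≡ f → Within x e → Within y f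
within-cong refl refl w = w

-- Powers of 1/φ, evaluated at rationals near √5

_^ᵣ_ : ℚ → ℕ → ℚ
q ^ᵣ zero  = 1ℚ
q ^ᵣ suc n = q *ᵣ q ^ᵣ n

φpow : ℕ → Q5
φpow zero    = embQ 1ℚ
φpow (suc n) = φinv ⊗ φpow n

-- 3^j bounds both coefficients of φ^(−j) in ℚ(√5)

coefficients : ∀ j → Within (re (φpow j)) (ι (3 ^ j)) × Within (ir (φpow j)) (ι (3 ^ j))
coefficients zero = (ℚ.≤-refl {0ℚ} & ℚ.<⇒≤ (ℚ.positive⁻¹ (1ℚ +ᵣ 1ℚ))) , (ℚ.<⇒≤ (ℚ.positive⁻¹ 1ℚ) & ℚ.<⇒≤ (ℚ.positive⁻¹ 1ℚ))
coefficients (suc j) = within-cong refl (trans (l (ι (3 ^ j))) (sym (ι-* 3 (3 ^ j)))) (within-+ (within-* half± (proj₁ ih)) (within-* five± (within-* half+ (proj₂ ih))))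
    , (subst (0ℚ ≤ᵣ_) (l₁ (ι (3 ^ j)) (re z) (ir z) (ι-* 3 (3 ^ j))) (+≥0 (Within.ub B±) (*≥0 two≥0 (ι≥0 (3 ^ j))))
      & subst (0ℚ ≤ᵣ_) (l₂ (ι (3 ^ j)) (re z) (ir z) (ι-* 3 (3 ^ j))) (+≥0 (Within.lb B±) (*≥0 two≥0 (ι≥0 (3 ^ j)))))
  where
  z = φpow j
  ih = coefficients j
  two≥0 : 0ℚ ≤ᵣ ι 2
  two≥0 = ι≥0 2
  half± : Within (-ᵣ half) half
  half± = ℚ.<⇒≤ (ℚ.positive⁻¹ 1ℚ) & ℚ.≤-refl {0ℚ}
  half+ : Within half half
  half+ = ℚ.≤-refl {0ℚ} & ℚ.<⇒≤ (ℚ.positive⁻¹ 1ℚ)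
  five± : Within five five
  five± = ℚ.≤-refl {0ℚ} & ℚ.<⇒≤ (ℚ.positive⁻¹ (five +ᵣ five))
  B± : Within (-ᵣ half *ᵣ ir z +ᵣ half *ᵣ re z) (half *ᵣ ι (3 ^ j) +ᵣ half *ᵣ ι (3 ^ j))
  B± = within-+ (within-* half± (proj₂ ih)) (within-* half+ (proj₁ ih))
  l : ∀ x → half *ᵣ x +ᵣ five *ᵣ (half *ᵣ x) ≡ ι 3 *ᵣ x
  l = solve 1 (λ x → con half :* x :+ con five :* (con half :* x) := con (ι 3) :* x) refl
  l₁ : ∀ x a b {y} → y ≡ ι 3 *ᵣ x → ((half *ᵣ x +ᵣ half *ᵣ x) -ᵣ (-ᵣ half *ᵣ b +ᵣ half *ᵣ a)) +ᵣ ι 2 *ᵣ x ≡ y -ᵣ (-ᵣ half *ᵣ b +ᵣ half *ᵣ a)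
  l₁ x a b refl = solve 3 (λ x a b → ((con half :* x :+ con half :* x) :- (con (-ᵣ half) :* b :+ con half :* a)) :+ con (ι 2) :* x := con (ι 3) :* x :- (con (-ᵣ half) :* b :+ con half :* a)) refl x a b
  l₂ : ∀ x a b {y} → y ≡ ι 3 *ᵣ x → ((half *ᵣ x +ᵣ half *ᵣ x) +ᵣ (-ᵣ half *ᵣ b +ᵣ half *ᵣ a)) +ᵣ ι 2 *ᵣ x ≡ y +ᵣ (-ᵣ half *ᵣ b +ᵣ half *ᵣ a)
  l₂ x a b refl = solve 3 (λ x a b → ((con half :* x :+ con half :* x) :+ (con (-ᵣ half) :* b :+ con half :* a)) :+ con (ι 2) :* x := con (ι 3) :* x :+ (con (-ᵣ half) :* b :+ con half :* a)) refl x a b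

-- drift j / D bounds the distance between φ^(−j) evaluated at a rational near √5 and the j-th power of a rational near 1/φ

drift : ℕ → ℕ
drift zero    = 0
drift (suc j) = drift j + (2 + 7 * 3 ^ j)

drift-mono : ∀ {i j} → i ≤ j → drift i ≤ drift j
drift-mono {i} {j} h = subst (λ x → drift i ≤ drift x) (m+[n∸m]≡n h) (go (j ∸ i))
  where
  go : ∀ d → drift i ≤ drift (i + d)
  go zero    = ≤-reflexive (cong drift (sym (+-identityʳ i)))
  go (suc d) = ≤-trans (go d) (≤-trans (m≤m+n _ _) (≤-reflexive (cong drift (sym (+-suc i d)))))

power-within : ∀ q j → Within q 1ℚ → Within (q ^ᵣ j) 1ℚ
power-within q zero    w = ℚ.≤-refl {0ℚ} & ℚ.<⇒≤ (ℚ.positive⁻¹ (1ℚ +ᵣ 1ℚ))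
power-within q (suc j) w = within-* w (power-within q j w)

module _ (t q δ : ℚ) where
  private
    r : ℚ
    r = half *ᵣ (t -ᵣ 1ℚ)

  -- Multiplication in ℚ(√5) uses √5² = 5, so evaluation at t is not multiplicative:
  -- `ev t (φinv ⊗ z)` is r · `ev t z` + ½ (5 - t²) · `ir z`. With r and q at most 1 and `ir z` at
  -- most 3^j in absolute value, the error grows in one step by at most (2 + 7 · 3^j) δ.
  approximation : Within r 1ℚ → Within q 1ℚ → Within (r -ᵣ q) (ι 2 *ᵣ δ) → Within (five -ᵣ t *ᵣ t) (ι 14 *ᵣ δ) →
    ∀ j → Within (ev t (φpow j) -ᵣ q ^ᵣ j) (ι (drift j) *ᵣ δ)
  approximation wr wq wrq w5 zero = within-cong (sym (l t)) (sym (ℚ.*-zeroˡ δ)) (ℚ.≤-refl {0ℚ} & ℚ.≤-refl {0ℚ})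
    where
    l : ∀ t → (1ℚ +ᵣ 0ℚ *ᵣ t) -ᵣ 1ℚ ≡ 0ℚ
    l = solve 1 (λ t → (con 1ℚ :+ con 0ℚ :* t) :- con 1ℚ := con 0ℚ) refl
  approximation wr wq wrq w5 (suc j) = within-cong (l (re z) (ir z) t q (q ^ᵣ j)) (l′ (ι (drift j)) δ (ι (3 ^ j)) c≡)
      (within-+ (within-+ (within-* wr (approximation wr wq wrq w5 j)) (within-* wrq (power-within q j wq)))
        (within-* half+ (within-* (proj₂ (coefficients j)) w5)))
    where
    z = φpow j
    half+ : Within half half
    half+ = ℚ.≤-refl {0ℚ} & ℚ.<⇒≤ (ℚ.positive⁻¹ 1ℚ)
    c≡ : ι (drift (suc j)) ≡ ι (drift j) +ᵣ (ι 2 +ᵣ ι 7 *ᵣ ι (3 ^ j))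
    c≡ = trans (ι-+ (drift j) (2 + 7 * 3 ^ j)) (cong (ι (drift j) +ᵣ_) (trans (ι-+ 2 (7 * 3 ^ j)) (cong (ι 2 +ᵣ_) (ι-* 7 (3 ^ j)))))
    l : ∀ a b t q y → half *ᵣ (t -ᵣ 1ℚ) *ᵣ ((a +ᵣ b *ᵣ t) -ᵣ y) +ᵣ (half *ᵣ (t -ᵣ 1ℚ) -ᵣ q) *ᵣ y +ᵣ half *ᵣ (b *ᵣ (five -ᵣ t *ᵣ t))
      ≡ ((-ᵣ half *ᵣ a +ᵣ five *ᵣ (half *ᵣ b)) +ᵣ (-ᵣ half *ᵣ b +ᵣ half *ᵣ a) *ᵣ t) -ᵣ q *ᵣ y
    l = solve 5 (λ a b t q y → con half :* (t :- con 1ℚ) :* ((a :+ b :* t) :- y) :+ (con half :* (t :- con 1ℚ) :- q) :* y :+ con half :* (b :* (con five :- t :* t))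
      := ((con (-ᵣ half) :* a :+ con five :* (con half :* b)) :+ (con (-ᵣ half) :* b :+ con half :* a) :* t) :- q :* y) refl
    l′ : ∀ c δ y {x} → x ≡ c +ᵣ (ι 2 +ᵣ ι 7 *ᵣ y) → 1ℚ *ᵣ (c *ᵣ δ) +ᵣ ι 2 *ᵣ δ *ᵣ 1ℚ +ᵣ half *ᵣ (y *ᵣ (ι 14 *ᵣ δ)) ≡ x *ᵣ δ
    l′ c δ y refl = solve 3 (λ c δ y → con 1ℚ :* (c :* δ) :+ con (ι 2) :* δ :* con 1ℚ :+ con half :* (y :* (con (ι 14) :* δ)) := (c :+ (con (ι 2) :+ con (ι 7) :* y)) :* δ) refl c δ y

0⊗ : ∀ z → embQ 0ℚ ⊗ z ≡ embQ 0ℚ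
0⊗ (a +√5· b) = cong₂ _+√5·_
  (solve 2 (λ a b → con 0ℚ :* a :+ con five :* (con 0ℚ :* b) := con 0ℚ) refl a b)
  (solve 2 (λ a b → con 0ℚ :* b :+ con 0ℚ :* a := con 0ℚ) refl a b)

1⊗ : ∀ z → embQ 1ℚ ⊗ z ≡ z
1⊗ (a +√5· b) = cong₂ _+√5·_
  (solve 2 (λ a b → con 1ℚ :* a :+ con five :* (con 0ℚ :* b) := a) refl a b)
  (solve 2 (λ a b → con 1ℚ :* b :+ con 0ℚ :* a := b) refl a b)

⊗0 : ∀ z → z ⊗ embQ 0ℚ ≡ embQ 0ℚ
⊗0 (a +√5· b) = cong₂ _+√5·_
  (solve 2 (λ a b → a :* con 0ℚ :+ con five :* (b :* con 0ℚ) := con 0ℚ) refl a b)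
  (solve 2 (λ a b → a :* con 0ℚ :+ b :* con 0ℚ := con 0ℚ) refl a b)

-- The regions of the theorem as inequalities of integers

module Thresholds {D R : ℕ} (Sc : Scale D R) where
  open Scale Sc
  open Typical Sc using (p; p≤3D; t-bound)

  private
    D>0 : 0 < D
    D>0 = ≤-trans (s≤s z≤n) D≥12

  d s δ : ℚ
  d = ι D
  s = ι p
  δ = 1/ D

  δd : δ *ᵣ d ≡ 1ℚ
  δd = 1/-inverse D D>0

  δ>0 : 0ℚ <ᵣ δ
  δ>0 = 1/>0 D D>0

  δ≥0 : 0ℚ ≤ᵣ δ
  δ≥0 = ℚ.<⇒≤ δ>0

  lo hi : ℚ
  lo = s *ᵣ δ
  hi = ι (suc p) *ᵣ δ

  square-id : ∀ δ d u → δ *ᵣ d ≡ 1ℚ → δ *ᵣ δ *ᵣ (ι 5 *ᵣ (d *ᵣ d) -ᵣ u *ᵣ u) ≡ five -ᵣ u *ᵣ δ *ᵣ (u *ᵣ δ)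
  square-id δ d u e = trans (l δ d u) (cong (λ x → five *ᵣ (x *ᵣ x) -ᵣ u *ᵣ δ *ᵣ (u *ᵣ δ)) e)
    where
    l : ∀ δ d u → δ *ᵣ δ *ᵣ (ι 5 *ᵣ (d *ᵣ d) -ᵣ u *ᵣ u) ≡ five *ᵣ (δ *ᵣ d *ᵣ (δ *ᵣ d)) -ᵣ u *ᵣ δ *ᵣ (u *ᵣ δ)
    l = solve 3 (λ δ d u → δ :* δ :* (con (ι 5) :* (d :* d) :- u :* u) := con five :* (δ :* d :* (δ :* d)) :- u :* δ :* (u :* δ)) refl

  ι5DD : ι (5 * (D * D)) ≡ ι 5 *ᵣ (d *ᵣ d)
  ι5DD = trans (ι-* 5 (D * D)) (cong (ι 5 *ᵣ_) (ι-* D D))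

  lo² : lo *ᵣ lo ≤ᵣ five
  lo² = ≤-from (*≥0 (*≥0 δ≥0 δ≥0) (subst₂ (λ x y → 0ℚ ≤ᵣ x -ᵣ y) ι5DD (ι-* p p) (≤-diff (ι-mono p²≤)))) (sym (square-id δ d s δd))

  hi² : five ≤ᵣ hi *ᵣ hi
  hi² = ≤-from (*≥0 (*≥0 δ≥0 δ≥0) (subst₂ (λ x y → 0ℚ ≤ᵣ y -ᵣ x) ι5DD (ι-* (suc p) (suc p)) (≤-diff (ι-mono (<⇒≤ p²>)))))
      (trans (l five (hi *ᵣ hi)) (trans (cong (λ x → 0ℚ -ᵣ x) (sym (square-id δ d (ι (suc p)) δd))) (l′ (δ *ᵣ δ) (ι 5 *ᵣ (d *ᵣ d)) (ι (suc p) *ᵣ ι (suc p)))))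
    where
    l : ∀ x y → y -ᵣ x ≡ 0ℚ -ᵣ (x -ᵣ y)
    l = solve 2 (λ x y → y :- x := con 0ℚ :- (x :- y)) refl
    l′ : ∀ z x y → 0ℚ -ᵣ z *ᵣ (x -ᵣ y) ≡ z *ᵣ (y -ᵣ x)
    l′ = solve 3 (λ z x y → con 0ℚ :- z :* (x :- y) := z :* (y :- x)) refl

  p>0 : 0 < p
  p>0 = ≤-trans (s≤s z≤n) (m≤n+m 3 (R + D))

  lo>0 : 0ℚ <ᵣ lo
  lo>0 = *ᵣ>0 (ι>0 p>0) δ>0

  hi>0 : 0ℚ <ᵣ hi
  hi>0 = *ᵣ>0 (ι>0 {suc p} (s≤s z≤n)) δ>0

  private
    10d>0 : 0ℚ <ᵣ ι 10 *ᵣ d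
    10d>0 = *ᵣ>0 (ℚ.positive⁻¹ (ι 10)) (ι>0 D>0)

    ι-zone : ∀ c g → ι (10 * D * c + 200 * g) ≡ ι 10 *ᵣ d *ᵣ ι c +ᵣ ι 200 *ᵣ ι g
    ι-zone c g = trans (ι-+ (10 * D * c) (200 * g)) (cong₂ _+ᵣ_ (trans (ι-* (10 * D) c) (cong (_*ᵣ ι c) (ι-* 10 D))) (ι-* 200 g))

    ι-lin : ∀ A B u g → ι ((A * D + B * u) * g) ≡ (ι A *ᵣ d +ᵣ ι B *ᵣ ι u) *ᵣ ι g
    ι-lin A B u g = trans (ι-* (A * D + B * u) g) (cong (_*ᵣ ι g) (trans (ι-+ (A * D) (B * u)) (cong₂ _+ᵣ_ (ι-* A D) (ι-* B u))))

  -- α + β √5 with 10 α = A and 10 β = B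
  module Threshold (α β : ℚ) (A B : ℕ) (eα : ι 10 *ᵣ α ≡ ι A) (eβ : ι 10 *ᵣ β ≡ ι B) (β≥0 : 0ℚ ≤ᵣ β) where

    private
      0≤g*e : ∀ g {ε} → ι 20 ≤ᵣ ε *ᵣ d → 0ℚ ≤ᵣ ι 10 *ᵣ ι g *ᵣ (ε *ᵣ d -ᵣ ι 20)
      0≤g*e g h = *≥0 (*≥0 (ι≥0 10) (ι≥0 g)) (≤-diff h)

      below-id : ∀ {ε g c} u → ι 10 *ᵣ d *ᵣ ((((α -ᵣ ε) *ᵣ g +ᵣ five *ᵣ ((β -ᵣ 0ℚ) *ᵣ 0ℚ)) -ᵣ c) +ᵣ (((α -ᵣ ε) *ᵣ 0ℚ +ᵣ (β -ᵣ 0ℚ) *ᵣ g) -ᵣ 0ℚ) *ᵣ (u *ᵣ δ)) +ᵣ ι 10 *ᵣ g *ᵣ (ε *ᵣ d -ᵣ ι 20)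
        ≡ (ι A *ᵣ d +ᵣ ι B *ᵣ u) *ᵣ g -ᵣ (ι 10 *ᵣ d *ᵣ c +ᵣ ι 200 *ᵣ g)
      below-id {ε} {g} {c} u = trans (l α β ε g c d u δ) (trans (cong (λ x → (ι 10 *ᵣ α *ᵣ d +ᵣ ι 10 *ᵣ β *ᵣ u *ᵣ x) *ᵣ g -ᵣ (ι 10 *ᵣ d *ᵣ c +ᵣ ι 200 *ᵣ g)) δd)
        (cong₂ (λ x y → (x *ᵣ d +ᵣ y) *ᵣ g -ᵣ (ι 10 *ᵣ d *ᵣ c +ᵣ ι 200 *ᵣ g)) eα (trans (ℚ.*-identityʳ (ι 10 *ᵣ β *ᵣ u)) (cong (_*ᵣ u) eβ))))
        where
        l : ∀ α β ε g c d u δ → ι 10 *ᵣ d *ᵣ ((((α -ᵣ ε) *ᵣ g +ᵣ five *ᵣ ((β -ᵣ 0ℚ) *ᵣ 0ℚ)) -ᵣ c) +ᵣ (((α -ᵣ ε) *ᵣ 0ℚ +ᵣ (β -ᵣ 0ℚ) *ᵣ g) -ᵣ 0ℚ) *ᵣ (u *ᵣ δ)) +ᵣ ι 10 *ᵣ g *ᵣ (ε *ᵣ d -ᵣ ι 20)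
          ≡ (ι 10 *ᵣ α *ᵣ d +ᵣ ι 10 *ᵣ β *ᵣ u *ᵣ (δ *ᵣ d)) *ᵣ g -ᵣ (ι 10 *ᵣ d *ᵣ c +ᵣ ι 200 *ᵣ g)
        l = solve 8 (λ α β ε g c d u δ → con (ι 10) :* d :* ((((α :- ε) :* g :+ con five :* ((β :- con 0ℚ) :* con 0ℚ)) :- c) :+ (((α :- ε) :* con 0ℚ :+ (β :- con 0ℚ) :* g) :- con 0ℚ) :* (u :* δ)) :+ con (ι 10) :* g :* (ε :* d :- con (ι 20))
          := (con (ι 10) :* α :* d :+ con (ι 10) :* β :* u :* (δ :* d)) :* g :- (con (ι 10) :* d :* c :+ con (ι 200) :* g)) refl

      above-id : ∀ {ε g c} u → ι 10 *ᵣ d *ᵣ ((c -ᵣ ((α +ᵣ ε) *ᵣ g +ᵣ five *ᵣ ((β +ᵣ 0ℚ) *ᵣ 0ℚ))) +ᵣ (0ℚ -ᵣ ((α +ᵣ ε) *ᵣ 0ℚ +ᵣ (β +ᵣ 0ℚ) *ᵣ g)) *ᵣ (u *ᵣ δ)) +ᵣ ι 10 *ᵣ g *ᵣ (ε *ᵣ d -ᵣ ι 20)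
        ≡ ι 10 *ᵣ d *ᵣ c -ᵣ ((ι A *ᵣ d +ᵣ ι B *ᵣ u) *ᵣ g +ᵣ ι 200 *ᵣ g)
      above-id {ε} {g} {c} u = trans (l α β ε g c d u δ) (trans (cong (λ x → ι 10 *ᵣ d *ᵣ c -ᵣ ((ι 10 *ᵣ α *ᵣ d +ᵣ ι 10 *ᵣ β *ᵣ u *ᵣ x) *ᵣ g +ᵣ ι 200 *ᵣ g)) δd)
        (cong₂ (λ x y → ι 10 *ᵣ d *ᵣ c -ᵣ ((x *ᵣ d +ᵣ y) *ᵣ g +ᵣ ι 200 *ᵣ g)) eα (trans (ℚ.*-identityʳ (ι 10 *ᵣ β *ᵣ u)) (cong (_*ᵣ u) eβ))))
        where
        l : ∀ α β ε g c d u δ → ι 10 *ᵣ d *ᵣ ((c -ᵣ ((α +ᵣ ε) *ᵣ g +ᵣ five *ᵣ ((β +ᵣ 0ℚ) *ᵣ 0ℚ))) +ᵣ (0ℚ -ᵣ ((α +ᵣ ε) *ᵣ 0ℚ +ᵣ (β +ᵣ 0ℚ) *ᵣ g)) *ᵣ (u *ᵣ δ)) +ᵣ ι 10 *ᵣ g *ᵣ (ε *ᵣ d -ᵣ ι 20)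
          ≡ ι 10 *ᵣ d *ᵣ c -ᵣ ((ι 10 *ᵣ α *ᵣ d +ᵣ ι 10 *ᵣ β *ᵣ u *ᵣ (δ *ᵣ d)) *ᵣ g +ᵣ ι 200 *ᵣ g)
        l = solve 8 (λ α β ε g c d u δ → con (ι 10) :* d :* ((c :- ((α :+ ε) :* g :+ con five :* ((β :+ con 0ℚ) :* con 0ℚ))) :+ (con 0ℚ :- ((α :+ ε) :* con 0ℚ :+ (β :+ con 0ℚ) :* g)) :* (u :* δ)) :+ con (ι 10) :* g :* (ε :* d :- con (ι 20))
          := con (ι 10) :* d :* c :- ((con (ι 10) :* α :* d :+ con (ι 10) :* β :* u :* (δ :* d)) :* g :+ con (ι 200) :* g)) refl

      ratio-id : ∀ {g c r} u → r *ᵣ g ≡ c → ι 10 *ᵣ d *ᵣ g *ᵣ ((α -ᵣ r) +ᵣ (β -ᵣ 0ℚ) *ᵣ (u *ᵣ δ)) ≡ (ι A *ᵣ d +ᵣ ι B *ᵣ u) *ᵣ g -ᵣ ι 10 *ᵣ d *ᵣ c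
      ratio-id {g} {c} {r} u e = trans (l α β g r d u δ) (trans (cong₂ (λ x y → (ι 10 *ᵣ α *ᵣ d +ᵣ ι 10 *ᵣ β *ᵣ u *ᵣ x) *ᵣ g -ᵣ ι 10 *ᵣ d *ᵣ y) δd e)
        (cong₂ (λ x y → (x *ᵣ d +ᵣ y) *ᵣ g -ᵣ ι 10 *ᵣ d *ᵣ c) eα (trans (ℚ.*-identityʳ (ι 10 *ᵣ β *ᵣ u)) (cong (_*ᵣ u) eβ))))
        where
        l : ∀ α β g r d u δ → ι 10 *ᵣ d *ᵣ g *ᵣ ((α -ᵣ r) +ᵣ (β -ᵣ 0ℚ) *ᵣ (u *ᵣ δ)) ≡ (ι 10 *ᵣ α *ᵣ d +ᵣ ι 10 *ᵣ β *ᵣ u *ᵣ (δ *ᵣ d)) *ᵣ g -ᵣ ι 10 *ᵣ d *ᵣ (r *ᵣ g)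
        l = solve 7 (λ α β g r d u δ → con (ι 10) :* d :* g :* ((α :- r) :+ (β :- con 0ℚ) :* (u :* δ)) := (con (ι 10) :* α :* d :+ con (ι 10) :* β :* u :* (δ :* d)) :* g :- con (ι 10) :* d :* (r :* g)) refl

      slope : ∀ x g → x *ᵣ 0ℚ +ᵣ (β -ᵣ 0ℚ) *ᵣ g -ᵣ 0ℚ ≡ β *ᵣ g
      slope x g = solve 3 (λ x β g → x :* con 0ℚ :+ (β :- con 0ℚ) :* g :- con 0ℚ := β :* g) refl x β g

      slope′ : ∀ x g → 0ℚ -ᵣ (x *ᵣ 0ℚ +ᵣ (β +ᵣ 0ℚ) *ᵣ g) ≡ 0ℚ -ᵣ β *ᵣ g
      slope′ x g = solve 3 (λ x β g → con 0ℚ :- (x :* con 0ℚ :+ (β :+ con 0ℚ) :* g) := con 0ℚ :- β :* g) refl x β g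

    -- The coefficient of √5 is β g ≥ 0, so positivity passes from √5 to `hi`, which is why `suc p`
    -- appears. The hypothesis ε D ≥ 20 turns the margin ε g into 200 g after multiplication by 10
    -- D.
    below : ∀ ε g c → ι 20 ≤ᵣ ε *ᵣ d → embN c <₅ (((α +√5· β) ⊖ embQ ε) ⊗ embN g) → 10 * D * c + 200 * g < (A * D + B * suc p) * g
    below ε g c h t = ι-cancel-< (<-from (+>0 (*ᵣ>0 10d>0 (pos-elim-hi (((α -ᵣ ε) *ᵣ ι g +ᵣ five *ᵣ ((β -ᵣ 0ℚ) *ᵣ 0ℚ)) -ᵣ ι c) (((α -ᵣ ε) *ᵣ 0ℚ +ᵣ (β -ᵣ 0ℚ) *ᵣ ι g) -ᵣ 0ℚ) hi (subst (0ℚ ≤ᵣ_) (sym (slope (α -ᵣ ε) (ι g))) (*≥0 β≥0 (ι≥0 g))) hi>0 hi² t)) (0≤g*e g {ε} h))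
      (trans (cong₂ _-ᵣ_ (ι-lin A B (suc p) g) (ι-zone c g)) (sym (below-id {ε} {ι g} {ι c} (ι (suc p))))))

    above : ∀ ε g c → ι 20 ≤ᵣ ε *ᵣ d → (((α +√5· β) ⊕ embQ ε) ⊗ embN g) <₅ embN c → (A * D + B * p) * g + 200 * g < 10 * D * c
    above ε g c h t = ι-cancel-< (<-from (+>0 (*ᵣ>0 10d>0 (pos-elim-lo (ι c -ᵣ ((α +ᵣ ε) *ᵣ ι g +ᵣ five *ᵣ ((β +ᵣ 0ℚ) *ᵣ 0ℚ))) (0ℚ -ᵣ ((α +ᵣ ε) *ᵣ 0ℚ +ᵣ (β +ᵣ 0ℚ) *ᵣ ι g)) lo (subst (_≤ᵣ 0ℚ) (sym (slope′ (α +ᵣ ε) (ι g))) (≤-from (*≥0 β≥0 (ι≥0 g)) (dbl (β *ᵣ ι g)))) lo>0 lo² t)) (0≤g*e g {ε} h))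
      (trans (cong₂ _-ᵣ_ (trans (ι-* (10 * D) c) (cong (_*ᵣ ι c) (ι-* 10 D))) (trans (ι-+ ((A * D + B * p) * g) (200 * g)) (cong₂ _+ᵣ_ (ι-lin A B p g) (ι-* 200 g)))) (sym (above-id {ε} {ι g} {ι c} s))))
      where
      dbl : ∀ x → 0ℚ -ᵣ (0ℚ -ᵣ x) ≡ x
      dbl = solve 1 (λ x → con 0ℚ :- (con 0ℚ :- x) := x) refl

    module _ (c k : ℕ) where
      private
        g = suc k
        r = ℤ.+ c ℚ./ suc k
        10dg>0 : 0ℚ <ᵣ ι 10 *ᵣ d *ᵣ ι g
        10dg>0 = *ᵣ>0 10d>0 (ι>0 {g} (s≤s z≤n))

        ev-pos : ∀ u → 10 * D * c < (A * D + B * u) * g → 0ℚ <ᵣ (α -ᵣ r) +ᵣ (β -ᵣ 0ℚ) *ᵣ (ι u *ᵣ δ)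
        ev-pos u h = cancel-pos 10dg>0 (subst (0ℚ <ᵣ_) (sym (trans (ratio-id {ι g} {ι c} {r} (ι u) (quotient c k)) (cong₂ _-ᵣ_ (sym (ι-lin A B u g)) (sym (trans (ι-* (10 * D) c) (cong (_*ᵣ ι c) (ι-* 10 D)))))))
          (<-diff (ι-strict h)))
          where
          ι-strict : ∀ {m n} → m < n → ι m <ᵣ ι n
          ι-strict {m} {n} l = ℚ.<-≤-trans (<-from (ℚ.positive⁻¹ 1ℚ) (trans (cong (λ x → x -ᵣ ι m) (ι-+ 1 m)) (solve 1 (λ x → con 1ℚ :+ x :- x := con 1ℚ) refl (ι m)))) (ι-mono l)

      ratio-below : 10 * D * c < (A * D + B * p) * g → posB ((α +√5· β) ⊖ embQ r) ≡ true
      ratio-below h = T⇒≡ (pos-intro ((α -ᵣ r) +√5· (β -ᵣ 0ℚ)) lo hi lo>0 lo² hi>0 hi² (ev-pos p h) (ev-pos (suc p) (≤-trans h (*-monoˡ-≤ g (+-monoʳ-≤ (A * D) (*-monoʳ-≤ B (n≤1+n p)))))))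

      ratio-above : (A * D + B * suc p) * g ≤ 10 * D * c → posB ((α +√5· β) ⊖ embQ r) ≡ false
      ratio-above h = ¬T⇒≡ λ t → <⇒≱ (ι-cancel-< (<-from (*ᵣ>0 10dg>0 (pos-elim-hi (α -ᵣ r) (β -ᵣ 0ℚ) hi (subst (0ℚ ≤ᵣ_) (solve 1 (λ β → β := β :- con 0ℚ) refl β) β≥0) hi>0 hi² t))
        (trans (cong₂ _-ᵣ_ (ι-lin A B (suc p) g) (trans (ι-* (10 * D) c) (cong (_*ᵣ ι c) (ι-* 10 D)))) (sym (ratio-id {ι g} {ι c} {r} (ι (suc p)) (quotient c k)))))) h

  module Γ₁ = Threshold (ℤ.+ 1 ℚ./ 2) (ℤ.+ 1 ℚ./ 10) 5 1 refl refl (ℚ.<⇒≤ (ℚ.positive⁻¹ (ℤ.+ 1 ℚ./ 10)))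
  module Γ₂ = Threshold 1ℚ (ℤ.+ 1 ℚ./ 5) 10 2 refl refl (ℚ.<⇒≤ (ℚ.positive⁻¹ (ℤ.+ 1 ℚ./ 5)))

  zone : ∀ ε g c → ι 20 ≤ᵣ ε *ᵣ d → InRegion ε g c → Zone D p g c
  zone ε g c h (inj₁ (c≥1 , t)) = lowZone c≥1 (≤-trans (<⇒≤ (Γ₁.below ε g c h t)) (≤-reflexive (cong (_* g) (l (5 * D) p))))
    where
    l : ∀ x p → x + 1 * suc p ≡ x + p + 1
    l = solve-∀
  zone ε g c h (inj₂ (inj₁ (t , t′))) = midZone (≤-trans (≤-reflexive (cong (λ x → (5 * D + x) * g + 200 * g) (sym (+-identityʳ p)))) (<⇒≤ (Γ₁.above ε g c h t)))
      (≤-trans (<⇒≤ (Γ₂.below ε g c h t′)) (≤-reflexive (cong (_* g) (l D p))))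
    where
    l : ∀ D p → 10 * D + 2 * suc p ≡ 2 * (5 * D + p) + 2
    l = solve-∀
  zone ε g c h (inj₂ (inj₂ (t , _))) = highZone (≤-trans (≤-reflexive (cong (λ x → x * g + 200 * g) (l D p))) (<⇒≤ (Γ₂.above ε g c h t)))
    where
    l : ∀ D p → 2 * (5 * D + p) ≡ 10 * D + 2 * p
    l = solve-∀

  zone-value : ∀ {g c} → Zone D p g c → Q5
  zone-value z = if isLow z then embQ 0ℚ else (if isMid z then φinv else embQ 1ℚ)

  f₁-value : ∀ k c (z : Zone D p (suc k) c) → f₁ (ratio c (suc k)) ≡ zone-value z
  f₁-value k c (lowZone _ h) = cong (λ x → if x then embQ 0ℚ else (if ratio c (suc k) <₅ᵇ twoγ then φinv else embQ 1ℚ))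
    (Γ₁.ratio-below c k (lin (199 * k + 198) h (l (5 * D) p (10 * D * c) k)))
    where
    l : ∀ x p y k → suc y + (x + p + 1) * suc k + (199 * k + 198) ≡ (x + 1 * p) * suc k + (y + 200 * suc k)
    l = solve-∀
  f₁-value k c (midZone h h′) = cong₂ (λ x y → if x then embQ 0ℚ else (if y then φinv else embQ 1ℚ))
    (Γ₁.ratio-above c k (lin (199 * suc k) h (l (5 * D) p (10 * D * c) k)))
    (Γ₂.ratio-below c k (lin (198 * k + 197) h′ (l′ D p (10 * D * c) k)))
    where
    l : ∀ x p y k → (x + 1 * suc p) * suc k + y + 199 * suc k ≡ y + ((x + p) * suc k + 200 * suc k)
    l = solve-∀
    l′ : ∀ D p y k → suc y + (2 * (5 * D + p) + 2) * suc k + (198 * k + 197) ≡ (10 * D + 2 * p) * suc k + (y + 200 * suc k)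
    l′ = solve-∀
  f₁-value k c (highZone h) = cong₂ (λ x y → if x then embQ 0ℚ else (if y then φinv else embQ 1ℚ))
    (Γ₁.ratio-above c k (lin (5 * D * suc k + p * suc k + 199 * suc k) h (l D p (10 * D * c) k)))
    (Γ₂.ratio-above c k (lin (198 * suc k) h (l′ D p (10 * D * c) k)))
    where
    l : ∀ D p y k → (5 * D + 1 * suc p) * suc k + y + (5 * D * suc k + p * suc k + 199 * suc k) ≡ y + (2 * (5 * D + p) * suc k + 200 * suc k)
    l = solve-∀
    l′ : ∀ D p y k → (10 * D + 2 * suc p) * suc k + y + 198 * suc k ≡ y + (2 * (5 * D + p) * suc k + 200 * suc k)
    l′ = solve-∀

  product-value : ∀ k {C} (zs : All (Zone D p (suc k)) C) →
    prodQ5 (map (λ n → f₁ (ratio n (suc k))) C) ≡ (if anyLow zs then embQ 0ℚ else φpow (mids zs))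
  product-value k []       = refl
  product-value k {c ∷ C} (z ∷ zs) = trans (cong₂ _⊗_ (f₁-value k c z) (product-value k zs)) (step z)
    where
    rest = if anyLow zs then embQ 0ℚ else φpow (mids zs)
    step : ∀ z → zone-value z ⊗ (if anyLow zs then embQ 0ℚ else φpow (mids zs)) ≡ (if isLow z ∨ anyLow zs then embQ 0ℚ else φpow (χ (isMid z) + mids zs))
    step (lowZone _ _) = 0⊗ rest
    step (midZone _ _) with anyLow zs
    ... | true  = ⊗0 φinv
    ... | false = refl
    step (highZone _)  = 1⊗ rest

-- Choice of the parameters and conclusion

isqrt : ∀ n → ∃[ p ] (p * p ≤ n × n < suc p * suc p)
isqrt zero    = 0 , z≤n , s≤s z≤n
isqrt (suc n) with isqrt n
... | p , l , u with suc p * suc p ≤? suc n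
...   | no h  = p , ≤-trans l (n≤1+n n) , ≰⇒> h
...   | yes h = suc p , h , ≤-trans (s≤s u) (≤-trans (m≤m+n _ (2 + 2 * p)) (≤-reflexive (lem p)))
  where
  lem : ∀ p → suc (suc p * suc p) + (2 + 2 * p) ≡ suc (suc p) * suc (suc p)
  lem = solve-∀

scale-exists : ∀ D → 12 ≤ D → ∃[ R ] Scale D R
scale-exists D D≥12 with isqrt (5 * (D * D))
... | p , l , u = p ∸ (D + 3) , record { D≥12 = D≥12 ; p²≤ = subst (λ x → x * x ≤ 5 * (D * D)) (sym p≡) l ; p²> = subst (λ x → 5 * (D * D) < suc x * suc x) (sym p≡) u }
  where
  2D≤p : 2 * D ≤ p
  2D≤p = ≮⇒≥ λ h → <⇒≱ u (≤-trans (*-mono-≤ h h) (≤-trans (m≤m+n _ (D * D)) (≤-reflexive (m D))))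
    where
    m : ∀ D → 2 * D * (2 * D) + D * D ≡ 5 * (D * D)
    m = solve-∀
  p≡ : p ∸ (D + 3) + D + 3 ≡ p
  p≡ = trans (+-assoc (p ∸ (D + 3)) D 3) (m∸n+n≡m (≤-trans (+-monoʳ-≤ D (≤-trans (s≤s (s≤s (s≤s z≤n))) (≤-trans D≥12 (≤-reflexive (sym (+-identityʳ D)))))) 2D≤p))

archimedes : ∀ ε → 0ℚ <ᵣ ε → ∃[ E ] (0 < E × 1ℚ ≤ᵣ ε *ᵣ ι E)
archimedes ε@(ℚ.mkℚ (ℤ.+ suc n) d _) h = suc d , s≤s z≤n , subst (λ x → 1ℚ ≤ᵣ x *ᵣ ι (suc d)) (ℚ.↥p/↧p≡p ε) (subst (1ℚ ≤ᵣ_) (sym (quotient (suc n) d)) (ι-mono {1} {suc n} (s≤s z≤n)))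
archimedes ε@(ℚ.mkℚ (ℤ.+ zero) d _) h = ⊥-elim (ℚ.<-irrefl refl (ℚ.<-≤-trans h (ℚ.nonPositive⁻¹ ε)))
archimedes ε@(ℚ.mkℚ (ℤ.-[1+ n ]) d _) h = ⊥-elim (ℚ.<-irrefl refl (ℚ.<-≤-trans h (ℚ.nonPositive⁻¹ ε)))

positive-rational : ∀ ε → embQ 0ℚ <₅ embQ ε → 0ℚ <ᵣ ε
positive-rational ε t = subst (0ℚ <ᵣ_) (solve 1 (λ e → (e :- con 0ℚ) :+ con 0ℚ :* con (ι 3) := e) refl ε)
  (pos-elim-hi (ε -ᵣ 0ℚ) 0ℚ (ι 3) (ℚ.≤-refl {0ℚ}) (ℚ.positive⁻¹ (ι 3)) (ι-mono {5} {9} (≤ᵇ⇒≤ 5 9 tt)) t)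

length-filter : ∀ {A : Set} (p : A → Bool) xs → length (filter (λ x → T? (p x)) xs) ≡ count p xs
length-filter p []       = refl
length-filter p (x ∷ xs) with p x
... | true  = cong suc (length-filter p xs)
... | false = length-filter p xs

probability : ∀ g C s → length (𝒮 g) ≡ suc s → probSub g C ≡ embQ (ℤ.+ count (λ gs → allB (inS gs) C) (𝒮 g) ℚ./ suc s)
probability g C s e with length (𝒮 g) | e
... | .(suc s) | refl = cong (λ n → embQ (ℤ.+ n ℚ./ suc s)) (length-filter (λ gs → allB (inS gs) C) (𝒮 g))

ι-^ : ∀ q h x → q *ᵣ h *ᵣ ι x ≡ q → ∀ j → (q *ᵣ h) ^ᵣ j *ᵣ ι (x ^ j) ≡ q ^ᵣ j
ι-^ q h x e zero    = refl
ι-^ q h x e (suc j) = trans (cong ((q *ᵣ h) *ᵣ (q *ᵣ h) ^ᵣ j *ᵣ_) (ι-* x (x ^ j)))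
  (trans (l (q *ᵣ h) ((q *ᵣ h) ^ᵣ j) (ι x) (ι (x ^ j))) (cong₂ _*ᵣ_ e (ι-^ q h x e j)))
  where
  l : ∀ a b c d → a *ᵣ b *ᵣ (c *ᵣ d) ≡ a *ᵣ c *ᵣ (b *ᵣ d)
  l = solve 4 (λ a b c d → a :* b :* (c :* d) := a :* c :* (b :* d)) refl

ι-power : ∀ n j → ι (n ^ j) ≡ ι n ^ᵣ j
ι-power n zero    = refl
ι-power n (suc j) = trans (ι-* n (n ^ j)) (cong (ι n *ᵣ_) (ι-power n j))

module Approximants {D R : ℕ} (Sc : Scale D R) where
  open Scale Sc
  open Typical Sc using (p; p≤3D; t-bound)
  open Thresholds Sc

  h : ℚ
  h = half *ᵣ δ

  private
    h≥0 : 0ℚ ≤ᵣ h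
    h≥0 = *≥0 half≥0 δ≥0

    h2D : h *ᵣ ι (2 * D) ≡ 1ℚ
    h2D = trans (cong (h *ᵣ_) (ι-* 2 D)) (trans (l δ d) δd)
      where
      l : ∀ δ d → half *ᵣ δ *ᵣ (ι 2 *ᵣ d) ≡ δ *ᵣ d
      l = solve 2 (λ δ d → con half :* δ :* (con (ι 2) :* d) := δ :* d) refl

  fraction : ℕ → ℚ
  fraction n = ι n *ᵣ h

  fraction-power : ∀ n j → fraction n ^ᵣ j *ᵣ ι ((2 * D) ^ j) ≡ ι (n ^ j)
  fraction-power n j = trans (ι-^ (ι n) h (2 * D) (trans (ℚ.*-assoc (ι n) h _) (trans (cong (ι n *ᵣ_) h2D) (ℚ.*-identityʳ (ι n)))) j) (sym (ι-power n j))

  private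
    fraction-within : ∀ n → n ≤ 2 * D → Within (fraction n) 1ℚ
    fraction-within n l = subst (0ℚ ≤ᵣ_) (trans (e₁ h (ι (2 * D)) (ι n)) (cong (_-ᵣ′ fraction n) h2D)) (*≥0 h≥0 (≤-diff (ι-mono l)))
      & +≥0 (ℚ.<⇒≤ (ℚ.positive⁻¹ 1ℚ)) (*≥0 (ι≥0 n) h≥0)
      where
      _-ᵣ′_ : ℚ → ℚ → ℚ
      x -ᵣ′ y = x -ᵣ y
      e₁ : ∀ h x y → h *ᵣ (x -ᵣ y) ≡ h *ᵣ x -ᵣ y *ᵣ h
      e₁ = solve 3 (λ h x y → h :* (x :- y) := h :* x :- y :* h) refl

    fractions-close : ∀ a b → a ≤ 4 + b → b ≤ 4 + a → Within (fraction a -ᵣ fraction b) (ι 2 *ᵣ δ)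
    fractions-close a b l l′ = subst (0ℚ ≤ᵣ_) (trans (cong (λ x → h *ᵣ (x -ᵣ ι a)) (ι-+ 4 b)) (e₁ δ (ι a) (ι b))) (*≥0 h≥0 (≤-diff (ι-mono l)))
      & subst (0ℚ ≤ᵣ_) (trans (cong (λ x → h *ᵣ (x -ᵣ ι b)) (ι-+ 4 a)) (e₂ δ (ι a) (ι b))) (*≥0 h≥0 (≤-diff (ι-mono l′)))
      where
      e₁ : ∀ δ a b → half *ᵣ δ *ᵣ (ι 4 +ᵣ b -ᵣ a) ≡ ι 2 *ᵣ δ -ᵣ (a *ᵣ (half *ᵣ δ) -ᵣ b *ᵣ (half *ᵣ δ))
      e₁ = solve 3 (λ δ a b → con half :* δ :* (con (ι 4) :+ b :- a) := con (ι 2) :* δ :- (a :* (con half :* δ) :- b :* (con half :* δ))) refl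
      e₂ : ∀ δ a b → half *ᵣ δ *ᵣ (ι 4 +ᵣ a -ᵣ b) ≡ ι 2 *ᵣ δ +ᵣ (a *ᵣ (half *ᵣ δ) -ᵣ b *ᵣ (half *ᵣ δ))
      e₂ = solve 3 (λ δ a b → con half :* δ :* (con (ι 4) :+ a :- b) := con (ι 2) :* δ :+ (a :* (con half :* δ) :- b :* (con half :* δ))) refl

    near-√5 : ∀ u → 5 * (D * D) ≤ 14 * D + u * u → u * u ≤ 14 * D + 5 * (D * D) → Within (five -ᵣ ι u *ᵣ δ *ᵣ (ι u *ᵣ δ)) (ι 14 *ᵣ δ)
    near-√5 u l l′ = subst (0ℚ ≤ᵣ_) (trans (cong₂ (λ x y → δ *ᵣ δ *ᵣ (x -ᵣ y)) (trans (ι-+ (14 * D) (u * u)) (cong₂ _+ᵣ_ (ι-* 14 D) (ι-* u u))) ι5DD) (trans (e₁ δ d (ι u) (ι 5 *ᵣ (d *ᵣ d))) tail₁)) (*≥0 (*≥0 δ≥0 δ≥0) (≤-diff (ι-mono l)))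
      & subst (0ℚ ≤ᵣ_) (trans (cong₂ (λ x y → δ *ᵣ δ *ᵣ (x -ᵣ y)) (trans (ι-+ (14 * D) (5 * (D * D))) (cong₂ _+ᵣ_ (ι-* 14 D) ι5DD)) (ι-* u u)) (trans (e₂ δ d (ι u) (ι 5 *ᵣ (d *ᵣ d))) tail₂)) (*≥0 (*≥0 δ≥0 δ≥0) (≤-diff (ι-mono l′)))
      where
      e₁ : ∀ δ d u z → δ *ᵣ δ *ᵣ (ι 14 *ᵣ d +ᵣ u *ᵣ u -ᵣ z) ≡ ι 14 *ᵣ δ *ᵣ (δ *ᵣ d) -ᵣ δ *ᵣ δ *ᵣ (z -ᵣ u *ᵣ u)
      e₁ = solve 4 (λ δ d u z → δ :* δ :* (con (ι 14) :* d :+ u :* u :- z) := con (ι 14) :* δ :* (δ :* d) :- δ :* δ :* (z :- u :* u)) refl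
      e₂ : ∀ δ d u z → δ *ᵣ δ *ᵣ (ι 14 *ᵣ d +ᵣ z -ᵣ u *ᵣ u) ≡ ι 14 *ᵣ δ *ᵣ (δ *ᵣ d) +ᵣ δ *ᵣ δ *ᵣ (z -ᵣ u *ᵣ u)
      e₂ = solve 4 (λ δ d u z → δ :* δ :* (con (ι 14) :* d :+ z :- u :* u) := con (ι 14) :* δ :* (δ :* d) :+ δ :* δ :* (z :- u :* u)) refl
      fourteen : ι 14 *ᵣ δ *ᵣ (δ *ᵣ d) ≡ ι 14 *ᵣ δ
      fourteen = trans (cong (ι 14 *ᵣ δ *ᵣ_) δd) (ℚ.*-identityʳ (ι 14 *ᵣ δ))
      tail₁ = cong₂ (λ x y → x -ᵣ y) fourteen (square-id δ d (ι u) δd)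
      tail₂ = cong₂ _+ᵣ_ fourteen (square-id δ d (ι u) δd)

    p-square : 5 * (D * D) ≤ 14 * D + p * p
    p-square = ≤-trans (s≤s⁻¹ p²>) (≤-trans (≤-reflexive (m p)) (+-monoˡ-≤ (p * p) (≤-trans (*-monoʳ-≤ 2 p≤3D) (≤-trans (≤-reflexive (sym (*-assoc 2 3 D))) (*-monoˡ-≤ D (≤ᵇ⇒≤ 6 14 tt))))))
      where
      m : ∀ p → p + p * suc p ≡ 2 * p + p * p
      m = solve-∀

    p+1-square : suc p * suc p ≤ 14 * D + 5 * (D * D)
    p+1-square = ≤-trans (≤-reflexive (m p)) (+-mono-≤ (≤-trans (+-mono-≤ (*-monoʳ-≤ 2 p≤3D) (≤-trans (s≤s z≤n) D≥12)) (≤-trans (≤-reflexive (m′ D)) (*-monoˡ-≤ D (≤ᵇ⇒≤ 7 14 tt)))) p²≤)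
      where
      m : ∀ p → suc p * suc p ≡ 2 * p + 1 + p * p
      m = solve-∀
      m′ : ∀ D → 2 * (3 * D) + D ≡ 7 * D
      m′ = solve-∀

    evaluate : ∀ a u → u ≡ a + D → half *ᵣ (ι u *ᵣ δ -ᵣ 1ℚ) ≡ fraction a
    evaluate a u refl = trans (cong₂ (λ x y → half *ᵣ (x *ᵣ δ -ᵣ y)) (ι-+ a D) (sym δd)) (l δ d (ι a))
      where
      l : ∀ δ d a → half *ᵣ ((a +ᵣ d) *ᵣ δ -ᵣ δ *ᵣ d) ≡ a *ᵣ (half *ᵣ δ)
      l = solve 3 (λ δ d a → con half :* ((a :+ d) :* δ :- δ :* d) := a :* (con half :* δ)) refl

    approximate : ∀ a u b → u ≡ a + D → a ≤ 2 * D → b ≤ 2 * D → a ≤ 4 + b → b ≤ 4 + a →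
      5 * (D * D) ≤ 14 * D + u * u → u * u ≤ 14 * D + 5 * (D * D) →
      ∀ j → Within (ev (ι u *ᵣ δ) (φpow j) -ᵣ fraction b ^ᵣ j) (ι (drift j) *ᵣ δ)
    approximate a u b e a≤ b≤ l l′ s s′ = approximation (ι u *ᵣ δ) (fraction b) δ
      (subst (λ x → Within x 1ℚ) (sym (evaluate a u e)) (fraction-within a a≤)) (fraction-within b b≤)
      (subst (λ x → Within (x -ᵣ fraction b) (ι 2 *ᵣ δ)) (sym (evaluate a u e)) (fractions-close a b l l′)) (near-√5 u s s′)

    R+4≤ : suc (R + 3) ≤ 2 * D
    R+4≤ = ≤-trans (≤-reflexive (sym (+-suc R 3))) (≤-trans (+-monoʳ-≤ R (s≤s (s≤s (s≤s (s≤s z≤n))))) t-bound)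

    swap : R + D + 3 ≡ R + 3 + D
    swap = trans (+-assoc R D 3) (trans (cong (R +_) (+-comm D 3)) (sym (+-assoc R 3 D)))

  -- Since p = R + 3 + D, the number (`lo` - 1) / 2 is (R + 3) / 2D. Every b from R to R + 5 differs
  -- from R + 3 by at most 4, hence its fraction by at most 2 δ; the same holds for R + 4, which
  -- belongs to `hi`.
  approximate-lo : ∀ b → b ≤ R + 5 → R ≤ b → ∀ j → Within (ev lo (φpow j) -ᵣ fraction b ^ᵣ j) (ι (drift j) *ᵣ δ)
  approximate-lo b b≤ ≤b = approximate (R + 3) p b swap (≤-trans (n≤1+n _) R+4≤) (≤-trans b≤ t-bound)
    (≤-trans (≤-reflexive (+-comm R 3)) (≤-trans (+-monoʳ-≤ 3 ≤b) (n≤1+n (3 + b))))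
    (≤-trans b≤ (≤-trans (+-monoʳ-≤ R (≤ᵇ⇒≤ 5 7 tt)) (≤-reflexive (m R)))) p-square (≤-trans p²≤ (m≤n+m _ (14 * D)))
    where
    m : ∀ R → R + 7 ≡ 4 + (R + 3)
    m = solve-∀

  approximate-hi : ∀ b → b ≤ R + 5 → R ≤ b → ∀ j → Within (ev hi (φpow j) -ᵣ fraction b ^ᵣ j) (ι (drift j) *ᵣ δ)
  approximate-hi b b≤ ≤b = approximate (suc (R + 3)) (suc p) b (cong suc swap) R+4≤ (≤-trans b≤ t-bound)
    (≤-trans (≤-reflexive (cong suc (+-comm R 3))) (+-monoʳ-≤ 4 ≤b))
    (≤-trans b≤ (≤-trans (+-monoʳ-≤ R (≤ᵇ⇒≤ 5 8 tt)) (≤-reflexive (m R)))) (≤-trans (<⇒≤ p²>) (m≤n+m _ (14 * D))) p+1-square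
    where
    m : ∀ R → R + 8 ≡ 4 + suc (R + 3)
    m = solve-∀

module Ratios (K : ℕ) (K>0 : 0 < K) (A s : ℕ) where

  P κ : ℚ
  P = ℤ.+ A ℚ./ suc s
  κ = 1/ K

  κK : κ *ᵣ ι K ≡ 1ℚ
  κK = 1/-inverse K K>0

  private
    S = suc s

    KxS>0 : ∀ x → 0 < x → 0ℚ <ᵣ ι K *ᵣ ι x *ᵣ ι S
    KxS>0 x x>0 = *ᵣ>0 (*ᵣ>0 (ι>0 K>0) (ι>0 x>0)) (ι>0 {S} (s≤s z≤n))

    ι-** : ∀ a b c → ι (a * b * c) ≡ ι a *ᵣ ι b *ᵣ ι c
    ι-** a b c = trans (ι-* (a * b) c) (cong (_*ᵣ ι c) (ι-* a b))

    big : ∀ x y → ι ((K * y + 2 * x) * S) ≡ (ι K *ᵣ ι y +ᵣ ι 2 *ᵣ ι x) *ᵣ ι S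
    big x y = trans (ι-* (K * y + 2 * x) S) (cong (_*ᵣ ι S) (trans (ι-+ (K * y) (2 * x)) (cong₂ _+ᵣ_ (ι-* K y) (ι-* 2 x))))

    sum : ∀ x → ι (K * x * A + 2 * x * S) ≡ ι K *ᵣ ι x *ᵣ ι A +ᵣ ι 2 *ᵣ ι x *ᵣ ι S
    sum x = trans (ι-+ (K * x * A) (2 * x * S)) (cong₂ _+ᵣ_ (ι-** K x A) (ι-** 2 x S))

  upper-ratio : ∀ x y q → 0 < x → q *ᵣ ι x ≡ ι y → K * x * A ≤ (K * y + 2 * x) * S → 0ℚ ≤ᵣ (q +ᵣ ι 2 *ᵣ κ) -ᵣ P
  upper-ratio x y q x>0 e h = cancel-nonneg (KxS>0 x x>0) (subst (0ℚ ≤ᵣ_)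
      (trans (cong₂ (λ u v → u -ᵣ v) (big x y) (ι-** K x A)) (rearrange (ι K) (ι x) (ι S) (ι y) (ι A) {q} {κ} {P} κK e (quotient A s)))
      (≤-diff (ι-mono h)))
    where
    rearrange : ∀ k x s y a {q κ P} → κ *ᵣ k ≡ 1ℚ → q *ᵣ x ≡ y → P *ᵣ s ≡ a →
      (k *ᵣ y +ᵣ ι 2 *ᵣ x) *ᵣ s -ᵣ k *ᵣ x *ᵣ a ≡ k *ᵣ x *ᵣ s *ᵣ ((q +ᵣ ι 2 *ᵣ κ) -ᵣ P)
    rearrange k x s _ _ {q} {κ} {P} e refl refl = trans (l k x s q P)
      (trans (cong (λ u → k *ᵣ q *ᵣ x *ᵣ s +ᵣ ι 2 *ᵣ u *ᵣ x *ᵣ s -ᵣ k *ᵣ x *ᵣ (P *ᵣ s)) (sym e)) (l′ k x s q P κ))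
      where
      l : ∀ k x s q P → (k *ᵣ (q *ᵣ x) +ᵣ ι 2 *ᵣ x) *ᵣ s -ᵣ k *ᵣ x *ᵣ (P *ᵣ s) ≡ k *ᵣ q *ᵣ x *ᵣ s +ᵣ ι 2 *ᵣ 1ℚ *ᵣ x *ᵣ s -ᵣ k *ᵣ x *ᵣ (P *ᵣ s)
      l = solve 5 (λ k x s q P → (k :* (q :* x) :+ con (ι 2) :* x) :* s :- k :* x :* (P :* s) := k :* q :* x :* s :+ con (ι 2) :* con 1ℚ :* x :* s :- k :* x :* (P :* s)) refl
      l′ : ∀ k x s q P κ → k *ᵣ q *ᵣ x *ᵣ s +ᵣ ι 2 *ᵣ (κ *ᵣ k) *ᵣ x *ᵣ s -ᵣ k *ᵣ x *ᵣ (P *ᵣ s) ≡ k *ᵣ x *ᵣ s *ᵣ ((q +ᵣ ι 2 *ᵣ κ) -ᵣ P)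
      l′ = solve 6 (λ k x s q P κ → k :* q :* x :* s :+ con (ι 2) :* (κ :* k) :* x :* s :- k :* x :* (P :* s) := k :* x :* s :* ((q :+ con (ι 2) :* κ) :- P)) refl

  lower-ratio : ∀ x y q → 0 < x → y ≤ x → q *ᵣ ι x ≡ ι y → K * y * S ≤ K * x * A + 2 * y * S → 0ℚ ≤ᵣ (P +ᵣ ι 2 *ᵣ κ) -ᵣ q
  lower-ratio x y q x>0 y≤x e h = cancel-nonneg (KxS>0 x x>0) (subst (0ℚ ≤ᵣ_)
      (trans (cong₂ (λ u v → u -ᵣ v) (sum x) (ι-** K y S)) (rearrange (ι K) (ι x) (ι S) (ι y) (ι A) {q} {κ} {P} κK e (quotient A s)))
      (≤-diff (ι-mono (≤-trans h (+-monoʳ-≤ (K * x * A) (*-monoˡ-≤ S (*-monoʳ-≤ 2 y≤x)))))))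
    where
    rearrange : ∀ k x s y a {q κ P} → κ *ᵣ k ≡ 1ℚ → q *ᵣ x ≡ y → P *ᵣ s ≡ a →
      (k *ᵣ x *ᵣ a +ᵣ ι 2 *ᵣ x *ᵣ s) -ᵣ k *ᵣ y *ᵣ s ≡ k *ᵣ x *ᵣ s *ᵣ ((P +ᵣ ι 2 *ᵣ κ) -ᵣ q)
    rearrange k x s _ _ {q} {κ} {P} e refl refl = trans (l k x s q P)
      (trans (cong (λ u → k *ᵣ x *ᵣ (P *ᵣ s) +ᵣ ι 2 *ᵣ u *ᵣ x *ᵣ s -ᵣ k *ᵣ (q *ᵣ x) *ᵣ s) (sym e)) (l′ k x s q P κ))
      where
      l : ∀ k x s q P → (k *ᵣ x *ᵣ (P *ᵣ s) +ᵣ ι 2 *ᵣ x *ᵣ s) -ᵣ k *ᵣ (q *ᵣ x) *ᵣ s ≡ k *ᵣ x *ᵣ (P *ᵣ s) +ᵣ ι 2 *ᵣ 1ℚ *ᵣ x *ᵣ s -ᵣ k *ᵣ (q *ᵣ x) *ᵣ s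
      l = solve 5 (λ k x s q P → (k :* x :* (P :* s) :+ con (ι 2) :* x :* s) :- k :* (q :* x) :* s := k :* x :* (P :* s) :+ con (ι 2) :* con 1ℚ :* x :* s :- k :* (q :* x) :* s) refl
      l′ : ∀ k x s q P κ → k *ᵣ x *ᵣ (P *ᵣ s) +ᵣ ι 2 *ᵣ (κ *ᵣ k) *ᵣ x *ᵣ s -ᵣ k *ᵣ (q *ᵣ x) *ᵣ s ≡ k *ᵣ x *ᵣ s *ᵣ ((P +ᵣ ι 2 *ᵣ κ) -ᵣ q)
      l′ = solve 6 (λ k x s q P κ → k :* x :* (P :* s) :+ con (ι 2) :* (κ :* k) :* x :* s :- k :* (q :* x) :* s := k :* x :* s :* ((P :+ con (ι 2) :* κ) :- q)) refl

-- Here q bounds the probability from above and w from below, each up to 2 κ, and both are within c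
-- of Φ evaluated at `lo` and at `hi`. So both affine functions behind `absLt` are positive at the
-- two ends, and `pos-intro` applies.
absLt-from : ∀ P ε κ c q w {lo hi} Φ → 0ℚ <ᵣ lo → lo *ᵣ lo ≤ᵣ five → 0ℚ <ᵣ hi → five ≤ᵣ hi *ᵣ hi →
  0ℚ <ᵣ ε -ᵣ ι 2 *ᵣ κ -ᵣ c → 0ℚ ≤ᵣ (q +ᵣ ι 2 *ᵣ κ) -ᵣ P → 0ℚ ≤ᵣ (P +ᵣ ι 2 *ᵣ κ) -ᵣ w →
  Within (ev lo Φ -ᵣ q) c → Within (ev hi Φ -ᵣ q) c → Within (ev lo Φ -ᵣ w) c → Within (ev hi Φ -ᵣ w) c →
  absLt (embQ P ⊖ Φ) (embQ ε)
absLt-from P ε κ c q w {lo} {hi} Φ@(a +√5· b) lo>0 lo² hi>0 hi² gap up down q-lo q-hi w-lo w-hi =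
  T-∧⁺ {posB (embQ ε ⊖ (embQ P ⊖ Φ))} (pos-intro (embQ ε ⊖ (embQ P ⊖ Φ)) lo hi lo>0 lo² hi>0 hi² (minus lo q-lo) (minus hi q-hi))
    (pos-intro (embQ ε ⊕ (embQ P ⊖ Φ)) lo hi lo>0 lo² hi>0 hi² (plus lo w-lo) (plus hi w-hi))
  where
  minus : ∀ t → Within (ev t Φ -ᵣ q) c → 0ℚ <ᵣ ev t (embQ ε ⊖ (embQ P ⊖ Φ))
  minus t h = subst (0ℚ <ᵣ_) (l ε κ c q P a b t) (+>0 (+>0 gap up) (Within.lb h))
    where
    l : ∀ ε κ c q P a b t → ((ε -ᵣ ι 2 *ᵣ κ -ᵣ c) +ᵣ ((q +ᵣ ι 2 *ᵣ κ) -ᵣ P)) +ᵣ (c +ᵣ ((a +ᵣ b *ᵣ t) -ᵣ q)) ≡ (ε -ᵣ (P -ᵣ a)) +ᵣ (0ℚ -ᵣ (0ℚ -ᵣ b)) *ᵣ t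
    l = solve 8 (λ ε κ c q P a b t → ((ε :- con (ι 2) :* κ :- c) :+ ((q :+ con (ι 2) :* κ) :- P)) :+ (c :+ ((a :+ b :* t) :- q)) := (ε :- (P :- a)) :+ (con 0ℚ :- (con 0ℚ :- b)) :* t) refl
  plus : ∀ t → Within (ev t Φ -ᵣ w) c → 0ℚ <ᵣ ev t (embQ ε ⊕ (embQ P ⊖ Φ))
  plus t h = subst (0ℚ <ᵣ_) (l ε κ c w P a b t) (+>0 (+>0 gap down) (Within.ub h))
    where
    l : ∀ ε κ c w P a b t → ((ε -ᵣ ι 2 *ᵣ κ -ᵣ c) +ᵣ ((P +ᵣ ι 2 *ᵣ κ) -ᵣ w)) +ᵣ (c -ᵣ ((a +ᵣ b *ᵣ t) -ᵣ w)) ≡ (ε +ᵣ (P -ᵣ a)) +ᵣ (0ℚ +ᵣ (0ℚ -ᵣ b)) *ᵣ t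
    l = solve 8 (λ ε κ c w P a b t → ((ε :- con (ι 2) :* κ :- c) :+ ((P :+ con (ι 2) :* κ) :- w)) :+ (c :- ((a :+ b :* t) :- w)) := (ε :+ (P :- a)) :+ (con 0ℚ :+ (con 0ℚ :- b)) :* t) refl

amplify : ∀ {ε E D} n → 0ℚ <ᵣ ε → 1ℚ ≤ᵣ ε *ᵣ ι E → n * E ≤ D → ι n ≤ᵣ ε *ᵣ ι D
amplify {ε} {E} {D} n ε>0 h k = ≤-from (+≥0 (*≥0 (ℚ.<⇒≤ ε>0) (≤-diff (ι-mono k))) (*≥0 (ι≥0 n) (≤-diff h)))
    (trans (l ε (ι D) (ι n) (ι E)) (cong (λ x → ε *ᵣ (ι D -ᵣ x) +ᵣ ι n *ᵣ (ε *ᵣ ι E -ᵣ 1ℚ)) (sym (ι-* n E))))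
  where
  l : ∀ ε d n e → ε *ᵣ d -ᵣ n ≡ ε *ᵣ (d -ᵣ n *ᵣ e) +ᵣ n *ᵣ (ε *ᵣ e -ᵣ 1ℚ)
  l = solve 4 (λ ε d n e → ε :* d :- n := ε :* (d :- n :* e) :+ n :* (ε :* e :- con 1ℚ)) refl

module Main (l : ℕ) (ε₁ ε₂ : ℚ) (ε₁>0 : 0ℚ <ᵣ ε₁) (ε₂>0 : 0ℚ <ᵣ ε₂) (E₁ E₂ : ℕ) (E₂>0 : 0 < E₂)
  (h₁ : 1ℚ ≤ᵣ ε₁ *ᵣ ι E₁) (h₂ : 1ℚ ≤ᵣ ε₂ *ᵣ ι E₂) (K : ℕ) (K≡ : K ≡ 4 * E₂)
  (D R : ℕ) (D≥ : 20 * E₁ + K * drift l ≤ D) (Sc : Scale D R) where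

  open Scale Sc
  open Typical Sc using (p; t-bound)
  open Thresholds Sc
  open Approximants Sc
  open Estimate Sc K l

  private
    K>0 : 0 < K
    K>0 = ≤-trans E₂>0 (≤-trans (m≤m+n E₂ (3 * E₂)) (≤-reflexive (sym K≡)))

    D>0 : 0 < D
    D>0 = ≤-trans (s≤s z≤n) D≥12

    2D>0 : 0 < 2 * D
    2D>0 = ≤-trans D>0 (m≤m+n D (D + 0))

    R≤2D : R ≤ 2 * D
    R≤2D = ≤-trans (m≤m+n R 5) t-bound

    κ = 1/ K

    κK : κ *ᵣ ι K ≡ 1ℚ
    κK = 1/-inverse K K>0

    20≤ : ι 20 ≤ᵣ ε₁ *ᵣ ι D
    20≤ = amplify {ε₁} {E₁} {D} 20 ε₁>0 h₁ (≤-trans (m≤m+n (20 * E₁) (K * drift l)) D≥)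

    4≤ : ι 4 ≤ᵣ ε₂ *ᵣ ι K
    4≤ = amplify {ε₂} {E₂} {K} 4 ε₂>0 h₂ (≤-reflexive (sym K≡))

    -- The choice K = 4 E₂ gives ε₂ ≥ 4 κ, and K · `drift l` ≤ D makes the last term at most κ; at
    -- least κ is left over.
    gap : ∀ j → j ≤ l → 0ℚ <ᵣ ε₂ -ᵣ ι 2 *ᵣ κ -ᵣ ι (drift j) *ᵣ δ
    gap j j≤ = subst (0ℚ <ᵣ_) (rearrange ε₂ κ (ι K) δ d (ι (drift j)) κK δd)
        (+>0 (+>0 (1/>0 K K>0) (*≥0 (ℚ.<⇒≤ (1/>0 K K>0)) (≤-diff 4≤)))
          (*≥0 (*≥0 (ℚ.<⇒≤ (1/>0 K K>0)) δ≥0) (≤-diff (subst (_≤ᵣ d) (ι-* K (drift j)) (ι-mono (≤-trans (*-monoʳ-≤ K (drift-mono j≤)) (≤-trans (m≤n+m _ (20 * E₁)) D≥)))))))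
      where
      rearrange : ∀ ε κ k δ d c → κ *ᵣ k ≡ 1ℚ → δ *ᵣ d ≡ 1ℚ →
        (κ +ᵣ κ *ᵣ (ε *ᵣ k -ᵣ ι 4)) +ᵣ κ *ᵣ δ *ᵣ (d -ᵣ k *ᵣ c) ≡ ε -ᵣ ι 2 *ᵣ κ -ᵣ c *ᵣ δ
      rearrange ε κ k δ d c e e′ = trans (m ε κ k δ d c) (trans (cong₂ (λ x y → ε *ᵣ x -ᵣ ι 3 *ᵣ κ +ᵣ κ *ᵣ y -ᵣ x *ᵣ c *ᵣ δ) e e′) (m′ ε κ δ c))
        where
        m : ∀ ε κ k δ d c → (κ +ᵣ κ *ᵣ (ε *ᵣ k -ᵣ ι 4)) +ᵣ κ *ᵣ δ *ᵣ (d -ᵣ k *ᵣ c) ≡ ε *ᵣ (κ *ᵣ k) -ᵣ ι 3 *ᵣ κ +ᵣ κ *ᵣ (δ *ᵣ d) -ᵣ κ *ᵣ k *ᵣ c *ᵣ δ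
        m = solve 6 (λ ε κ k δ d c → (κ :+ κ :* (ε :* k :- con (ι 4))) :+ κ :* δ :* (d :- k :* c) := ε :* (κ :* k) :- con (ι 3) :* κ :+ κ :* (δ :* d) :- κ :* k :* c :* δ) refl
        m′ : ∀ ε κ δ c → ε *ᵣ 1ℚ -ᵣ ι 3 *ᵣ κ +ᵣ κ *ᵣ 1ℚ -ᵣ 1ℚ *ᵣ c *ᵣ δ ≡ ε -ᵣ ι 2 *ᵣ κ -ᵣ c *ᵣ δ
        m′ = solve 4 (λ ε κ δ c → ε :* con 1ℚ :- con (ι 3) :* κ :+ κ :* con 1ℚ :- con 1ℚ :* c :* δ := ε :- con (ι 2) :* κ :- c :* δ) refl

    zero-within : ∀ t → Within (ev t (embQ 0ℚ) -ᵣ 0ℚ) (ι (drift 0) *ᵣ δ)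
    zero-within t = within-cong (sym (m t)) (sym (ℚ.*-zeroˡ δ)) (ℚ.≤-refl {0ℚ} & ℚ.≤-refl {0ℚ})
      where
      m : ∀ t → (0ℚ +ᵣ 0ℚ *ᵣ t) -ᵣ 0ℚ ≡ 0ℚ
      m = solve 1 (λ t → (con 0ℚ :+ con 0ℚ :* t) :- con 0ℚ := con 0ℚ) refl

  bound : ∀ {C} k → M < suc k → Unique C → All (InRegion ε₁ (suc k)) C → length C ≡ l →
    absLt (probSub (suc k) C ⊖ prodQ5 (map (λ n → f₁ (ratio n (suc k))) C)) (embQ ε₂)
  bound {C} k M<g u regions len = size (length (𝒮 g)) refl
    where
    g = suc k
    open At g (<⇒≤ M<g)
    A = count (λ gs → allB (inS gs) C) (𝒮 g)

    zs : All (Zone D p g) C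
    zs = All.map (λ {c} → zone ε₁ g c 20≤) regions

    ℓ = mids zs
    x = (2 * D) ^ ℓ

    x>0 : 0 < x
    x>0 = m^n>0 (2 * D) {{>-nonZero 2D>0}} ℓ

    ℓ≤l : ℓ ≤ l
    ℓ≤l = ≤-trans (mids-≤ zs) (≤-reflexive len)

    total : count (λ _ → true) (𝒮 g) ≡ length (𝒮 g)
    total = sumL-1 (𝒮 g)

    size : ∀ n → length (𝒮 g) ≡ n → absLt (probSub g C ⊖ prodQ5 (map (λ n → f₁ (ratio n g)) C)) (embQ ε₂)
    -- There are at least F g > 0 semigroups, so the default value of `probSub` for an empty list
    -- never occurs.
    size zero    e = ⊥-elim (<⇒≱ (F>0 g) (≤-trans (F≤genus-count g) (≤-reflexive (trans total e))))
    size (suc s) e = subst₂ (λ X Y → absLt (X ⊖ Y) (embQ ε₂)) (sym (probability g C s e)) (sym (product-value k zs)) (value (anyLow zs) refl)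
      where
      open Ratios K K>0 A s using (P; upper-ratio; lower-ratio)
      total′ : count (λ _ → true) (𝒮 g) ≡ suc s
      total′ = trans total e

      value : ∀ b → anyLow zs ≡ b → absLt (embQ P ⊖ (if b then embQ 0ℚ else φpow ℓ)) (embQ ε₂)
      value true  eq = absLt-from P ε₂ κ (ι (drift 0) *ᵣ δ) 0ℚ 0ℚ (embQ 0ℚ) lo>0 lo² hi>0 hi² (gap 0 z≤n)
        (upper-ratio 1 0 0ℚ (s≤s z≤n) refl (subst (λ S → K * 1 * A ≤ (K * 0 + 2 * 1) * S) total′ (estimate-low zs (subst T (sym eq) tt))))
        (lower-ratio 1 0 0ℚ (s≤s z≤n) z≤n refl (≤-trans (≤-reflexive (cong (_* suc s) (*-zeroʳ K))) z≤n))
        (zero-within lo) (zero-within hi) (zero-within lo) (zero-within hi)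
      value false eq = absLt-from P ε₂ κ (ι (drift ℓ) *ᵣ δ) (fraction (R + 5) ^ᵣ ℓ) (fraction R ^ᵣ ℓ) (φpow ℓ) lo>0 lo² hi>0 hi² (gap ℓ ℓ≤l)
        (upper-ratio x ((R + 5) ^ ℓ) (fraction (R + 5) ^ᵣ ℓ) x>0 (fraction-power (R + 5) ℓ)
          (subst (λ S → K * x * A ≤ (K * (R + 5) ^ ℓ + 2 * x) * S) total′ (estimate-upper zs u eq)))
        (lower-ratio x (R ^ ℓ) (fraction R ^ᵣ ℓ) x>0 (^-monoˡ-≤ ℓ R≤2D) (fraction-power R ℓ)
          (subst (λ S → K * R ^ ℓ * S ≤ K * x * A + 2 * R ^ ℓ * S) total′ (estimate-lower zs u eq (≤-reflexive len))))
        (approximate-lo (R + 5) ≤-refl (m≤m+n R 5) ℓ) (approximate-hi (R + 5) ≤-refl (m≤m+n R 5) ℓ)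
        (approximate-lo R (m≤m+n R 5) ≤-refl ℓ) (approximate-hi R (m≤m+n R 5) ≤-refl ℓ)

theorem6p6 : (l : ℕ) (ε₁ ε₂ : ℚ) → embQ 0ℚ <₅ embQ ε₁ → embQ 0ℚ <₅ embQ ε₂ →
    ∃ λ (M : ℕ) → (g : ℕ) → M < g → (C : List ℕ) → Unique C →
      All (InRegion ε₁ g) C → length C ≡ l →
      absLt (probSub g C ⊖ prodQ5 (map (λ n → f₁ (ratio n g)) C)) (embQ ε₂)
theorem6p6 l ε₁ ε₂ t₁ t₂ = choose (archimedes ε₁ ε₁>0) (archimedes ε₂ ε₂>0)
  where
  ε₁>0 = positive-rational ε₁ t₁
  ε₂>0 = positive-rational ε₂ t₂
  choose : ∃[ E ] (0 < E × 1ℚ ≤ᵣ ε₁ *ᵣ ι E) → ∃[ E ] (0 < E × 1ℚ ≤ᵣ ε₂ *ᵣ ι E) → _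
  choose (E₁ , _ , h₁) (E₂ , E₂>0 , h₂) = pick (scale-exists D (m≤m+n 12 _))
    where
    K = 4 * E₂
    -- The 12 is required by `Scale`, 20 E₁ makes ε₁ D at least 20, and K · `drift l` keeps the
    -- error in the powers of 1/φ up to the l-th below 1/K.
    D = 12 + (20 * E₁ + K * drift l)
    pick : ∃[ R ] Scale D R → _
    pick (R , Sc) = M , λ { (suc k) M<g C u regions len → bound k M<g u regions len }
      where
      open Main l ε₁ ε₂ ε₁>0 ε₂>0 E₁ E₂ E₂>0 h₁ h₂ K refl D R (m≤n+m _ 12) Sc using (bound)
      open Estimate Sc K l using (M)
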